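{- For every fixed $\gamma\in(0,1)$ there are constants $0<a\le b$ (depending on $\gamma$) and $n_0$ such that for all $n\ge n_0$ and all integers $d$ with $n^{\gamma}\le d\le n/2$, $$a\max\{\log d,\ d^2/n\}\ \le\ g(n,d)\ \le\ b\max\{\log d,\ d^2/n\},$$ where $g(n,d)$ is the maximum integer $g$ such that every $n$-vertex triangle-free graph with minimum degree at least $d$ contains an induced bipartite subgraph with minimum degree at least $g$.
   Context: Graphs are finite and simple. -}

module Defs where

open import Data.Nat using (ℕ; zero; suc; _+_; _*_; _≤_; _<_; _⊔_; _^_)
open import Data.Fin using (Fin; zero; suc)
open import Data.Bool using (Bool; true; false; _∧_)
open import Data.Product using (Σ; ∃; _×_; _,_)
open import Data.Empty using (⊥)
open import Relation.Binary.PropositionalEquality using (_≡_; _≢_)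
open import Relation.Nullary using (¬_)

record Graph (n : ℕ) : Set where
  field
    adj   : Fin n → Fin n → Bool
    sym   : ∀ u v → adj u v ≡ adj v u
    irref : ∀ v → adj v v ≡ false
open Graph public

count : ∀ {n} → (Fin n → Bool) → ℕ
count {zero}  P = 0
count {suc n} P with P zero
... | true  = suc (count (λ i → P (suc i)))
... | false = count (λ i → P (suc i))

Subset : ℕ → Set
Subset n = Fin n → Bool

degree : ∀ {n} → Graph n → Fin n → ℕ
degree G v = count (adj G v)

degreeIn : ∀ {n} → Graph n → Subset n → Fin n → ℕ
degreeIn G S v = count (λ u → S u ∧ adj G v u)

MinDegree≥ : ∀ {n} → Graph n → ℕ → Set
MinDegree≥ G d = ∀ v → d ≤ degree G v

TriangleFree : ∀ {n} → Graph n → Set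
TriangleFree G = ∀ u v w → adj G u v ≡ true → adj G v w ≡ true → adj G u w ≡ true → ⊥

NonEmpty : ∀ {n} → Subset n → Set
NonEmpty S = ∃ λ v → S v ≡ true

InducedBipartite : ∀ {n} → Graph n → Subset n → Set
InducedBipartite {n} G S =
  Σ (Fin n → Bool) λ c → ∀ u v → S u ≡ true → S v ≡ true → adj G u v ≡ true → c u ≢ c v

HasInducedBipartiteMinDeg : ∀ {n} → Graph n → ℕ → Set
HasInducedBipartiteMinDeg {n} G g =
  Σ (Subset n) λ S → NonEmpty S × InducedBipartite G S × (∀ v → S v ≡ true → g ≤ degreeIn G S v)

Good : ℕ → ℕ → ℕ → Set
Good n d g = (G : Graph n) → TriangleFree G → MinDegree≥ G d → HasInducedBipartiteMinDeg G g

IsG : ℕ → ℕ → ℕ → Set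
IsG n d g = Good n d g × (∀ g' → Good n d g' → g' ≤ g)

{-# OPTIONS --safe #-}
-- Lower bound.  Draw two independent sets I and J from the same distribution μ.  The expected number of edges between them
-- is the sum of μ(u) μ(v) over the ordered adjacent pairs; if it exceeds c times the expected value of |I| + |J|, then some
-- I ∪ J has a subgraph of minimum degree at least of order c, found by deleting vertices of small degree.  For d²/n let μ be
-- the neighbourhood of a random vertex.  For log d pass to a d-degenerate induced subgraph of minimum degree d and take
-- Martinsson's random independent set, which contains each vertex with probability of order (log d) / d.
--
-- Upper bound.  Join each new vertex to a random independent set of the triangle-free graph built so far.  Two potentials,
-- which are sums over independent sets, stay bounded along a suitable choice of these sets.  With n = 2^(10 m) vertices, the
-- first bounds the size of independent sets by O(√(n m)), and the second bounds the number of edges between two independent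
-- sets A and B by O(m) (|A| + |B|).  So induced bipartite subgraphs have minimum degree O(m), while after the removal of few
-- vertices all degrees are at least of order √(n m).  Balanced blow-ups of these graphs settle all d that are small compared
-- to n, and complete bipartite graphs the others.
module Submission where

open import Defs hiding (sym)
open import Data.Bool using (Bool; true; false; _∧_; _∨_; not; if_then_else_)
import Data.Bool.Properties as Boolₚ
open import Data.Empty using (⊥; ⊥-elim)
open import Data.Fin using (Fin; zero; suc)
import Data.Fin.Properties as Finₚ
open import Data.Nat as ℕ using (ℕ; zero; suc)
import Data.Nat.DivMod as DM
import Data.Nat.Properties as ℕₚ
import Data.Nat.Tactic.RingSolver as NR
open import Data.Product using (∃; _×_; _,_; proj₁; proj₂)
open import Data.Sum using (_⊎_; inj₁; inj₂)
open import Data.Unit using (⊤; tt)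
open import Relation.Binary.PropositionalEquality hiding ([_]; resp)
open import Relation.Nullary using (¬_; Dec; yes; no; does)

-- The difficulty lies in the upper bound. For an independent set `B` of size about `√(n m)`, the
-- new neighbourhood, itself an independent set, must meet `B` almost as if each vertex were taken
-- independently with probability `ε`. The selection process achieves this up to a factor governed
-- by the sum of `|N(v) ∩ B|²` over all vertices `v`, where `N(v)` consists of the older neighbours
-- of `v`. That sum is bounded through the second potential, and the estimate in turn keeps the
-- second potential bounded, so the two are carried along together. The probability of missing `B`
-- needs one more safeguard: a step that kills many weights at once could raise it too much. Runs in
-- which this threatens are cut off, and a moment of order `h = 12` shows that at least half of the
-- mass survives. With `U = 2^m` there are `U^10` vertices, weights may grow by a factor `U`, and
-- the factor `P` from the degrees is at most `U`, so the losses fit into `U^12`. Each neighbourhood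
-- is found by averaging over a finite list with rational weights, so no union bound over the
-- finished graph occurs.

module Rationals where

  -- Rational arithmetic: inequalities with ring certificates, powers, finite sums and products.

  open import Level using (0ℓ)
  open import Data.Maybe using (Maybe; just; nothing)
  open import Data.Rational public using (ℚ; 0ℚ; 1ℚ; _+_; _*_; _-_; -_; _≤_; _<_; NonNegative; Positive; nonNegative; positive; ≢-nonZero; 1/_; _≟_; _≤?_; _<?_)
  open import Data.Rational.Properties
  open import Tactic.RingSolver using (solve-∀) public
  open import Tactic.RingSolver.Core.AlmostCommutativeRing using (AlmostCommutativeRing; fromCommutativeRing)

  ringℚ : AlmostCommutativeRing 0ℓ 0ℓ
  ringℚ = fromCommutativeRing +-*-commutativeRing isZero
    where
    isZero : (x : ℚ) → Maybe (0ℚ ≡ x)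
    isZero x with 0ℚ ≟ x
    ... | yes e = just e
    ... | no  _ = nothing

  2ℚ : ℚ
  2ℚ = 1ℚ + 1ℚ

  4ℚ : ℚ
  4ℚ = 2ℚ + 2ℚ

  0≤1 : 0ℚ ≤ 1ℚ
  0≤1 = nonNegative⁻¹ 1ℚ

  0<1 : 0ℚ < 1ℚ
  0<1 = positive⁻¹ 1ℚ

  0≤2 : 0ℚ ≤ 2ℚ
  0≤2 = nonNegative⁻¹ 2ℚ

  1≤2 : 1ℚ ≤ 2ℚ
  1≤2 = +-monoʳ-≤ 1ℚ 0≤1

  0<2 : 0ℚ < 2ℚ
  0<2 = positive⁻¹ 2ℚ

  0≤4 : 0ℚ ≤ 4ℚ
  0≤4 = nonNegative⁻¹ 4ℚ

  0<4 : 0ℚ < 4ℚ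
  0<4 = positive⁻¹ 4ℚ

  -- a ≤ b from a certificate b = a + c with c ≥ 0; the ring solver checks the equation.
  ≤⁺ : ∀ {a b c} → 0ℚ ≤ c → b ≡ a + c → a ≤ b
  ≤⁺ {a} {b} {c} h refl = ≤-trans (≤-reflexive (sym (+-identityʳ a))) (+-monoʳ-≤ a h)

  <⁺ : ∀ {a b c} → 0ℚ < c → b ≡ a + c → a < b
  <⁺ {a} {b} {c} h refl = ≤-<-trans (≤-reflexive (sym (+-identityʳ a))) (+-monoʳ-< a h)

  nn+ : ∀ {a b} → 0ℚ ≤ a → 0ℚ ≤ b → 0ℚ ≤ a + b
  nn+ p q = +-mono-≤ p q

  *-monoˡ : ∀ {a b c} → 0ℚ ≤ c → a ≤ b → c * a ≤ c * b
  *-monoˡ {c = c} h = *-monoˡ-≤-nonNeg c {{nonNegative h}}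

  *-monoʳ : ∀ {a b c} → 0ℚ ≤ c → a ≤ b → a * c ≤ b * c
  *-monoʳ {c = c} h = *-monoʳ-≤-nonNeg c {{nonNegative h}}

  nn* : ∀ {a b} → 0ℚ ≤ a → 0ℚ ≤ b → 0ℚ ≤ a * b
  nn* {a} {b} p q = ≤-trans (≤-reflexive (sym (*-zeroʳ a))) (*-monoˡ p q)

  pos* : ∀ {a b} → 0ℚ < a → 0ℚ < b → 0ℚ < a * b
  pos* {a} {b} p q = subst (_< a * b) (*-zeroʳ a) (*-monoʳ-<-pos a {{positive p}} q)

  *-mono : ∀ {a b c d} → 0ℚ ≤ a → 0ℚ ≤ d → a ≤ b → c ≤ d → a * c ≤ b * d
  *-mono ha hd p q = ≤-trans (*-monoˡ ha q) (*-monoʳ hd p)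

  *-cancelˡ : ∀ {a b c} → 0ℚ < c → c * a ≤ c * b → a ≤ b
  *-cancelˡ {c = c} h = *-cancelˡ-≤-pos c {{positive h}}

  *-cancelʳ : ∀ {a b c} → 0ℚ < c → a * c ≤ b * c → a ≤ b
  *-cancelʳ {c = c} h = *-cancelʳ-≤-pos c {{positive h}}

  p≤q⇒0≤q-p : ∀ {a b} → a ≤ b → 0ℚ ≤ b - a
  p≤q⇒0≤q-p {a} {b} h = ≤-trans (≤-reflexive (sym (+-inverseʳ a))) (+-monoˡ-≤ (- a) h)

  p<q⇒0<q-p : ∀ {a b} → a < b → 0ℚ < b - a
  p<q⇒0<q-p {a} {b} h = ≤-<-trans (≤-reflexive (sym (+-inverseʳ a))) (+-monoˡ-< (- a) h)

  0<q-p⇒p<q : ∀ {a b} → 0ℚ < b - a → a < b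
  0<q-p⇒p<q {a} {b} h = <⁺ h (e a b)
    where e : ∀ a b → b ≡ a + (b - a)
          e = solve-∀ ringℚ

  opaque
    -- Totalised with the value `0ℚ` at zero, so that boosted weights can be written down before
    -- `1ℚ - p` is known to be positive.
    inv : ℚ → ℚ
    inv x with x ≟ 0ℚ
    ... | yes _ = 0ℚ
    ... | no x≢0 = (1/ x) {{≢-nonZero x≢0}}

    inv-r : ∀ {x} → 0ℚ < x → x * inv x ≡ 1ℚ
    inv-r {x} h with x ≟ 0ℚ
    ... | yes e = ⊥-elim (<⇒≢ h (sym e))
    ... | no x≢0 = *-inverseʳ x {{≢-nonZero x≢0}}

    inv-pos : ∀ {x} → 0ℚ < x → 0ℚ < inv x
    inv-pos {x} h with inv x ≤? 0ℚ
    ... | no q = ≰⇒> q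
    ... | yes q = ⊥-elim (<-irrefl refl (<-≤-trans 0<1 (≤-trans (≤-reflexive (sym (inv-r h)))
                    (≤-trans (*-monoˡ (<⇒≤ h) q) (≤-reflexive (*-zeroʳ x))))))

  -- The recursion makes `ι (suc n)` unfold to `1ℚ + ι n`, the form in which inductions hand it to
  -- the ring solver.
  ι : ℕ → ℚ
  ι zero = 0ℚ
  ι (suc n) = 1ℚ + ι n

  ι≥0 : ∀ n → 0ℚ ≤ ι n
  ι≥0 zero = ≤-refl
  ι≥0 (suc n) = nn+ 0≤1 (ι≥0 n)

  ι>0 : ∀ {n} → 0 ℕ.< n → 0ℚ < ι n
  ι>0 {suc n} _ = <-≤-trans 0<1 (≤⁺ (ι≥0 n) refl)

  ι-+ : ∀ m n → ι (m ℕ.+ n) ≡ ι m + ι n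
  ι-+ zero n = sym (+-identityˡ (ι n))
  ι-+ (suc m) n = trans (cong (1ℚ +_) (ι-+ m n)) (sym (+-assoc 1ℚ (ι m) (ι n)))

  ι-* : ∀ m n → ι (m ℕ.* n) ≡ ι m * ι n
  ι-* zero n = sym (*-zeroˡ (ι n))
  ι-* (suc m) n = trans (ι-+ n (m ℕ.* n)) (trans (cong (ι n +_) (ι-* m n)) (e (ι m) (ι n)))
    where e : ∀ a b → b + a * b ≡ (1ℚ + a) * b
          e = solve-∀ ringℚ

  ι-mono : ∀ {m n} → m ℕ.≤ n → ι m ≤ ι n
  ι-mono {n = n} ℕ.z≤n = ι≥0 n
  ι-mono (ℕ.s≤s h) = +-monoʳ-≤ 1ℚ (ι-mono h)

  ι-mono< : ∀ {m n} → m ℕ.< n → ι m < ι n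
  ι-mono< {m} h = <-≤-trans (<⁺ 0<1 (+-comm 1ℚ (ι m))) (ι-mono h)

  ι-cancel : ∀ {m n} → ι m ≤ ι n → m ℕ.≤ n
  ι-cancel {m} {n} h with m ℕ.≤? n
  ... | yes q = q
  ... | no q = ⊥-elim (<-irrefl refl (<-≤-trans (ι-mono< (ℕₚ.≰⇒> q)) h))

  ι-cancel< : ∀ {m n} → ι m < ι n → m ℕ.< n
  ι-cancel< {m} {n} h with m ℕ.<? n
  ... | yes q = q
  ... | no q = ⊥-elim (<-irrefl refl (<-≤-trans h (ι-mono (ℕₚ.≮⇒≥ q))))

  infixr 8 _^_
  _^_ : ℚ → ℕ → ℚ
  x ^ zero = 1ℚ
  x ^ suc n = x * x ^ n

  ^-nn : ∀ {x} n → 0ℚ ≤ x → 0ℚ ≤ x ^ n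
  ^-nn zero _ = 0≤1
  ^-nn (suc n) h = nn* h (^-nn n h)

  ^-pos : ∀ {x} n → 0ℚ < x → 0ℚ < x ^ n
  ^-pos zero _ = 0<1
  ^-pos (suc n) h = pos* h (^-pos n h)

  ^-mono : ∀ {x y} n → 0ℚ ≤ x → x ≤ y → x ^ n ≤ y ^ n
  ^-mono zero _ _ = ≤-refl
  ^-mono (suc n) h q = *-mono h (^-nn n (≤-trans h q)) q (^-mono n h q)

  ^-≥1 : ∀ {x} n → 1ℚ ≤ x → 1ℚ ≤ x ^ n
  ^-≥1 zero _ = ≤-refl
  ^-≥1 (suc n) h = ≤-trans (≤-reflexive (sym (*-identityˡ 1ℚ))) (*-mono 0≤1 (^-nn n (≤-trans 0≤1 h)) h (^-≥1 n h))

  ^-≤1 : ∀ {x} n → 0ℚ ≤ x → x ≤ 1ℚ → x ^ n ≤ 1ℚ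
  ^-≤1 zero _ _ = ≤-refl
  ^-≤1 (suc n) h q = ≤-trans (*-mono h 0≤1 q (^-≤1 n h q)) (≤-reflexive (*-identityˡ 1ℚ))

  ^-+ : ∀ x m n → x ^ (m ℕ.+ n) ≡ x ^ m * x ^ n
  ^-+ x zero n = sym (*-identityˡ (x ^ n))
  ^-+ x (suc m) n = trans (cong (x *_) (^-+ x m n)) (sym (*-assoc x (x ^ m) (x ^ n)))

  ^-* : ∀ x y n → (x * y) ^ n ≡ x ^ n * y ^ n
  ^-* x y zero = refl
  ^-* x y (suc n) = trans (cong (x * y *_) (^-* x y n)) (e x y (x ^ n) (y ^ n))
    where e : ∀ a b c d → a * b * (c * d) ≡ a * c * (b * d)
          e = solve-∀ ringℚ

  1^ : ∀ n → 1ℚ ^ n ≡ 1ℚ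
  1^ zero = refl
  1^ (suc n) = trans (*-identityˡ _) (1^ n)

  ^-^ : ∀ x m n → x ^ (m ℕ.* n) ≡ (x ^ n) ^ m
  ^-^ x zero n = refl
  ^-^ x (suc m) n = trans (^-+ x n (m ℕ.* n)) (cong (x ^ n *_) (^-^ x m n))

  ^-monoʳ : ∀ {x m n} → 1ℚ ≤ x → m ℕ.≤ n → x ^ m ≤ x ^ n
  ^-monoʳ {n = n} h ℕ.z≤n = ^-≥1 n h
  ^-monoʳ h (ℕ.s≤s q) = *-monoˡ (≤-trans 0≤1 h) (^-monoʳ h q)

  ^-root : ∀ {x y} n → 0ℚ ≤ y → x ^ suc n ≤ y ^ suc n → x ≤ y
  ^-root {x} {y} n hy q with x ≤? y
  ... | yes h = h
  ... | no h = ⊥-elim (<-irrefl refl (<-≤-trans lt q))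
    where
    y<x = ≰⇒> h
    0<x = ≤-<-trans hy y<x
    lt : y ^ suc n < x ^ suc n
    lt = ≤-<-trans (*-monoˡ hy (^-mono n hy (<⇒≤ y<x)))
           (*-monoˡ-<-pos (x ^ n) {{positive (^-pos n 0<x)}} y<x)

  ι-^ : ∀ m n → ι (m ℕ.^ n) ≡ ι m ^ n
  ι-^ m zero = refl
  ι-^ m (suc n) = trans (ι-* m (m ℕ.^ n)) (cong (ι m *_) (ι-^ m n))

  bernoulli : ∀ {x} n → 0ℚ ≤ x → 1ℚ + ι n * x ≤ (1ℚ + x) ^ n
  bernoulli {x} zero h = ≤-reflexive (e x)
    where e : ∀ x → 1ℚ + 0ℚ * x ≡ 1ℚ
          e = solve-∀ ringℚ
  bernoulli {x} (suc n) h = ≤-trans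
    (≤⁺ (nn* (nn* (ι≥0 n) h) h) (e x (ι n)))
    (*-monoˡ (nn+ 0≤1 h) (bernoulli n h))
    where e : ∀ x k → (1ℚ + x) * (1ℚ + k * x) ≡ 1ℚ + (1ℚ + k) * x + k * x * x
          e = solve-∀ ringℚ

  bernoulli⁻ : ∀ {x} n → 0ℚ ≤ x → x ≤ 1ℚ → 1ℚ - ι n * x ≤ (1ℚ - x) ^ n
  bernoulli⁻ {x} zero h q = ≤-reflexive (e x)
    where e : ∀ x → 1ℚ - 0ℚ * x ≡ 1ℚ
          e = solve-∀ ringℚ
  bernoulli⁻ {x} (suc n) h q = ≤-trans
    (≤⁺ (nn* (nn* (ι≥0 n) h) h) (e x (ι n)))
    (*-monoˡ (p≤q⇒0≤q-p q) (bernoulli⁻ n h q))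
    where e : ∀ x k → (1ℚ - x) * (1ℚ - k * x) ≡ 1ℚ - (1ℚ + k) * x + k * x * x
          e = solve-∀ ringℚ

  -- Because (1 + x)^n (1 - x)^n ≤ 1.
  ^≤2 : ∀ {x} n → 0ℚ ≤ x → x ≤ 1ℚ → 2ℚ * (ι n * x) ≤ 1ℚ → (1ℚ + x) ^ n ≤ 2ℚ
  ^≤2 {x} n h q r = *-cancelʳ 0<1 (begin
    P * 1ℚ              ≤⟨ *-monoˡ P≥0 (≤⁺ (p≤q⇒0≤q-p r) (e₁ (ι n * x))) ⟩
    P * (2ℚ * (1ℚ - ι n * x)) ≤⟨ *-monoˡ P≥0 (*-monoˡ 0≤2 (bernoulli⁻ n h q)) ⟩
    P * (2ℚ * (1ℚ - x) ^ n)  ≡⟨ e₂ P ((1ℚ - x) ^ n) ⟩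
    2ℚ * (P * (1ℚ - x) ^ n)  ≡⟨ cong (2ℚ *_) (sym (^-* (1ℚ + x) (1ℚ - x) n)) ⟩
    2ℚ * ((1ℚ + x) * (1ℚ - x)) ^ n ≤⟨ *-monoˡ 0≤2 (^-≤1 n (nn* (nn+ 0≤1 h) (p≤q⇒0≤q-p q)) (≤⁺ (nn* h h) (e₃ x))) ⟩
    2ℚ * 1ℚ ∎)
    where
    open ≤-Reasoning
    P = (1ℚ + x) ^ n
    P≥0 = ^-nn n (nn+ 0≤1 h)
    e₁ : ∀ y → (1ℚ + 1ℚ) * (1ℚ - y) ≡ 1ℚ + (1ℚ - (1ℚ + 1ℚ) * y)
    e₁ = solve-∀ ringℚ
    e₂ : ∀ a b → a * (2ℚ * b) ≡ 2ℚ * (a * b)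
    e₂ = solve-∀ ringℚ
    e₃ : ∀ x → 1ℚ ≡ (1ℚ + x) * (1ℚ - x) + x * x
    e₃ = solve-∀ ringℚ

  sum : ∀ {n} → (Fin n → ℚ) → ℚ
  sum {zero} f = 0ℚ
  sum {suc n} f = f zero + sum (λ i → f (suc i))

  prod : ∀ {n} → (Fin n → ℚ) → ℚ
  prod {zero} f = 1ℚ
  prod {suc n} f = f zero * prod (λ i → f (suc i))

  [_] : Bool → ℚ
  [ b ] = if b then 1ℚ else 0ℚ

  []≥0 : ∀ b → 0ℚ ≤ [ b ]
  []≥0 true = 0≤1
  []≥0 false = ≤-refl

  []≤1 : ∀ b → [ b ] ≤ 1ℚ
  []≤1 true = ≤-refl
  []≤1 false = 0≤1

  sum-cong : ∀ {n} {f g : Fin n → ℚ} → (∀ i → f i ≡ g i) → sum f ≡ sum g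
  sum-cong {zero} h = refl
  sum-cong {suc n} h = cong₂ _+_ (h zero) (sum-cong (λ i → h (suc i)))

  sum-mono : ∀ {n} {f g : Fin n → ℚ} → (∀ i → f i ≤ g i) → sum f ≤ sum g
  sum-mono {zero} h = ≤-refl
  sum-mono {suc n} h = +-mono-≤ (h zero) (sum-mono (λ i → h (suc i)))

  sum-nn : ∀ {n} {f : Fin n → ℚ} → (∀ i → 0ℚ ≤ f i) → 0ℚ ≤ sum f
  sum-nn {zero} h = ≤-refl
  sum-nn {suc n} h = nn+ (h zero) (sum-nn (λ i → h (suc i)))

  sum-0 : ∀ n → sum {n} (λ _ → 0ℚ) ≡ 0ℚ
  sum-0 zero = refl
  sum-0 (suc n) = trans (+-identityˡ _) (sum-0 n)

  sum-+ : ∀ {n} (f g : Fin n → ℚ) → sum (λ i → f i + g i) ≡ sum f + sum g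
  sum-+ {zero} f g = refl
  sum-+ {suc n} f g = trans (cong (f zero + g zero +_) (sum-+ (λ i → f (suc i)) (λ i → g (suc i)))) (e (f zero) (g zero) _ _)
    where e : ∀ a b c d → a + b + (c + d) ≡ a + c + (b + d)
          e = solve-∀ ringℚ

  sum-* : ∀ {n} c (f : Fin n → ℚ) → sum (λ i → c * f i) ≡ c * sum f
  sum-* {zero} c f = sym (*-zeroʳ c)
  sum-* {suc n} c f = trans (cong (c * f zero +_) (sum-* c (λ i → f (suc i)))) (sym (*-distribˡ-+ c _ _))

  sum-const : ∀ n c → sum {n} (λ _ → c) ≡ ι n * c
  sum-const zero c = sym (*-zeroˡ c)
  sum-const (suc n) c = trans (cong (c +_) (sum-const n c)) (e c (ι n))
    where e : ∀ c k → c + k * c ≡ (1ℚ + k) * c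
          e = solve-∀ ringℚ

  sum-swap : ∀ {m n} (f : Fin m → Fin n → ℚ) → sum (λ i → sum (f i)) ≡ sum (λ j → sum (λ i → f i j))
  sum-swap {zero} {n} f = sym (sum-0 n)
  sum-swap {suc m} f = trans (cong (sum (f zero) +_) (sum-swap (λ i → f (suc i)))) (sym (sum-+ (f zero) _))

  term≤sum : ∀ {n} {f : Fin n → ℚ} → (∀ i → 0ℚ ≤ f i) → ∀ i → f i ≤ sum f
  term≤sum {f = f} h zero = ≤⁺ (sum-nn (λ i → h (suc i))) refl
  term≤sum {f = f} h (suc i) = ≤-trans (term≤sum (λ i → h (suc i)) i) (≤⁺ (h zero) (+-comm (f zero) _))

  prod-cong : ∀ {n} {f g : Fin n → ℚ} → (∀ i → f i ≡ g i) → prod f ≡ prod g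
  prod-cong {zero} h = refl
  prod-cong {suc n} h = cong₂ _*_ (h zero) (prod-cong (λ i → h (suc i)))

  prod-nn : ∀ {n} {f : Fin n → ℚ} → (∀ i → 0ℚ ≤ f i) → 0ℚ ≤ prod f
  prod-nn {zero} h = 0≤1
  prod-nn {suc n} h = nn* (h zero) (prod-nn (λ i → h (suc i)))

  prod-mono : ∀ {n} {f g : Fin n → ℚ} → (∀ i → 0ℚ ≤ f i) → (∀ i → f i ≤ g i) → prod f ≤ prod g
  prod-mono {zero} h q = ≤-refl
  prod-mono {suc n} h q = *-mono (h zero) (prod-nn (λ i → ≤-trans (h (suc i)) (q (suc i)))) (q zero) (prod-mono (λ i → h (suc i)) (λ i → q (suc i)))

  prod-≥1 : ∀ {n} {f : Fin n → ℚ} → (∀ i → 1ℚ ≤ f i) → 1ℚ ≤ prod f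
  prod-≥1 {zero} h = ≤-refl
  prod-≥1 {suc n} h = ≤-trans (≤-reflexive (sym (*-identityˡ 1ℚ))) (*-mono 0≤1 (≤-trans 0≤1 (prod-≥1 (λ i → h (suc i)))) (h zero) (prod-≥1 (λ i → h (suc i))))

  prod-if : ∀ {n} (B : Subset n) x → prod (λ i → if B i then x else 1ℚ) ≡ x ^ count B
  prod-if {zero} B x = refl
  prod-if {suc n} B x with B zero
  ... | true = cong (x *_) (prod-if (λ i → B (suc i)) x)
  ... | false = trans (*-identityˡ _) (prod-if (λ i → B (suc i)) x)

  sum-[] : ∀ {n} (B : Subset n) → sum (λ i → [ B i ]) ≡ ι (count B)
  sum-[] {zero} B = refl
  sum-[] {suc n} B with B zero
  ... | true = cong (1ℚ +_) (sum-[] (λ i → B (suc i)))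
  ... | false = trans (+-identityˡ _) (sum-[] (λ i → B (suc i)))

-- Finite measures on subsets and the first moment method.

module Measures where

  open Rationals
  open import Data.List using (List; []; _∷_; _++_)
  open import Data.Rational.Properties

  -- A finite, not necessarily normalised measure on the subsets of an n-element set.
  Meas : ℕ → Set
  Meas n = List (ℚ × Subset n)

  𝔼 : ∀ {n} → Meas n → (Subset n → ℚ) → ℚ
  𝔼 [] F = 0ℚ
  𝔼 ((w , I) ∷ μ) F = w * F I + 𝔼 μ F

  branch : ∀ {m n} → ℚ → (Subset m → Subset n) → Meas m → Meas n
  branch p g [] = []
  branch p g ((w , I) ∷ μ) = (p * w , g I) ∷ branch p g μ

  -- `P` is asked only of sets of positive weight: a run also lists outcomes of probability zero,
  -- and these may violate it.
  data Supp {n} (P : Subset n → Set) : Meas n → Set where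
    []  : Supp P []
    _∷_ : ∀ {w I μ} → 0ℚ ≤ w × (0ℚ < w → P I) → Supp P μ → Supp P ((w , I) ∷ μ)

  𝔼-++ : ∀ {n} (μ ν : Meas n) F → 𝔼 (μ ++ ν) F ≡ 𝔼 μ F + 𝔼 ν F
  𝔼-++ [] ν F = sym (+-identityˡ _)
  𝔼-++ ((w , I) ∷ μ) ν F = trans (cong (w * F I +_) (𝔼-++ μ ν F)) (sym (+-assoc (w * F I) _ _))

  𝔼-branch : ∀ {m n} p (g : Subset m → Subset n) μ F → 𝔼 (branch p g μ) F ≡ p * 𝔼 μ (λ I → F (g I))
  𝔼-branch p g [] F = sym (*-zeroʳ p)
  𝔼-branch p g ((w , I) ∷ μ) F = trans (cong (p * w * F (g I) +_) (𝔼-branch p g μ F)) (e p w (F (g I)) _)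
    where e : ∀ p w f s → p * w * f + p * s ≡ p * (w * f + s)
          e = solve-∀ ringℚ

  𝔼-split : ∀ {m n} p q (g h : Subset m → Subset n) μ ν F →
    𝔼 (branch p g μ ++ branch q h ν) F ≡ p * 𝔼 μ (λ I → F (g I)) + q * 𝔼 ν (λ I → F (h I))
  𝔼-split p q g h μ ν F = trans (𝔼-++ (branch p g μ) (branch q h ν) F) (cong₂ _+_ (𝔼-branch p g μ F) (𝔼-branch q h ν F))

  𝔼-cong : ∀ {n} (μ : Meas n) {F G} → (∀ I → F I ≡ G I) → 𝔼 μ F ≡ 𝔼 μ G
  𝔼-cong [] h = refl
  𝔼-cong ((w , I) ∷ μ) h = cong₂ _+_ (cong (w *_) (h I)) (𝔼-cong μ h)

  𝔼-+ : ∀ {n} (μ : Meas n) F G → 𝔼 μ (λ I → F I + G I) ≡ 𝔼 μ F + 𝔼 μ G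
  𝔼-+ [] F G = refl
  𝔼-+ ((w , I) ∷ μ) F G = trans (cong (w * (F I + G I) +_) (𝔼-+ μ F G)) (e w (F I) (G I) (𝔼 μ F) (𝔼 μ G))
    where e : ∀ w f g s t → w * (f + g) + (s + t) ≡ w * f + s + (w * g + t)
          e = solve-∀ ringℚ

  𝔼-* : ∀ {n} (μ : Meas n) c F → 𝔼 μ (λ I → c * F I) ≡ c * 𝔼 μ F
  𝔼-* [] c F = sym (*-zeroʳ c)
  𝔼-* ((w , I) ∷ μ) c F = trans (cong (w * (c * F I) +_) (𝔼-* μ c F)) (e w c (F I) (𝔼 μ F))
    where e : ∀ w c f s → w * (c * f) + c * s ≡ c * (w * f + s)
          e = solve-∀ ringℚ

  𝔼-0 : ∀ {n} (μ : Meas n) → 𝔼 μ (λ _ → 0ℚ) ≡ 0ℚ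
  𝔼-0 [] = refl
  𝔼-0 ((w , I) ∷ μ) = trans (cong₂ _+_ (*-zeroʳ w) (𝔼-0 μ)) refl

  𝔼-const : ∀ {n} (μ : Meas n) c → 𝔼 μ (λ _ → c) ≡ c * 𝔼 μ (λ _ → 1ℚ)
  𝔼-const μ c = trans (𝔼-cong μ (λ _ → sym (*-identityʳ c))) (𝔼-* μ c (λ _ → 1ℚ))

  𝔼-sum : ∀ {n m} (μ : Meas n) (F : Fin m → Subset n → ℚ) → 𝔼 μ (λ I → sum (λ i → F i I)) ≡ sum (λ i → 𝔼 μ (F i))
  𝔼-sum {m = zero} μ F = 𝔼-0 μ
  𝔼-sum {m = suc m} μ F = trans (𝔼-+ μ (F zero) (λ I → sum (λ i → F (suc i) I))) (cong (𝔼 μ (F zero) +_) (𝔼-sum μ (λ i → F (suc i))))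

  𝔼-mono : ∀ {n P} {μ : Meas n} → Supp P μ → ∀ {F G} → (∀ I → F I ≤ G I) → 𝔼 μ F ≤ 𝔼 μ G
  𝔼-mono [] h = ≤-refl
  𝔼-mono ((w≥0 , _) ∷ s) h = +-mono-≤ (*-monoˡ w≥0 (h _)) (𝔼-mono s h)

  𝔼-nn : ∀ {n P} {μ : Meas n} → Supp P μ → ∀ {F} → (∀ I → 0ℚ ≤ F I) → 0ℚ ≤ 𝔼 μ F
  𝔼-nn {μ = μ} s h = ≤-trans (≤-reflexive (sym (𝔼-0 μ))) (𝔼-mono s h)

  Supp-++ : ∀ {n P} {μ ν : Meas n} → Supp P μ → Supp P ν → Supp P (μ ++ ν)
  Supp-++ [] t = t
  Supp-++ (x ∷ s) t = x ∷ Supp-++ s t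

  0<*⇒0<ˡ : ∀ {a b} → 0ℚ ≤ b → 0ℚ < a * b → 0ℚ < a
  0<*⇒0<ˡ {a} {b} hb h with a ≤? 0ℚ
  ... | no q = ≰⇒> q
  ... | yes q = ⊥-elim (<-irrefl refl (<-≤-trans h (≤-trans (*-monoʳ hb q) (≤-reflexive (*-zeroˡ b)))))

  Supp-branch : ∀ {m n} {P : Subset m → Set} {Q : Subset n → Set} {p g μ} → 0ℚ ≤ p →
    (0ℚ < p → ∀ {I} → P I → Q (g I)) → Supp P μ → Supp Q (branch p g μ)
  Supp-branch hp f [] = []
  Supp-branch {p = p} hp f (_∷_ {w = w} (hw , k) s) =
    (nn* hp hw , λ h → f (0<*⇒0<ˡ hw h) (k (0<*⇒0<ˡ hp (subst (0ℚ <_) (*-comm p w) h)))) ∷ Supp-branch hp f s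

  𝔼-exists : ∀ {n P} {μ : Meas n} → Supp P μ → ∀ F → 0ℚ < 𝔼 μ F → ∃ λ I → P I × 0ℚ < F I
  𝔼-exists [] F h = ⊥-elim (<-irrefl refl h)
  𝔼-exists (_∷_ {w = w} {I = I} {μ = μ} (hw , k) s) F h with 0ℚ <? 𝔼 μ F
  ... | yes q = 𝔼-exists s F q
  ... | no q = I , k 0<w , 0<F
    where
    0<wF : 0ℚ < w * F I
    0<wF = <-≤-trans h (≤-trans (+-monoʳ-≤ (w * F I) (≮⇒≥ q)) (≤-reflexive (+-identityʳ _)))
    0<F : 0ℚ < F I
    0<F = 0<*⇒0<ˡ hw (subst (0ℚ <_) (*-comm w (F I)) 0<wF)
    0<w : 0ℚ < w
    0<w = 0<*⇒0<ˡ (<⇒≤ 0<F) 0<wF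

  -- Comparing with the mass replaces normalisation; the measures of the upper bound lose mass when
  -- runs are stopped.
  𝔼-exists< : ∀ {n P} {μ : Meas n} → Supp P μ → ∀ F κ → 𝔼 μ F < κ * 𝔼 μ (λ _ → 1ℚ) → ∃ λ I → P I × F I < κ
  𝔼-exists< {μ = μ} s F κ h =
    let I , p , q = 𝔼-exists s (λ I → κ + - 1ℚ * F I) pos in I , p , 0<q-p⇒p<q (subst (0ℚ <_) (e (F I) κ) q)
    where
    e : ∀ a κ → κ + - 1ℚ * a ≡ κ - a
    e = solve-∀ ringℚ
    pos : 0ℚ < 𝔼 μ (λ I → κ + - 1ℚ * F I)
    pos = subst (0ℚ <_) (sym (trans (𝔼-+ μ (λ _ → κ) (λ I → - 1ℚ * F I)) (trans (cong₂ _+_ (𝔼-const μ κ) (𝔼-* μ (- 1ℚ) F)) (e (𝔼 μ F) (κ * 𝔼 μ (λ _ → 1ℚ)))))) (p<q⇒0<q-p h)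

-- From a distribution on independent sets to an induced bipartite subgraph.

module WeightedGraphs where

  open Rationals
  open Measures
  open import Data.Rational.Properties
  open import Relation.Nullary.Decidable using (_×-dec_)

  α : ∀ {n} → Graph n → Fin n → Fin n → ℚ
  α G x y = [ adj G x y ]

  α≥0 : ∀ {n} (G : Graph n) x y → 0ℚ ≤ α G x y
  α≥0 G x y = []≥0 (adj G x y)

  α-sym : ∀ {n} (G : Graph n) x y → α G x y ≡ α G y x
  α-sym G x y = cong [_] (Graph.sym G x y)

  size : ∀ {n} → Subset n → ℚ
  size S = sum (λ x → [ S x ])

  weightTo : ∀ {n} → Graph n → (Fin n → ℚ) → Fin n → ℚ
  weightTo G p x = sum (λ y → α G x y * p y)

  edges : ∀ {n} → Graph n → Subset n → Subset n → ℚ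
  edges G I J = sum (λ x → [ I x ] * weightTo G (λ y → [ J y ]) x)

  mass : ∀ {n} → Meas n → ℚ
  mass μ = 𝔼 μ (λ _ → 1ℚ)

  marg : ∀ {n} → Meas n → Fin n → ℚ
  marg μ x = 𝔼 μ (λ I → [ I x ])

  -- For independent draws `I` and `J` the expectation of `edges G I J - c * (size I + size J)` is
  -- the sum of `p x * weightTo G p x` minus `2 c m` times the sum of `p`, hence positive by the
  -- hypotheses. The two draws are fixed one after the other, first `I` through its conditional
  -- expectation `A I`. The factor `marg μ x` in the degree hypothesis confines it to vertices that
  -- can occur.
  dense-pair : ∀ {n P} (G : Graph n) {μ : Meas n} → Supp P μ → ∀ c s →
    (∀ x → marg μ x * s ≤ marg μ x * weightTo G (marg μ) x) → 0ℚ < sum (marg μ) → 2ℚ * (c * mass μ) < s →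
    ∃ λ I → ∃ λ J → P I × P J × c * (size I + size J) < edges G I J
  dense-pair {n} {P} G {μ} sup c s hs pos hc =
    let I , pI , q = 𝔼-exists sup A (subst (0ℚ <_) (sym EA) EA>0)
        J , pJ , r = 𝔼-exists sup (B I) (subst (0ℚ <_) (sym (EB I)) q)
    in I , J , pI , pJ , 0<q-p⇒p<q (subst (0ℚ <_) (e₀ (edges G I J) c (size I) (size J)) r)
    where
    p = marg μ
    m = mass μ
    A : Subset n → ℚ
    A I = sum (λ x → weightTo G p x * [ I x ]) + ((- c * m) * size I + - c * sum p)
    B : Subset n → Subset n → ℚ
    B I J = edges G I J + (- c * size I + - c * size J)
    e₀ : ∀ a c i j → a + (- c * i + - c * j) ≡ a - c * (i + j)
    e₀ = solve-∀ ringℚ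
    EB : ∀ I → 𝔼 μ (B I) ≡ A I
    EB I = trans (𝔼-+ μ (edges G I) (λ J → - c * size I + - c * size J)) (cong₂ _+_
      (trans (𝔼-sum μ (λ x J → [ I x ] * weightTo G (λ y → [ J y ]) x)) (sum-cong (λ x →
        trans (𝔼-* μ [ I x ] (λ J → weightTo G (λ y → [ J y ]) x)) (trans (*-comm [ I x ] _) (cong (_* [ I x ])
          (trans (𝔼-sum μ (λ y J → α G x y * [ J y ])) (sum-cong (λ y → 𝔼-* μ (α G x y) (λ J → [ J y ])))))))))
      (trans (𝔼-+ μ (λ _ → - c * size I) (λ J → - c * size J)) (cong₂ _+_
        (trans (𝔼-const μ (- c * size I)) (e₁ (- c) (size I) m))
        (trans (𝔼-* μ (- c) size) (cong (- c *_) (𝔼-sum μ (λ y J → [ J y ])))))))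
      where e₁ : ∀ c i m → c * i * m ≡ c * m * i
            e₁ = solve-∀ ringℚ
    EA : 𝔼 μ A ≡ sum (λ x → p x * weightTo G p x) + ((- c * m) * sum p + - c * sum p * m)
    EA = trans (𝔼-+ μ (λ I → sum (λ x → weightTo G p x * [ I x ])) (λ I → (- c * m) * size I + - c * sum p)) (cong₂ _+_
      (trans (𝔼-sum μ (λ x I → weightTo G p x * [ I x ])) (sum-cong (λ x →
        trans (𝔼-* μ (weightTo G p x) (λ I → [ I x ])) (*-comm (weightTo G p x) (p x)))))
      (trans (𝔼-+ μ (λ I → (- c * m) * size I) (λ _ → - c * sum p)) (cong₂ _+_
        (trans (𝔼-* μ (- c * m) size) (cong (- c * m *_) (𝔼-sum μ (λ y J → [ J y ]))))
        (𝔼-const μ (- c * sum p)))))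
    EA>0 : 0ℚ < sum (λ x → p x * weightTo G p x) + ((- c * m) * sum p + - c * sum p * m)
    EA>0 = <-≤-trans (pos* pos (p<q⇒0<q-p hc)) (≤-trans (≤-reflexive (e₂ (sum p) s c m))
      (+-monoˡ-≤ _ (≤-trans (≤-reflexive (trans (sym (sum-* s p)) (sum-cong (λ x → *-comm s (p x))))) (sum-mono hs))))
      where e₂ : ∀ q s c m → q * (s - 2ℚ * (c * m)) ≡ s * q + ((- c * m) * q + - c * q * m)
            e₂ = solve-∀ ringℚ

  δ : ∀ {n} → Fin n → Fin n → Bool
  δ v x = does (v Finₚ.≟ x)

  sum-δ : ∀ {n} (v : Fin n) (f : Fin n → ℚ) → sum (λ x → f x * [ δ v x ]) ≡ f v
  sum-δ {suc n} zero f = trans (cong₂ _+_ (*-identityʳ (f zero)) (trans (sum-cong (λ i → *-zeroʳ (f (suc i)))) (sum-0 n))) (+-identityʳ _)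
  sum-δ {suc n} (suc v) f = trans (cong₂ _+_ (*-zeroʳ (f zero)) (sum-δ v (λ i → f (suc i)))) (+-identityˡ _)

  _∖_ : ∀ {n} → Subset n → Fin n → Subset n
  (S ∖ v) x = S x ∧ not (δ v x)

  ∖-⊆ : ∀ {n} (S : Subset n) v {x} → (S ∖ v) x ≡ true → S x ≡ true
  ∖-⊆ S v {x} h with S x
  ... | true = refl

  [∖] : ∀ {n} (S : Subset n) v → S v ≡ true → ∀ x → [ (S ∖ v) x ] ≡ [ S x ] - [ δ v x ]
  [∖] S v hv x with v Finₚ.≟ x
  ... | yes refl rewrite hv = refl
  ... | no _ = trans (cong [_] (Boolₚ.∧-identityʳ (S x))) (sym (+-identityʳ _))

  size-∖ : ∀ {n} (S : Subset n) v → S v ≡ true → size S ≡ 1ℚ + size (S ∖ v)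
  size-∖ S v hv = begin
    size S                                                       ≡⟨ sum-cong (λ x → e [ S x ] [ δ v x ]) ⟩
    sum (λ x → 1ℚ * [ δ v x ] + ([ S x ] - [ δ v x ]))           ≡⟨ sum-+ (λ x → 1ℚ * [ δ v x ]) (λ x → [ S x ] - [ δ v x ]) ⟩
    sum (λ x → 1ℚ * [ δ v x ]) + sum (λ x → [ S x ] - [ δ v x ]) ≡⟨ cong₂ _+_ (sum-δ v (λ _ → 1ℚ)) (sum-cong (λ x → sym ([∖] S v hv x))) ⟩
    1ℚ + size (S ∖ v) ∎
    where
    open ≡-Reasoning
    e : ∀ a b → a ≡ 1ℚ * b + (a - b)
    e = solve-∀ ringℚ

  count-∖ : ∀ {n} (S : Subset n) v → S v ≡ true → count S ≡ suc (count (S ∖ v))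
  count-∖ S v hv = ℕₚ.≤-antisym (ι-cancel (≤-reflexive q)) (ι-cancel (≤-reflexive (sym q)))
    where q : ι (count S) ≡ ι (suc (count (S ∖ v)))
          q = trans (sym (sum-[] S)) (trans (size-∖ S v hv) (cong (1ℚ +_) (sum-[] (S ∖ v))))

  weight-count : ∀ {n} (G : Graph n) (S : Subset n) v → weightTo G (λ y → [ S y ]) v ≡ ι (degreeIn G S v)
  weight-count G S v = trans (sum-cong (λ y → e (adj G v y) (S y))) (sum-[] (λ u → S u ∧ adj G v u))
    where
    e : ∀ a b → [ a ] * [ b ] ≡ [ b ∧ a ]
    e true true = refl
    e true false = refl
    e false true = refl
    e false false = refl

  -- `edges` counts ordered pairs, so `v` accounts for twice its degree. The certificate leaves the
  -- diagonal term at `v`, which is nonnegative; this avoids an appeal to the absence of loops.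
  edges-∖ : ∀ {n} (G : Graph n) (S : Subset n) v → S v ≡ true →
    edges G S S ≤ edges G (S ∖ v) (S ∖ v) + 2ℚ * ι (degreeIn G S v)
  edges-∖ {n} G S v hv = begin
    sum (λ x → s x * sum (λ y → a x y * s y))                ≡⟨ sum-cong (λ x → sym (sum-* (s x) (λ y → a x y * s y))) ⟩
    sum (λ x → sum (λ y → s x * (a x y * s y)))              ≤⟨ sum-mono (λ x → sum-mono (λ y → pt x y)) ⟩
    sum (λ x → sum (λ y → t x * (a x y * t y) + (s x * a x y * d y + a x y * s y * d x)))
      ≡⟨ sum-cong (λ x → trans (sum-+ (λ y → t x * (a x y * t y)) (λ y → s x * a x y * d y + a x y * s y * d x))
           (cong₂ _+_ (sum-* (t x) (λ y → a x y * t y)) (trans (sum-+ (λ y → s x * a x y * d y) (λ y → a x y * s y * d x))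
             (cong₂ _+_ (sum-δ v (λ y → s x * a x y)) (trans (sum-cong (λ y → *-comm (a x y * s y) (d x))) (trans (sum-* (d x) (λ y → a x y * s y)) (*-comm (d x) _))))))) ⟩
    sum (λ x → t x * weightTo G t x + (s x * a x v + weightTo G s x * d x))
      ≡⟨ trans (sum-+ (λ x → t x * weightTo G t x) (λ x → s x * a x v + weightTo G s x * d x)) (cong (sum (λ x → t x * weightTo G t x) +_)
           (trans (sum-+ (λ x → s x * a x v) (λ x → weightTo G s x * d x)) (cong₂ _+_ (sum-cong (λ x → trans (*-comm (s x) (a x v)) (cong (_* s x) (α-sym G x v)))) (sum-δ v (weightTo G s))))) ⟩
    edges G (S ∖ v) (S ∖ v) + (weightTo G s v + weightTo G s v)
      ≡⟨ cong (edges G (S ∖ v) (S ∖ v) +_) (trans (e₂ (weightTo G s v)) (cong (2ℚ *_) (weight-count G S v))) ⟩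
    edges G (S ∖ v) (S ∖ v) + 2ℚ * ι (degreeIn G S v) ∎
    where
    open ≤-Reasoning
    s t d : Fin n → ℚ
    s x = [ S x ]
    t x = [ (S ∖ v) x ]
    d x = [ δ v x ]
    a = α G
    e₂ : ∀ z → z + z ≡ 2ℚ * z
    e₂ = solve-∀ ringℚ
    e₁ : ∀ a s s' d d' → (s - d) * (a * (s' - d')) + (s * a * d' + a * s' * d) ≡ s * (a * s') + a * (d * d')
    e₁ = solve-∀ ringℚ
    pt : ∀ x y → s x * (a x y * s y) ≤ t x * (a x y * t y) + (s x * a x y * d y + a x y * s y * d x)
    pt x y = ≤⁺ (nn* (α≥0 G x y) (nn* ([]≥0 (δ v x)) ([]≥0 (δ v y))))
      (trans (cong₂ (λ u w → u * (a x y * w) + (s x * a x y * d y + a x y * s y * d x)) ([∖] S v hv x) ([∖] S v hv y)) (e₁ (a x y) (s x) (s y) (d x) (d y)))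

  size0 : ∀ {n} (S : Subset n) → ¬ NonEmpty S → ∀ x → S x ≡ false
  size0 S h x with S x in eq
  ... | true = ⊥-elim (h (x , eq))
  ... | false = refl

  _⊆_ : ∀ {n} → Subset n → Subset n → Set
  S ⊆ T = ∀ {x} → S x ≡ true → T x ≡ true

  empty-edges : ∀ {n} (G : Graph n) (S : Subset n) → ¬ NonEmpty S → edges G S S ≡ 0ℚ
  empty-edges {n} G S emp = trans (sum-cong (λ x → trans (cong (λ b → [ b ] * weightTo G (λ y → [ S y ]) x) (size0 S emp x))
    (*-zeroˡ (weightTo G (λ y → [ S y ]) x)))) (sum-0 n)

  -- Deleting a vertex of degree below `g` costs at most `2 g` ordered pairs, which is what
  -- `2 g |S|` drops by, so the hypothesis survives each deletion. It fails for the empty set, so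
  -- the process stops earlier. The number `k` only bounds the recursion.
  prune : ∀ {n} (G : Graph n) g k (S : Subset n) → count S ℕ.≤ k → 2ℚ * (ι g * size S) < edges G S S →
    ∃ λ T → T ⊆ S × NonEmpty T × (∀ v → T v ≡ true → g ℕ.≤ degreeIn G T v)
  prune {n} G g k S hk h = low? (Finₚ.any? (λ v → (S v Boolₚ.≟ true) ×-dec (degreeIn G S v ℕ.<? g)))
    where
    Low Result : Set
    Low = ∃ λ v → S v ≡ true × degreeIn G S v ℕ.< g
    Result = ∃ λ T → T ⊆ S × NonEmpty T × (∀ v → T v ≡ true → g ℕ.≤ degreeIn G T v)
    nonempty? : ¬ Low → Dec (NonEmpty S) → Result
    nonempty? none (yes ne) = S , (λ z → z) , ne , λ v hv → ℕₚ.≮⇒≥ (λ lt → none (v , hv , lt))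
    nonempty? none (no emp) = ⊥-elim (<-irrefl refl (≤-<-trans (nn* 0≤2 (nn* (ι≥0 g) (sum-nn (λ x → []≥0 (S x)))))
      (<-≤-trans h (≤-reflexive (empty-edges G S emp)))))
    e₁ : ∀ g s E' → E' - 2ℚ * (g * s) ≡ (E' + 2ℚ * g) - 2ℚ * (g * (1ℚ + s))
    e₁ = solve-∀ ringℚ
    remove : ∀ k → count S ℕ.≤ k → Low → Result
    remove zero hk (v , hv , lt) = ⊥-elim (ℕₚ.n≮0 (subst (ℕ._≤ 0) (count-∖ S v hv) hk))
    remove (suc k) hk (v , hv , lt) =
      let T , sub , ne , md = prune G g k (S ∖ v) (ℕₚ.≤-pred (subst (ℕ._≤ suc k) (count-∖ S v hv) hk)) h'
      in T , (λ {x} hx → ∖-⊆ S v {x} (sub hx)) , ne , md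
      where
      h' : 2ℚ * (ι g * size (S ∖ v)) < edges G (S ∖ v) (S ∖ v)
      h' = 0<q-p⇒p<q (subst (0ℚ <_) (sym (e₁ (ι g) (size (S ∖ v)) (edges G (S ∖ v) (S ∖ v)))) (p<q⇒0<q-p (<-≤-trans (subst (λ z → 2ℚ * (ι g * z) < edges G S S) (size-∖ S v hv) h)
            (≤-trans (edges-∖ G S v hv) (+-monoʳ-≤ (edges G (S ∖ v) (S ∖ v)) (*-monoˡ 0≤2 (ι-mono (ℕₚ.<⇒≤ lt))))))))
    low? : Dec Low → Result
    low? (no none) = nonempty? none (Finₚ.any? (λ v → S v Boolₚ.≟ true))
    low? (yes low) = remove k hk low

  Indep : ∀ {n} → Graph n → Subset n → Set
  Indep G I = ∀ x y → I x ≡ true → I y ≡ true → adj G x y ≡ false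

  _∪_ : ∀ {n} → Subset n → Subset n → Subset n
  (I ∪ J) x = I x ∨ J x

  [∪]ˡ : ∀ a b → [ a ] ≤ [ a ∨ b ]
  [∪]ˡ true b = ≤-refl
  [∪]ˡ false b = []≥0 b

  [∪]ʳ : ∀ a b → [ b ] ≤ [ a ∨ b ]
  [∪]ʳ true b = []≤1 b
  [∪]ʳ false b = ≤-refl

  [∪]≤ : ∀ a b → [ a ∨ b ] ≤ [ a ] + [ b ]
  [∪]≤ true b = ≤⁺ ([]≥0 b) refl
  [∪]≤ false b = ≤-reflexive (sym (+-identityˡ _))

  -- `I` and `J` may overlap. Colouring by membership in `I` still works: vertices of the same
  -- colour lie both in `I` or both in `J`.
  indep-pair→bipartite : ∀ {n} (G : Graph n) g (I J : Subset n) → Indep G I → Indep G J →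
    2ℚ * ι g * (size I + size J) < edges G I J → HasInducedBipartiteMinDeg G g
  indep-pair→bipartite {n} G g I J hI hJ h =
    let T , sub , ne , md = prune G g (count S) S ℕₚ.≤-refl h'
    in T , ne , (I , bip T sub) , md
    where
    S = I ∪ J
    h' : 2ℚ * (ι g * size S) < edges G S S
    h' = ≤-<-trans (≤-trans (≤-reflexive (sym (*-assoc 2ℚ (ι g) (size S))))
           (*-monoˡ (nn* 0≤2 (ι≥0 g)) (≤-trans (sum-mono (λ x → [∪]≤ (I x) (J x))) (≤-reflexive (sum-+ (λ x → [ I x ]) (λ x → [ J x ]))))))
         (<-≤-trans h (sum-mono (λ x → *-mono ([]≥0 (I x)) (sum-nn (λ y → nn* (α≥0 G x y) ([]≥0 (S y)))) ([∪]ˡ (I x) (J x))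
           (sum-mono (λ y → *-monoˡ (α≥0 G x y) ([∪]ʳ (I y) (J y)))))))
    t≢f : ∀ {b} → b ≡ true → b ≡ false → ⊥
    t≢f refl ()
    bip : ∀ T → T ⊆ S → ∀ u v → T u ≡ true → T v ≡ true → adj G u v ≡ true → I u ≢ I v
    bip T sub u v tu tv a eq = cases (I u) refl
      where
      cases : ∀ b → I u ≡ b → ⊥
      cases true eu = t≢f a (hI u v eu (trans (sym eq) eu))
      cases false eu = t≢f a (hJ u v (subst (λ b → b ∨ J u ≡ true) eu (sub tu)) (subst (λ b → b ∨ J v ≡ true) (trans (sym eq) eu) (sub tv)))

-- Martinsson's random independent sets and lower bounds for their marginals.

module SelectionProcess where

  open Rationals
  open Measures
  open WeightedGraphs
  open import Data.List using (List; []; _∷_; _++_)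
  open import Data.List.Membership.Propositional using (_∈_)
  open import Data.List.Relation.Unary.Any using (here; there)
  open import Data.Rational.Properties
  open import Relation.Nullary.Decidable using (dec-true; dec-false)

  δ-refl : ∀ {n} (v : Fin n) → δ v v ≡ true
  δ-refl v = dec-true (v Finₚ.≟ v) refl

  δ≡true : ∀ {n} (v x : Fin n) → δ v x ≡ true → v ≡ x
  δ≡true v x h with v Finₚ.≟ x
  ... | yes e = e

  true≢false : ∀ {b} → b ≡ true → b ≡ false → ⊥
  true≢false refl ()

  bool : ∀ (b : Bool) → b ≡ true ⊎ b ≡ false
  bool true = inj₁ refl
  bool false = inj₂ refl

  -- Independent sets of a triangle-free graph from weights updated along an ordering of the vertices
  -- (A. Martinsson): a vertex of weight w is selected with probability w, which kills the weights of its
  -- neighbours; otherwise these are multiplied by 1 / (1 - w), so all weights are martingales.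
  module Selection {n} (G : Graph n) (cap : ℚ) (cap≥0 : 0ℚ ≤ cap) (2cap≤1 : 2ℚ * cap ≤ 1ℚ) where

    V : Set
    V = Fin n

    trunc′ : ∀ w → Dec (w ≤ cap) → ℚ
    trunc′ w (yes _) = w
    trunc′ w (no _) = 0ℚ

    -- A vertex above the cap is selected with probability zero. This keeps `1ℚ - p` away from zero;
    -- the resulting loss in the marginals is what `marginal` controls.
    trunc : ℚ → ℚ
    trunc w = trunc′ w (w ≤? cap)

    kill : V → (V → ℚ) → V → ℚ
    kill y w x = if adj G y x then 0ℚ else w x

    boost : V → ℚ → (V → ℚ) → V → ℚ
    boost y p w x = if adj G y x then w x * inv (1ℚ - p) else w x

    insert : V → Subset n → Subset n
    insert y I x = δ y x ∨ I x

    run : List V → (V → ℚ) → Meas n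
    run [] w = (1ℚ , λ _ → false) ∷ []
    run (y ∷ ys) w = branch p (insert y) (run ys (kill y w)) ++ branch (1ℚ - p) (λ I → I) (run ys (boost y p w))
      where p = trunc (w y)

    trunc≥0 : ∀ {w} → 0ℚ ≤ w → 0ℚ ≤ trunc w
    trunc≥0 {w} h = go (w ≤? cap)
      where go : ∀ d → 0ℚ ≤ trunc′ w d
            go (yes _) = h
            go (no _) = ≤-refl

    trunc≤ : ∀ {w} → 0ℚ ≤ w → trunc w ≤ w
    trunc≤ {w} h = go (w ≤? cap)
      where go : ∀ d → trunc′ w d ≤ w
            go (yes _) = ≤-refl
            go (no _) = h

    trunc≤cap : ∀ w → trunc w ≤ cap
    trunc≤cap w = go (w ≤? cap)
      where go : ∀ d → trunc′ w d ≤ cap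
            go (yes q) = q
            go (no _) = cap≥0

    cap<1 : cap < 1ℚ
    cap<1 = *-cancelˡ-<-nonNeg 2ℚ {{nonNegative 0≤2}} (≤-<-trans 2cap≤1 (<⁺ 0<1 refl))

    1-trunc>0 : ∀ w → 0ℚ < 1ℚ - trunc w
    1-trunc>0 w = p<q⇒0<q-p (≤-<-trans (trunc≤cap w) cap<1)

    kill-adj : ∀ y w {x} → adj G y x ≡ true → kill y w x ≡ 0ℚ
    kill-adj y w h rewrite h = refl

    kill-non : ∀ y w {x} → adj G y x ≡ false → kill y w x ≡ w x
    kill-non y w h rewrite h = refl

    boost-adj : ∀ y p w {x} → adj G y x ≡ true → boost y p w x ≡ w x * inv (1ℚ - p)
    boost-adj y p w h rewrite h = refl

    boost-non : ∀ y p w {x} → adj G y x ≡ false → boost y p w x ≡ w x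
    boost-non y p w h rewrite h = refl

    NonNeg : (V → ℚ) → Set
    NonNeg w = ∀ x → 0ℚ ≤ w x

    kill≥0 : ∀ y {w} → NonNeg w → NonNeg (kill y w)
    kill≥0 y {w} h x = go (adj G y x)
      where go : ∀ b → 0ℚ ≤ (if b then 0ℚ else w x)
            go true = ≤-refl
            go false = h x

    boost≥0 : ∀ y {p w} → 0ℚ < 1ℚ - p → NonNeg w → NonNeg (boost y p w)
    boost≥0 y {p} {w} hp h x = go (adj G y x)
      where go : ∀ b → 0ℚ ≤ (if b then w x * inv (1ℚ - p) else w x)
            go true = nn* (h x) (<⇒≤ (inv-pos hp))
            go false = h x

    kill-boost : ∀ y p w → 0ℚ < 1ℚ - p → ∀ x → p * kill y w x + (1ℚ - p) * boost y p w x ≡ w x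
    kill-boost y p w hp x = go (adj G y x)
      where
      e₁ : ∀ p w i → p * 0ℚ + (1ℚ - p) * (w * i) ≡ w * ((1ℚ - p) * i)
      e₁ = solve-∀ ringℚ
      e₂ : ∀ p w → p * w + (1ℚ - p) * w ≡ w
      e₂ = solve-∀ ringℚ
      go : ∀ b → p * (if b then 0ℚ else w x) + (1ℚ - p) * (if b then w x * inv (1ℚ - p) else w x) ≡ w x
      go true = trans (e₁ p (w x) (inv (1ℚ - p))) (trans (cong (w x *_) (inv-r hp)) (*-identityʳ (w x)))
      go false = e₂ p (w x)

    mass-run : ∀ ys w → mass (run ys w) ≡ 1ℚ
    mass-run [] w = refl
    mass-run (y ∷ ys) w = trans (𝔼-split p (1ℚ - p) (insert y) (λ I → I) (run ys (kill y w)) (run ys (boost y p w)) (λ _ → 1ℚ))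
      (trans (cong₂ (λ a b → p * a + (1ℚ - p) * b) (mass-run ys (kill y w)) (mass-run ys (boost y p w))) (e p))
      where
      p = trunc (w y)
      e : ∀ p → p * 1ℚ + (1ℚ - p) * 1ℚ ≡ 1ℚ
      e = solve-∀ ringℚ

    Within : (V → ℚ) → Subset n → Set
    Within w I = Indep G I × (∀ x → I x ≡ true → 0ℚ < w x)

    -- Positivity of the weights on `I` carries the induction: neighbours of a selected vertex have
    -- weight zero from then on and so cannot enter `I`.
    supp-run : ∀ ys w → NonNeg w → Supp (Within w) (run ys w)
    supp-run [] w h = (0≤1 , λ _ → (λ x y ()) , λ x ()) ∷ []
    supp-run (y ∷ ys) w h = Supp-++
      (Supp-branch (trunc≥0 (h y)) sel (supp-run ys (kill y w) (kill≥0 y h)))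
      (Supp-branch (<⇒≤ hp) skip (supp-run ys (boost y p w) (boost≥0 y {p} hp h)))
      where
      p = trunc (w y)
      hp = 1-trunc>0 (w y)
      alive : ∀ {x} → 0ℚ < kill y w x → adj G y x ≡ false × 0ℚ < w x
      alive {x} k with bool (adj G y x)
      ... | inj₁ t = ⊥-elim (<-irrefl refl (subst (0ℚ <_) (kill-adj y w t) k))
      ... | inj₂ f = f , subst (0ℚ <_) (kill-non y w f) k
      sel : 0ℚ < p → ∀ {I} → Within (kill y w) I → Within w (insert y I)
      sel p>0 {I} (ind , pos) = ind' , pos'
        where
        cases : ∀ x → insert y I x ≡ true → y ≡ x ⊎ I x ≡ true
        cases x hx with bool (δ y x)
        ... | inj₁ t = inj₁ (δ≡true y x t)
        ... | inj₂ f = inj₂ (subst (λ b → b ∨ I x ≡ true) f hx)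
        ind' : Indep G (insert y I)
        ind' a b ha hb with cases a ha | cases b hb
        ... | inj₁ refl | inj₁ refl = Graph.irref G y
        ... | inj₁ refl | inj₂ ib = proj₁ (alive (pos b ib))
        ... | inj₂ ia | inj₁ refl = trans (Graph.sym G a y) (proj₁ (alive (pos a ia)))
        ... | inj₂ ia | inj₂ ib = ind a b ia ib
        pos' : ∀ x → insert y I x ≡ true → 0ℚ < w x
        pos' x hx with cases x hx
        ... | inj₁ refl = <-≤-trans p>0 (trunc≤ (h y))
        ... | inj₂ ix = proj₂ (alive (pos x ix))
      skip : 0ℚ < 1ℚ - p → ∀ {I} → Within (boost y p w) I → Within w I
      skip _ {I} (ind , pos) = ind , λ x ix → back x (pos x ix)
        where
        back : ∀ x → 0ℚ < boost y p w x → 0ℚ < w x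
        back x k with bool (adj G y x)
        ... | inj₁ t = 0<*⇒0<ˡ (<⇒≤ (inv-pos hp)) (subst (0ℚ <_) (boost-adj y p w t) k)
        ... | inj₂ f = subst (0ℚ <_) (boost-non y p w f) k

    -- The recursion ends at the first occurrence of `u`. Being linear in `w`, this quantity
    -- inherits the martingale property of the weights.
    earlierWeight : List V → V → (V → ℚ) → ℚ
    earlierWeight [] u w = 0ℚ
    earlierWeight (y ∷ ys) u w = if δ y u then 0ℚ else α G y u * w y + earlierWeight ys u w

    earlierWeight-cong : ∀ ys u {w w'} → (∀ x → adj G x u ≡ true → w x ≡ w' x) → earlierWeight ys u w ≡ earlierWeight ys u w'
    earlierWeight-cong [] u h = refl
    earlierWeight-cong (y ∷ ys) u {w} {w'} h = cong (λ z → if δ y u then 0ℚ else z) (cong₂ _+_ (pt (bool (adj G y u))) (earlierWeight-cong ys u h))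
      where
      pt : adj G y u ≡ true ⊎ adj G y u ≡ false → α G y u * w y ≡ α G y u * w' y
      pt (inj₁ t) = cong (α G y u *_) (h y t)
      pt (inj₂ f) = trans (cong (λ b → [ b ] * w y) f) (trans (*-zeroˡ (w y)) (trans (sym (*-zeroˡ (w' y))) (sym (cong (λ b → [ b ] * w' y) f))))

    earlierWeight-mix : ∀ ys u p q {w a b} → (∀ x → p * a x + q * b x ≡ w x) →
      p * earlierWeight ys u a + q * earlierWeight ys u b ≡ earlierWeight ys u w
    earlierWeight-mix [] u p q h = e p q
      where e : ∀ p q → p * 0ℚ + q * 0ℚ ≡ 0ℚ
            e = solve-∀ ringℚ
    earlierWeight-mix (y ∷ ys) u p q {w} {a} {b} h = go (δ y u)
      where
      e₀ : ∀ p q → p * 0ℚ + q * 0ℚ ≡ 0ℚ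
      e₀ = solve-∀ ringℚ
      e₁ : ∀ p q c a b s t → p * (c * a + s) + q * (c * b + t) ≡ c * (p * a + q * b) + (p * s + q * t)
      e₁ = solve-∀ ringℚ
      go : ∀ d → p * (if d then 0ℚ else α G y u * a y + earlierWeight ys u a) + q * (if d then 0ℚ else α G y u * b y + earlierWeight ys u b)
               ≡ (if d then 0ℚ else α G y u * w y + earlierWeight ys u w)
      go true = e₀ p q
      go false = trans (e₁ p q (α G y u) (a y) (b y) (earlierWeight ys u a) (earlierWeight ys u b))
        (cong₂ _+_ (cong (α G y u *_) (h y)) (earlierWeight-mix ys u p q h))

    earlier : List V → V → ℕ
    earlier [] u = 0
    earlier (y ∷ ys) u = if δ y u then 0 else (if adj G y u then 1 else 0) ℕ.+ earlier ys u

    earlierWeight≤ : ∀ ys u w {ε} → (∀ x → w x ≤ ε) → earlierWeight ys u w ≤ ε * ι (earlier ys u)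
    earlierWeight≤ [] u w {ε} h = ≤-reflexive (sym (*-zeroʳ ε))
    earlierWeight≤ (y ∷ ys) u w {ε} h = go (δ y u) (adj G y u)
      where
      e₁ : ∀ ε k → ε * (1ℚ + k) ≡ 1ℚ * ε + ε * k
      e₁ = solve-∀ ringℚ
      go : ∀ d b → (if d then 0ℚ else [ b ] * w y + earlierWeight ys u w) ≤ ε * ι (if d then 0 else (if b then 1 else 0) ℕ.+ earlier ys u)
      go true b = ≤-reflexive (sym (*-zeroʳ ε))
      go false true = ≤-trans (+-mono-≤ (*-monoˡ 0≤1 (h y)) (earlierWeight≤ ys u w h)) (≤-reflexive (sym (e₁ ε (ι (earlier ys u)))))
      go false false = ≤-trans (≤-reflexive (trans (cong (_+ earlierWeight ys u w) (*-zeroˡ (w y))) (+-identityˡ _))) (earlierWeight≤ ys u w h)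

    module Marginal (tf : TriangleFree G) (κ ε : ℚ) (h : ℕ) (κ≥0 : 0ℚ ≤ κ) (κh : ι h * κ ≡ 2ℚ) (capε : ε * 2ℚ ^ h ≤ cap) where

      K : ℚ
      K = 2ℚ * κ

      -- σ is the weight of the earlier neighbours already processed.
      Inv : ℚ → ℚ → Set
      Inv w σ = K * σ ≤ 1ℚ → w * (1ℚ - κ * σ) ^ h ≤ ε

      -- Since `h κ = 2`, Bernoulli gives `(1 - κp)^h (1 + 2p) ≤ (1 - κ²p²)^h ≤ 1`, and
      -- `1 ≤ (1 - p)(1 + 2p)` because `2p ≤ 1`. A boost by `1 / (1 - p)` is thus paid for by adding
      -- `p` to `σ` in `Inv`.
      shrink : ∀ {p} → 0ℚ ≤ p → 2ℚ * p ≤ 1ℚ → κ * p ≤ 1ℚ → (1ℚ - κ * p) ^ h ≤ 1ℚ - p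
      shrink {p} hp h2 h1 = *-cancelʳ {c = 1ℚ + 2ℚ * p} (<-≤-trans 0<1 (≤⁺ (nn* 0≤2 hp) refl)) (begin
        (1ℚ - κ * p) ^ h * (1ℚ + 2ℚ * p)       ≡⟨ cong (λ z → (1ℚ - κ * p) ^ h * (1ℚ + z)) (trans (cong (_* p) (sym κh)) (*-assoc (ι h) κ p)) ⟩
        (1ℚ - κ * p) ^ h * (1ℚ + ι h * (κ * p)) ≤⟨ *-monoˡ (^-nn h (p≤q⇒0≤q-p h1)) (bernoulli h (nn* κ≥0 hp)) ⟩
        (1ℚ - κ * p) ^ h * (1ℚ + κ * p) ^ h    ≡⟨ sym (^-* (1ℚ - κ * p) (1ℚ + κ * p) h) ⟩
        ((1ℚ - κ * p) * (1ℚ + κ * p)) ^ h      ≤⟨ ^-≤1 h (nn* (p≤q⇒0≤q-p h1) (nn+ 0≤1 (nn* κ≥0 hp))) (≤⁺ (nn* (nn* κ≥0 hp) (nn* κ≥0 hp)) (e₁ (κ * p))) ⟩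
        1ℚ                                     ≤⟨ ≤⁺ (nn* hp (p≤q⇒0≤q-p h2)) (e₂ p) ⟩
        (1ℚ - p) * (1ℚ + 2ℚ * p) ∎)
        where
        open ≤-Reasoning
        e₁ : ∀ x → 1ℚ ≡ (1ℚ - x) * (1ℚ + x) + x * x
        e₁ = solve-∀ ringℚ
        e₂ : ∀ p → (1ℚ - p) * (1ℚ + 2ℚ * p) ≡ 1ℚ + p * (1ℚ - 2ℚ * p)
        e₂ = solve-∀ ringℚ

      κ≤½ : ∀ {z} → K * z ≤ 1ℚ → 2ℚ * (κ * z) ≤ 1ℚ
      κ≤½ {z} q = ≤-trans (≤-reflexive (sym (*-assoc 2ℚ κ z))) q

      half≤1 : ∀ {z} → 0ℚ ≤ z → 2ℚ * z ≤ 1ℚ → z ≤ 1ℚ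
      half≤1 {z} hz q = ≤-trans (≤⁺ hz (e z)) q
        where e : ∀ z → 2ℚ * z ≡ z + z
              e = solve-∀ ringℚ

      Inv-boost : ∀ {w σ p} → 0ℚ ≤ w → 0ℚ ≤ σ → 0ℚ ≤ p → 2ℚ * p ≤ 1ℚ → 0ℚ < 1ℚ - p → Inv w σ → Inv (w * inv (1ℚ - p)) (σ + p)
      Inv-boost {w} {σ} {p} hw hσ hp h2 h1 i q = begin
        w * iv * (1ℚ - κ * (σ + p)) ^ h             ≤⟨ *-monoˡ wiv≥0 (^-mono h t'≥0 (≤⁺ (nn* (nn* κ≥0 hp) (nn* κ≥0 hσ)) (e₁ κ σ p))) ⟩
        w * iv * ((1ℚ - κ * σ) * (1ℚ - κ * p)) ^ h  ≡⟨ cong (w * iv *_) (^-* (1ℚ - κ * σ) (1ℚ - κ * p) h) ⟩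
        w * iv * ((1ℚ - κ * σ) ^ h * (1ℚ - κ * p) ^ h) ≤⟨ *-monoˡ wiv≥0 (*-monoˡ (^-nn h t≥0) (shrink hp h2 κp≤1)) ⟩
        w * iv * ((1ℚ - κ * σ) ^ h * (1ℚ - p))      ≡⟨ e₂ w iv ((1ℚ - κ * σ) ^ h) (1ℚ - p) ⟩
        w * (1ℚ - κ * σ) ^ h * ((1ℚ - p) * iv)      ≡⟨ trans (cong (w * (1ℚ - κ * σ) ^ h *_) (inv-r h1)) (*-identityʳ _) ⟩
        w * (1ℚ - κ * σ) ^ h                        ≤⟨ i (≤-trans (*-monoˡ (nn* 0≤2 κ≥0) (≤⁺ hp refl)) q) ⟩
        ε ∎
        where
        open ≤-Reasoning
        iv = inv (1ℚ - p)
        wiv≥0 = nn* hw (<⇒≤ (inv-pos h1))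
        all≤1 : κ * (σ + p) ≤ 1ℚ
        all≤1 = half≤1 (nn* κ≥0 (nn+ hσ hp)) (κ≤½ q)
        t'≥0 = p≤q⇒0≤q-p all≤1
        t≥0 = p≤q⇒0≤q-p (≤-trans (*-monoˡ κ≥0 (≤⁺ hp refl)) all≤1)
        κp≤1 = ≤-trans (*-monoˡ κ≥0 (≤⁺ hσ (+-comm σ p))) all≤1
        e₁ : ∀ κ σ p → (1ℚ - κ * σ) * (1ℚ - κ * p) ≡ (1ℚ - κ * (σ + p)) + κ * p * (κ * σ)
        e₁ = solve-∀ ringℚ
        e₂ : ∀ a b c d → a * b * (c * d) ≡ a * c * (d * b)
        e₂ = solve-∀ ringℚ

      -- A vertex above the cap has seen earlier neighbours of total weight more than 1 / K.
      capped : ∀ {w σ} → 0ℚ ≤ w → Inv w σ → ¬ (w ≤ cap) → 1ℚ ≤ K * σ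
      capped {w} {σ} hw i big with 1ℚ ≤? K * σ
      ... | yes q = q
      ... | no q = ⊥-elim (big (≤-trans w≤ capε))
        where
        Kσ≤1 = <⇒≤ (≰⇒> q)
        w≤ : w ≤ ε * 2ℚ ^ h
        w≤ = begin
          w                                       ≡⟨ sym (*-identityʳ w) ⟩
          w * 1ℚ                                  ≤⟨ *-monoˡ hw (^-≥1 h (≤⁺ (p≤q⇒0≤q-p (κ≤½ Kσ≤1)) (e₁ (κ * σ)))) ⟩
          w * ((1ℚ - κ * σ) * 2ℚ) ^ h             ≡⟨ cong (w *_) (^-* (1ℚ - κ * σ) 2ℚ h) ⟩
          w * ((1ℚ - κ * σ) ^ h * 2ℚ ^ h)         ≡⟨ sym (*-assoc w _ _) ⟩
          w * (1ℚ - κ * σ) ^ h * 2ℚ ^ h           ≤⟨ *-monoʳ (^-nn h 0≤2) (i Kσ≤1) ⟩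
          ε * 2ℚ ^ h ∎
          where
          open ≤-Reasoning
          e₁ : ∀ z → (1ℚ - z) * 2ℚ ≡ 1ℚ + (1ℚ - 2ℚ * z)
          e₁ = solve-∀ ringℚ

      marg≥0 : ∀ ys {w} → NonNeg w → ∀ u → 0ℚ ≤ marg (run ys w) u
      marg≥0 ys {w} hw u = 𝔼-nn (supp-run ys w hw) (λ I → []≥0 (I u))

      -- Follow `u` through rejections of its neighbours. At a neighbour `y` the rejection
      -- probability cancels against the boost of `w u`, and by triangle-freeness no other neighbour
      -- of `u` changes its weight, so `σ` grows by at most `w y`. At a non-neighbour the remaining
      -- earlier weight keeps its mean. Hence the mean of the final `σ`, weighted by `w u`, is at
      -- most `σ + earlierWeight ys u w`, and at `u` itself `capped` gives a selection probability
      -- of at least `w u * (1ℚ - K * σ)`.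
      marginal : ∀ ys w σ u → u ∈ ys → NonNeg w → 0ℚ ≤ σ → Inv (w u) σ →
        w u * (1ℚ - K * (σ + earlierWeight ys u w)) ≤ marg (run ys w) u
      marginal (y ∷ ys) w σ u mem hw hσ i = go mem (y Finₚ.≟ u) (bool (adj G y u))
        where
        p = trunc (w y)
        q = 1ℚ - p
        hp = trunc≥0 (hw y)
        hq = 1-trunc>0 (w y)
        K≥0 = nn* 0≤2 κ≥0
        wk = kill y w
        wb = boost y p w
        E₁ E₂ : ℚ
        E₁ = 𝔼 (run ys wk) (λ I → [ insert y I u ])
        E₂ = marg (run ys wb) u
        split : marg (run (y ∷ ys) w) u ≡ p * E₁ + q * E₂
        split = 𝔼-split p q (insert y) (λ I → I) (run ys wk) (run ys wb) (λ I → [ I u ])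
        E₂≥0 = marg≥0 ys (boost≥0 y {p} hq hw) u
        E₁≥ : marg (run ys wk) u ≤ E₁
        E₁≥ = 𝔼-mono (supp-run ys wk (kill≥0 y hw)) (λ I → [∪]ʳ (δ y u) (I u))
        E₁≥0 : 0ℚ ≤ E₁
        E₁≥0 = ≤-trans (marg≥0 ys (kill≥0 y hw) u) E₁≥
        Goal : Set
        Goal = w u * (1ℚ - K * (σ + earlierWeight (y ∷ ys) u w)) ≤ marg (run (y ∷ ys) w) u
        self : y ≡ u → Goal
        self refl = ≤-trans (≤-reflexive (cong (λ b → w u * (1ℚ - K * (σ + (if b then 0ℚ else α G u u * w u + earlierWeight ys u w)))) (δ-refl u)))
          (≤-trans (trunc-case (w u ≤? cap)) (≤-trans (≤⁺ (nn* (<⇒≤ hq) E₂≥0) (cong (λ z → p * z + q * E₂) E₁≡1)) (≤-reflexive (sym split))))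
          where
          E₁≡1 : E₁ ≡ 1ℚ
          E₁≡1 = trans (𝔼-cong (run ys wk) (λ I → cong (λ b → [ b ∨ I u ]) (δ-refl u))) (mass-run ys wk)
          e₁ : ∀ w s → w * 1ℚ ≡ w * (1ℚ - (s + 0ℚ)) + w * s
          e₁ = solve-∀ ringℚ
          e₂ : ∀ w k s → 0ℚ * 1ℚ ≡ w * (1ℚ - k * (s + 0ℚ)) + w * (k * s - 1ℚ)
          e₂ = solve-∀ ringℚ
          e₃ : ∀ w k s → w * 1ℚ ≡ w * (1ℚ - k * (s + 0ℚ)) + w * (k * s)
          e₃ = solve-∀ ringℚ
          trunc-case : ∀ d → w u * (1ℚ - K * (σ + 0ℚ)) ≤ trunc′ (w u) d * 1ℚ
          trunc-case (yes _) = ≤⁺ (nn* (hw u) (nn* K≥0 hσ)) (e₃ (w u) K σ)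
          -- Above the cap the selection probability is zero, but there the left side is not
          -- positive either, since `K * σ` is at least one.
          trunc-case (no big) = ≤⁺ (nn* (hw u) (p≤q⇒0≤q-p (capped (hw u) i big))) (e₂ (w u) K σ)
        other : ¬ (y ≡ u) → u ∈ ys → adj G y u ≡ true ⊎ adj G y u ≡ false → Goal
        other ne mem' c = ≤-trans (≤-reflexive (cong (λ b → w u * (1ℚ - K * (σ + (if b then 0ℚ else α G y u * w y + S)))) (dec-false (y Finₚ.≟ u) ne)))
          (≤-trans (body c) (≤-reflexive (sym split)))
          where
          S = earlierWeight ys u w
          Sk = earlierWeight ys u wk
          Sb = earlierWeight ys u wb
          body : adj G y u ≡ true ⊎ adj G y u ≡ false → w u * (1ℚ - K * (σ + (α G y u * w y + S))) ≤ p * E₁ + q * E₂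
          body (inj₁ t) = begin
            w u * (1ℚ - K * (σ + (α G y u * w y + S)))  ≡⟨ cong (λ b → w u * (1ℚ - K * (σ + ([ b ] * w y + S)))) t ⟩
            w u * (1ℚ - K * (σ + (1ℚ * w y + S)))       ≤⟨ ≤⁺ (nn* (hw u) (nn* K≥0 (p≤q⇒0≤q-p (trunc≤ (hw y))))) (e₁ (w u) K σ (w y) S p) ⟩
            w u * (1ℚ - K * ((σ + p) + S))              ≡⟨ sym (*-identityˡ _) ⟩
            1ℚ * (w u * (1ℚ - K * ((σ + p) + S)))       ≡⟨ cong (_* (w u * (1ℚ - K * ((σ + p) + S)))) (sym (inv-r hq)) ⟩
            q * inv q * (w u * (1ℚ - K * ((σ + p) + S))) ≡⟨ e₂ q (inv q) (w u) (1ℚ - K * ((σ + p) + S)) ⟩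
            q * (w u * inv q * (1ℚ - K * ((σ + p) + S))) ≡⟨ cong₂ (λ a s → q * (a * (1ℚ - K * ((σ + p) + s)))) (sym (boost-adj y p w t)) same ⟩
            q * (wb u * (1ℚ - K * ((σ + p) + Sb)))      ≤⟨ *-monoˡ (<⇒≤ hq) (marginal ys wb (σ + p) u mem' (boost≥0 y {p} hq hw) (nn+ hσ hp) inv') ⟩
            q * E₂                                      ≤⟨ ≤⁺ (nn* hp E₁≥0) (+-comm (p * E₁) (q * E₂)) ⟩
            p * E₁ + q * E₂ ∎
            where
            open ≤-Reasoning
            e₁ : ∀ w k s y t p → w * (1ℚ - k * (s + p + t)) ≡ w * (1ℚ - k * (s + (1ℚ * y + t))) + w * (k * (y - p))
            e₁ = solve-∀ ringℚ
            e₂ : ∀ q i w r → q * i * (w * r) ≡ q * (w * i * r)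
            e₂ = solve-∀ ringℚ
            same : S ≡ Sb
            same = earlierWeight-cong ys u (λ x a → sym (boost-non y p w (yx x a)))
              where
              yx : ∀ x → adj G x u ≡ true → adj G y x ≡ false
              yx x a with bool (adj G y x)
              ... | inj₁ t' = ⊥-elim (tf y x u t' a t)
              ... | inj₂ f' = f'
            inv' : Inv (wb u) (σ + p)
            inv' = subst (λ z → Inv z (σ + p)) (sym (boost-adj y p w t))
              (Inv-boost (hw u) hσ hp (≤-trans (*-monoˡ 0≤2 (trunc≤cap (w y))) 2cap≤1) hq i)
          body (inj₂ f) = begin
            w u * (1ℚ - K * (σ + (α G y u * w y + S)))  ≡⟨ cong (λ b → w u * (1ℚ - K * (σ + ([ b ] * w y + S)))) f ⟩
            w u * (1ℚ - K * (σ + (0ℚ * w y + S)))       ≡⟨ cong (λ s → w u * (1ℚ - K * (σ + (0ℚ * w y + s)))) (sym (earlierWeight-mix ys u p q (kill-boost y p w hq))) ⟩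
            w u * (1ℚ - K * (σ + (0ℚ * w y + (p * Sk + q * Sb)))) ≡⟨ e₁ (w u) K σ (w y) p Sk Sb ⟩
            p * (w u * (1ℚ - K * (σ + Sk))) + q * (w u * (1ℚ - K * (σ + Sb)))
              ≡⟨ cong₂ (λ a b → p * (a * (1ℚ - K * (σ + Sk))) + q * (b * (1ℚ - K * (σ + Sb)))) (sym (kill-non y w f)) (sym (boost-non y p w f)) ⟩
            p * (wk u * (1ℚ - K * (σ + Sk))) + q * (wb u * (1ℚ - K * (σ + Sb)))
              ≤⟨ +-mono-≤ (*-monoˡ hp (≤-trans (marginal ys wk σ u mem' (kill≥0 y hw) hσ (subst (λ z → Inv z σ) (sym (kill-non y w f)) i)) E₁≥))
                          (*-monoˡ (<⇒≤ hq) (marginal ys wb σ u mem' (boost≥0 y {p} hq hw) hσ (subst (λ z → Inv z σ) (sym (boost-non y p w f)) i))) ⟩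
            p * E₁ + q * E₂ ∎
            where
            open ≤-Reasoning
            e₁ : ∀ w k s y p a b → w * (1ℚ - k * (s + (0ℚ * y + (p * a + (1ℚ - p) * b)))) ≡ p * (w * (1ℚ - k * (s + a))) + (1ℚ - p) * (w * (1ℚ - k * (s + b)))
            e₁ = solve-∀ ringℚ
        go : u ∈ (y ∷ ys) → Dec (y ≡ u) → adj G y u ≡ true ⊎ adj G y u ≡ false → Goal
        go _ (yes e) c = self e
        go (here e) (no ne) c = ⊥-elim (ne (sym e))
        go (there m) (no ne) c = other ne m c

-- Degeneracy orders, large independent sets and the lower bound of order log d.

module LowerBound where

  open Rationals
  open Measures
  open WeightedGraphs
  open SelectionProcess
  open import Data.List using (List; []; _∷_)
  open import Data.List.Membership.Propositional using (_∈_)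
  open import Data.List.Relation.Unary.Any using (here; there)
  open import Data.Rational.Properties
  open import Relation.Nullary.Decidable using (_×-dec_; dec-false)

  -- earlier does not depend on the cap of the selection process.
  earlier : ∀ {n} → Graph n → List (Fin n) → Fin n → ℕ
  earlier G = Selection.earlier G 0ℚ ≤-refl (≤-trans (≤-reflexive (*-zeroʳ 2ℚ)) 0≤1)

  𝔼-supp-0 : ∀ {n P} {μ : Meas n} → Supp P μ → ∀ {F} → (∀ {I} → P I → F I ≡ 0ℚ) → 𝔼 μ F ≡ 0ℚ
  𝔼-supp-0 [] h = refl
  𝔼-supp-0 (_∷_ {w = w} {I = I} (hw , k) s) {F} h = trans (cong₂ _+_ (go (<-cmp 0ℚ w)) (𝔼-supp-0 s h)) refl
    where
    open import Relation.Binary.Definitions using (tri<; tri≈; tri>; Tri)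
    go : Tri (0ℚ < w) (0ℚ ≡ w) (w < 0ℚ) → w * F I ≡ 0ℚ
    go (tri< a _ _) = trans (cong (w *_) (h (k a))) (*-zeroʳ w)
    go (tri≈ _ e _) = trans (cong (_* F I) (sym e)) (*-zeroˡ (F I))
    go (tri> _ _ c) = ⊥-elim (<-irrefl refl (<-≤-trans c hw))

  -- Parameters for at most `d` earlier neighbours. The loss factor is `K = 4 / h`, so
  -- `ε = h / (8 d)` makes `K * ε * d` equal to one half; `small` then says that the cap
  -- `ε * 2ℚ ^ h` is at most one half.
  module Rate (h d : ℕ) (h>0 : 0 ℕ.< h) (d>0 : 0 ℕ.< d) (small : h ℕ.* 2 ℕ.^ h ℕ.≤ 4 ℕ.* d) where

    private
      8d : ℚ
      8d = ι (8 ℕ.* d)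
      8d>0 : 0ℚ < 8d
      8d>0 = ι>0 (ℕₚ.<-≤-trans d>0 (ℕₚ.m≤n*m d 8))

    ε : ℚ
    ε = ι h * inv 8d

    8dε : 8d * ε ≡ ι h
    8dε = trans (e 8d (ι h) (inv 8d)) (trans (cong (ι h *_) (inv-r 8d>0)) (*-identityʳ (ι h)))
      where e : ∀ a b c → a * (b * c) ≡ b * (a * c)
            e = solve-∀ ringℚ

    ε≥0 : 0ℚ ≤ ε
    ε≥0 = nn* (ι≥0 h) (<⇒≤ (inv-pos 8d>0))

    private
      cap : ℚ
      cap = ε * 2ℚ ^ h

      2cap≤1 : 2ℚ * cap ≤ 1ℚ
      2cap≤1 = *-cancelˡ 8d>0 (begin
        8d * (2ℚ * (ε * 2ℚ ^ h))        ≡⟨ e 8d ε (2ℚ ^ h) ⟩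
        2ℚ * (8d * ε * 2ℚ ^ h)          ≡⟨ cong (λ z → 2ℚ * (z * 2ℚ ^ h)) 8dε ⟩
        2ℚ * (ι h * 2ℚ ^ h)             ≡⟨ cong (λ z → 2ℚ * (ι h * z)) (sym (ι-^ 2 h)) ⟩
        2ℚ * (ι h * ι (2 ℕ.^ h))        ≡⟨ cong (2ℚ *_) (sym (ι-* h (2 ℕ.^ h))) ⟩
        2ℚ * ι (h ℕ.* 2 ℕ.^ h)          ≤⟨ *-monoˡ 0≤2 (ι-mono small) ⟩
        2ℚ * ι (4 ℕ.* d)                ≡⟨ sym (ι-* 2 (4 ℕ.* d)) ⟩
        ι (2 ℕ.* (4 ℕ.* d))             ≡⟨ cong ι (sym (ℕₚ.*-assoc 2 4 d)) ⟩
        8d                              ≡⟨ sym (*-identityʳ 8d) ⟩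
        8d * 1ℚ ∎)
        where
        open ≤-Reasoning
        e : ∀ a b c → a * (2ℚ * (b * c)) ≡ 2ℚ * (a * b * c)
        e = solve-∀ ringℚ

      κ : ℚ
      κ = 2ℚ * inv (ι h)
      κ≥0 : 0ℚ ≤ κ
      κ≥0 = nn* 0≤2 (<⇒≤ (inv-pos (ι>0 h>0)))
      κh : ι h * κ ≡ 2ℚ
      κh = trans (e (ι h) (inv (ι h))) (trans (cong (2ℚ *_) (inv-r (ι>0 h>0))) (*-identityʳ 2ℚ))
        where e : ∀ a b → a * (2ℚ * b) ≡ 2ℚ * (a * b)
              e = solve-∀ ringℚ

      -- K ε d = 1/2, where K = 2 κ = 4 / h.
      half : 2ℚ * (2ℚ * κ * (ε * ι d)) ≡ 1ℚ
      half = begin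
        2ℚ * (2ℚ * (2ℚ * inv (ι h)) * (ε * ι d))  ≡⟨ e₁ (inv (ι h)) ε (ι d) ⟩
        inv (ι h) * (ι 8 * ι d * ε)               ≡⟨ cong (λ z → inv (ι h) * (z * ε)) (sym (ι-* 8 d)) ⟩
        inv (ι h) * (8d * ε)                      ≡⟨ cong (inv (ι h) *_) 8dε ⟩
        inv (ι h) * ι h                           ≡⟨ trans (*-comm (inv (ι h)) (ι h)) (inv-r (ι>0 h>0)) ⟩
        1ℚ ∎
        where
        open ≡-Reasoning
        e₁ : ∀ a b c → 2ℚ * (2ℚ * (2ℚ * a) * (b * c)) ≡ a * (ι 8 * c * b)
        e₁ = solve-∀ ringℚ

    -- At most `d` earlier neighbours carry weight at most `ε * ι d`, so `marginal` loses at most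
    -- half of each initial weight.
    select : ∀ {n} (G : Graph n) → TriangleFree G → (ys : List (Fin n)) (w : Fin n → ℚ) → (∀ x → 0ℚ ≤ w x) → (∀ x → w x ≤ ε) →
      (∀ u → u ∈ ys → earlier G ys u ℕ.≤ d) →
      ∃ λ μ → Supp (λ I → Indep G I × (∀ x → I x ≡ true → 0ℚ < w x)) μ × mass μ ≡ 1ℚ × (∀ u → u ∈ ys → w u ≤ 2ℚ * marg μ u)
    select {n} G tf ys w w≥0 w≤ε few = S.run ys w , S.supp-run ys w w≥0 , S.mass-run ys w , bound
      where
      module S = Selection G cap (nn* ε≥0 (^-nn h 0≤2)) 2cap≤1
      module M = S.Marginal tf κ ε h κ≥0 κh ≤-refl
      earlier-eq : ∀ ys u → S.earlier ys u ≡ earlier G ys u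
      earlier-eq [] u = refl
      earlier-eq (y ∷ ys) u = cong (λ z → if δ y u then 0 else (if adj G y u then 1 else 0) ℕ.+ z) (earlier-eq ys u)
      bound : ∀ u → u ∈ ys → w u ≤ 2ℚ * marg (S.run ys w) u
      bound u m = begin
        w u                                              ≤⟨ ≤⁺ (nn* (w≥0 u) (p≤q⇒0≤q-p KY)) (e (w u) M.K Y) ⟩
        2ℚ * (w u * (1ℚ - M.K * (0ℚ + Y)))               ≤⟨ *-monoˡ 0≤2 (M.marginal ys w 0ℚ u m w≥0 ≤-refl inv0) ⟩
        2ℚ * marg (S.run ys w) u ∎
        where
        open ≤-Reasoning
        Y = S.earlierWeight ys u w
        e : ∀ w k y → 2ℚ * (w * (1ℚ - k * (0ℚ + y))) ≡ w + w * (1ℚ - 2ℚ * (k * y))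
        e = solve-∀ ringℚ
        KY : 2ℚ * (M.K * Y) ≤ 1ℚ
        KY = ≤-trans (*-monoˡ 0≤2 (*-monoˡ (nn* 0≤2 κ≥0) (≤-trans (S.earlierWeight≤ ys u w w≤ε)
               (*-monoˡ ε≥0 (ι-mono (subst (ℕ._≤ d) (sym (earlier-eq ys u)) (few u m))))))) (≤-reflexive half)
        inv0 : M.Inv (w u) 0ℚ
        inv0 _ = ≤-trans (≤-reflexive (trans (cong (λ z → w u * z ^ h) (e₁ κ)) (trans (cong (w u *_) (1^ h)) (*-identityʳ (w u))))) (w≤ε u)
          where e₁ : ∀ k → 1ℚ - k * 0ℚ ≡ 1ℚ
                e₁ = solve-∀ ringℚ

  count-cong : ∀ {n} {S T : Subset n} → (∀ x → S x ≡ T x) → count S ≡ count T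
  count-cong {zero} h = refl
  count-cong {suc n} {S} {T} h with S zero | T zero | h zero
  ... | true | true | _ = cong suc (count-cong (λ i → h (suc i)))
  ... | false | false | _ = count-cong (λ i → h (suc i))

  count-mono : ∀ {n} {S T : Subset n} → S ⊆ T → count S ℕ.≤ count T
  count-mono {S = S} {T} h = ι-cancel (≤-trans (≤-reflexive (sym (sum-[] S))) (≤-trans (sum-mono pt) (≤-reflexive (sum-[] T))))
    where
    pt : ∀ x → [ S x ] ≤ [ T x ]
    pt x with bool (S x)
    ... | inj₁ t = ≤-reflexive (cong [_] (trans t (sym (h t))))
    ... | inj₂ f = ≤-trans (≤-reflexive (cong [_] f)) ([]≥0 (T x))

  _∪₁_ : ∀ {n} → Subset n → Fin n → Subset n
  (S ∪₁ v) x = δ v x ∨ S x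

  -- The elements of the list are outside S, and each has fewer than d neighbours among S and its predecessors in the list.
  Degenerate : ∀ {n} → Graph n → ℕ → Subset n → List (Fin n) → Set
  Degenerate G d S [] = ⊤
  Degenerate G d S (x ∷ xs) = S x ≡ false × degreeIn G S x ℕ.< d × Degenerate G d (S ∪₁ x) xs

  Degenerate-ext : ∀ {n} (G : Graph n) d {S T} xs → (∀ x → S x ≡ T x) → Degenerate G d S xs → Degenerate G d T xs
  Degenerate-ext G d [] h _ = tt
  Degenerate-ext G d {S} {T} (x ∷ xs) h (a , b , c) =
    trans (sym (h x)) a , subst (ℕ._< d) (count-cong (λ u → cong (_∧ adj G x u) (h u))) b ,
    Degenerate-ext G d xs (λ u → cong (δ x u ∨_) (h u)) c

  degreeIn-∪₁ : ∀ {n} (G : Graph n) (S : Subset n) x u → S x ≡ false → degreeIn G (S ∪₁ x) u ≡ (if adj G x u then 1 else 0) ℕ.+ degreeIn G S u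
  degreeIn-∪₁ {n} G S x u hx = ℕₚ.≤-antisym (ι-cancel (≤-reflexive q)) (ι-cancel (≤-reflexive (sym q)))
    where
    ι-if : ∀ b → ι (if b then 1 else 0) ≡ [ b ]
    ι-if true = refl
    ι-if false = refl
    pt : ∀ y → α G u y * [ (S ∪₁ x) y ] ≡ α G u y * [ δ x y ] + α G u y * [ S y ]
    pt y = trans (cong (α G u y *_) (disj (bool (δ x y)))) (*-distribˡ-+ (α G u y) _ _)
      where
      disj : δ x y ≡ true ⊎ δ x y ≡ false → [ δ x y ∨ S y ] ≡ [ δ x y ] + [ S y ]
      disj (inj₁ t) with δ≡true x y t
      ... | refl = trans (cong (λ b → [ b ∨ S x ]) t) (trans (sym (+-identityʳ 1ℚ)) (sym (cong₂ (λ b c → [ b ] + [ c ]) t hx)))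
      disj (inj₂ f) = trans (cong (λ b → [ b ∨ S y ]) f) (trans (sym (+-identityˡ _)) (sym (cong (λ b → [ b ] + [ S y ]) f)))
    q : ι (degreeIn G (S ∪₁ x) u) ≡ ι ((if adj G x u then 1 else 0) ℕ.+ degreeIn G S u)
    q = begin
      ι (degreeIn G (S ∪₁ x) u) ≡⟨ sym (weight-count G (S ∪₁ x) u) ⟩
      sum (λ y → α G u y * [ (S ∪₁ x) y ]) ≡⟨ trans (sum-cong pt) (sum-+ (λ y → α G u y * [ δ x y ]) (λ y → α G u y * [ S y ])) ⟩
      sum (λ y → α G u y * [ δ x y ]) + weightTo G (λ y → [ S y ]) u ≡⟨ cong₂ _+_ (trans (sum-δ x (α G u)) (trans (α-sym G u x) (sym (ι-if (adj G x u))))) (weight-count G S u) ⟩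
      ι (if adj G x u then 1 else 0) + ι (degreeIn G S u) ≡⟨ sym (ι-+ (if adj G x u then 1 else 0) (degreeIn G S u)) ⟩
      ι ((if adj G x u then 1 else 0) ℕ.+ degreeIn G S u) ∎
      where open ≡-Reasoning

  Degenerate-earlier : ∀ {n} (G : Graph n) d S xs u → Degenerate G d S xs → u ∈ xs → earlier G xs u ℕ.+ degreeIn G S u ℕ.< d
  Degenerate-earlier G d S (x ∷ xs) u (sx , lt , D) m = go m (x Finₚ.≟ u)
    where
    Goal : Set
    Goal = earlier G (x ∷ xs) u ℕ.+ degreeIn G S u ℕ.< d
    go : u ∈ (x ∷ xs) → Dec (x ≡ u) → Goal
    go _ (yes refl) = subst (λ b → (if b then 0 else (if adj G x x then 1 else 0) ℕ.+ earlier G xs x) ℕ.+ degreeIn G S x ℕ.< d) (sym (δ-refl x)) lt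
    go (here e) (no ne) = ⊥-elim (ne (sym e))
    go (there m) (no ne) = subst (λ b → (if b then 0 else (if adj G x u then 1 else 0) ℕ.+ earlier G xs u) ℕ.+ degreeIn G S u ℕ.< d) (sym (dec-false (x Finₚ.≟ u) ne))
      (subst (ℕ._< d) (trans (cong (earlier G xs u ℕ.+_) (degreeIn-∪₁ G S x u sx)) (rearr (earlier G xs u) (if adj G x u then 1 else 0) (degreeIn G S u)))
        (Degenerate-earlier G d (S ∪₁ x) xs u D m))
      where
      rearr : ∀ a b c → a ℕ.+ (b ℕ.+ c) ≡ b ℕ.+ a ℕ.+ c
      rearr a b c = trans (sym (ℕₚ.+-assoc a b c)) (cong (ℕ._+ c) (ℕₚ.+-comm a b))

  ∖-∪₁ : ∀ {n} (S : Subset n) r → S r ≡ true → ∀ x → S x ≡ ((S ∖ r) ∪₁ r) x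
  ∖-∪₁ S r hr x with r Finₚ.≟ x
  ... | yes refl = hr
  ... | no _ = sym (Boolₚ.∧-identityʳ (S x))

  -- Removed vertices go to the front of the list, so the list is the reverse order of removal: when
  -- `v` is removed, what remains is `T` together with the vertices that end up before `v`.
  peel : ∀ {n} (G : Graph n) d k (S : Subset n) acc → count S ℕ.≤ k → Degenerate G d S acc →
    ∃ λ T → ∃ λ xs → T ⊆ S × (∀ v → T v ≡ true → d ℕ.≤ degreeIn G T v) × Degenerate G d T xs ×
      (∀ v → S v ≡ true → T v ≡ true ⊎ v ∈ xs) × (∀ v → v ∈ acc → v ∈ xs)
  peel G d k S acc hk D with Finₚ.any? (λ v → (S v Boolₚ.≟ true) ×-dec (degreeIn G S v ℕ.<? d))
  ... | no none = S , acc , (λ z → z) , (λ v hv → ℕₚ.≮⇒≥ (λ lt → none (v , hv , lt))) , D , (λ v → inj₁) , λ v m → m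
  peel G d zero S acc hk D | yes (v , hv , lt) = ⊥-elim (ℕₚ.n≮0 (subst (ℕ._≤ 0) (count-∖ S v hv) hk))
  peel G d (suc k) S acc hk D | yes (v , hv , lt) =
    let T , xs , sub , md , D' , cov , keep = peel G d k (S ∖ v) (v ∷ acc) (ℕₚ.≤-pred (subst (ℕ._≤ suc k) (count-∖ S v hv) hk))
                                                (out , lt' , Degenerate-ext G d acc (∖-∪₁ S v hv) D)
    in T , xs , (λ {x} t → ∖-⊆ S v {x} (sub t)) , md , D' , cover cov keep , λ u m → keep u (there m)
    where
    out : (S ∖ v) v ≡ false
    out = trans (cong (λ b → S v ∧ not b) (δ-refl v)) (Boolₚ.∧-zeroʳ (S v))
    lt' : degreeIn G (S ∖ v) v ℕ.< d
    lt' = ℕₚ.≤-<-trans (count-mono {S = λ u → (S ∖ v) u ∧ adj G v u} {T = λ u → S u ∧ adj G v u} sub) lt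
      where
      sub : ∀ {u} → (S ∖ v) u ∧ adj G v u ≡ true → S u ∧ adj G v u ≡ true
      sub {u} h with S u | adj G v u
      ... | true | true = refl
      ... | true | false = ⊥-elim (true≢false h (Boolₚ.∧-zeroʳ _))
    cover : ∀ {T : Subset _} {xs} → (∀ u → (S ∖ v) u ≡ true → T u ≡ true ⊎ u ∈ xs) → (∀ u → u ∈ (v ∷ acc) → u ∈ xs) →
      ∀ u → S u ≡ true → T u ≡ true ⊎ u ∈ xs
    cover cov keep u hu with v Finₚ.≟ u in eq
    ... | yes refl = inj₂ (keep v (here refl))
    ... | no ne = cov u (subst (λ b → S u ∧ not b ≡ true) (sym (dec-false (v Finₚ.≟ u) ne)) (trans (Boolₚ.∧-identityʳ (S u)) hu))

  -- Shrink S to the d-core of S ∖ v while that is nonempty.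
  degenerate-core : ∀ {n} (G : Graph n) d k (S : Subset n) → count S ℕ.≤ k → NonEmpty S → (∀ v → S v ≡ true → d ℕ.≤ degreeIn G S v) →
    ∃ λ T → ∃ λ ys → NonEmpty T × (∀ v → T v ≡ true → d ℕ.≤ degreeIn G T v) × (∀ v → T v ≡ true → v ∈ ys) × (∀ u → u ∈ ys → earlier G ys u ℕ.≤ d)
  degenerate-core G d zero S hk (v , hv) md = ⊥-elim (ℕₚ.n≮0 (subst (ℕ._≤ 0) (count-∖ S v hv) hk))
  degenerate-core {n} G d (suc k) S hk (v , hv) md = go (peel G d k (S ∖ v) [] hk' tt)
    where
    hk' = ℕₚ.≤-pred (subst (ℕ._≤ suc k) (count-∖ S v hv) hk)
    Result : Set
    Result = ∃ λ T → ∃ λ ys → NonEmpty T × (∀ v → T v ≡ true → d ℕ.≤ degreeIn G T v) × (∀ v → T v ≡ true → v ∈ ys) × (∀ u → u ∈ ys → earlier G ys u ℕ.≤ d)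
    go : (∃ λ T → ∃ λ xs → T ⊆ (S ∖ v) × (∀ v → T v ≡ true → d ℕ.≤ degreeIn G T v) × Degenerate G d T xs ×
      (∀ u → (S ∖ v) u ≡ true → T u ≡ true ⊎ u ∈ xs) × (∀ v → v ∈ [] → v ∈ xs)) → Result
    go (T , xs , sub , mdT , D , cov , _) = decide (Finₚ.any? (λ u → T u Boolₚ.≟ true))
      where
      decide : Dec (NonEmpty T) → Result
      decide (yes ne) = degenerate-core G d k T (ℕₚ.≤-trans (count-mono {S = T} {T = S ∖ v} (λ {x} → sub {x})) hk') ne mdT
      -- The whole of `S` without `v` has been peeled off. Putting `v` first adds at most one
      -- earlier neighbour to the fewer than `d` that each other vertex has.
      decide (no emp) = S , v ∷ xs , (v , hv) , md , cov' , few
        where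
        cov' : ∀ u → S u ≡ true → u ∈ (v ∷ xs)
        cov' u hu = at (v Finₚ.≟ u)
          where
          at : Dec (v ≡ u) → u ∈ (v ∷ xs)
          at (yes refl) = here refl
          at (no ne) with cov u (subst (λ b → S u ∧ not b ≡ true) (sym (dec-false (v Finₚ.≟ u) ne)) (trans (Boolₚ.∧-identityʳ (S u)) hu))
          ... | inj₁ t = ⊥-elim (emp (u , t))
          ... | inj₂ m = there m
        few : ∀ u → u ∈ (v ∷ xs) → earlier G (v ∷ xs) u ℕ.≤ d
        few u m = at m (v Finₚ.≟ u)
          where
          if≤1 : ∀ b → (if b then 1 else 0) ℕ.≤ 1
          if≤1 true = ℕₚ.≤-refl
          if≤1 false = ℕ.z≤n
          at : u ∈ (v ∷ xs) → Dec (v ≡ u) → earlier G (v ∷ xs) u ℕ.≤ d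
          at _ (yes refl) = subst (λ b → (if b then 0 else (if adj G v v then 1 else 0) ℕ.+ earlier G xs v) ℕ.≤ d) (sym (δ-refl v)) ℕ.z≤n
          at (here e) (no ne) = ⊥-elim (ne (sym e))
          at (there m) (no ne) = subst (λ b → (if b then 0 else (if adj G v u then 1 else 0) ℕ.+ earlier G xs u) ℕ.≤ d) (sym (dec-false (v Finₚ.≟ u) ne))
            (ℕₚ.≤-trans (ℕₚ.+-monoˡ-≤ (earlier G xs u) (if≤1 (adj G v u)))
              (ℕₚ.≤-trans (ℕ.s≤s (ℕₚ.m≤m+n (earlier G xs u) (degreeIn G T u))) (Degenerate-earlier G d T xs u D m)))

  module _ {h d : ℕ} (h>0 : 0 ℕ.< h) (d>0 : 0 ℕ.< d) (small : h ℕ.* 2 ℕ.^ h ℕ.≤ 4 ℕ.* d) where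

    private module R = Rate h d h>0 d>0 small

    -- The random set contains each vertex of `T` with probability at least `ε / 2 = h / (16 d)`;
    -- some outcome is at least as large as the mean.
    large-independent-set : ∀ {n} (G : Graph n) → TriangleFree G → ∀ ys → (∀ u → u ∈ ys → earlier G ys u ℕ.≤ d) →
      (T : Subset n) → (∀ v → T v ≡ true → v ∈ ys) → ∃ λ I → Indep G I × count T ℕ.* h ℕ.≤ 16 ℕ.* d ℕ.* count I
    large-independent-set {n} G tf ys few T cov =
      let μ , sup , m1 , bd = R.select G tf ys (λ _ → R.ε) (λ _ → R.ε≥0) (λ _ → ≤-refl) few
          I , (ind , _) , lt = 𝔼-exists sup (F μ) (pos μ sup m1 bd)
      in I , ind , ℕₚ.≤-pred (ι-cancel< (conv I lt))
      where
      A B : ℚ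
      A = ι (16 ℕ.* d)
      B = ι (count T ℕ.* h)
      F : Meas n → Subset n → ℚ
      -- The extra one gives the strict positivity that `𝔼-exists` asks for; it is harmless because
      -- an inequality between integers is wanted.
      F μ I = A * size I + (1ℚ - B)
      pt : ∀ (μ : Meas n) → (∀ u → u ∈ ys → R.ε ≤ 2ℚ * marg μ u) → (∀ u → 0ℚ ≤ marg μ u) → ∀ u → R.ε * [ T u ] ≤ 2ℚ * marg μ u
      pt μ bd nn u with bool (T u)
      ... | inj₁ t = ≤-trans (≤-reflexive (trans (cong (λ b → R.ε * [ b ]) t) (*-identityʳ R.ε))) (bd u (cov u t))
      ... | inj₂ f = ≤-trans (≤-reflexive (trans (cong (λ b → R.ε * [ b ]) f) (*-zeroʳ R.ε))) (nn* 0≤2 (nn u))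
      e₁ : ∀ x e s → x * e * s ≡ x * (e * s)
      e₁ = solve-∀ ringℚ
      e₂ : ∀ x s → x * (2ℚ * s) ≡ (2ℚ * x) * s
      e₂ = solve-∀ ringℚ
      e₃ : ∀ a b → a + (1ℚ - b) ≡ 1ℚ + (a - b)
      e₃ = solve-∀ ringℚ
      pos : ∀ (μ : Meas n) {P} → Supp P μ → mass μ ≡ 1ℚ → (∀ u → u ∈ ys → R.ε ≤ 2ℚ * marg μ u) → 0ℚ < 𝔼 μ (F μ)
      pos μ sup m1 bd = subst (0ℚ <_) (sym EF) (<-≤-trans 0<1 (≤⁺ (p≤q⇒0≤q-p B≤) (e₃ (A * sum (marg μ)) B)))
        where
        EF : 𝔼 μ (F μ) ≡ A * sum (marg μ) + (1ℚ - B)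
        EF = trans (𝔼-+ μ (λ I → A * size I) (λ _ → 1ℚ - B)) (cong₂ _+_
          (trans (𝔼-* μ A size) (cong (A *_) (𝔼-sum μ (λ u I → [ I u ]))))
          (trans (𝔼-const μ (1ℚ - B)) (trans (cong ((1ℚ - B) *_) m1) (*-identityʳ _))))
        B≤ : B ≤ A * sum (marg μ)
        B≤ = begin
          ι (count T ℕ.* h)                        ≡⟨ trans (ι-* (count T) h) (*-comm (ι (count T)) (ι h)) ⟩
          ι h * ι (count T)                        ≡⟨ cong (_* ι (count T)) (sym R.8dε) ⟩
          ι (8 ℕ.* d) * R.ε * ι (count T)          ≡⟨ trans (cong (ι (8 ℕ.* d) * R.ε *_) (sym (sum-[] T))) (e₁ (ι (8 ℕ.* d)) R.ε (size T)) ⟩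
          ι (8 ℕ.* d) * (R.ε * size T)             ≡⟨ cong (ι (8 ℕ.* d) *_) (sym (sum-* R.ε (λ u → [ T u ]))) ⟩
          ι (8 ℕ.* d) * sum (λ u → R.ε * [ T u ])  ≤⟨ *-monoˡ (ι≥0 (8 ℕ.* d)) (sum-mono (pt μ bd (λ u → 𝔼-nn sup (λ I → []≥0 (I u))))) ⟩
          ι (8 ℕ.* d) * sum (λ u → 2ℚ * marg μ u)  ≡⟨ trans (cong (ι (8 ℕ.* d) *_) (sum-* 2ℚ (marg μ))) (e₂ (ι (8 ℕ.* d)) (sum (marg μ))) ⟩
          2ℚ * ι (8 ℕ.* d) * sum (marg μ)          ≡⟨ cong (_* sum (marg μ)) (trans (sym (ι-* 2 (8 ℕ.* d))) (cong ι (sym (ℕₚ.*-assoc 2 8 d)))) ⟩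
          A * sum (marg μ) ∎
          where open ≤-Reasoning
      conv : ∀ I → 0ℚ < A * size I + (1ℚ - B) → B < ι (suc (16 ℕ.* d ℕ.* count I))
      conv I lt = subst (B <_) (cong (1ℚ +_) (trans (cong (A *_) (sum-[] I)) (sym (ι-* (16 ℕ.* d) (count I)))))
        (0<q-p⇒p<q (subst (0ℚ <_) (e₄ (A * size I) B) lt))
        where e₄ : ∀ a b → a + (1ℚ - b) ≡ (1ℚ + a) - b
              e₄ = solve-∀ ringℚ

    -- On the core the marginals are at least `ε / 2`, so every vertex there has expected degree at
    -- least `d ε / 2 = h / 16` into the second random set. `dense-pair` with `c = 2 g` asks for
    -- more than `4 g`.
    log-bipartite : ∀ {n} (G : Graph n) → Fin n → TriangleFree G → MinDegree≥ G d → ∀ g → 64 ℕ.* g ℕ.< h → HasInducedBipartiteMinDeg G g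
    log-bipartite {n} G v₀ tf md g lt =
      let S , ys , ne , mdS , cov , few = degenerate-core G d n (λ _ → true) count≤ (v₀ , refl) (λ v _ → md v)
      in conclude S ys ne mdS cov few
      where
      count≤ : ∀ {n} → count {n} (λ _ → true) ℕ.≤ n
      count≤ {zero} = ℕ.z≤n
      count≤ {suc n} = ℕ.s≤s count≤
      conclude : ∀ S ys → NonEmpty S → (∀ v → S v ≡ true → d ℕ.≤ degreeIn G S v) → (∀ v → S v ≡ true → v ∈ ys) →
        (∀ u → u ∈ ys → earlier G ys u ℕ.≤ d) → HasInducedBipartiteMinDeg G g
      conclude S ys (v , hv) mdS cov few =
        let μ , sup , m1 , bd = R.select G tf ys w w≥0 w≤ε few
            I , J , (hI , _) , (hJ , _) , q = dense-pair G sup (2ℚ * ι g) (ι d * (R.ε * inv 2ℚ)) (hs μ sup bd) (sum>0 μ sup bd) (c-small μ m1)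
        in indep-pair→bipartite G g I J hI hJ q
        where
        w : Fin n → ℚ
        -- Zero weight outside `S` keeps the random set inside `S`, where the degrees are at least
        -- `d`.
        w x = R.ε * [ S x ]
        w≥0 : ∀ x → 0ℚ ≤ w x
        w≥0 x = nn* R.ε≥0 ([]≥0 (S x))
        w≤ε : ∀ x → w x ≤ R.ε
        w≤ε x = ≤-trans (*-monoˡ R.ε≥0 ([]≤1 (S x))) (≤-reflexive (*-identityʳ R.ε))
        P : Subset n → Set
        P I = Indep G I × (∀ x → I x ≡ true → 0ℚ < w x)
        i2 = inv 2ℚ
        i2≥0 = <⇒≤ (inv-pos 0<2)
        marg≥0' : ∀ (μ : Meas n) → Supp P μ → ∀ u → 0ℚ ≤ marg μ u
        marg≥0' μ sup u = 𝔼-nn sup (λ I → []≥0 (I u))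
        e₂ : ∀ e s i → e * i * s ≡ e * s * i
        e₂ = solve-∀ ringℚ
        lower : ∀ (μ : Meas n) → Supp P μ → (∀ u → u ∈ ys → w u ≤ 2ℚ * marg μ u) → ∀ u → R.ε * i2 * [ S u ] ≤ marg μ u
        lower μ sup bd u with bool (S u)
        ... | inj₁ t = ≤-trans (≤-reflexive (e₂ R.ε [ S u ] i2)) (≤-trans (*-monoʳ i2≥0 (bd u (cov u t))) (≤-reflexive (trans (e₃ (marg μ u) i2) (trans (cong (marg μ u *_) (inv-r 0<2)) (*-identityʳ _)))))
          where e₃ : ∀ m i → 2ℚ * m * i ≡ m * (2ℚ * i)
                e₃ = solve-∀ ringℚ
        ... | inj₂ f = ≤-trans (≤-reflexive (trans (cong (λ b → R.ε * i2 * [ b ]) f) (*-zeroʳ (R.ε * i2)))) (marg≥0' μ sup u)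
        ε>0 : 0ℚ < R.ε
        ε>0 = 0<*⇒0<ˡ (ι≥0 (8 ℕ.* d)) (subst (0ℚ <_) (trans (sym R.8dε) (*-comm _ R.ε)) (ι>0 h>0))
        sum>0 : ∀ (μ : Meas n) → Supp P μ → (∀ u → u ∈ ys → w u ≤ 2ℚ * marg μ u) → 0ℚ < sum (marg μ)
        sum>0 μ sup bd = <-≤-trans (subst (0ℚ <_) (trans (sym (*-identityʳ _)) (sym (cong (λ b → R.ε * i2 * [ b ]) hv))) (pos* ε>0 (inv-pos 0<2)))
          (≤-trans (lower μ sup bd v) (term≤sum (marg≥0' μ sup) v))
        hs : ∀ (μ : Meas n) → Supp P μ → (∀ u → u ∈ ys → w u ≤ 2ℚ * marg μ u) → ∀ x → marg μ x * (ι d * (R.ε * i2)) ≤ marg μ x * weightTo G (marg μ) x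
        hs μ sup bd x with bool (S x)
        ... | inj₁ t = *-monoˡ (marg≥0' μ sup x) (begin
            ι d * (R.ε * i2)                                  ≤⟨ *-monoʳ (nn* R.ε≥0 i2≥0) (ι-mono (mdS x t)) ⟩
            ι (degreeIn G S x) * (R.ε * i2)                   ≡⟨ trans (*-comm _ (R.ε * i2)) (cong (R.ε * i2 *_) (sym (weight-count G S x))) ⟩
            R.ε * i2 * weightTo G (λ y → [ S y ]) x           ≡⟨ sym (sum-* (R.ε * i2) (λ y → α G x y * [ S y ])) ⟩
            sum (λ y → R.ε * i2 * (α G x y * [ S y ]))        ≤⟨ sum-mono (λ y → ≤-trans (≤-reflexive (e₄ (R.ε * i2) (α G x y) [ S y ])) (*-monoˡ (α≥0 G x y) (lower μ sup bd y))) ⟩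
            weightTo G (marg μ) x ∎)
            where
            open ≤-Reasoning
            e₄ : ∀ a b c → a * (b * c) ≡ b * (a * c)
            e₄ = solve-∀ ringℚ
        ... | inj₂ f = ≤-reflexive (trans (cong (_* (ι d * (R.ε * i2))) z) (trans (*-zeroˡ (ι d * (R.ε * i2))) (sym (trans (cong (_* weightTo G (marg μ) x) z) (*-zeroˡ (weightTo G (marg μ) x))))))
          where
          z : marg μ x ≡ 0ℚ
          z = 𝔼-supp-0 sup (λ {I} p → out I p (bool (I x)))
            where
            out : ∀ I → P I → I x ≡ true ⊎ I x ≡ false → [ I x ] ≡ 0ℚ
            out I (_ , pp) (inj₁ t) = ⊥-elim (<-irrefl refl (subst (0ℚ <_) (trans (cong (λ b → R.ε * [ b ]) f) (*-zeroʳ R.ε)) (pp x t)))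
            out I _ (inj₂ f') = cong [_] f'
        c-small : ∀ (μ : Meas n) → mass μ ≡ 1ℚ → 2ℚ * (2ℚ * ι g * mass μ) < ι d * (R.ε * i2)
        c-small μ m1 = *-cancelˡ-<-nonNeg (ι 16) {{nonNegative (ι≥0 16)}} (subst₂ _<_ (sym lhs) (sym rhs) (ι-mono< lt))
          where
          open ≡-Reasoning
          lhs : ι 16 * (2ℚ * (2ℚ * ι g * mass μ)) ≡ ι (64 ℕ.* g)
          lhs = trans (cong (λ m → ι 16 * (2ℚ * (2ℚ * ι g * m))) m1) (trans (e₅ (ι g)) (sym (ι-* 64 g)))
            where e₅ : ∀ g → ι 16 * (2ℚ * (2ℚ * g * 1ℚ)) ≡ ι 64 * g
                  e₅ = solve-∀ ringℚ
          rhs : ι 16 * (ι d * (R.ε * i2)) ≡ ι h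
          rhs = trans (e₆ (ι d) R.ε i2) (trans (cong (λ z → ι 8 * ι d * R.ε * z) (inv-r 0<2)) (trans (*-identityʳ _) (trans (cong (_* R.ε) (sym (ι-* 8 d))) R.8dε)))
            where e₆ : ∀ d e i → ι 16 * (d * (e * i)) ≡ ι 8 * d * e * (2ℚ * i)
                  e₆ = solve-∀ ringℚ

  -- Random neighbourhoods and the lower bound of order d²/n.

  tabulate : ∀ {m n} → (Fin m → Subset n) → Meas n
  tabulate {zero} f = []
  tabulate {suc m} f = (1ℚ , f zero) ∷ tabulate (λ i → f (suc i))

  𝔼-tabulate : ∀ {m n} (f : Fin m → Subset n) F → 𝔼 (tabulate f) F ≡ sum (λ i → F (f i))
  𝔼-tabulate {zero} f F = refl
  𝔼-tabulate {suc m} f F = cong₂ _+_ (*-identityˡ (F (f zero))) (𝔼-tabulate (λ i → f (suc i)) F)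

  Supp-tabulate : ∀ {m n P} (f : Fin m → Subset n) → (∀ i → P (f i)) → Supp P (tabulate f)
  Supp-tabulate {zero} f h = []
  Supp-tabulate {suc m} f h = (0≤1 , λ _ → h zero) ∷ Supp-tabulate (λ i → f (suc i)) (λ i → h (suc i))

  -- Each neighbourhood gets weight one, so the mass is `n`, the marginals are the degrees, and the
  -- weight of any neighbourhood is at least `d²`; the factor 4 is `2 c` for `c = 2 g`.
  dense-bipartite : ∀ {n d} (G : Graph n) → Fin n → TriangleFree G → MinDegree≥ G d → ∀ g → 4 ℕ.* g ℕ.* n ℕ.< d ℕ.* d → HasInducedBipartiteMinDeg G g
  dense-bipartite {n} {d} G v₀ tf md g lt =
    let I , J , hI , hJ , q = dense-pair G sup (2ℚ * ι g) (ι d * ι d) hs sum>0 small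
    in indep-pair→bipartite G g I J hI hJ q
    where
    μ : Meas n
    μ = tabulate (adj G)
    sup : Supp (Indep G) μ
    sup = Supp-tabulate (adj G) ind
      where
      ind : ∀ u → Indep G (adj G u)
      ind u x y hx hy with bool (adj G x y)
      ... | inj₁ t = ⊥-elim (tf u x y hx t hy)
      ... | inj₂ f = f
    marg-deg : ∀ x → marg μ x ≡ ι (degree G x)
    marg-deg x = trans (𝔼-tabulate (adj G) (λ I → [ I x ])) (trans (sum-cong (λ u → α-sym G u x)) (sum-[] (adj G x)))
    marg≥d : ∀ x → ι d ≤ marg μ x
    marg≥d x = ≤-trans (ι-mono (md x)) (≤-reflexive (sym (marg-deg x)))
    marg≥0' : ∀ x → 0ℚ ≤ marg μ x
    marg≥0' x = ≤-trans (ι≥0 d) (marg≥d x)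
    d>0 : 0 ℕ.< d
    d>0 = pos d lt
      where pos : ∀ d → 4 ℕ.* g ℕ.* n ℕ.< d ℕ.* d → 0 ℕ.< d
            pos (suc d) _ = ℕ.s≤s ℕ.z≤n
    sum>0 : 0ℚ < sum (marg μ)
    sum>0 = <-≤-trans (ι>0 d>0) (≤-trans (marg≥d v₀) (term≤sum marg≥0' v₀))
    hs : ∀ x → marg μ x * (ι d * ι d) ≤ marg μ x * weightTo G (marg μ) x
    hs x = *-monoˡ (marg≥0' x) (begin
      ι d * ι d                      ≤⟨ *-monoʳ (ι≥0 d) (ι-mono (md x)) ⟩
      ι (degree G x) * ι d           ≡⟨ trans (*-comm _ (ι d)) (cong (ι d *_) (sym (sum-[] (adj G x)))) ⟩
      ι d * sum (α G x)              ≡⟨ sym (sum-* (ι d) (α G x)) ⟩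
      sum (λ y → ι d * α G x y)      ≤⟨ sum-mono (λ y → ≤-trans (≤-reflexive (*-comm (ι d) (α G x y))) (*-monoˡ (α≥0 G x y) (marg≥d y))) ⟩
      weightTo G (marg μ) x ∎)
      where open ≤-Reasoning
    mass-n : mass μ ≡ ι n
    mass-n = trans (𝔼-tabulate (adj G) (λ _ → 1ℚ)) (trans (sum-const n 1ℚ) (*-identityʳ (ι n)))
    small : 2ℚ * (2ℚ * ι g * mass μ) < ι d * ι d
    small = subst₂ _<_ (sym eq) (ι-* d d) (ι-mono< lt)
      where
      e : ∀ g n → 2ℚ * (2ℚ * g * n) ≡ ι 4 * g * n
      e = solve-∀ ringℚ
      eq : 2ℚ * (2ℚ * ι g * mass μ) ≡ ι (4 ℕ.* g ℕ.* n)
      eq = trans (cong (λ m → 2ℚ * (2ℚ * ι g * m)) mass-n) (trans (e (ι g) (ι n)) (sym (trans (ι-* (4 ℕ.* g) n) (cong (_* ι n) (ι-* 4 g)))))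

-- Product test functions and their change in one selection step.

module ProductTests where

  open Rationals
  open WeightedGraphs
  open SelectionProcess using (bool)
  open import Data.Rational.Properties

  -- For the indicator of `I` in place of `w` this is `2^|I ∩ B|` when `a = 1` and the indicator of
  -- `I ∩ B = ∅` when `a = -1`. For general `w` it is their expectation under independent choices
  -- with probabilities `w`.
  wt : ∀ {n} → ℚ → Subset n → (Fin n → ℚ) → ℚ
  wt a B w = prod (λ x → if B x then 1ℚ + a * w x else 1ℚ)

  hit : ∀ {n} → Subset n → Subset n → ℕ
  hit {zero} I B = 0
  hit {suc n} I B = (if I zero ∧ B zero then 1 else 0) ℕ.+ hit (λ x → I (suc x)) (λ x → B (suc x))

  hit≡count : ∀ {n} (I B : Subset n) → hit I B ≡ count (λ x → I x ∧ B x)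
  hit≡count {zero} I B = refl
  hit≡count {suc n} I B with I zero ∧ B zero
  ... | true = cong suc (hit≡count (λ x → I (suc x)) (λ x → B (suc x)))
  ... | false = hit≡count (λ x → I (suc x)) (λ x → B (suc x))

  hit≡0 : ∀ {n} (I B : Subset n) → (∀ x → I x ≡ true → B x ≡ true → ⊥) → hit I B ≡ 0
  hit≡0 {zero} I B h = refl
  hit≡0 {suc n} I B h = cong₂ ℕ._+_ (go (I zero) (B zero) (h zero)) (hit≡0 (λ x → I (suc x)) (λ x → B (suc x)) (λ x → h (suc x)))
    where
    go : ∀ i b → (i ≡ true → b ≡ true → ⊥) → (if i ∧ b then 1 else 0) ≡ 0
    go true true k = ⊥-elim (k refl refl)
    go true false k = refl
    go false b k = refl

  killed : ∀ {n} → Subset n → (Fin n → ℚ) → Fin n → ℚ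
  killed I w x = if I x then 0ℚ else w x

  boosted : ∀ {n} → Subset n → ℚ → (Fin n → ℚ) → Fin n → ℚ
  boosted I iv w x = if I x then w x * iv else w x

  killed-in : ∀ {n} (I : Subset n) w {x} → I x ≡ true → killed I w x ≡ 0ℚ
  killed-in I w h rewrite h = refl

  killed-out : ∀ {n} (I : Subset n) w {x} → I x ≡ false → killed I w x ≡ w x
  killed-out I w h rewrite h = refl

  boosted-in : ∀ {n} (I : Subset n) iv w {x} → I x ≡ true → boosted I iv w x ≡ w x * iv
  boosted-in I iv w h rewrite h = refl

  boosted-out : ∀ {n} (I : Subset n) iv w {x} → I x ≡ false → boosted I iv w x ≡ w x
  boosted-out I iv w h rewrite h = refl

  wt-cong : ∀ {n} a (B : Subset n) {w w'} → (∀ x → B x ≡ true → w x ≡ w' x) → wt a B w ≡ wt a B w'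
  wt-cong a B {w} {w'} h = prod-cong (λ x → pt x (bool (B x)))
    where
    pt : ∀ x → B x ≡ true ⊎ B x ≡ false → (if B x then 1ℚ + a * w x else 1ℚ) ≡ (if B x then 1ℚ + a * w' x else 1ℚ)
    pt x (inj₁ t) = cong (λ z → if B x then 1ℚ + a * z else 1ℚ) (h x t)
    pt x (inj₂ f) = trans (cong (λ b → if b then 1ℚ + a * w x else 1ℚ) f) (sym (cong (λ b → if b then 1ℚ + a * w' x else 1ℚ) f))

  if-nn : ∀ b {x} → 0ℚ ≤ x → 0ℚ ≤ (if b then x else 1ℚ)
  if-nn true h = h
  if-nn false _ = 0≤1

  if-≥1 : ∀ b {x} → 1ℚ ≤ x → 1ℚ ≤ (if b then x else 1ℚ)
  if-≥1 true h = h
  if-≥1 false _ = ≤-refl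

  1≤1+ : ∀ {x} → 0ℚ ≤ x → 1ℚ ≤ 1ℚ + x
  1≤1+ h = ≤⁺ h refl

  wt-≥1 : ∀ {n a} (B : Subset n) {w} → 0ℚ ≤ a → (∀ x → 0ℚ ≤ w x) → 1ℚ ≤ wt a B w
  wt-≥1 B ha hw = prod-≥1 (λ x → if-≥1 (B x) (1≤1+ (nn* ha (hw x))))

  wt⁻-nn : ∀ {n} (B : Subset n) {w} → (∀ x → w x ≤ 1ℚ) → 0ℚ ≤ wt (- 1ℚ) B w
  wt⁻-nn B {w} h = prod-nn (λ x → if-nn (B x) (subst (0ℚ ≤_) (e (w x)) (p≤q⇒0≤q-p (h x))))
    where e : ∀ w → 1ℚ - w ≡ 1ℚ + - 1ℚ * w
          e = solve-∀ ringℚ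

  common⁺ : ∀ p r K Q W {X Y} → 0ℚ ≤ r → Q ≤ W * X × p * K + (1ℚ - p) * Q ≤ W * Y →
    r * Q ≤ (r * W) * X × p * (r * K) + (1ℚ - p) * (r * Q) ≤ (r * W) * Y
  common⁺ p r K Q W {X} {Y} hr (u , v) = ≤-trans (*-monoˡ hr u) (≤-reflexive (sym (*-assoc r W X))) ,
    ≤-trans (≤-reflexive (e p r K Q)) (≤-trans (*-monoˡ hr v) (≤-reflexive (sym (*-assoc r W Y))))
    where e : ∀ p r K Q → p * (r * K) + (1ℚ - p) * (r * Q) ≡ r * (p * K + (1ℚ - p) * Q)
          e = solve-∀ ringℚ

  -- One selection step changes the weights of I; its second order effect on wt a B.
  module Drift (p iv : ℚ) (p≥0 : 0ℚ ≤ p) (iv≥0 : 0ℚ ≤ iv) (q·iv : (1ℚ - p) * iv ≡ 1ℚ) where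

    iv-1 : iv ≡ 1ℚ + p * iv
    iv-1 = trans (e p iv) (cong (_+ p * iv) q·iv)
      where e : ∀ p i → i ≡ (1ℚ - p) * i + p * i
            e = solve-∀ ringℚ

    2p≥0 : 0ℚ ≤ 2ℚ * p
    2p≥0 = nn* 0≤2 p≥0

    module _ (a b σ : ℚ) (a≥0 : 0ℚ ≤ a) (b≥0 : 0ℚ ≤ b) (cond : (1ℚ + 2ℚ * p * σ) * iv ≤ 2ℚ) where

      special⁺ : ∀ K Q W w s → 0ℚ ≤ W → 0ℚ ≤ w → a * w ≤ b → 0ℚ ≤ s → b * s ≤ σ →
        Q ≤ W * (1ℚ + 2ℚ * p * (b * s)) × p * K + (1ℚ - p) * Q ≤ W * (1ℚ + 2ℚ * p * ((b * s) * (b * s))) →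
        (1ℚ + a * (w * iv)) * Q ≤ ((1ℚ + a * w) * W) * (1ℚ + 2ℚ * p * (b * (1ℚ + s))) ×
        p * ((1ℚ + a * 0ℚ) * K) + (1ℚ - p) * ((1ℚ + a * (w * iv)) * Q) ≤ ((1ℚ + a * w) * W) * (1ℚ + 2ℚ * p * ((b * (1ℚ + s)) * (b * (1ℚ + s))))
      special⁺ K Q W w s W≥0 w≥0 c≤b s≥0 S≤σ ih = fst' , snd'
        where
        open ≤-Reasoning
        c S X Y : ℚ
        c = a * w
        S = b * s
        X = 1ℚ + 2ℚ * p * S
        Y = 1ℚ + 2ℚ * p * (S * S)
        c≥0 : 0ℚ ≤ c
        c≥0 = nn* a≥0 w≥0
        S≥0 : 0ℚ ≤ S
        S≥0 = nn* b≥0 s≥0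
        cond' : X * iv ≤ 2ℚ
        cond' = ≤-trans (*-monoʳ iv≥0 (+-monoʳ-≤ 1ℚ (*-monoˡ 2p≥0 S≤σ))) cond
        e₁ : ∀ a w p i W X → (1ℚ + a * (w * (1ℚ + p * i))) * (W * X) ≡ W * ((1ℚ + a * w) * X) + W * (a * w * p) * (X * i)
        e₁ = solve-∀ ringℚ
        e₂ : ∀ W c p b S → ((1ℚ + c) * W) * (1ℚ + 2ℚ * p * (b + S)) ≡ (W * ((1ℚ + c) * (1ℚ + 2ℚ * p * S)) + W * (c * p) * 2ℚ) + W * (2ℚ * p) * (c * b + (b - c))
        e₂ = solve-∀ ringℚ
        e₃ : ∀ p a K w i Q → p * ((1ℚ + a * 0ℚ) * K) + (1ℚ - p) * ((1ℚ + a * (w * i)) * Q) ≡ (p * K + (1ℚ - p) * Q) + a * w * Q * ((1ℚ - p) * i)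
        e₃ = solve-∀ ringℚ
        e₄ : ∀ W c p b S → ((1ℚ + c) * W) * (1ℚ + 2ℚ * p * ((b + S) * (b + S))) ≡ (W * (1ℚ + 2ℚ * p * (S * S)) + c * (W * (1ℚ + 2ℚ * p * S)) * 1ℚ) + W * (2ℚ * p) * ((S * b + b * b) + S * (b - c) + c * ((S + b) * (S + b)))
        e₄ = solve-∀ ringℚ
        e₅ : ∀ b s → b * (1ℚ + s) ≡ b + b * s
        e₅ = solve-∀ ringℚ
        fst' : (1ℚ + a * (w * iv)) * Q ≤ ((1ℚ + c) * W) * (1ℚ + 2ℚ * p * (b * (1ℚ + s)))
        fst' = begin
          (1ℚ + a * (w * iv)) * Q              ≤⟨ *-monoˡ (nn+ 0≤1 (nn* a≥0 (nn* w≥0 iv≥0))) (proj₁ ih) ⟩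
          (1ℚ + a * (w * iv)) * (W * X)        ≡⟨ cong (λ z → (1ℚ + a * (w * z)) * (W * X)) iv-1 ⟩
          (1ℚ + a * (w * (1ℚ + p * iv))) * (W * X) ≡⟨ e₁ a w p iv W X ⟩
          W * ((1ℚ + c) * X) + W * (c * p) * (X * iv) ≤⟨ +-monoʳ-≤ (W * ((1ℚ + c) * X)) (*-monoˡ (nn* W≥0 (nn* c≥0 p≥0)) cond') ⟩
          W * ((1ℚ + c) * X) + W * (c * p) * 2ℚ ≤⟨ ≤⁺ (nn* (nn* W≥0 2p≥0) (nn+ (nn* c≥0 b≥0) (p≤q⇒0≤q-p c≤b))) (e₂ W c p b S) ⟩
          ((1ℚ + c) * W) * (1ℚ + 2ℚ * p * (b + S)) ≡⟨ cong (λ z → ((1ℚ + c) * W) * (1ℚ + 2ℚ * p * z)) (sym (e₅ b s)) ⟩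
          ((1ℚ + c) * W) * (1ℚ + 2ℚ * p * (b * (1ℚ + s))) ∎
        snd' : p * ((1ℚ + a * 0ℚ) * K) + (1ℚ - p) * ((1ℚ + a * (w * iv)) * Q) ≤ ((1ℚ + c) * W) * (1ℚ + 2ℚ * p * ((b * (1ℚ + s)) * (b * (1ℚ + s))))
        snd' = begin
          p * ((1ℚ + a * 0ℚ) * K) + (1ℚ - p) * ((1ℚ + a * (w * iv)) * Q) ≡⟨ e₃ p a K w iv Q ⟩
          (p * K + (1ℚ - p) * Q) + c * Q * ((1ℚ - p) * iv)              ≡⟨ cong (λ z → (p * K + (1ℚ - p) * Q) + c * Q * z) q·iv ⟩
          (p * K + (1ℚ - p) * Q) + c * Q * 1ℚ                           ≤⟨ +-mono-≤ (proj₂ ih) (*-monoʳ 0≤1 (*-monoˡ c≥0 (proj₁ ih))) ⟩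
          W * Y + c * (W * X) * 1ℚ    ≤⟨ ≤⁺ (nn* (nn* W≥0 2p≥0) (nn+ (nn+ (nn+ (nn* S≥0 b≥0) (nn* b≥0 b≥0)) (nn* S≥0 (p≤q⇒0≤q-p c≤b))) (nn* c≥0 (nn* (nn+ S≥0 b≥0) (nn+ S≥0 b≥0))))) (e₄ W c p b S) ⟩
          ((1ℚ + c) * W) * (1ℚ + 2ℚ * p * ((b + S) * (b + S))) ≡⟨ cong (λ z → ((1ℚ + c) * W) * (1ℚ + 2ℚ * p * (z * z))) (sym (e₅ b s)) ⟩
          ((1ℚ + c) * W) * (1ℚ + 2ℚ * p * ((b * (1ℚ + s)) * (b * (1ℚ + s)))) ∎

      -- Both bounds are needed at once. A vertex of `I ∩ B` with `c = a * w x` turns the mean into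
      -- `p K + (1 - p) Q + c Q`, as `(1 - p) iv = 1`; the linear bound on `Q` then makes the error
      -- of the mean quadratic in the number of hits. `cond` keeps the linear bound inductive.
      drift⁺ : ∀ {n} (I B : Subset n) (w : Fin n → ℚ) → (∀ x → 0ℚ ≤ w x) → (∀ x → a * w x ≤ b) → b * ι (hit I B) ≤ σ →
        wt a B (boosted I iv w) ≤ wt a B w * (1ℚ + 2ℚ * p * (b * ι (hit I B))) ×
        p * wt a B (killed I w) + (1ℚ - p) * wt a B (boosted I iv w) ≤ wt a B w * (1ℚ + 2ℚ * p * ((b * ι (hit I B)) * (b * ι (hit I B))))
      drift⁺ {zero} I B w hw hb hσ = ≤-reflexive (sym (e₁ p b)) , ≤-reflexive (e₂ p b)
        where
        e₁ : ∀ p b → 1ℚ * (1ℚ + 2ℚ * p * (b * 0ℚ)) ≡ 1ℚ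
        e₁ = solve-∀ ringℚ
        e₂ : ∀ p b → p * 1ℚ + (1ℚ - p) * 1ℚ ≡ 1ℚ * (1ℚ + 2ℚ * p * ((b * 0ℚ) * (b * 0ℚ)))
        e₂ = solve-∀ ringℚ
      drift⁺ {suc n} I B w hw hb hσ = step (I zero) (B zero) hσ
        where
        I' B' : Subset n
        I' x = I (suc x)
        B' x = B (suc x)
        w' : Fin n → ℚ
        w' x = w (suc x)
        s : ℕ
        s = hit I' B'
        K Q W : ℚ
        K = wt a B' (killed I' w')
        Q = wt a B' (boosted I' iv w')
        W = wt a B' w'
        S≤ : b * ι s ≤ b * ι (suc s)
        S≤ = *-monoˡ b≥0 (≤⁺ 0≤1 (+-comm 1ℚ (ι s)))
        ih : b * ι s ≤ σ → Q ≤ W * (1ℚ + 2ℚ * p * (b * ι s)) × p * K + (1ℚ - p) * Q ≤ W * (1ℚ + 2ℚ * p * ((b * ι s) * (b * ι s)))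
        ih h = drift⁺ I' B' w' (λ x → hw (suc x)) (λ x → hb (suc x)) h
        step : ∀ i c → b * ι ((if i ∧ c then 1 else 0) ℕ.+ s) ≤ σ →
          (if c then 1ℚ + a * (if i then w zero * iv else w zero) else 1ℚ) * Q ≤ ((if c then 1ℚ + a * w zero else 1ℚ) * W) * (1ℚ + 2ℚ * p * (b * ι ((if i ∧ c then 1 else 0) ℕ.+ s))) ×
          p * ((if c then 1ℚ + a * (if i then 0ℚ else w zero) else 1ℚ) * K) + (1ℚ - p) * ((if c then 1ℚ + a * (if i then w zero * iv else w zero) else 1ℚ) * Q)
            ≤ ((if c then 1ℚ + a * w zero else 1ℚ) * W) * (1ℚ + 2ℚ * p * ((b * ι ((if i ∧ c then 1 else 0) ℕ.+ s)) * (b * ι ((if i ∧ c then 1 else 0) ℕ.+ s))))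
        step true true h = special⁺ K Q W (w zero) (ι s) (≤-trans 0≤1 (wt-≥1 B' a≥0 (λ x → hw (suc x)))) (hw zero) (hb zero) (ι≥0 s) (≤-trans S≤ h) (ih (≤-trans S≤ h))
        step true false h = common⁺ p 1ℚ K Q W 0≤1 (ih h)
        step false true h = common⁺ p (1ℚ + a * w zero) K Q W (nn+ 0≤1 (nn* a≥0 (hw zero))) (ih h)
        step false false h = common⁺ p 1ℚ K Q W 0≤1 (ih h)

    module _ (b : ℚ) (b≥0 : 0ℚ ≤ b) (iv≤2 : iv ≤ 2ℚ) where

      special⁻ : ∀ K Q W w s → 0ℚ ≤ K → 0ℚ ≤ Q → Q ≤ K → 0ℚ ≤ w → w ≤ 1ℚ → w ≤ b → w * iv ≤ 1ℚ → 0ℚ ≤ s →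
        W ≤ Q + 2ℚ * p * (b * s) * K × p * K + (1ℚ - p) * Q ≤ W + p * ((b * s) * (b * s)) * K →
        (1ℚ + - 1ℚ * w) * W ≤ (1ℚ + - 1ℚ * (w * iv)) * Q + 2ℚ * p * (b * (1ℚ + s)) * ((1ℚ + - 1ℚ * 0ℚ) * K) ×
        p * ((1ℚ + - 1ℚ * 0ℚ) * K) + (1ℚ - p) * ((1ℚ + - 1ℚ * (w * iv)) * Q) ≤ (1ℚ + - 1ℚ * w) * W + p * ((b * (1ℚ + s)) * (b * (1ℚ + s))) * ((1ℚ + - 1ℚ * 0ℚ) * K)
      special⁻ K Q W w s K≥0 Q≥0 Q≤K w≥0 w≤1 w≤b wiv≤1 s≥0 (u , v) = fst' , snd'
        where
        open ≤-Reasoning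
        S : ℚ
        S = b * s
        S≥0 : 0ℚ ≤ S
        S≥0 = nn* b≥0 s≥0
        e₁ : ∀ w p i Q S K → (1ℚ - w) * (Q + 2ℚ * p * S * K) + (w * (2ℚ * p * S * K) + w * Q * (p * i)) ≡ (1ℚ + - 1ℚ * (w * (1ℚ + p * i))) * Q + 2ℚ * p * S * K + w * Q * (p * i) + w * Q * (p * i)
        e₁ = solve-∀ ringℚ
        e₁' : ∀ w W → (1ℚ + - 1ℚ * w) * W ≡ (1ℚ - w) * W
        e₁' = solve-∀ ringℚ
        e₂ : ∀ w p i Q S K → (1ℚ - w) * (Q + 2ℚ * p * S * K) ≡ (1ℚ + - 1ℚ * (w * (1ℚ + p * i))) * Q + (w * Q * (p * i) + (1ℚ - w) * (2ℚ * p * S * K))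
        e₂ = solve-∀ ringℚ
        e₃ : ∀ p b s K → b * K * (p * 2ℚ) + 2ℚ * p * (b * s) * K ≡ 2ℚ * p * (b * (1ℚ + s)) * ((1ℚ + - 1ℚ * 0ℚ) * K)
        e₃ = solve-∀ ringℚ
        e₄ : ∀ x w → x ≡ (1ℚ - w) * x + w * x
        e₄ = solve-∀ ringℚ
        2pSK≥0 : 0ℚ ≤ 2ℚ * p * S * K
        2pSK≥0 = nn* (nn* 2p≥0 S≥0) K≥0
        fst' : (1ℚ + - 1ℚ * w) * W ≤ (1ℚ + - 1ℚ * (w * iv)) * Q + 2ℚ * p * (b * (1ℚ + s)) * ((1ℚ + - 1ℚ * 0ℚ) * K)
        fst' = begin
          (1ℚ + - 1ℚ * w) * W                ≡⟨ e₁' w W ⟩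
          (1ℚ - w) * W                       ≤⟨ *-monoˡ (p≤q⇒0≤q-p w≤1) u ⟩
          (1ℚ - w) * (Q + 2ℚ * p * S * K)    ≡⟨ e₂ w p iv Q S K ⟩
          (1ℚ + - 1ℚ * (w * (1ℚ + p * iv))) * Q + (w * Q * (p * iv) + (1ℚ - w) * (2ℚ * p * S * K)) ≡⟨ cong (λ z → (1ℚ + - 1ℚ * (w * z)) * Q + (w * Q * (p * iv) + (1ℚ - w) * (2ℚ * p * S * K))) (sym iv-1) ⟩
          (1ℚ + - 1ℚ * (w * iv)) * Q + (w * Q * (p * iv) + (1ℚ - w) * (2ℚ * p * S * K))
            ≤⟨ +-monoʳ-≤ ((1ℚ + - 1ℚ * (w * iv)) * Q) (+-mono-≤ (*-mono (nn* w≥0 Q≥0) (nn* p≥0 0≤2) (*-mono w≥0 K≥0 w≤b Q≤K) (*-monoˡ p≥0 iv≤2)) (≤⁺ (nn* w≥0 2pSK≥0) (e₄ (2ℚ * p * S * K) w))) ⟩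
          (1ℚ + - 1ℚ * (w * iv)) * Q + (b * K * (p * 2ℚ) + 2ℚ * p * S * K)  ≡⟨ cong ((1ℚ + - 1ℚ * (w * iv)) * Q +_) (e₃ p b s K) ⟩
          (1ℚ + - 1ℚ * (w * iv)) * Q + 2ℚ * p * (b * (1ℚ + s)) * ((1ℚ + - 1ℚ * 0ℚ) * K) ∎
        e₅ : ∀ p K w i Q → p * ((1ℚ + - 1ℚ * 0ℚ) * K) + (1ℚ - p) * ((1ℚ + - 1ℚ * (w * i)) * Q) ≡ (p * K + (1ℚ - p) * Q) - w * Q * ((1ℚ - p) * i)
        e₅ = solve-∀ ringℚ
        e₆ : ∀ W w p S K Q → (W + p * (S * S) * K) - w * Q * 1ℚ ≡ ((1ℚ + - 1ℚ * w) * W + p * (S * S) * K) + w * (W - Q)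
        e₆ = solve-∀ ringℚ
        e₇ : ∀ Q X → (Q + X) - Q ≡ X
        e₇ = solve-∀ ringℚ
        e₈ : ∀ W w p b s K → (1ℚ + - 1ℚ * w) * W + p * ((b * (1ℚ + s)) * (b * (1ℚ + s))) * ((1ℚ + - 1ℚ * 0ℚ) * K) ≡ (((1ℚ + - 1ℚ * w) * W + p * ((b * s) * (b * s)) * K) + b * (2ℚ * p * (b * s) * K)) + p * (b * b) * K
        e₈ = solve-∀ ringℚ
        snd' : p * ((1ℚ + - 1ℚ * 0ℚ) * K) + (1ℚ - p) * ((1ℚ + - 1ℚ * (w * iv)) * Q) ≤ (1ℚ + - 1ℚ * w) * W + p * ((b * (1ℚ + s)) * (b * (1ℚ + s))) * ((1ℚ + - 1ℚ * 0ℚ) * K)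
        snd' = begin
          p * ((1ℚ + - 1ℚ * 0ℚ) * K) + (1ℚ - p) * ((1ℚ + - 1ℚ * (w * iv)) * Q) ≡⟨ e₅ p K w iv Q ⟩
          (p * K + (1ℚ - p) * Q) - w * Q * ((1ℚ - p) * iv)   ≡⟨ cong (λ z → (p * K + (1ℚ - p) * Q) - w * Q * z) q·iv ⟩
          (p * K + (1ℚ - p) * Q) - w * Q * 1ℚ                ≤⟨ +-monoˡ-≤ (- (w * Q * 1ℚ)) v ⟩
          (W + p * (S * S) * K) - w * Q * 1ℚ                 ≡⟨ e₆ W w p S K Q ⟩
          ((1ℚ + - 1ℚ * w) * W + p * (S * S) * K) + w * (W - Q) ≤⟨ +-monoʳ-≤ ((1ℚ + - 1ℚ * w) * W + p * (S * S) * K) (≤-trans (*-monoˡ w≥0 (≤-trans (+-monoˡ-≤ (- Q) u) (≤-reflexive (e₇ Q (2ℚ * p * S * K))))) (*-monoʳ 2pSK≥0 w≤b)) ⟩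
          ((1ℚ + - 1ℚ * w) * W + p * (S * S) * K) + b * (2ℚ * p * S * K) ≤⟨ ≤⁺ (nn* (nn* p≥0 (nn* b≥0 b≥0)) K≥0) (e₈ W w p b s K) ⟩
          (1ℚ + - 1ℚ * w) * W + p * ((b * (1ℚ + s)) * (b * (1ℚ + s))) * ((1ℚ + - 1ℚ * 0ℚ) * K) ∎

      common⁻ : ∀ r K Q W X Y → 0ℚ ≤ r → W ≤ Q + X * K × p * K + (1ℚ - p) * Q ≤ W + Y * K →
        r * W ≤ r * Q + X * (r * K) × p * (r * K) + (1ℚ - p) * (r * Q) ≤ r * W + Y * (r * K)
      common⁻ r K Q W X Y hr (u , v) = ≤-trans (*-monoˡ hr u) (≤-reflexive (e₁ r Q X K)) ,
        ≤-trans (≤-reflexive (e₂ p r K Q)) (≤-trans (*-monoˡ hr v) (≤-reflexive (e₁ r W Y K)))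
        where
        e₁ : ∀ r Q X K → r * (Q + X * K) ≡ r * Q + X * (r * K)
        e₁ = solve-∀ ringℚ
        e₂ : ∀ p r K Q → p * (r * K) + (1ℚ - p) * (r * Q) ≡ r * (p * K + (1ℚ - p) * Q)
        e₂ = solve-∀ ringℚ

      killed≤1 : ∀ {n} (I : Subset n) {w} → (∀ x → w x ≤ 1ℚ) → ∀ x → killed I w x ≤ 1ℚ
      killed≤1 I {w} hw x = go (I x)
        where go : ∀ i → (if i then 0ℚ else w x) ≤ 1ℚ
              go true = 0≤1
              go false = hw x

      boosted≤1 : ∀ {n} (I : Subset n) {w} → (∀ x → w x ≤ 1ℚ) → (∀ x → w x * iv ≤ 1ℚ) → ∀ x → boosted I iv w x ≤ 1ℚ
      boosted≤1 I {w} hw h x = go (I x)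
        where go : ∀ i → (if i then w x * iv else w x) ≤ 1ℚ
              go true = h x
              go false = hw x

      1-≥0 : ∀ {z} → z ≤ 1ℚ → 0ℚ ≤ 1ℚ + - 1ℚ * z
      1-≥0 {z} h = subst (0ℚ ≤_) (e z) (p≤q⇒0≤q-p h)
        where e : ∀ w → 1ℚ - w ≡ 1ℚ + - 1ℚ * w
              e = solve-∀ ringℚ

      boosted≤killed : ∀ {n} (I B : Subset n) w → (∀ x → 0ℚ ≤ w x) → (∀ x → w x ≤ 1ℚ) → (∀ x → w x * iv ≤ 1ℚ) →
        wt (- 1ℚ) B (boosted I iv w) ≤ wt (- 1ℚ) B (killed I w)
      boosted≤killed I B w hw h1 hiv = prod-mono (λ x → if-nn (B x) (1-≥0 (boosted≤1 I h1 hiv x))) (λ x → pt (B x) (I x) x)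
        where
        e : ∀ z → 1ℚ + - 1ℚ * 0ℚ ≡ (1ℚ + - 1ℚ * z) + z
        e = solve-∀ ringℚ
        pt : ∀ c i x → (if c then 1ℚ + - 1ℚ * (if i then w x * iv else w x) else 1ℚ) ≤ (if c then 1ℚ + - 1ℚ * (if i then 0ℚ else w x) else 1ℚ)
        pt true true x = ≤⁺ (nn* (hw x) iv≥0) (e (w x * iv))
        pt true false x = ≤-refl
        pt false i x = ≤-refl

      -- For `a = -1` killing increases the product, and `W` may be much smaller than the value
      -- after killing. The errors are therefore measured against the latter; `killed-ratio`
      -- converts them.
      drift⁻ : ∀ {n} (I B : Subset n) (w : Fin n → ℚ) → (∀ x → 0ℚ ≤ w x) → (∀ x → w x ≤ 1ℚ) → (∀ x → w x ≤ b) → (∀ x → w x * iv ≤ 1ℚ) →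
        wt (- 1ℚ) B w ≤ wt (- 1ℚ) B (boosted I iv w) + 2ℚ * p * (b * ι (hit I B)) * wt (- 1ℚ) B (killed I w) ×
        p * wt (- 1ℚ) B (killed I w) + (1ℚ - p) * wt (- 1ℚ) B (boosted I iv w) ≤ wt (- 1ℚ) B w + p * ((b * ι (hit I B)) * (b * ι (hit I B))) * wt (- 1ℚ) B (killed I w)
      drift⁻ {zero} I B w hw h1 hb hiv = ≤-reflexive (sym (e₁ p b)) , ≤-reflexive (e₂ p b)
        where
        e₁ : ∀ p b → 1ℚ + 2ℚ * p * (b * 0ℚ) * 1ℚ ≡ 1ℚ
        e₁ = solve-∀ ringℚ
        e₂ : ∀ p b → p * 1ℚ + (1ℚ - p) * 1ℚ ≡ 1ℚ + p * ((b * 0ℚ) * (b * 0ℚ)) * 1ℚ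
        e₂ = solve-∀ ringℚ
      drift⁻ {suc n} I B w hw h1 hb hiv = step (I zero) (B zero)
        where
        I' B' : Subset n
        I' x = I (suc x)
        B' x = B (suc x)
        w' : Fin n → ℚ
        w' x = w (suc x)
        s : ℕ
        s = hit I' B'
        K Q W X Y : ℚ
        X = 2ℚ * p * (b * ι s)
        Y = p * ((b * ι s) * (b * ι s))
        K = wt (- 1ℚ) B' (killed I' w')
        Q = wt (- 1ℚ) B' (boosted I' iv w')
        W = wt (- 1ℚ) B' w'
        ih : W ≤ Q + 2ℚ * p * (b * ι s) * K × p * K + (1ℚ - p) * Q ≤ W + p * ((b * ι s) * (b * ι s)) * K
        ih = drift⁻ I' B' w' (λ x → hw (suc x)) (λ x → h1 (suc x)) (λ x → hb (suc x)) (λ x → hiv (suc x))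
        step : ∀ i c →
          (if c then 1ℚ + - 1ℚ * w zero else 1ℚ) * W ≤ (if c then 1ℚ + - 1ℚ * (if i then w zero * iv else w zero) else 1ℚ) * Q
            + 2ℚ * p * (b * ι ((if i ∧ c then 1 else 0) ℕ.+ s)) * ((if c then 1ℚ + - 1ℚ * (if i then 0ℚ else w zero) else 1ℚ) * K) ×
          p * ((if c then 1ℚ + - 1ℚ * (if i then 0ℚ else w zero) else 1ℚ) * K) + (1ℚ - p) * ((if c then 1ℚ + - 1ℚ * (if i then w zero * iv else w zero) else 1ℚ) * Q)
            ≤ (if c then 1ℚ + - 1ℚ * w zero else 1ℚ) * W
            + p * ((b * ι ((if i ∧ c then 1 else 0) ℕ.+ s)) * (b * ι ((if i ∧ c then 1 else 0) ℕ.+ s))) * ((if c then 1ℚ + - 1ℚ * (if i then 0ℚ else w zero) else 1ℚ) * K)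
        step true true = special⁻ K Q W (w zero) (ι s) (wt⁻-nn B' (killed≤1 I' (λ x → h1 (suc x)))) (wt⁻-nn B' (boosted≤1 I' (λ x → h1 (suc x)) (λ x → hiv (suc x))))
          (boosted≤killed I' B' w' (λ x → hw (suc x)) (λ x → h1 (suc x)) (λ x → hiv (suc x))) (hw zero) (h1 zero) (hb zero) (hiv zero) (ι≥0 s) ih
        step true false = common⁻ 1ℚ K Q W X Y 0≤1 ih
        step false true = common⁻ (1ℚ + - 1ℚ * w zero) K Q W X Y (1-≥0 (h1 zero)) ih
        step false false = common⁻ 1ℚ K Q W X Y 0≤1 ih

  -- Killing a vertex of weight `v` removes a factor `1 - v`, and `1 ≤ (1 - v)^h (1 + 2 h v)` by
  -- Bernoulli. The product on the right is the one that the stopping rule of the random process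
  -- bounds.
  killed-ratio : ∀ {n} h (I B : Subset n) (w : Fin n → ℚ) → (∀ x → 0ℚ ≤ w x) → (∀ x → 2ℚ * (ι h * w x) ≤ 1ℚ) → (∀ x → w x ≤ 1ℚ) →
    wt (- 1ℚ) B (killed I w) ^ h ≤ wt (- 1ℚ) B w ^ h * wt (2ℚ * ι h) I w
  killed-ratio {zero} h I B w hw h2 h1 = ≤-reflexive (sym (*-identityʳ (1ℚ ^ h)))
  killed-ratio {suc n} h I B w hw h2 h1 = step (I zero) (B zero)
    where
    open ≤-Reasoning
    I' B' : Subset n
    I' x = I (suc x)
    B' x = B (suc x)
    w' : Fin n → ℚ
    w' x = w (suc x)
    K W X v θ : ℚ
    K = wt (- 1ℚ) B' (killed I' w')
    W = wt (- 1ℚ) B' w'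
    X = wt (2ℚ * ι h) I' w'
    v = w zero
    θ = 2ℚ * ι h
    θ≥0 : 0ℚ ≤ θ
    θ≥0 = nn* 0≤2 (ι≥0 h)
    W≥0 : 0ℚ ≤ W
    W≥0 = wt⁻-nn B' (λ x → h1 (suc x))
    ih : K ^ h ≤ W ^ h * X
    ih = killed-ratio h I' B' w' (λ x → hw (suc x)) (λ x → h2 (suc x)) (λ x → h1 (suc x))
    f g : Bool → Bool → ℚ
    f i c = if c then 1ℚ + - 1ℚ * (if i then 0ℚ else v) else 1ℚ
    g i c = if c then 1ℚ + - 1ℚ * v else 1ℚ
    e₀ : 1ℚ + - 1ℚ * 0ℚ ≡ 1ℚ
    e₀ = refl
    e₁ : ∀ v → 1ℚ + - 1ℚ * v ≡ 1ℚ - v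
    e₁ = solve-∀ ringℚ
    e₂ : ∀ v k → (1ℚ - k * v) * (1ℚ + 2ℚ * k * v) ≡ 1ℚ + (k * v) * (1ℚ - 2ℚ * (k * v))
    e₂ = solve-∀ ringℚ
    θv≥0 : 0ℚ ≤ θ * v
    θv≥0 = nn* θ≥0 (hw zero)
    factor : ∀ i c → f i c ^ h ≤ g i c ^ h * (if i then 1ℚ + θ * v else 1ℚ)
    factor true true = begin
      (1ℚ + - 1ℚ * 0ℚ) ^ h            ≡⟨ trans (cong (_^ h) e₀) (1^ h) ⟩
      1ℚ                              ≤⟨ ≤⁺ (nn* (nn* (ι≥0 h) (hw zero)) (p≤q⇒0≤q-p (h2 zero))) (e₂ v (ι h)) ⟩
      (1ℚ - ι h * v) * (1ℚ + θ * v)   ≤⟨ *-monoʳ (nn+ 0≤1 θv≥0) (bernoulli⁻ h (hw zero) (h1 zero)) ⟩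
      (1ℚ - v) ^ h * (1ℚ + θ * v)     ≡⟨ cong (λ z → z ^ h * (1ℚ + θ * v)) (sym (e₁ v)) ⟩
      (1ℚ + - 1ℚ * v) ^ h * (1ℚ + θ * v) ∎
    factor true false = ≤-trans (≤-reflexive (sym (*-identityʳ (1ℚ ^ h)))) (*-monoˡ (^-nn h 0≤1) (1≤1+ θv≥0))
    factor false true = ≤-reflexive (sym (*-identityʳ _))
    factor false false = ≤-reflexive (sym (*-identityʳ (1ℚ ^ h)))
    f≥0 : ∀ i c → 0ℚ ≤ g i c
    f≥0 i c = if-nn c (subst (0ℚ ≤_) (sym (e₁ v)) (p≤q⇒0≤q-p (h1 zero)))
    g≥0 : ∀ i → 0ℚ ≤ (if i then 1ℚ + θ * v else 1ℚ)
    g≥0 i = if-nn i (nn+ 0≤1 θv≥0)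
    K≥0 : 0ℚ ≤ K
    K≥0 = wt⁻-nn B' (λ x → pt (I' x) x)
      where pt : ∀ i x → (if i then 0ℚ else w' x) ≤ 1ℚ
            pt true x = 0≤1
            pt false x = h1 (suc x)
    e₃ : ∀ a b c d → a * b * (c * d) ≡ a * c * (b * d)
    e₃ = solve-∀ ringℚ
    step : ∀ i c → (f i c * K) ^ h ≤ (g i c * W) ^ h * ((if i then 1ℚ + θ * v else 1ℚ) * X)
    step i c = begin
      (f i c * K) ^ h                   ≡⟨ ^-* (f i c) K h ⟩
      f i c ^ h * K ^ h                 ≤⟨ *-monoʳ (^-nn h K≥0) (factor i c) ⟩
      g i c ^ h * G * K ^ h             ≤⟨ *-monoˡ (nn* (^-nn h (f≥0 i c)) (g≥0 i)) ih ⟩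
      g i c ^ h * G * (W ^ h * X)       ≡⟨ e₃ (g i c ^ h) G (W ^ h) X ⟩
      g i c ^ h * W ^ h * (G * X)       ≡⟨ cong (_* (G * X)) (sym (^-* (g i c) W h)) ⟩
      (g i c * W) ^ h * (G * X) ∎
      where G = if i then 1ℚ + θ * v else 1ℚ

-- The stopped selection process on graphs built vertex by vertex.

module RandomIndependentSet where

  open Rationals
  open Measures
  open WeightedGraphs
  open SelectionProcess using (true≢false; bool)
  open LowerBound using (count-mono)
  open ProductTests
  open import Data.List using ([]; _∷_; _++_)
  open import Data.Rational.Properties

  infixr 5 _◂_

  -- Graphs built one vertex at a time: the newest vertex has index zero and is joined to the given set of older vertices.
  data Gr : ℕ → Set where
    []ᴳ : Gr 0
    _◂_ : ∀ {n} → Subset n → Gr n → Gr (suc n)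

  adjᴳ : ∀ {n} → Gr n → Fin n → Fin n → Bool
  adjᴳ (I ◂ H) zero zero = false
  adjᴳ (I ◂ H) zero (suc y) = I y
  adjᴳ (I ◂ H) (suc x) zero = I x
  adjᴳ (I ◂ H) (suc x) (suc y) = adjᴳ H x y

  symᴳ : ∀ {n} (H : Gr n) x y → adjᴳ H x y ≡ adjᴳ H y x
  symᴳ (I ◂ H) zero zero = refl
  symᴳ (I ◂ H) zero (suc y) = refl
  symᴳ (I ◂ H) (suc x) zero = refl
  symᴳ (I ◂ H) (suc x) (suc y) = symᴳ H x y

  irrefᴳ : ∀ {n} (H : Gr n) x → adjᴳ H x x ≡ false
  irrefᴳ (I ◂ H) zero = refl
  irrefᴳ (I ◂ H) (suc x) = irrefᴳ H x

  graph : ∀ {n} → Gr n → Graph n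
  graph H = record { adj = adjᴳ H ; sym = symᴳ H ; irref = irrefᴳ H }

  TFᴳ : ∀ {n} → Gr n → Set
  TFᴳ []ᴳ = ⊤
  TFᴳ (I ◂ H) = Indep (graph H) I × TFᴳ H

  TFᴳ⇒ : ∀ {n} (H : Gr n) → TFᴳ H → TriangleFree (graph H)
  TFᴳ⇒ (I ◂ H) (ind , tf) zero (suc v) (suc w) a b c = true≢false b (ind v w a c)
  TFᴳ⇒ (I ◂ H) (ind , tf) (suc u) zero (suc w) a b c = true≢false c (ind u w a b)
  TFᴳ⇒ (I ◂ H) (ind , tf) (suc u) (suc v) zero a b c = true≢false a (ind u v c b)
  TFᴳ⇒ (I ◂ H) (ind , tf) (suc u) (suc v) (suc w) a b c = TFᴳ⇒ H tf u v w a b c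

  -- Each vertex has at most k common neighbours older than both with every older vertex.
  Codeg : ∀ {n} → ℕ → Gr n → Set
  Codeg k []ᴳ = ⊤
  Codeg k (I ◂ H) = (∀ u → hit I (adjᴳ H u) ℕ.≤ k) × Codeg k H

  tail : ∀ {n} {A : Set} → (Fin (suc n) → A) → Fin n → A
  tail f x = f (suc x)

  cons : ∀ {n} → Bool → Subset n → Subset (suc n)
  cons b I zero = b
  cons b I (suc x) = I x

  hit≤count : ∀ {n} (I B : Subset n) → hit I B ℕ.≤ count B
  hit≤count I B = subst (ℕ._≤ count B) (sym (hit≡count I B)) (count-mono {S = λ x → I x ∧ B x} {T = B} sub)
    where
    sub : ∀ {x} → I x ∧ B x ≡ true → B x ≡ true
    sub {x} h with I x
    ... | true = h

  count-tail : ∀ {n} (B : Subset (suc n)) → count (tail B) ℕ.≤ count B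
  count-tail B with B zero
  ... | true = ℕₚ.n≤1+n _
  ... | false = ℕₚ.≤-refl

  1+-p≥0 : ∀ {p} → p ≤ 1ℚ → 0ℚ ≤ 1ℚ + - 1ℚ * p
  1+-p≥0 {p} hp = subst (0ℚ ≤_) (e p) (p≤q⇒0≤q-p hp)
    where e : ∀ w → 1ℚ - w ≡ 1ℚ + - 1ℚ * w
          e = solve-∀ ringℚ

  guard : ∀ {n} {P : Set} → Dec P → Meas n → Meas n
  guard (yes _) μ = μ
  guard (no _) μ = []

  -- The accumulated error in `expect`: one factor for each vertex, quadratic in the number of its
  -- older neighbours in `B`.
  drift : ∀ {n} → ℚ → Gr n → Subset n → ℚ
  drift γ []ᴳ B = 1ℚ
  drift γ (I ◂ H) B = (1ℚ + γ * (ι (hit I (tail B)) * ι (hit I (tail B)))) * drift γ H (tail B)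

  drift≥1 : ∀ {n γ} (H : Gr n) B → 0ℚ ≤ γ → 1ℚ ≤ drift γ H B
  drift≥1 []ᴳ B h = ≤-refl
  drift≥1 (I ◂ H) B h = ≤-trans (≤-reflexive (sym (*-identityˡ 1ℚ))) (*-mono 0≤1 (≤-trans 0≤1 ih) (1≤1+ (nn* h (nn* (ι≥0 j) (ι≥0 j)))) ih)
    where ih = drift≥1 H (tail B) h
          j = hit I (tail B)

  -- A random independent set of H, newest vertices first.  With T u = w_u^h ∏_{x ~ u} (1 + 2 h w_x), the process stops
  -- (and its mass is lost) as soon as some T u exceeds ω^h; this keeps all weights below ω.
  module Random (ε ω M : ℚ) (h' : ℕ) (ε>0 : 0ℚ < ε) (M≥0 : 0ℚ ≤ M) (ω≡ : ω ≡ ε * M) (θω≤1 : 2ℚ * (ι (suc h') * ω) ≤ 1ℚ) (4ω≤1 : 4ℚ * ω ≤ 1ℚ) where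

    h : ℕ
    h = suc h'

    θ β : ℚ
    θ = 2ℚ * ι h
    β = ω ^ h

    θ≥0 : 0ℚ ≤ θ
    θ≥0 = nn* 0≤2 (ι≥0 h)

    ε≥0 : 0ℚ ≤ ε
    ε≥0 = <⇒≤ ε>0

    ω≥0 : 0ℚ ≤ ω
    ω≥0 = subst (0ℚ ≤_) (sym ω≡) (nn* ε≥0 M≥0)

    T : ∀ {n} → Gr n → (Fin n → ℚ) → Fin n → ℚ
    T H w u = w u ^ h * wt θ (adjᴳ H u) w

    Ok : ∀ {n} → Gr n → (Fin n → ℚ) → Set
    Ok H w = ∀ u → T H w u ≤ β

    ok? : ∀ {n} (H : Gr n) w → Dec (Ok H w)
    ok? H w = Finₚ.all? (λ u → T H w u ≤? β)

    wk wb : ∀ {n} → Subset n → (Fin (suc n) → ℚ) → Fin n → ℚ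
    wk I w = killed I (tail w)
    wb I w = boosted I (inv (1ℚ - w zero)) (tail w)

    run : ∀ {n} → Gr n → (Fin n → ℚ) → Meas n
    run []ᴳ w = (1ℚ , λ ()) ∷ []
    run (I ◂ H) w = guard (ok? (I ◂ H) w) (branch (w zero) (cons true) (run H (wk I w)) ++ branch (1ℚ - w zero) (cons false) (run H (wb I w)))

    -- Weights start at `ε` and are afterwards only killed or increased. The lower bound in `live`
    -- turns a bound on `T` into a bound on its second factor.
    record Inv {n} (w : Fin n → ℚ) : Set where
      field
        nn : ∀ x → 0ℚ ≤ w x
        ≤1 : ∀ x → w x ≤ 1ℚ
        live : ∀ x → w x ≡ 0ℚ ⊎ ε ≤ w x
    open Inv

    half≤ : ∀ {z} → 0ℚ ≤ z → 2ℚ * z ≤ 1ℚ → z ≤ 1ℚ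
    half≤ {z} hz q = ≤-trans (≤⁺ hz (e z)) q
      where e : ∀ z → 2ℚ * z ≡ z + z
            e = solve-∀ ringℚ

    2ω≤1 : 2ℚ * ω ≤ 1ℚ
    2ω≤1 = half≤ (nn* 0≤2 ω≥0) (≤-trans (≤-reflexive (e ω)) 4ω≤1)
      where e : ∀ z → 2ℚ * (2ℚ * z) ≡ 4ℚ * z
            e = solve-∀ ringℚ

    module Node {n} (I : Subset n) (H : Gr n) (w : Fin (suc n) → ℚ) (i : Inv w) (ok : Ok (I ◂ H) w) where

      p q iv : ℚ
      p = w zero
      q = 1ℚ - p
      iv = inv q

      ≤ω : ∀ x → w x ≤ ω
      ≤ω x = ^-root h' ω≥0 (≤-trans (≤-trans (≤-reflexive (sym (*-identityʳ (w x ^ h))))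
        (*-monoˡ (^-nn h (nn i x)) (wt-≥1 (adjᴳ (I ◂ H) x) θ≥0 (nn i)))) (ok x))

      p≥0 : 0ℚ ≤ p
      p≥0 = nn i zero

      2p≤1 : 2ℚ * p ≤ 1ℚ
      2p≤1 = ≤-trans (*-monoˡ 0≤2 (≤ω zero)) 2ω≤1

      q>0 : 0ℚ < q
      q>0 = *-cancelˡ-<-nonNeg 2ℚ {{nonNegative 0≤2}} (<-≤-trans (≤-<-trans (≤-reflexive (*-zeroʳ 2ℚ)) 0<1) (≤⁺ (p≤q⇒0≤q-p 2p≤1) (e p)))
        where e : ∀ p → 2ℚ * (1ℚ - p) ≡ 1ℚ + (1ℚ - 2ℚ * p)
              e = solve-∀ ringℚ

      q≥0 : 0ℚ ≤ q
      q≥0 = <⇒≤ q>0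

      q≤1 : q ≤ 1ℚ
      q≤1 = ≤⁺ p≥0 (e p)
        where e : ∀ p → 1ℚ ≡ (1ℚ - p) + p
              e = solve-∀ ringℚ

      q·iv : q * iv ≡ 1ℚ
      q·iv = inv-r q>0

      iv≥0 : 0ℚ ≤ iv
      iv≥0 = <⇒≤ (inv-pos q>0)

      -- The bound z ≤ 2 (1 - p) in the form z / (1 - p) ≤ 2.
      /q≤2 : ∀ z → z ≤ 2ℚ * q → z * iv ≤ 2ℚ
      /q≤2 z hz = ≤-trans (*-monoʳ iv≥0 hz) (≤-reflexive (trans (*-assoc 2ℚ q iv) (trans (cong (2ℚ *_) q·iv) (*-identityʳ 2ℚ))))

      iv≤2 : iv ≤ 2ℚ
      iv≤2 = ≤-trans (≤-reflexive (sym (*-identityˡ iv))) (/q≤2 1ℚ (≤⁺ (p≤q⇒0≤q-p 2p≤1) (e p)))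
        where e : ∀ p → 2ℚ * (1ℚ - p) ≡ 1ℚ + (1ℚ - 2ℚ * p)
              e = solve-∀ ringℚ

      iv≥1 : 1ℚ ≤ iv
      iv≥1 = ≤-trans (≤-reflexive (sym q·iv)) (≤-trans (*-monoʳ iv≥0 q≤1) (≤-reflexive (*-identityˡ iv)))

      wiv≤1 : ∀ x → w x * iv ≤ 1ℚ
      wiv≤1 x = ≤-trans (*-mono (nn i x) 0≤2 (≤ω x) iv≤2) (≤-trans (≤-reflexive (*-comm ω 2ℚ)) 2ω≤1)

      cond : ∀ {σ} → 0ℚ ≤ σ → 4ℚ * (ω * σ) ≤ 1ℚ → (1ℚ + 2ℚ * p * σ) * iv ≤ 2ℚ
      cond {σ} hσ hc = /q≤2 (1ℚ + 2ℚ * p * σ) (*-cancelˡ 0<2 (≤⁺ (nn+ (p≤q⇒0≤q-p (≤-trans (*-monoˡ 0≤4 (≤ω zero)) 4ω≤1)) (p≤q⇒0≤q-p (≤-trans (*-monoˡ 0≤4 (*-monoʳ hσ (≤ω zero))) hc))) (e p σ)))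
        where e : ∀ p s → 2ℚ * (2ℚ * (1ℚ - p)) ≡ 2ℚ * (1ℚ + 2ℚ * p * s) + ((1ℚ - 4ℚ * p) + (1ℚ - 4ℚ * (p * s)))
              e = solve-∀ ringℚ

      inv-wk : Inv (wk I w)
      inv-wk = record { nn = λ x → a x (I x) ; ≤1 = λ x → b x (I x) ; live = λ x → c x (I x) }
        where
        a : ∀ x t → 0ℚ ≤ (if t then 0ℚ else w (suc x))
        a x true = ≤-refl
        a x false = nn i (suc x)
        b : ∀ x t → (if t then 0ℚ else w (suc x)) ≤ 1ℚ
        b x true = 0≤1
        b x false = ≤1 i (suc x)
        c : ∀ x t → (if t then 0ℚ else w (suc x)) ≡ 0ℚ ⊎ ε ≤ (if t then 0ℚ else w (suc x))
        c x true = inj₁ refl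
        c x false = live i (suc x)

      inv-wb : Inv (wb I w)
      inv-wb = record { nn = λ x → a x (I x) ; ≤1 = λ x → b x (I x) ; live = λ x → c x (I x) }
        where
        a : ∀ x t → 0ℚ ≤ (if t then w (suc x) * iv else w (suc x))
        a x true = nn* (nn i (suc x)) iv≥0
        a x false = nn i (suc x)
        b : ∀ x t → (if t then w (suc x) * iv else w (suc x)) ≤ 1ℚ
        b x true = wiv≤1 (suc x)
        b x false = ≤1 i (suc x)
        up : ∀ {z} → z ≡ 0ℚ ⊎ ε ≤ z → z * iv ≡ 0ℚ ⊎ ε ≤ z * iv
        up (inj₁ e) = inj₁ (trans (cong (_* iv) e) (*-zeroˡ iv))
        up (inj₂ l) = inj₂ (≤-trans (≤-reflexive (sym (*-identityʳ ε))) (*-mono ε≥0 iv≥0 l iv≥1))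
        c : ∀ x t → (if t then w (suc x) * iv else w (suc x)) ≡ 0ℚ ⊎ ε ≤ (if t then w (suc x) * iv else w (suc x))
        c x true = up (live i (suc x))
        c x false = live i (suc x)

      open Drift p iv p≥0 iv≥0 q·iv public

      split : ∀ F → 𝔼 (branch p (cons true) (run H (wk I w)) ++ branch q (cons false) (run H (wb I w))) F
        ≡ p * 𝔼 (run H (wk I w)) (λ J → F (cons true J)) + q * 𝔼 (run H (wb I w)) (λ J → F (cons false J))
      split F = 𝔼-split p q (cons true) (cons false) (run H (wk I w)) (run H (wb I w)) F

    Within : ∀ {n} → Gr n → (Fin n → ℚ) → Subset n → Set
    Within H w J = Indep (graph H) J × (∀ x → J x ≡ true → 0ℚ < w x)

    supp-run : ∀ {n} (H : Gr n) w → Inv w → Supp (Within H w) (run H w)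
    supp-run []ᴳ w i = (0≤1 , λ _ → (λ ()) , λ ()) ∷ []
    supp-run (I ◂ H) w i = go (ok? (I ◂ H) w)
      where
      go : ∀ d → Supp (Within (I ◂ H) w) (guard d (branch (w zero) (cons true) (run H (wk I w)) ++ branch (1ℚ - w zero) (cons false) (run H (wb I w))))
      go (no _) = []
      go (yes ok) = Supp-++ (Supp-branch N.p≥0 sel (supp-run H (wk I w) N.inv-wk)) (Supp-branch N.q≥0 skip (supp-run H (wb I w) N.inv-wb))
        where
        module N = Node I H w i ok
        alive : ∀ {x} → 0ℚ < wk I w x → I x ≡ false × 0ℚ < w (suc x)
        alive {x} k with bool (I x)
        ... | inj₁ t = ⊥-elim (<-irrefl refl (subst (0ℚ <_) (killed-in I (tail w) t) k))
        ... | inj₂ f = f , subst (0ℚ <_) (killed-out I (tail w) f) k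
        sel : 0ℚ < w zero → ∀ {J} → Within H (wk I w) J → Within (I ◂ H) w (cons true J)
        sel p>0 {J} (ind , pos) = ind' , pos'
          where
          ind' : Indep (graph (I ◂ H)) (cons true J)
          ind' zero zero _ _ = refl
          ind' zero (suc y) _ b = proj₁ (alive (pos y b))
          ind' (suc x) zero a _ = proj₁ (alive (pos x a))
          ind' (suc x) (suc y) a b = ind x y a b
          pos' : ∀ x → cons true J x ≡ true → 0ℚ < w x
          pos' zero _ = p>0
          pos' (suc x) a = proj₂ (alive (pos x a))
        skip : 0ℚ < 1ℚ - w zero → ∀ {J} → Within H (wb I w) J → Within (I ◂ H) w (cons false J)
        skip _ {J} (ind , pos) = ind' , pos'
          where
          ind' : Indep (graph (I ◂ H)) (cons false J)
          ind' (suc x) (suc y) a b = ind x y a b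
          pos' : ∀ x → cons false J x ≡ true → 0ℚ < w x
          pos' (suc x) a = back (bool (I x)) (pos x a)
            where
            back : I x ≡ true ⊎ I x ≡ false → 0ℚ < wb I w x → 0ℚ < w (suc x)
            back (inj₁ t) k = 0<*⇒0<ˡ N.iv≥0 (subst (0ℚ <_) (boosted-in I N.iv (tail w) t) k)
            back (inj₂ f) k = subst (0ℚ <_) (boosted-out I N.iv (tail w) f) k

    -- The weights are martingales; equality fails because stopped runs contribute nothing.
    marg-run : ∀ {n} (H : Gr n) w → Inv w → ∀ u → marg (run H w) u ≤ w u
    mass≤1 : ∀ {n} (H : Gr n) w → Inv w → mass (run H w) ≤ 1ℚ

    mass≤1 []ᴳ w i = ≤-reflexive refl
    mass≤1 (I ◂ H) w i = go (ok? (I ◂ H) w)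
      where
      go : ∀ d → mass (guard d (branch (w zero) (cons true) (run H (wk I w)) ++ branch (1ℚ - w zero) (cons false) (run H (wb I w)))) ≤ 1ℚ
      go (no _) = 0≤1
      go (yes ok) = ≤-trans (≤-reflexive (N.split (λ _ → 1ℚ))) (≤-trans (+-mono-≤ (*-monoˡ N.p≥0 (mass≤1 H (wk I w) N.inv-wk)) (*-monoˡ N.q≥0 (mass≤1 H (wb I w) N.inv-wb))) (≤-reflexive (e (w zero))))
        where
        module N = Node I H w i ok
        e : ∀ p → p * 1ℚ + (1ℚ - p) * 1ℚ ≡ 1ℚ
        e = solve-∀ ringℚ

    marg-run (I ◂ H) w i u = go (ok? (I ◂ H) w) u
      where
      go : ∀ d u → 𝔼 (guard d (branch (w zero) (cons true) (run H (wk I w)) ++ branch (1ℚ - w zero) (cons false) (run H (wb I w)))) (λ J → [ J u ]) ≤ w u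
      go (no _) u = nn i u
      go (yes ok) zero = ≤-trans (≤-reflexive (N.split (λ J → [ J zero ])))
        (≤-trans (+-mono-≤ (*-monoˡ N.p≥0 (mass≤1 H (wk I w) N.inv-wk)) (*-monoˡ N.q≥0 (≤-reflexive (𝔼-0 (run H (wb I w)))))) (≤-reflexive (e (w zero))))
        where
        module N = Node I H w i ok
        e : ∀ p → p * 1ℚ + (1ℚ - p) * 0ℚ ≡ p
        e = solve-∀ ringℚ
      go (yes ok) (suc u) = ≤-trans (≤-reflexive (N.split (λ J → [ J (suc u) ])))
        (≤-trans (+-mono-≤ (*-monoˡ N.p≥0 (marg-run H (wk I w) N.inv-wk u)) (*-monoˡ N.q≥0 (marg-run H (wb I w) N.inv-wb u))) (≤-reflexive (at (I u))))
        where
        module N = Node I H w i ok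
        e₁ : ∀ p w i → p * 0ℚ + (1ℚ - p) * (w * i) ≡ w * ((1ℚ - p) * i)
        e₁ = solve-∀ ringℚ
        e₂ : ∀ p w → p * w + (1ℚ - p) * w ≡ w
        e₂ = solve-∀ ringℚ
        at : ∀ t → w zero * (if t then 0ℚ else w (suc u)) + (1ℚ - w zero) * (if t then w (suc u) * N.iv else w (suc u)) ≡ w (suc u)
        at true = trans (e₁ (w zero) (w (suc u)) N.iv) (trans (cong (w (suc u) *_) N.q·iv) (*-identityʳ (w (suc u))))
        at false = e₂ (w zero) (w (suc u))

    -- Both instances a = 1 and a = -1 of the product test functions at once.
    module Expect (a γ : ℚ) (γ≥0 : 0ℚ ≤ γ) (1+a≥0 : 0ℚ ≤ 1ℚ + a) (s : ℕ)
      (wt-nn : ∀ {n} (B : Subset n) {w} → Inv w → 0ℚ ≤ wt a B w)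
      (1+ap : ∀ {p} → 0ℚ ≤ p → p ≤ 1ℚ → 0ℚ ≤ 1ℚ + a * p)
      (step : ∀ {n} (I : Subset n) H w B (i : Inv w) (ok : Ok (I ◂ H) w) → count B ℕ.≤ s →
        w zero * wt a B (wk I w) + (1ℚ - w zero) * wt a B (wb I w) ≤ wt a B (tail w) * (1ℚ + γ * (ι (hit I B) * ι (hit I B)))) where

      -- If the newest vertex lies in `B`, its neighbours do not, since `B` is independent. The
      -- weights on `B` then stay as they are and the factor `1 + a p` comes out exactly. If it lies
      -- outside `B`, `step` supplies one factor of the drift.
      expect : ∀ {n} (H : Gr n) w B → Inv w → count B ℕ.≤ s → Indep (graph H) B →
        𝔼 (run H w) (λ J → wt a B (λ x → [ J x ])) ≤ wt a B w * drift γ H B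
      expect []ᴳ w B i hs ind = ≤-reflexive refl
      expect (I ◂ H) w B i hs ind = go (ok? (I ◂ H) w)
        where
        B' = tail B
        D = drift γ H B'
        D≥0 : 0ℚ ≤ D
        D≥0 = ≤-trans 0≤1 (drift≥1 H B' γ≥0)
        W = wt a B' (tail w)
        j2 = ι (hit I B') * ι (hit I B')
        F : Subset _ → ℚ
        F J = wt a B (λ x → [ J x ])
        go : ∀ d → 𝔼 (guard d (branch (w zero) (cons true) (run H (wk I w)) ++ branch (1ℚ - w zero) (cons false) (run H (wb I w)))) F ≤ wt a B w * ((1ℚ + γ * j2) * D)
        go (no _) = nn* (wt-nn B i) (nn* (nn+ 0≤1 (nn* γ≥0 (nn* (ι≥0 (hit I B')) (ι≥0 (hit I B'))))) D≥0)
        go (yes ok) = ≤-trans (≤-reflexive (trans (N.split F) (cong₂ (λ x y → N.p * x + N.q * y)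
            (𝔼-* (run H (wk I w)) (if B zero then 1ℚ + a * 1ℚ else 1ℚ) (λ J → wt a B' (λ x → [ J x ])))
            (𝔼-* (run H (wb I w)) (if B zero then 1ℚ + a * 0ℚ else 1ℚ) (λ J → wt a B' (λ x → [ J x ]))))))
          (cases (B zero) refl)
          where
          open ≤-Reasoning
          module N = Node I H w i ok
          Ek Eb : ℚ
          Ek = 𝔼 (run H (wk I w)) (λ J → wt a B' (λ x → [ J x ]))
          Eb = 𝔼 (run H (wb I w)) (λ J → wt a B' (λ x → [ J x ]))
          hs' : count B' ℕ.≤ s
          hs' = ℕₚ.≤-trans (count-tail B) hs
          ind' : Indep (graph H) B'
          ind' x y bx by = ind (suc x) (suc y) bx by
          Ek≤ : Ek ≤ wt a B' (wk I w) * D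
          Ek≤ = expect H (wk I w) B' N.inv-wk hs' ind'
          Eb≤ : Eb ≤ wt a B' (wb I w) * D
          Eb≤ = expect H (wb I w) B' N.inv-wb hs' ind'
          e₀ : ∀ p q k b D → p * (1ℚ * (k * D)) + q * (1ℚ * (b * D)) ≡ (p * k + q * b) * D
          e₀ = solve-∀ ringℚ
          e₁ : ∀ W c D → W * c * D ≡ 1ℚ * W * (c * D)
          e₁ = solve-∀ ringℚ
          e₂ : ∀ p a W D → p * ((1ℚ + a * 1ℚ) * (W * D)) + (1ℚ - p) * ((1ℚ + a * 0ℚ) * (W * D)) ≡ (1ℚ + a * p) * W * D
          e₂ = solve-∀ ringℚ
          e₃ : ∀ X D g → X * ((1ℚ + g) * D) ≡ X * D + X * (g * D)
          e₃ = solve-∀ ringℚ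
          e₄ : ∀ a → 1ℚ + a ≡ 1ℚ + a * 1ℚ
          e₄ = solve-∀ ringℚ
          e₅ : ∀ a → 1ℚ ≡ 1ℚ + a * 0ℚ
          e₅ = solve-∀ ringℚ
          cases : ∀ b → B zero ≡ b → N.p * ((if b then 1ℚ + a * 1ℚ else 1ℚ) * Ek) + N.q * ((if b then 1ℚ + a * 0ℚ else 1ℚ) * Eb)
            ≤ ((if b then 1ℚ + a * w zero else 1ℚ) * W) * ((1ℚ + γ * j2) * D)
          cases false _ = begin
            N.p * (1ℚ * Ek) + N.q * (1ℚ * Eb)    ≤⟨ +-mono-≤ (*-monoˡ N.p≥0 (*-monoˡ 0≤1 Ek≤)) (*-monoˡ N.q≥0 (*-monoˡ 0≤1 Eb≤)) ⟩
            N.p * (1ℚ * (wt a B' (wk I w) * D)) + N.q * (1ℚ * (wt a B' (wb I w) * D)) ≡⟨ e₀ N.p N.q (wt a B' (wk I w)) (wt a B' (wb I w)) D ⟩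
            (N.p * wt a B' (wk I w) + N.q * wt a B' (wb I w)) * D  ≤⟨ *-monoʳ D≥0 (step I H w B' i ok hs') ⟩
            W * (1ℚ + γ * j2) * D                  ≡⟨ e₁ W (1ℚ + γ * j2) D ⟩
            1ℚ * W * ((1ℚ + γ * j2) * D) ∎
          cases true hb = begin
            N.p * ((1ℚ + a * 1ℚ) * Ek) + N.q * ((1ℚ + a * 0ℚ) * Eb)
              ≤⟨ +-mono-≤ (*-monoˡ N.p≥0 (*-monoˡ (subst (0ℚ ≤_) (e₄ a) 1+a≥0) (≤-trans Ek≤ (≤-reflexive (cong (_* D) same-k)))))
                          (*-monoˡ N.q≥0 (*-monoˡ (subst (0ℚ ≤_) (e₅ a) 0≤1) (≤-trans Eb≤ (≤-reflexive (cong (_* D) same-b))))) ⟩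
            N.p * ((1ℚ + a * 1ℚ) * (W * D)) + N.q * ((1ℚ + a * 0ℚ) * (W * D)) ≡⟨ e₂ N.p a W D ⟩
            X * D                                  ≤⟨ ≤⁺ (nn* X≥0 (nn* (nn* γ≥0 (nn* (ι≥0 (hit I B')) (ι≥0 (hit I B')))) D≥0)) (e₃ X D (γ * j2)) ⟩
            X * ((1ℚ + γ * j2) * D) ∎
            where
            X = (1ℚ + a * N.p) * W
            X≥0 : 0ℚ ≤ X
            X≥0 = nn* (1+ap N.p≥0 (≤1 i zero)) (wt-nn B' (record { nn = λ x → nn i (suc x) ; ≤1 = λ x → ≤1 i (suc x) ; live = λ x → live i (suc x) }))
            out : ∀ x → B' x ≡ true → I x ≡ false
            out x bx = ind zero (suc x) hb bx
            same-k : wt a B' (wk I w) ≡ W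
            same-k = wt-cong a B' (λ x bx → killed-out I (tail w) (out x bx))
            same-b : wt a B' (wb I w) ≡ W
            same-b = wt-cong a B' (λ x bx → boosted-out I N.iv (tail w) (out x bx))

    module Tests (γ : ℚ) (2ω³≤γ : 2ℚ * (ω * (ω * ω)) ≤ γ) (Mω³≤γ : M * (ω * (ω * ω)) ≤ γ) (s : ℕ) (4ω²s≤1 : 4ℚ * (ω * (ω * ι s)) ≤ 1ℚ) where

      γ≥0 : 0ℚ ≤ γ
      γ≥0 = ≤-trans (nn* M≥0 (nn* ω≥0 (nn* ω≥0 ω≥0))) Mω³≤γ

      step⁺ : ∀ {n} (I : Subset n) H w B (i : Inv w) (ok : Ok (I ◂ H) w) → count B ℕ.≤ s →
        w zero * wt 1ℚ B (wk I w) + (1ℚ - w zero) * wt 1ℚ B (wb I w) ≤ wt 1ℚ B (tail w) * (1ℚ + γ * (ι (hit I B) * ι (hit I B)))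
      step⁺ I H w B i ok hs = ≤-trans (proj₂ (N.drift⁺ 1ℚ ω (ω * ι (hit I B)) 0≤1 ω≥0 (N.cond (nn* ω≥0 j≥0) small) I B (tail w)
          (λ x → nn i (suc x)) (λ x → ≤-trans (≤-reflexive (*-identityˡ _)) (N.≤ω (suc x))) ≤-refl))
        (*-monoˡ (≤-trans 0≤1 (wt-≥1 B 0≤1 (λ x → nn i (suc x)))) (+-monoʳ-≤ 1ℚ (≤-trans (≤-reflexive (e N.p ω j))
          (*-monoʳ (nn* j≥0 j≥0) (≤-trans (*-monoˡ 0≤2 (*-monoʳ (nn* ω≥0 ω≥0) (N.≤ω zero))) 2ω³≤γ)))))
        where
        module N = Node I H w i ok
        j = ι (hit I B)
        j≥0 : 0ℚ ≤ j
        j≥0 = ι≥0 (hit I B)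
        small : 4ℚ * (ω * (ω * j)) ≤ 1ℚ
        small = ≤-trans (*-monoˡ 0≤4 (*-monoˡ ω≥0 (*-monoˡ ω≥0 (ι-mono (ℕₚ.≤-trans (hit≤count I B) hs))))) 4ω²s≤1
        e : ∀ p o j → 2ℚ * p * ((o * j) * (o * j)) ≡ 2ℚ * (p * (o * o)) * (j * j)
        e = solve-∀ ringℚ

      -- The error is a multiple of the value `K` after killing. A vertex of weight zero causes
      -- none. Otherwise its weight is at least `ε`, so `T ≤ ω^h = (ε M)^h` at this vertex bounds
      -- the product over `I` by `M^h`, and `killed-ratio` yields `K ≤ M W`.
      step⁻ : ∀ {n} (I : Subset n) H w B (i : Inv w) (ok : Ok (I ◂ H) w) → count B ℕ.≤ s →
        w zero * wt (- 1ℚ) B (wk I w) + (1ℚ - w zero) * wt (- 1ℚ) B (wb I w) ≤ wt (- 1ℚ) B (tail w) * (1ℚ + γ * (ι (hit I B) * ι (hit I B)))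
      step⁻ I H w B i ok hs = ≤-trans (proj₂ (N.drift⁻ ω ω≥0 N.iv≤2 I B (tail w) (λ x → nn i (suc x)) (λ x → ≤1 i (suc x)) (λ x → N.≤ω (suc x)) (λ x → N.wiv≤1 (suc x))))
        (≤-trans (+-monoʳ-≤ W (p·K (live i zero))) (≤-reflexive (e₁ W γ (j * j))))
        where
        open ≤-Reasoning
        module N = Node I H w i ok
        j = ι (hit I B)
        j≥0 : 0ℚ ≤ j
        j≥0 = ι≥0 (hit I B)
        W K X : ℚ
        W = wt (- 1ℚ) B (tail w)
        K = wt (- 1ℚ) B (wk I w)
        X = wt θ I (tail w)
        W≥0 : 0ℚ ≤ W
        W≥0 = wt⁻-nn B (λ x → ≤1 i (suc x))
        e₁ : ∀ W g j → W + g * j * W ≡ W * (1ℚ + g * j)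
        e₁ = solve-∀ ringℚ
        e₂ : ∀ o j K → 0ℚ * ((o * j) * (o * j)) * K ≡ 0ℚ
        e₂ = solve-∀ ringℚ
        e₃ : ∀ o j M W → o * ((o * j) * (o * j)) * (M * W) ≡ M * (o * (o * o)) * (j * j) * W
        e₃ = solve-∀ ringℚ
        p·K : w zero ≡ 0ℚ ⊎ ε ≤ w zero → w zero * ((ω * j) * (ω * j)) * K ≤ γ * (j * j) * W
        p·K (inj₁ z) = ≤-trans (≤-reflexive (trans (cong (λ p → p * ((ω * j) * (ω * j)) * K) z) (e₂ ω j K))) (nn* (nn* γ≥0 (nn* j≥0 j≥0)) W≥0)
        p·K (inj₂ l) = begin
          w zero * ((ω * j) * (ω * j)) * K    ≤⟨ *-mono (nn* N.p≥0 (nn* ωj≥0 ωj≥0)) (nn* M≥0 W≥0) (*-monoʳ (nn* ωj≥0 ωj≥0) (N.≤ω zero)) K≤MW ⟩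
          ω * ((ω * j) * (ω * j)) * (M * W)   ≡⟨ e₃ ω j M W ⟩
          M * (ω * (ω * ω)) * (j * j) * W     ≤⟨ *-monoʳ W≥0 (*-monoʳ (nn* j≥0 j≥0) Mω³≤γ) ⟩
          γ * (j * j) * W ∎
          where
          ωj≥0 : 0ℚ ≤ ω * j
          ωj≥0 = nn* ω≥0 j≥0
          εh>0 : 0ℚ < ε ^ h
          εh>0 = ^-pos h ε>0
          X≥0 : 0ℚ ≤ X
          X≥0 = ≤-trans 0≤1 (wt-≥1 I θ≥0 (λ x → nn i (suc x)))
          X≤Mh : X ≤ M ^ h
          X≤Mh = *-cancelˡ εh>0 (begin
            ε ^ h * X              ≤⟨ *-monoʳ X≥0 (^-mono h ε≥0 l) ⟩
            w zero ^ h * X         ≡⟨ cong (w zero ^ h *_) (sym (*-identityˡ X)) ⟩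
            w zero ^ h * (1ℚ * X)  ≤⟨ ok zero ⟩
            ω ^ h                  ≡⟨ trans (cong (_^ h) ω≡) (^-* ε M h) ⟩
            ε ^ h * M ^ h ∎)
          K≤MW : K ≤ M * W
          K≤MW = ^-root h' (nn* M≥0 W≥0) (begin
            K ^ h             ≤⟨ killed-ratio h I B (tail w) (λ x → nn i (suc x)) (λ x → ≤-trans (*-monoˡ 0≤2 (*-monoˡ (ι≥0 h) (N.≤ω (suc x)))) θω≤1) (λ x → ≤1 i (suc x)) ⟩
            W ^ h * X         ≤⟨ *-monoˡ (^-nn h W≥0) X≤Mh ⟩
            W ^ h * M ^ h     ≡⟨ trans (*-comm (W ^ h) (M ^ h)) (sym (^-* M W h)) ⟩
            (M * W) ^ h ∎)

      module E⁺ = Expect 1ℚ γ γ≥0 0≤2 s (λ B i → ≤-trans 0≤1 (wt-≥1 B 0≤1 (nn i))) (λ {p} hp _ → nn+ 0≤1 (nn* 0≤1 hp)) step⁺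
      module E⁻ = Expect (- 1ℚ) γ γ≥0 (≤-reflexive refl) s (λ B i → wt⁻-nn B (≤1 i)) (λ _ hp → 1+-p≥0 hp) step⁻

    module Mass (k : ℕ) (η : ℚ) (η≥0 : 0ℚ ≤ η) (small : 4ℚ * (ω * (θ * ω * ι k)) ≤ 1ℚ) (η-def : 2ℚ * ω * ((θ * ω * ι k) * (θ * ω * ι k)) ≤ η) where

      total : ∀ {n} → Gr n → (Fin n → ℚ) → ℚ
      total H w = sum (T H w)

      T-nn : ∀ {n} (H : Gr n) {w} → (∀ x → 0ℚ ≤ w x) → ∀ u → 0ℚ ≤ T H w u
      T-nn H hw u = nn* (^-nn h (hw u)) (≤-trans 0≤1 (wt-≥1 (adjᴳ H u) θ≥0 hw))

      -- For a neighbour `u` of the newest vertex, killing gives `0ℚ ^ h`, which vanishes as `h` is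
      -- a successor. The boost `iv ^ h` is paid by the factor `1 + θ p` that `T` at `u` loses with
      -- this neighbour; the rest of its product is unchanged, since `I` is independent. For other
      -- `u` the codegree bound makes the drift at most `1 + η`.
      step : ∀ {n} (I : Subset n) (H : Gr n) w (i : Inv w) (ok : Ok (I ◂ H) w) → Indep (graph H) I → (∀ u → hit I (adjᴳ H u) ℕ.≤ k) →
        ∀ u → w zero * T H (wk I w) u + (1ℚ - w zero) * T H (wb I w) u ≤ (1ℚ + η) * T (I ◂ H) w (suc u)
      step I H w i ok ind cod u = cases (I u) refl
        where
        open ≤-Reasoning
        module N = Node I H w i ok
        A = adjᴳ H u
        v W K Q b : ℚ
        v = w (suc u)
        W = wt θ A (tail w)
        K = wt θ A (wk I w)
        Q = wt θ A (wb I w)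
        b = θ * ω
        b≥0 : 0ℚ ≤ b
        b≥0 = nn* θ≥0 ω≥0
        j = ι (hit I A)
        W≥0 : 0ℚ ≤ W
        W≥0 = ≤-trans 0≤1 (wt-≥1 A θ≥0 (λ x → nn i (suc x)))
        vh≥0 : 0ℚ ≤ v ^ h
        vh≥0 = ^-nn h (nn i (suc u))
        bj≤ : b * j ≤ b * ι k
        bj≤ = *-monoˡ b≥0 (ι-mono (cod u))
        bk≥0 : 0ℚ ≤ b * ι k
        bk≥0 = nn* b≥0 (ι≥0 k)
        Y≥0 : 0ℚ ≤ (1ℚ + θ * N.p) * W
        Y≥0 = nn* (nn+ 0≤1 (nn* θ≥0 N.p≥0)) W≥0
        e₁ : ∀ p q v K Q → p * (v * K) + q * (v * Q) ≡ v * (p * K + q * Q)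
        e₁ = solve-∀ ringℚ
        e₂ : ∀ v W η → v * (W * (1ℚ + η)) ≡ (1ℚ + η) * (v * (1ℚ * W))
        e₂ = solve-∀ ringℚ
        cases : ∀ t → I u ≡ t → w zero * ((if t then 0ℚ else v) ^ h * K) + (1ℚ - w zero) * ((if t then v * N.iv else v) ^ h * Q)
          ≤ (1ℚ + η) * (v ^ h * ((if t then 1ℚ + θ * w zero else 1ℚ) * W))
        cases false _ = begin
          N.p * (v ^ h * K) + N.q * (v ^ h * Q)      ≡⟨ e₁ N.p N.q (v ^ h) K Q ⟩
          v ^ h * (N.p * K + N.q * Q)                ≤⟨ *-monoˡ vh≥0 (proj₂ (N.drift⁺ θ b (b * ι k) θ≥0 b≥0 (N.cond bk≥0 small) I A (tail w) (λ x → nn i (suc x)) (λ x → *-monoˡ θ≥0 (N.≤ω (suc x))) bj≤)) ⟩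
          v ^ h * (W * (1ℚ + 2ℚ * N.p * ((b * j) * (b * j)))) ≤⟨ *-monoˡ vh≥0 (*-monoˡ W≥0 (+-monoʳ-≤ 1ℚ (≤-trans
               (*-mono (nn* 0≤2 N.p≥0) (nn* bk≥0 bk≥0) (*-monoˡ 0≤2 (N.≤ω zero)) (*-mono (nn* b≥0 (ι≥0 (hit I A))) bk≥0 bj≤ bj≤)) η-def))) ⟩
          v ^ h * (W * (1ℚ + η))                     ≡⟨ e₂ (v ^ h) W η ⟩
          (1ℚ + η) * (v ^ h * (1ℚ * W)) ∎
        cases true hu = begin
          N.p * (0ℚ ^ h * K) + N.q * ((v * N.iv) ^ h * Q)  ≡⟨ cong₂ (λ x y → N.p * (0ℚ ^ h * K) + N.q * (x * y)) (^-* v N.iv h) Q≡W ⟩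
          N.p * (0ℚ * 0ℚ ^ h' * K) + N.q * (v ^ h * N.iv ^ h * W) ≡⟨ e₃ N.p (0ℚ ^ h') K N.q (v ^ h) (N.iv ^ h) W ⟩
          v ^ h * (N.q * N.iv ^ h * W)                     ≤⟨ *-monoˡ vh≥0 (*-monoʳ W≥0 (*-mono N.q≥0 (nn+ 0≤1 (nn* θ≥0 N.p≥0)) N.q≤1 iv^h)) ⟩
          v ^ h * (1ℚ * (1ℚ + θ * N.p) * W)                ≤⟨ ≤⁺ (nn* (nn* η≥0 vh≥0) Y≥0) (e₄ (v ^ h) (1ℚ + θ * N.p) W η) ⟩
          (1ℚ + η) * (v ^ h * ((1ℚ + θ * N.p) * W)) ∎
          where
          e₃ : ∀ p z K q v i W → p * (0ℚ * z * K) + q * (v * i * W) ≡ v * (q * i * W)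
          e₃ = solve-∀ ringℚ
          e₄ : ∀ v t W η → (1ℚ + η) * (v * (t * W)) ≡ v * (1ℚ * t * W) + η * v * (t * W)
          e₄ = solve-∀ ringℚ
          Q≡W : Q ≡ W
          Q≡W = wt-cong θ A (λ x ax → boosted-out I N.iv (tail w) (out x ax (bool (I x))))
            where
            out : ∀ x → A x ≡ true → I x ≡ true ⊎ I x ≡ false → I x ≡ false
            out x ax (inj₁ t) = ⊥-elim (true≢false ax (ind u x hu t))
            out x ax (inj₂ f) = f
          -- (1 - p)^h (1 + 2 h p) ≥ 1 by Bernoulli.
          iv^h : N.iv ^ h ≤ 1ℚ + θ * N.p
          iv^h = *-cancelˡ (^-pos h N.q>0) (begin
            N.q ^ h * N.iv ^ h                        ≡⟨ trans (sym (^-* N.q N.iv h)) (trans (cong (_^ h) N.q·iv) (1^ h)) ⟩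
            1ℚ                                        ≤⟨ ≤⁺ (nn* (nn* (ι≥0 h) N.p≥0) (p≤q⇒0≤q-p (≤-trans (*-monoˡ 0≤2 (*-monoˡ (ι≥0 h) (N.≤ω zero))) θω≤1))) (e₅ N.p (ι h)) ⟩
            (1ℚ - ι h * N.p) * (1ℚ + θ * N.p)         ≤⟨ *-monoʳ (nn+ 0≤1 (nn* θ≥0 N.p≥0)) (bernoulli⁻ h N.p≥0 (≤1 i zero)) ⟩
            N.q ^ h * (1ℚ + θ * N.p) ∎)
            where e₅ : ∀ v k → (1ℚ - k * v) * (1ℚ + 2ℚ * k * v) ≡ 1ℚ + (k * v) * (1ℚ - 2ℚ * (k * v))
                  e₅ = solve-∀ ringℚ

      -- A maximal inequality: up to the factors `1 + η` the sum of `T` is a supermartingale, and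
      -- where a run is stopped one summand alone exceeds `β`. So `β` times the lost mass is at most
      -- the initial sum with its growth.
      mass-run : ∀ {n} (H : Gr n) w → Inv w → TFᴳ H → Codeg k H → β ≤ (1ℚ + η) ^ n * total H w + β * mass (run H w)
      mass-run []ᴳ w i tf cd = ≤-reflexive (e β)
        where e : ∀ b → b ≡ 1ℚ * 0ℚ + b * (1ℚ * 1ℚ + 0ℚ)
              e = solve-∀ ringℚ
      mass-run {suc n} (I ◂ H) w i (ind , tf) (cod , cd) = go (ok? (I ◂ H) w)
        where
        open ≤-Reasoning
        C = (1ℚ + η) ^ n
        C≥0 : 0ℚ ≤ C
        C≥0 = ^-nn n (nn+ 0≤1 η≥0)
        S = total (I ◂ H) w
        S≥0 : 0ℚ ≤ S
        S≥0 = sum-nn (T-nn (I ◂ H) (nn i))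
        go : ∀ d → β ≤ (1ℚ + η) ^ suc n * S + β * mass (guard d (branch (w zero) (cons true) (run H (wk I w)) ++ branch (1ℚ - w zero) (cons false) (run H (wb I w))))
        go (no bad) = dead (Finₚ.¬∀⟶∃¬ (suc n) (λ u → T (I ◂ H) w u ≤ β) (λ u → T (I ◂ H) w u ≤? β) bad)
          where
          dead : (∃ λ u → ¬ (T (I ◂ H) w u ≤ β)) → β ≤ (1ℚ + η) ^ suc n * S + β * 0ℚ
          dead (u , big) = begin
            β                             ≤⟨ <⇒≤ (≰⇒> big) ⟩
            T (I ◂ H) w u                 ≤⟨ term≤sum (T-nn (I ◂ H) (nn i)) u ⟩
            S                             ≡⟨ sym (*-identityˡ S) ⟩
            1ℚ * S                        ≤⟨ *-monoʳ S≥0 (^-≥1 (suc n) (1≤1+ η≥0)) ⟩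
            (1ℚ + η) ^ suc n * S          ≡⟨ e ((1ℚ + η) ^ suc n * S) β ⟩
            (1ℚ + η) ^ suc n * S + β * 0ℚ ∎
            where e : ∀ x b → x ≡ x + b * 0ℚ
                  e = solve-∀ ringℚ
        go (yes ok) = begin
          β                                                     ≡⟨ e₁ N.p β ⟩
          N.p * β + N.q * β                                     ≤⟨ +-mono-≤ (*-monoˡ N.p≥0 (mass-run H (wk I w) N.inv-wk tf cd)) (*-monoˡ N.q≥0 (mass-run H (wb I w) N.inv-wb tf cd)) ⟩
          N.p * (C * Sk + β * mk) + N.q * (C * Sb + β * mb)     ≡⟨ e₂ N.p N.q C Sk Sb β mk mb ⟩
          C * (N.p * Sk + N.q * Sb) + β * (N.p * mk + N.q * mb) ≤⟨ +-monoˡ-≤ _ (*-monoˡ C≥0 sums) ⟩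
          C * ((1ℚ + η) * S) + β * (N.p * mk + N.q * mb)        ≡⟨ cong₂ (λ x y → x + β * y) (e₃ C (1ℚ + η) S) (sym (N.split (λ _ → 1ℚ))) ⟩
          (1ℚ + η) * C * S + β * mass (branch (w zero) (cons true) (run H (wk I w)) ++ branch (1ℚ - w zero) (cons false) (run H (wb I w))) ∎
          where
          module N = Node I H w i ok
          Sk Sb mk mb : ℚ
          Sk = total H (wk I w)
          Sb = total H (wb I w)
          mk = mass (run H (wk I w))
          mb = mass (run H (wb I w))
          e₁ : ∀ p b → b ≡ p * b + (1ℚ - p) * b
          e₁ = solve-∀ ringℚ
          e₂ : ∀ p q C s t b m l → p * (C * s + b * m) + q * (C * t + b * l) ≡ C * (p * s + q * t) + b * (p * m + q * l)
          e₂ = solve-∀ ringℚ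
          e₃ : ∀ C x S → C * (x * S) ≡ x * C * S
          e₃ = solve-∀ ringℚ
          sums : N.p * Sk + N.q * Sb ≤ (1ℚ + η) * S
          sums = begin
            N.p * Sk + N.q * Sb   ≡⟨ cong₂ _+_ (sym (sum-* N.p (T H (wk I w)))) (sym (sum-* N.q (T H (wb I w)))) ⟩
            sum (λ u → N.p * T H (wk I w) u) + sum (λ u → N.q * T H (wb I w) u) ≡⟨ sym (sum-+ (λ u → N.p * T H (wk I w) u) (λ u → N.q * T H (wb I w) u)) ⟩
            sum (λ u → N.p * T H (wk I w) u + N.q * T H (wb I w) u) ≤⟨ sum-mono (step I H w i ok ind cod) ⟩
            sum (λ u → (1ℚ + η) * T (I ◂ H) w (suc u))  ≡⟨ sum-* (1ℚ + η) (λ u → T (I ◂ H) w (suc u)) ⟩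
            (1ℚ + η) * sum (λ u → T (I ◂ H) w (suc u))  ≤⟨ *-monoˡ (nn+ 0≤1 η≥0) (≤⁺ (T-nn (I ◂ H) (nn i) zero) (+-comm (T (I ◂ H) w zero) _)) ⟩
            (1ℚ + η) * S ∎

-- Potentials as sums over independent sets, and simultaneous Markov bounds.

module Potentials where

  open Rationals
  open Measures
  open WeightedGraphs
  open SelectionProcess using (true≢false)
  open LowerBound using (count-cong)
  open ProductTests
  open RandomIndependentSet
  open import Data.Rational.Properties
  open import Relation.Nullary.Decidable using (dec-true; dec-false)

  sumS : ∀ {n} → (Subset n → ℚ) → ℚ
  sumS {zero} F = F (λ ())
  sumS {suc n} F = sumS (λ B → F (cons false B)) + sumS (λ B → F (cons true B))

  sumS-mono : ∀ {n} {F G : Subset n → ℚ} → (∀ B → F B ≤ G B) → sumS F ≤ sumS G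
  sumS-mono {zero} h = h _
  sumS-mono {suc n} h = +-mono-≤ (sumS-mono (λ B → h (cons false B))) (sumS-mono (λ B → h (cons true B)))

  sumS-cong : ∀ {n} {F G : Subset n → ℚ} → (∀ B → F B ≡ G B) → sumS F ≡ sumS G
  sumS-cong {zero} h = h _
  sumS-cong {suc n} h = cong₂ _+_ (sumS-cong (λ B → h (cons false B))) (sumS-cong (λ B → h (cons true B)))

  sumS-nn : ∀ {n} {F : Subset n → ℚ} → (∀ B → 0ℚ ≤ F B) → 0ℚ ≤ sumS F
  sumS-nn {zero} h = h _
  sumS-nn {suc n} h = nn+ (sumS-nn (λ B → h (cons false B))) (sumS-nn (λ B → h (cons true B)))

  sumS-+ : ∀ {n} (F G : Subset n → ℚ) → sumS (λ B → F B + G B) ≡ sumS F + sumS G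
  sumS-+ {zero} F G = refl
  sumS-+ {suc n} F G = trans (cong₂ _+_ (sumS-+ (λ B → F (cons false B)) (λ B → G (cons false B))) (sumS-+ (λ B → F (cons true B)) (λ B → G (cons true B))))
    (e (sumS (λ B → F (cons false B))) (sumS (λ B → G (cons false B))) (sumS (λ B → F (cons true B))) (sumS (λ B → G (cons true B))))
    where e : ∀ a b c d → a + b + (c + d) ≡ a + c + (b + d)
          e = solve-∀ ringℚ

  sumS-* : ∀ {n} c (F : Subset n → ℚ) → sumS (λ B → c * F B) ≡ c * sumS F
  sumS-* {zero} c F = refl
  sumS-* {suc n} c F = trans (cong₂ _+_ (sumS-* c (λ B → F (cons false B))) (sumS-* c (λ B → F (cons true B)))) (sym (*-distribˡ-+ c _ _))

  𝔼-sumS : ∀ {n m} (μ : Meas m) (F : Subset n → Subset m → ℚ) → 𝔼 μ (λ I → sumS (λ B → F B I)) ≡ sumS (λ B → 𝔼 μ (F B))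
  𝔼-sumS {zero} μ F = refl
  𝔼-sumS {suc n} μ F = trans (𝔼-+ μ (λ I → sumS (λ B → F (cons false B) I)) (λ I → sumS (λ B → F (cons true B) I)))
    (cong₂ _+_ (𝔼-sumS μ (λ B → F (cons false B))) (𝔼-sumS μ (λ B → F (cons true B))))

  -- Subsets are functions, so a term of `sumS` can be singled out only if `F` respects pointwise
  -- equality.
  Ext : ∀ {n} → (Subset n → ℚ) → Set
  Ext F = ∀ {A B} → A ≗ B → F A ≡ F B

  cons-cong : ∀ {n b} {A B : Subset n} → A ≗ B → cons b A ≗ cons b B
  cons-cong h zero = refl
  cons-cong h (suc x) = h x

  cons-tail : ∀ {n b} (B : Subset (suc n)) → B zero ≡ b → B ≗ cons b (tail B)
  cons-tail B h zero = h
  cons-tail B h (suc x) = refl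

  term≤sumS : ∀ {n} {F : Subset n → ℚ} → Ext F → (∀ B → 0ℚ ≤ F B) → ∀ B → F B ≤ sumS F
  term≤sumS {zero} ext h B = ≤-reflexive (ext (λ ()))
  term≤sumS {suc n} {F} ext h B = go (B zero) refl
    where
    go : ∀ b → B zero ≡ b → F B ≤ sumS F
    go false e = ≤-trans (≤-reflexive (ext (cons-tail B e))) (≤-trans (term≤sumS (λ q → ext (cons-cong q)) (λ A → h (cons false A)) (tail B))
      (≤⁺ (sumS-nn (λ A → h (cons true A))) refl))
    go true e = ≤-trans (≤-reflexive (ext (cons-tail B e))) (≤-trans (term≤sumS (λ q → ext (cons-cong q)) (λ A → h (cons true A)) (tail B))
      (≤⁺ (sumS-nn (λ A → h (cons false A))) (+-comm (sumS (λ A → F (cons false A))) _)))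

  -- dis I B is the indicator of I ∩ B = ∅, and two I B = 2^|I ∩ B|.
  dis two : ∀ {n} → Subset n → Subset n → ℚ
  dis I B = wt (- 1ℚ) B (λ x → [ I x ])
  two I B = wt 1ℚ B (λ x → [ I x ])

  below : ∀ {n} → ℕ → Subset n → ℚ
  below s B = [ does (count B ℕ.<? s) ]

  wt-ext : ∀ {n} a {A B : Subset n} w → A ≗ B → wt a A w ≡ wt a B w
  wt-ext a w h = prod-cong (λ x → cong (λ b → if b then 1ℚ + a * w x else 1ℚ) (h x))

  two-hit : ∀ {n} (I B : Subset n) → two I B ≡ 2ℚ ^ hit I B
  two-hit {zero} I B = refl
  two-hit {suc n} I B = trans (cong₂ _*_ (pt (I zero) (B zero)) (two-hit (tail I) (tail B))) (sym (^-+ 2ℚ (if I zero ∧ B zero then 1 else 0) (hit (tail I) (tail B))))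
    where
    pt : ∀ i b → (if b then 1ℚ + 1ℚ * [ i ] else 1ℚ) ≡ 2ℚ ^ (if i ∧ b then 1 else 0)
    pt true true = refl
    pt true false = refl
    pt false true = refl
    pt false false = refl

  dis-nn : ∀ {n} (I B : Subset n) → 0ℚ ≤ dis I B
  dis-nn I B = wt⁻-nn B (λ x → []≤1 (I x))

  dis≤1 : ∀ {n} (I B : Subset n) → dis I B ≤ 1ℚ
  dis≤1 {zero} I B = ≤-refl
  dis≤1 {suc n} I B = ≤-trans (*-mono (pt≥ (I zero) (B zero)) 0≤1 (pt (I zero) (B zero)) (dis≤1 (tail I) (tail B))) (≤-reflexive (*-identityˡ 1ℚ))
    where
    pt : ∀ i b → (if b then 1ℚ + - 1ℚ * [ i ] else 1ℚ) ≤ 1ℚ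
    pt true true = 0≤1
    pt true false = ≤-refl
    pt false true = ≤-refl
    pt false false = ≤-refl
    pt≥ : ∀ i b → 0ℚ ≤ (if b then 1ℚ + - 1ℚ * [ i ] else 1ℚ)
    pt≥ true true = ≤-refl
    pt≥ true false = 0≤1
    pt≥ false true = 0≤1
    pt≥ false false = 0≤1

  dis-cases : ∀ {n} (I B : Subset n) → dis I B ≡ 0ℚ ⊎ (∀ x → B x ≡ true → I x ≡ false)
  dis-cases {zero} I B = inj₂ (λ ())
  dis-cases {suc n} I B = go (I zero) (B zero) refl refl (dis-cases (tail I) (tail B))
    where
    Goal : Set
    Goal = dis I B ≡ 0ℚ ⊎ (∀ x → B x ≡ true → I x ≡ false)
    go : ∀ i b → I zero ≡ i → B zero ≡ b → dis (tail I) (tail B) ≡ 0ℚ ⊎ (∀ x → tail B x ≡ true → tail I x ≡ false) → Goal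
    go i b ei eb (inj₁ z) = inj₁ (trans (cong ((if B zero then 1ℚ + - 1ℚ * [ I zero ] else 1ℚ) *_) z) (*-zeroʳ (if B zero then 1ℚ + - 1ℚ * [ I zero ] else 1ℚ)))
    go true true ei eb (inj₂ h) = inj₁ (trans (cong (_* dis (tail I) (tail B)) (cong₂ (λ b i → if b then 1ℚ + - 1ℚ * [ i ] else 1ℚ) eb ei)) (*-zeroˡ (dis (tail I) (tail B))))
    go false b ei eb (inj₂ h) = inj₂ λ { zero _ → ei ; (suc x) → h x }
    go true false ei eb (inj₂ h) = inj₂ λ { zero t → ⊥-elim (true≢false t eb) ; (suc x) → h x }

  dis≡1 : ∀ {n} (I B : Subset n) → (∀ x → B x ≡ true → I x ≡ false) → dis I B ≡ 1ℚ
  dis≡1 {zero} I B h = refl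
  dis≡1 {suc n} I B h = trans (cong₂ _*_ (pt (I zero) (B zero) (h zero)) (dis≡1 (tail I) (tail B) (λ x → h (suc x)))) (*-identityˡ 1ℚ)
    where
    pt : ∀ i b → (b ≡ true → i ≡ false) → (if b then 1ℚ + - 1ℚ * [ i ] else 1ℚ) ≡ 1ℚ
    pt i false _ = refl
    pt false true _ = refl
    pt true true k = ⊥-elim (true≢false refl (k refl))

  below-cases : ∀ {n} s (B : Subset n) → below s B ≡ 0ℚ ⊎ count B ℕ.< s
  below-cases s B with count B ℕ.<? s
  ... | yes q = inj₂ q
  ... | no ge = inj₁ (cong [_] (dec-false (count B ℕ.<? s) ge))

  below≡1 : ∀ {n} s (B : Subset n) → count B ℕ.< s → below s B ≡ 1ℚ
  below≡1 s B h = cong [_] (dec-true (count B ℕ.<? s) h)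

  below-nn : ∀ {n} s (B : Subset n) → 0ℚ ≤ below s B
  below-nn s B = []≥0 (does (count B ℕ.<? s))

  below≤1 : ∀ {n} s (B : Subset n) → below s B ≤ 1ℚ
  below≤1 s B = []≤1 (does (count B ℕ.<? s))

  indep-cons-true : ∀ {n} (I : Subset n) (H : Gr n) B → B zero ≡ true → Indep (graph H) (tail B) → (∀ x → tail B x ≡ true → I x ≡ false) → Indep (graph (I ◂ H)) B
  indep-cons-true I H B hb ind d zero zero _ _ = refl
  indep-cons-true I H B hb ind d zero (suc y) _ q = d y q
  indep-cons-true I H B hb ind d (suc x) zero p _ = d x p
  indep-cons-true I H B hb ind d (suc x) (suc y) p q = ind x y p q

  indep-cons-false : ∀ {n} (I : Subset n) (H : Gr n) B → B zero ≡ false → Indep (graph H) (tail B) → Indep (graph (I ◂ H)) B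
  indep-cons-false I H B hb ind zero y p _ = ⊥-elim (true≢false p hb)
  indep-cons-false I H B hb ind (suc x) zero _ q = ⊥-elim (true≢false q hb)
  indep-cons-false I H B hb ind (suc x) (suc y) p q = ind x y p q

  count-cons : ∀ {n} (B : Subset (suc n)) b → B zero ≡ b → count B ≡ (if b then 1 else 0) ℕ.+ count (tail B)
  count-cons B b h with B zero
  count-cons B .true refl | true = refl
  count-cons B .false refl | false = refl

  -- Weights of independent sets of size at most s, as products over the vertices of the graph.
  module Potential (s : ℕ) (t : ℕ → ℚ) (f : ∀ {n} → Subset n → Subset n → ℚ)
    (t≥0 : ∀ c → 0ℚ ≤ t c) (f≥0 : ∀ {n} (I B : Subset n) → 0ℚ ≤ f I B) (f-ext : ∀ {n} (I : Subset n) → Ext (f I)) where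

    -- Independence and the size bound are enforced by factors that vanish, so the potential can be
    -- a sum over all subsets. The parameter `t` weighs a new member of `B`, and `f` a new vertex
    -- outside `B`.
    Ψ : ∀ {n} → Gr n → Subset n → ℚ
    Ψ []ᴳ B = 1ℚ
    Ψ (I ◂ H) B = Ψ H (tail B) * (if B zero then dis I (tail B) * (below s (tail B) * t (count (tail B))) else f I (tail B))

    Φ : ∀ {n} → Gr n → ℚ
    Φ H = sumS (Ψ H)

    Ψ≥0 : ∀ {n} (H : Gr n) B → 0ℚ ≤ Ψ H B
    Ψ≥0 []ᴳ B = 0≤1
    Ψ≥0 (I ◂ H) B = nn* (Ψ≥0 H (tail B)) (go (B zero))
      where
      go : ∀ b → 0ℚ ≤ (if b then dis I (tail B) * (below s (tail B) * t (count (tail B))) else f I (tail B))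
      go true = nn* (dis-nn I (tail B)) (nn* (below-nn s (tail B)) (t≥0 _))
      go false = f≥0 I (tail B)

    Ψ-ext : ∀ {n} (H : Gr n) → Ext (Ψ H)
    Ψ-ext []ᴳ h = refl
    Ψ-ext (I ◂ H) {A} {B} h = cong₂ _*_ (Ψ-ext H h') (trans (cong (λ b → if b then _ else _) (h zero)) (go (B zero)))
      where
      h' : tail A ≗ tail B
      h' x = h (suc x)
      go : ∀ b → (if b then dis I (tail A) * (below s (tail A) * t (count (tail A))) else f I (tail A))
               ≡ (if b then dis I (tail B) * (below s (tail B) * t (count (tail B))) else f I (tail B))
      go true = cong₂ _*_ (wt-ext (- 1ℚ) (λ x → [ I x ]) h') (cong (λ c → [ does (c ℕ.<? s) ] * t c) (count-cong h'))
      go false = f-ext I h'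

    Ψ≤Φ : ∀ {n} (H : Gr n) B → Ψ H B ≤ Φ H
    Ψ≤Φ H = term≤sumS (Ψ-ext H) (Ψ≥0 H)

    Ψ-cases : ∀ {n} (H : Gr n) B → Ψ H B ≡ 0ℚ ⊎ (Indep (graph H) B × count B ℕ.≤ s)
    Ψ-cases []ᴳ B = inj₂ ((λ ()) , ℕ.z≤n)
    Ψ-cases (I ◂ H) B = go (B zero) refl (Ψ-cases H (tail B))
      where
      R : ℚ
      R = if B zero then dis I (tail B) * (below s (tail B) * t (count (tail B))) else f I (tail B)
      go : ∀ b → B zero ≡ b → Ψ H (tail B) ≡ 0ℚ ⊎ (Indep (graph H) (tail B) × count (tail B) ℕ.≤ s) → Ψ (I ◂ H) B ≡ 0ℚ ⊎ (Indep (graph (I ◂ H)) B × count B ℕ.≤ s)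
      go b e (inj₁ z) = inj₁ (trans (cong (_* R) z) (*-zeroˡ R))
      go false e (inj₂ (ind , c)) = inj₂ (indep-cons-false I H B e ind , subst (ℕ._≤ s) (sym (count-cons B false e)) c)
      go true e (inj₂ (ind , c)) = on (dis-cases I (tail B)) (below-cases s (tail B))
        where
        R≡ : R ≡ dis I (tail B) * (below s (tail B) * t (count (tail B)))
        R≡ = cong (λ b → if b then dis I (tail B) * (below s (tail B) * t (count (tail B))) else f I (tail B)) e
        zero-out : R ≡ 0ℚ → Ψ (I ◂ H) B ≡ 0ℚ
        zero-out z = trans (cong (Ψ H (tail B) *_) z) (*-zeroʳ (Ψ H (tail B)))
        on : dis I (tail B) ≡ 0ℚ ⊎ (∀ x → tail B x ≡ true → I x ≡ false) → below s (tail B) ≡ 0ℚ ⊎ count (tail B) ℕ.< s →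
          Ψ (I ◂ H) B ≡ 0ℚ ⊎ (Indep (graph (I ◂ H)) B × count B ℕ.≤ s)
        on (inj₁ z) _ = inj₁ (zero-out (trans R≡ (trans (cong (_* (below s (tail B) * t (count (tail B)))) z) (*-zeroˡ (below s (tail B) * t (count (tail B)))))))
        on (inj₂ _) (inj₁ z) = inj₁ (zero-out (trans R≡ (trans (cong (λ y → dis I (tail B) * (y * t (count (tail B)))) z)
          (trans (cong (dis I (tail B) *_) (*-zeroˡ (t (count (tail B))))) (*-zeroʳ (dis I (tail B)))))))
        on (inj₂ d) (inj₂ c') = inj₂ (indep-cons-true I H B e ind d , subst (ℕ._≤ s) (sym (count-cons B true e)) c')

    Ψ-false : ∀ {n} (I : Subset n) H B → B zero ≡ false → Ψ (I ◂ H) B ≡ Ψ H (tail B) * f I (tail B)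
    Ψ-false I H B e = cong (λ b → Ψ H (tail B) * (if b then dis I (tail B) * (below s (tail B) * t (count (tail B))) else f I (tail B))) e

    Ψ-true : ∀ {n} (I : Subset n) H B → B zero ≡ true → Indep (graph (I ◂ H)) B → count B ℕ.≤ s → Ψ (I ◂ H) B ≡ Ψ H (tail B) * t (count (tail B))
    Ψ-true I H B e ind c = trans (cong (λ b → Ψ H (tail B) * (if b then dis I (tail B) * (below s (tail B) * t (count (tail B))) else f I (tail B))) e)
      (cong (Ψ H (tail B) *_) (trans (cong₂ (λ x y → x * (y * t (count (tail B)))) (dis≡1 I (tail B) (λ x hx → ind zero (suc x) e hx)) (below≡1 s (tail B) (subst (ℕ._≤ s) (count-cons B true e) c)))
        (trans (*-identityˡ _) (*-identityˡ (t (count (tail B)))))))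

    -- The part of `Φ (I ◂ H)` that comes from sets containing the new vertex.
    inc : ∀ {n} → Gr n → Subset n → ℚ
    inc H I = sumS (λ B → Ψ H B * (dis I B * (below s B * t (count B))))

  -- The sum of `f i / b i` has expectation at most `m`, which is at most `2 m` times the mass and
  -- so less than `2 m + 1` times the mass. Five functionals give the constant 11 that occurs from
  -- here on.
  markov : ∀ {n P m} {μ : Meas n} → Supp P μ → (f : Fin m → Subset n → ℚ) (b : Fin m → ℚ) →
    (∀ i I → 0ℚ ≤ f i I) → (∀ i → 0ℚ < b i) → (∀ i → 𝔼 μ (f i) ≤ b i) → 1ℚ ≤ 2ℚ * mass μ →
    ∃ λ I → P I × (∀ i → f i I ≤ ι (suc (2 ℕ.* m)) * b i)
  markov {n} {P} {m} {μ} sup f b f≥0 b>0 Ef hm =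
    let I , p , lt = 𝔼-exists< sup F κ EF< in I , p , λ i → bound I lt i
    where
    open ≤-Reasoning
    κ : ℚ
    κ = ι (suc (2 ℕ.* m))
    F : Subset n → ℚ
    F I = sum (λ i → inv (b i) * f i I)
    EF≤ : 𝔼 μ F ≤ ι m
    EF≤ = begin
      𝔼 μ F                                ≡⟨ trans (𝔼-sum μ (λ i I → inv (b i) * f i I)) (sum-cong (λ i → 𝔼-* μ (inv (b i)) (f i))) ⟩
      sum (λ i → inv (b i) * 𝔼 μ (f i))    ≤⟨ sum-mono (λ i → ≤-trans (*-monoˡ (<⇒≤ (inv-pos (b>0 i))) (Ef i)) (≤-reflexive (trans (*-comm (inv (b i)) (b i)) (inv-r (b>0 i))))) ⟩
      sum {m} (λ i → 1ℚ)                   ≡⟨ trans (sum-const m 1ℚ) (*-identityʳ (ι m)) ⟩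
      ι m ∎
    e : ∀ x m → x * (1ℚ + 2ℚ * m) ≡ m * (2ℚ * x) + x
    e = solve-∀ ringℚ
    mass>0 : 0ℚ < mass μ
    mass>0 = 0<*⇒0<ˡ 0≤2 (subst (0ℚ <_) (*-comm 2ℚ (mass μ)) (<-≤-trans 0<1 hm))
    EF< : 𝔼 μ F < κ * mass μ
    EF< = ≤-<-trans EF≤ (<-≤-trans (<⁺ mass>0 refl) (≤-trans (+-monoˡ-≤ (mass μ) (≤-trans (≤-reflexive (sym (*-identityʳ (ι m)))) (*-monoˡ (ι≥0 m) hm)))
      (≤-reflexive (trans (sym (e (mass μ) (ι m))) (trans (*-comm (mass μ) _) (cong (λ z → (1ℚ + z) * mass μ) (sym (ι-* 2 m))))))))
    bound : ∀ I → F I < κ → ∀ i → f i I ≤ κ * b i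
    bound I lt i = *-cancelˡ (inv-pos (b>0 i)) (begin
      inv (b i) * f i I      ≤⟨ term≤sum (λ j → nn* (<⇒≤ (inv-pos (b>0 j))) (f≥0 j I)) i ⟩
      F I                    ≤⟨ <⇒≤ lt ⟩
      κ                      ≡⟨ trans (sym (*-identityʳ κ)) (cong (κ *_) (sym (inv-r (b>0 i)))) ⟩
      κ * (b i * inv (b i))  ≡⟨ e₂ κ (b i) (inv (b i)) ⟩
      inv (b i) * (κ * b i) ∎)
      where e₂ : ∀ k b i → k * (b * i) ≡ i * (k * b)
            e₂ = solve-∀ ringℚ

-- The construction of the triangle-free graph and the quantities kept bounded.

module Growth where

  open Rationals
  open Measures
  open WeightedGraphs
  open SelectionProcess using (true≢false; bool)
  open ProductTests
  open RandomIndependentSet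
  open Potentials
  open import Data.Bool using (T)
  open import Data.Rational.Properties

  2^-cancel : ∀ {a b} → 2ℚ ^ a ≤ 2ℚ ^ b → a ℕ.≤ b
  2^-cancel {a} {b} h with a ℕ.≤? b
  ... | yes q = q
  ... | no q = ⊥-elim (<-irrefl refl (<-≤-trans lt (≤-trans (^-monoʳ 1≤2 (ℕₚ.≰⇒> q)) h)))
    where
    e : ∀ x → 2ℚ * x ≡ x + x
    e = solve-∀ ringℚ
    lt : 2ℚ ^ b < 2ℚ ^ suc b
    lt = <⁺ (^-pos b 0<2) (e (2ℚ ^ b))

  wt-const : ∀ {n} a (B : Subset n) e → wt a B (λ _ → e) ≡ (1ℚ + a * e) ^ count B
  wt-const a B e = prod-if B (1ℚ + a * e)

  Left : ∀ {n} → ℕ → Gr n → Set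
  Left D []ᴳ = ⊤
  Left D (I ◂ H) = count I ℕ.≤ D × Left D H

  -- The number of newer neighbours.
  rdeg : ∀ {n} → Gr n → Fin n → ℕ
  rdeg (I ◂ H) zero = 0
  rdeg (I ◂ H) (suc u) = (if I u then 1 else 0) ℕ.+ rdeg H u

  degree≤ : ∀ {n} D (H : Gr n) → Left D H → ∀ u → count (adjᴳ H u) ℕ.≤ D ℕ.+ rdeg H u
  degree≤ D (I ◂ H) (l , ls) zero = ℕₚ.≤-trans l (ℕₚ.m≤m+n D 0)
  degree≤ D (I ◂ H) (l , ls) (suc u) = subst (ℕ._≤ D ℕ.+ ((if I u then 1 else 0) ℕ.+ rdeg H u)) (sym (count-cons (adjᴳ (I ◂ H) (suc u)) (I u) refl))
    (subst ((if I u then 1 else 0) ℕ.+ count (adjᴳ H u) ℕ.≤_) (rearr D (if I u then 1 else 0) (rdeg H u)) (ℕₚ.+-monoʳ-≤ (if I u then 1 else 0) (degree≤ D H ls u)))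
    where
    rearr : ∀ a b c → b ℕ.+ (a ℕ.+ c) ≡ a ℕ.+ (b ℕ.+ c)
    rearr a b c = trans (sym (ℕₚ.+-assoc b a c)) (trans (cong (ℕ._+ c) (ℕₚ.+-comm b a)) (ℕₚ.+-assoc a b c))

  nbhd-indep : ∀ {n} (H : Gr n) → TFᴳ H → ∀ u → Indep (graph H) (adjᴳ H u)
  nbhd-indep H tf u x y hx hy = go (bool (adjᴳ H x y))
    where
    go : adjᴳ H x y ≡ true ⊎ adjᴳ H x y ≡ false → adjᴳ H x y ≡ false
    go (inj₁ t) = ⊥-elim (TFᴳ⇒ H tf u x y hx t hy)
    go (inj₂ f) = f

  sq : ∀ {n} → Gr n → Subset n → ℕ
  sq []ᴳ B = 0
  sq (I ◂ H) B = hit I (tail B) ℕ.* hit I (tail B) ℕ.+ sq H (tail B)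

  drift≤ : ∀ {n γ} (H : Gr n) B → 0ℚ ≤ γ → 2ℚ * (γ * ι (sq H B)) ≤ 1ℚ → drift γ H B ≤ 1ℚ + 2ℚ * (γ * ι (sq H B))
  drift≤ {γ = γ} []ᴳ B hγ q = ≤⁺ (nn* 0≤2 (nn* hγ ≤-refl)) refl
  drift≤ {γ = γ} (I ◂ H) B hγ q = begin
    (1ℚ + γ * (j * j)) * drift γ H (tail B)     ≤⟨ *-monoˡ (nn+ 0≤1 a≥0) (drift≤ H (tail B) hγ q') ⟩
    (1ℚ + γ * (j * j)) * (1ℚ + 2ℚ * (γ * S))    ≤⟨ ≤⁺ (nn* a≥0 (p≤q⇒0≤q-p q')) (e γ (j * j) S) ⟩
    1ℚ + 2ℚ * (γ * (j * j + S))                 ≡⟨ cong (λ z → 1ℚ + 2ℚ * (γ * z)) (sym eq) ⟩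
    1ℚ + 2ℚ * (γ * ι (sq (I ◂ H) B)) ∎
    where
    open ≤-Reasoning
    j S : ℚ
    j = ι (hit I (tail B))
    S = ι (sq H (tail B))
    jj≥0 : 0ℚ ≤ j * j
    jj≥0 = nn* (ι≥0 (hit I (tail B))) (ι≥0 (hit I (tail B)))
    a≥0 : 0ℚ ≤ γ * (j * j)
    a≥0 = nn* hγ jj≥0
    eq : ι (sq (I ◂ H) B) ≡ j * j + S
    eq = trans (ι-+ (hit I (tail B) ℕ.* hit I (tail B)) (sq H (tail B))) (cong (_+ S) (ι-* (hit I (tail B)) (hit I (tail B))))
    q' : 2ℚ * (γ * S) ≤ 1ℚ
    q' = ≤-trans (*-monoˡ 0≤2 (*-monoˡ hγ (≤-trans (≤⁺ jj≥0 (+-comm (j * j) S)) (≤-reflexive (sym eq))))) q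
    e : ∀ g a s → 1ℚ + 2ℚ * (g * (a + s)) ≡ (1ℚ + g * a) * (1ℚ + 2ℚ * (g * s)) + g * a * (1ℚ - 2ℚ * (g * s))
    e = solve-∀ ringℚ

  heavy : ∀ {n} → ℕ → Gr n → Subset n → ℕ
  heavy t []ᴳ B = 0
  heavy t (I ◂ H) B = (if t ℕ.≤ᵇ hit I (tail B) then hit I (tail B) else 0) ℕ.+ heavy t H (tail B)

  -- A vertex with at most `t` hits contributes at most `t²`; any other contributes at most `s`
  -- times its hits.
  sq≤ : ∀ {n} t s (H : Gr n) B → count B ℕ.≤ s → sq H B ℕ.≤ n ℕ.* (t ℕ.* t) ℕ.+ s ℕ.* heavy t H B
  sq≤ t s []ᴳ B hs = ℕ.z≤n
  sq≤ {suc n} t s (I ◂ H) B hs = ℕₚ.≤-trans (ℕₚ.+-mono-≤ pt (sq≤ t s H (tail B) hs')) (ℕₚ.≤-reflexive (rearr (t ℕ.* t) s x (n ℕ.* (t ℕ.* t)) (heavy t H (tail B))))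
    where
    j x : ℕ
    j = hit I (tail B)
    x = if t ℕ.≤ᵇ j then j else 0
    hs' = ℕₚ.≤-trans (count-tail B) hs
    j≤s : j ℕ.≤ s
    j≤s = ℕₚ.≤-trans (hit≤count I (tail B)) hs'
    go : ∀ b → (t ℕ.≤ᵇ j) ≡ b → j ℕ.* j ℕ.≤ t ℕ.* t ℕ.+ s ℕ.* (if b then j else 0)
    go true _ = ℕₚ.≤-trans (ℕₚ.*-monoˡ-≤ j j≤s) (ℕₚ.m≤n+m (s ℕ.* j) (t ℕ.* t))
    go false e = ℕₚ.≤-trans (ℕₚ.*-mono-≤ lt lt) (ℕₚ.m≤m+n (t ℕ.* t) (s ℕ.* 0))
      where lt : j ℕ.≤ t
            lt = ℕₚ.<⇒≤ (ℕₚ.≰⇒> (λ q → true≢false (Data.Bool.Properties.T-≡ .Function.Bundles.Equivalence.to (ℕₚ.≤⇒≤ᵇ q)) e))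
              where import Data.Bool.Properties
                    import Function.Bundles
    pt : j ℕ.* j ℕ.≤ t ℕ.* t ℕ.+ s ℕ.* x
    pt = go (t ℕ.≤ᵇ j) refl
    rearr : ∀ a s x b y → a ℕ.+ s ℕ.* x ℕ.+ (b ℕ.+ s ℕ.* y) ≡ a ℕ.+ b ℕ.+ s ℕ.* (x ℕ.+ y)
    rearr = R.solve-∀
      where import Data.Nat.Tactic.RingSolver as R

  -- The parameters of a random triangle-free graph on n vertices without independent sets of size s:
  -- a new vertex is joined to at most D₁ older ones and later to at most D₂ newer ones, and k bounds the codegrees.
  -- The independent set joined to a new vertex comes from initial weights ε and weights capped at ω;
  -- ℓ₁ and ℓ₂ scale the two potentials.
  record Params : Set where
    field
      n s k D₁ D₂ λ₂ h' : ℕ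
      ε ω M γ η σ ℓ₁ ℓ₂ : ℚ
    h : ℕ
    h = suc h'
    D : ℕ
    D = D₁ ℕ.+ D₂
    θ : ℚ
    θ = 2ℚ * ι h
    P : ℚ
    P = (1ℚ + θ * ε) ^ D
    b₂ : ℚ
    b₂ = 2ℚ * (ℓ₂ * (2ℚ * (1ℚ + 1ℚ * ε) ^ s + 1ℚ))

  record Valid (Par : Params) : Set where
    open Params Par
    field
      n>0 : 0 ℕ.< n
      ε>0 : 0ℚ < ε
      ε≤1 : ε ≤ 1ℚ
      M≥0 : 0ℚ ≤ M
      ω≡ : ω ≡ ε * M
      θω≤1 : 2ℚ * (ι h * ω) ≤ 1ℚ
      4ω≤1 : 4ℚ * ω ≤ 1ℚ
      2ω³≤γ : 2ℚ * (ω * (ω * ω)) ≤ γ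
      Mω³≤γ : M * (ω * (ω * ω)) ≤ γ
      4ω²s≤1 : 4ℚ * (ω * (ω * ι s)) ≤ 1ℚ
      η≥0 : 0ℚ ≤ η
      η-small : 4ℚ * (ω * (θ * ω * ι k)) ≤ 1ℚ
      η-def : 2ℚ * ω * ((θ * ω * ι k) * (θ * ω * ι k)) ≤ η
      σ≥0 : 0ℚ ≤ σ
      σ-def : σ * (1ℚ + - 1ℚ * ε) ≡ 1ℚ
      ℓ₁>0 : 0ℚ < ℓ₁
      ℓ₂>0 : 0ℚ < ℓ₂
      ℓ₂-def : ℓ₂ * 2ℚ ^ λ₂ ≡ 1ℚ
      growth₁ : ι n * (ι 11 * (4ℚ * ℓ₁)) ≤ 1ℚ
      growth₂ : ι n * (ι 11 * b₂) ≤ 1ℚ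
      D₁-def : ι 11 * (ε * ι n) ≤ ι D₁
      D₂-def : ι (suc n) * (1ℚ + ι 11 * ε) ^ n ≤ 2ℚ ^ D₂
      -- Neighbourhoods serve as test sets in the codegree estimate, so they must respect the size
      -- bound of the potentials.
      D≤s : D ℕ.≤ s
      -- The initial sum of `T` is at most `n ε^h P` and the threshold is `(ε M)^h`; with `η-total`
      -- the lost mass is at most one half.
      mass-def : 4ℚ * (ι n * P) ≤ M ^ h
      η-total : (1ℚ + η) ^ n ≤ 2ℚ
      k-def : ι 11 * (ι n * (2ℚ * P)) ≤ 2ℚ ^ k
      -- This is `sq≤` with `t = 2 λ₂` and the bound `2 + 2 λ₂ s` on the heavy hits; it keeps the
      -- drift below 2.
      sq-def : 2ℚ * (γ * ι (n ℕ.* (2 ℕ.* λ₂ ℕ.* (2 ℕ.* λ₂)) ℕ.+ s ℕ.* (2 ℕ.+ 2 ℕ.* (λ₂ ℕ.* s)))) ≤ 1ℚ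

  module Construction (Par : Params) (val : Valid Par) where
    open Params Par
    open Valid val
    private
      module R = Random ε ω M h' ε>0 M≥0 ω≡ θω≤1 4ω≤1
      module Te = R.Tests γ 2ω³≤γ Mω³≤γ s 4ω²s≤1
      module Ma = R.Mass k η η≥0 η-small η-def

    ε≥0 : 0ℚ ≤ ε
    ε≥0 = <⇒≤ ε>0

    -- Here `σ = 1 / (1 - ε)`: the factor `σ ^ c` offsets the probability, at most `2 (1 - ε)^c`,
    -- that the new neighbourhood misses a given independent set of size `c`. So the potential grows
    -- by a multiple of `ℓ₁` per vertex.
    module Q₁ = Potential s (λ c → ℓ₁ * σ ^ c) (λ _ _ → 1ℚ) (λ c → nn* (<⇒≤ ℓ₁>0) (^-nn c σ≥0)) (λ _ _ → 0≤1) (λ I h → refl)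

    two-nn : ∀ {n} (I B : Subset n) → 0ℚ ≤ two I B
    two-nn I B = subst (0ℚ ≤_) (sym (two-hit I B)) (^-nn (hit I B) 0≤2)

    -- Multiplied out, this potential is the sum of `ℓ₂^(|A| + |B|) 2^e` over independent `B` of
    -- size at most `s` and `A` disjoint from `B`, where `e` counts the edges from a vertex of `A`
    -- to an older vertex of `B`.
    module Q₂ = Potential s (λ _ → ℓ₂) (λ I B → 1ℚ + ℓ₂ * two I B) (λ _ → <⇒≤ ℓ₂>0) (λ I B → nn+ 0≤1 (nn* (<⇒≤ ℓ₂>0) (two-nn I B)))
      (λ I h → cong (λ z → 1ℚ + ℓ₂ * z) (wt-ext 1ℚ (λ x → [ I x ]) h))

    Λ : ℚ
    Λ = 2ℚ ^ λ₂

    -- A vertex outside `B` with `j ≥ 2 λ₂` hits has the factor `1 + ℓ₂ 2^j`, whose square is at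
    -- least `ℓ₂² 2^(2 j) ≥ 2^j`; hence the square on the right. Vertices of `B` have no hits, and
    -- `Λ` cancels their `ℓ₂`.
    heavy-bound : ∀ {v} (H : Gr v) B → Indep (graph H) B → count B ℕ.≤ s → 2ℚ ^ heavy (2 ℕ.* λ₂) H B ≤ (Q₂.Ψ H B * Λ ^ count B) * (Q₂.Ψ H B * Λ ^ count B)
    heavy-bound []ᴳ B ind c = ≤-reflexive refl
    heavy-bound (I ◂ H) B ind c = cases (B zero) refl
      where
      open ≤-Reasoning
      t j y : ℕ
      t = 2 ℕ.* λ₂
      j = hit I (tail B)
      y = heavy t H (tail B)
      x : Bool → ℕ
      x b = if b then j else 0
      X Ψ′ : ℚ
      Ψ′ = Q₂.Ψ H (tail B)
      X = Ψ′ * Λ ^ count (tail B)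
      c' = ℕₚ.≤-trans (count-tail B) c
      ih : 2ℚ ^ y ≤ X * X
      ih = heavy-bound H (tail B) (λ a b p q → ind (suc a) (suc b) p q) c'
      XX≥0 : 0ℚ ≤ X * X
      XX≥0 = nn* X≥0 X≥0
        where X≥0 : 0ℚ ≤ X
              X≥0 = nn* (Q₂.Ψ≥0 H (tail B)) (^-nn (count (tail B)) (^-nn λ₂ 0≤2))
      ℓ2j : ℚ
      ℓ2j = ℓ₂ * 2ℚ ^ j
      ℓ2j≥0 : 0ℚ ≤ ℓ2j
      ℓ2j≥0 = nn* (<⇒≤ ℓ₂>0) (^-nn j 0≤2)
      e₁ : ∀ l a → (l * a) * (l * a) ≡ l * l * a * a
      e₁ = solve-∀ ringℚ
      e₂ : ∀ l a → 1ℚ + l * (a + a) + (l * a) * (l * a) ≡ (1ℚ + l * a) * (1ℚ + l * a)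
      e₂ = solve-∀ ringℚ
      e₃ : ∀ l → l * l ≡ 0ℚ + l * l
      e₃ = solve-∀ ringℚ
      2^j≥ : ∀ b → (t ℕ.≤ᵇ j) ≡ b → 2ℚ ^ x b ≤ (1ℚ + ℓ2j) * (1ℚ + ℓ2j)
      2^j≥ false _ = ≤-trans (≤⁺ ℓ2j≥0 refl) (≤-trans (≤-reflexive (sym (*-identityʳ (1ℚ + ℓ2j)))) (*-monoˡ (nn+ 0≤1 ℓ2j≥0) (1≤1+ ℓ2j≥0)))
      2^j≥ true e = begin
        2ℚ ^ j                                    ≡⟨ sym (*-identityˡ (2ℚ ^ j)) ⟩
        1ℚ * 2ℚ ^ j                               ≡⟨ cong (_* 2ℚ ^ j) (sym (trans (cong₂ _*_ ℓ₂-def ℓ₂-def) refl)) ⟩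
        ℓ₂ * Λ * (ℓ₂ * Λ) * 2ℚ ^ j                ≡⟨ e₄ ℓ₂ Λ (2ℚ ^ j) ⟩
        ℓ₂ * ℓ₂ * (Λ * Λ) * 2ℚ ^ j                ≤⟨ *-monoʳ (^-nn j 0≤2) (*-monoˡ (nn* (<⇒≤ ℓ₂>0) (<⇒≤ ℓ₂>0)) ΛΛ≤) ⟩
        ℓ₂ * ℓ₂ * 2ℚ ^ j * 2ℚ ^ j                 ≡⟨ sym (e₁ ℓ₂ (2ℚ ^ j)) ⟩
        ℓ2j * ℓ2j                                 ≤⟨ *-mono ℓ2j≥0 (nn+ 0≤1 ℓ2j≥0) (≤⁺ 0≤1 (+-comm 1ℚ ℓ2j)) (≤⁺ 0≤1 (+-comm 1ℚ ℓ2j)) ⟩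
        (1ℚ + ℓ2j) * (1ℚ + ℓ2j) ∎
        where
        e₄ : ∀ l a b → l * a * (l * a) * b ≡ l * l * (a * a) * b
        e₄ = solve-∀ ringℚ
        t≤j : t ℕ.≤ j
        t≤j = ℕₚ.≤ᵇ⇒≤ t j (subst T (sym e) tt)
        ΛΛ≤ : Λ * Λ ≤ 2ℚ ^ j
        ΛΛ≤ = ≤-trans (≤-reflexive (trans (sym (^-+ 2ℚ λ₂ λ₂)) (cong (λ z → 2ℚ ^ (λ₂ ℕ.+ z)) (sym (ℕₚ.+-identityʳ λ₂))))) (^-monoʳ 1≤2 t≤j)
      e₅ : ∀ a c w → (a * (1ℚ + c) * w) * (a * (1ℚ + c) * w) ≡ (1ℚ + c) * (1ℚ + c) * ((a * w) * (a * w))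
      e₅ = solve-∀ ringℚ
      e₆ : ∀ a l L w → a * l * (L * w) ≡ l * L * (a * w)
      e₆ = solve-∀ ringℚ
      cases : ∀ b → B zero ≡ b → 2ℚ ^ (x (t ℕ.≤ᵇ j) ℕ.+ y) ≤ (Q₂.Ψ (I ◂ H) B * Λ ^ count B) * (Q₂.Ψ (I ◂ H) B * Λ ^ count B)
      cases false hb = begin
        2ℚ ^ (x (t ℕ.≤ᵇ j) ℕ.+ y)                 ≡⟨ ^-+ 2ℚ (x (t ℕ.≤ᵇ j)) y ⟩
        2ℚ ^ x (t ℕ.≤ᵇ j) * 2ℚ ^ y                ≤⟨ *-mono (^-nn (x (t ℕ.≤ᵇ j)) 0≤2) XX≥0 (2^j≥ (t ℕ.≤ᵇ j) refl) ih ⟩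
        (1ℚ + ℓ2j) * (1ℚ + ℓ2j) * (X * X)         ≡⟨ sym (e₅ Ψ′ ℓ2j (Λ ^ count (tail B))) ⟩
        (Ψ′ * (1ℚ + ℓ2j) * Λ ^ count (tail B)) * (Ψ′ * (1ℚ + ℓ2j) * Λ ^ count (tail B)) ≡⟨ cong (λ z → z * z) (sym eq) ⟩
        (Q₂.Ψ (I ◂ H) B * Λ ^ count B) * (Q₂.Ψ (I ◂ H) B * Λ ^ count B) ∎
        where
        eq : Q₂.Ψ (I ◂ H) B * Λ ^ count B ≡ Ψ′ * (1ℚ + ℓ2j) * Λ ^ count (tail B)
        eq = cong₂ _*_ (trans (Q₂.Ψ-false I H B hb) (cong (λ z → Ψ′ * (1ℚ + ℓ₂ * z)) (two-hit I (tail B)))) (cong (Λ ^_) (count-cons B false hb))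
      cases true hb = begin
        2ℚ ^ (x (t ℕ.≤ᵇ j) ℕ.+ y)                 ≡⟨ cong (λ z → 2ℚ ^ (z ℕ.+ y)) (trans (cong (λ z → if t ℕ.≤ᵇ z then z else 0) j≡0) (0-if (t ℕ.≤ᵇ 0))) ⟩
        2ℚ ^ y                                    ≤⟨ ih ⟩
        X * X                                     ≡⟨ cong (λ z → z * z) (sym eq) ⟩
        (Q₂.Ψ (I ◂ H) B * Λ ^ count B) * (Q₂.Ψ (I ◂ H) B * Λ ^ count B) ∎
        where
        0-if : ∀ b → (if b then 0 else 0) ≡ 0
        0-if true = refl
        0-if false = refl
        j≡0 : j ≡ 0
        j≡0 = hit≡0 I (tail B) (λ z p q → true≢false p (ind zero (suc z) hb q))
        eq : Q₂.Ψ (I ◂ H) B * Λ ^ count B ≡ X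
        eq = trans (cong₂ _*_ (Q₂.Ψ-true I H B hb ind c) (cong (Λ ^_) (count-cons B true hb)))
          (trans (e₆ Ψ′ ℓ₂ Λ (Λ ^ count (tail B))) (trans (cong (_* X) ℓ₂-def) (*-identityˡ X)))

    -- An exponential moment, so that a bound on it limits the largest number of newer neighbours.
    Φ₃ : ∀ {v} → Gr v → ℚ
    Φ₃ H = sum (λ u → 2ℚ ^ rdeg H u)

    g₁ g₂ y : ℚ
    g₁ = ι 11 * (4ℚ * ℓ₁)
    g₂ = ι 11 * b₂
    y = 1ℚ + ι 11 * ε

    record Fine {v} (H : Gr v) : Set where
      field
        tf : TFᴳ H
        cod : Codeg k H
        left : Left D₁ H
        φ₁ : Q₁.Φ H ≤ 1ℚ + ι v * g₁
        φ₂ : Q₂.Φ H ≤ 1ℚ + ι v * g₂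
        -- The summand `1ℚ` keeps the corresponding bound in `markov` positive for the empty graph.
        φ₃ : 1ℚ + Φ₃ H ≤ ι (suc v) * y ^ v

    y≥1 : 1ℚ ≤ y
    y≥1 = 1≤1+ (nn* (ι≥0 11) ε≥0)

    θε≥0 : 0ℚ ≤ θ * ε
    θε≥0 = nn* (nn* 0≤2 (ι≥0 h)) ε≥0

    P≥1 : 1ℚ ≤ P
    P≥1 = ^-≥1 D (1≤1+ θε≥0)

    P≥0 : 0ℚ ≤ P
    P≥0 = ≤-trans 0≤1 P≥1

    b₂>0 : 0ℚ < b₂
    b₂>0 = pos* 0<2 (pos* ℓ₂>0 (<-≤-trans 0<1 (≤⁺ (nn* 0≤2 (^-nn s (nn+ 0≤1 (nn* 0≤1 ε≥0)))) (+-comm (2ℚ * (1ℚ + 1ℚ * ε) ^ s) 1ℚ))))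

    g₁≥0 : 0ℚ ≤ g₁
    g₁≥0 = nn* (ι≥0 11) (nn* 0≤4 (<⇒≤ ℓ₁>0))

    g₂≥0 : 0ℚ ≤ g₂
    g₂≥0 = nn* (ι≥0 11) (<⇒≤ b₂>0)

    φ≤2 : ∀ {v z g} → v ℕ.≤ n → 0ℚ ≤ g → ι n * g ≤ 1ℚ → z ≤ 1ℚ + ι v * g → z ≤ 2ℚ
    φ≤2 hv hg hn h = ≤-trans h (+-monoʳ-≤ 1ℚ (≤-trans (*-monoʳ hg (ι-mono hv)) hn))

    module Consequences {v} (v≤n : v ℕ.≤ n) (H : Gr v) (F : Fine H) where
      open Fine F
      open ≤-Reasoning

      Φ₁≤2 : Q₁.Φ H ≤ 2ℚ
      Φ₁≤2 = φ≤2 v≤n g₁≥0 growth₁ φ₁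

      Φ₂≤2 : Q₂.Φ H ≤ 2ℚ
      Φ₂≤2 = φ≤2 v≤n g₂≥0 growth₂ φ₂

      Φ₃≥0 : 0ℚ ≤ Φ₃ H
      Φ₃≥0 = sum-nn (λ u → ^-nn (rdeg H u) 0≤2)

      rdeg≤ : ∀ u → rdeg H u ℕ.≤ D₂
      rdeg≤ u = 2^-cancel (begin
        2ℚ ^ rdeg H u        ≤⟨ term≤sum (λ x → ^-nn (rdeg H x) 0≤2) u ⟩
        Φ₃ H                 ≤⟨ ≤⁺ 0≤1 (+-comm 1ℚ (Φ₃ H)) ⟩
        1ℚ + Φ₃ H            ≤⟨ φ₃ ⟩
        ι (suc v) * y ^ v    ≤⟨ *-mono (ι≥0 (suc v)) (^-nn n (≤-trans 0≤1 y≥1)) (ι-mono (ℕ.s≤s v≤n)) (^-monoʳ y≥1 v≤n) ⟩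
        ι (suc n) * y ^ n    ≤⟨ D₂-def ⟩
        2ℚ ^ D₂ ∎)

      deg≤D : ∀ u → count (adjᴳ H u) ℕ.≤ D
      deg≤D u = ℕₚ.≤-trans (degree≤ D₁ H left u) (ℕₚ.+-monoʳ-≤ D₁ (rdeg≤ u))

      -- The point where the second potential supports the expectations: its bound gives
      -- `2^heavy ≤ (2 · 2^(λ₂ s))²`, hence few heavy hits, a small sum of squares and a small
      -- drift. These expectations in turn bound the growth of both potentials.
      drift≤2 : ∀ B → Indep (graph H) B → count B ℕ.≤ s → drift γ H B ≤ 2ℚ
      drift≤2 B ind c = ≤-trans (drift≤ H B Te.γ≥0 sq-small) (+-monoʳ-≤ 1ℚ sq-small)
        where
        t = 2 ℕ.* λ₂
        X : ℚ
        X = Q₂.Ψ H B * Λ ^ count B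
        X≤ : X ≤ 2ℚ ^ suc (λ₂ ℕ.* s)
        X≤ = *-mono (Q₂.Ψ≥0 H B) (^-nn (λ₂ ℕ.* s) 0≤2) (≤-trans (Q₂.Ψ≤Φ H B) Φ₂≤2)
          (≤-trans (≤-reflexive (sym (^-^ 2ℚ (count B) λ₂))) (^-monoʳ 1≤2 (ℕₚ.≤-trans (ℕₚ.*-monoˡ-≤ λ₂ c) (ℕₚ.≤-reflexive (ℕₚ.*-comm s λ₂)))))
        X≥0 : 0ℚ ≤ X
        X≥0 = nn* (Q₂.Ψ≥0 H B) (^-nn (count B) (^-nn λ₂ 0≤2))
        heavy≤ : heavy t H B ℕ.≤ 2 ℕ.+ 2 ℕ.* (λ₂ ℕ.* s)
        heavy≤ = 2^-cancel (begin
          2ℚ ^ heavy t H B                                   ≤⟨ heavy-bound H B ind c ⟩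
          X * X                                              ≤⟨ *-mono X≥0 (^-nn (suc (λ₂ ℕ.* s)) 0≤2) X≤ X≤ ⟩
          2ℚ ^ suc (λ₂ ℕ.* s) * 2ℚ ^ suc (λ₂ ℕ.* s)          ≡⟨ sym (^-+ 2ℚ (suc (λ₂ ℕ.* s)) (suc (λ₂ ℕ.* s))) ⟩
          2ℚ ^ (suc (λ₂ ℕ.* s) ℕ.+ suc (λ₂ ℕ.* s))           ≡⟨ cong (2ℚ ^_) (arith (λ₂ ℕ.* s)) ⟩
          2ℚ ^ (2 ℕ.+ 2 ℕ.* (λ₂ ℕ.* s)) ∎)
          where
          arith : ∀ z → suc z ℕ.+ suc z ≡ 2 ℕ.+ 2 ℕ.* z
          arith = NR.solve-∀
            where import Data.Nat.Tactic.RingSolver as NR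
        sq-small : 2ℚ * (γ * ι (sq H B)) ≤ 1ℚ
        sq-small = ≤-trans (*-monoˡ 0≤2 (*-monoˡ Te.γ≥0 (ι-mono (ℕₚ.≤-trans (sq≤ t s H B c)
          (ℕₚ.+-mono-≤ (ℕₚ.*-monoˡ-≤ (t ℕ.* t) v≤n) (ℕₚ.*-monoʳ-≤ s heavy≤)))))) sq-def

      w : Fin v → ℚ
      w _ = ε

      inv-w : R.Inv w
      inv-w = record { nn = λ _ → ε≥0 ; ≤1 = λ _ → ε≤1 ; live = λ _ → inj₂ ≤-refl }

      μ : Meas v
      μ = R.run H w

      supp : Supp (R.Within H w) μ
      supp = R.supp-run H w inv-w

      𝔼-two : ∀ B → Indep (graph H) B → count B ℕ.≤ s → 𝔼 μ (λ I → two I B) ≤ (1ℚ + 1ℚ * ε) ^ count B * 2ℚ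
      𝔼-two B ind c = ≤-trans (Te.E⁺.expect H w B inv-w c ind) (≤-trans (≤-reflexive (cong (_* drift γ H B) (wt-const 1ℚ B ε)))
        (*-monoˡ (^-nn (count B) (nn+ 0≤1 (nn* 0≤1 ε≥0))) (drift≤2 B ind c)))

      𝔼-dis : ∀ B → Indep (graph H) B → count B ℕ.≤ s → 𝔼 μ (λ I → dis I B) ≤ (1ℚ + - 1ℚ * ε) ^ count B * 2ℚ
      𝔼-dis B ind c = ≤-trans (Te.E⁻.expect H w B inv-w c ind) (≤-trans (≤-reflexive (cong (_* drift γ H B) (wt-const (- 1ℚ) B ε)))
        (*-monoˡ (^-nn (count B) (1+-p≥0 ε≤1)) (drift≤2 B ind c)))

      𝔼-dis≤1 : ∀ B → 𝔼 μ (λ I → dis I B) ≤ 1ℚ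
      𝔼-dis≤1 B = ≤-trans (𝔼-mono supp (λ I → dis≤1 I B)) (R.mass≤1 H w inv-w)

      total≤ : Ma.total H w ≤ ι n * (ε ^ h * P)
      total≤ = ≤-trans (sum-mono (λ u → *-monoˡ (^-nn h ε≥0) (≤-trans (≤-reflexive (wt-const θ (adjᴳ H u) ε)) (^-monoʳ (1≤1+ θε≥0) (deg≤D u)))))
        (≤-trans (≤-reflexive (sum-const v (ε ^ h * P))) (*-monoʳ (nn* (^-nn h ε≥0) P≥0) (ι-mono v≤n)))

      mass≥½ : 1ℚ ≤ 2ℚ * mass μ
      mass≥½ = *-cancelˡ β>0 (begin
        β * 1ℚ                                             ≡⟨ e₁ β ⟩
        2ℚ * β - β                                         ≤⟨ +-monoˡ-≤ (- β) (*-monoˡ 0≤2 main) ⟩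
        2ℚ * (2ℚ * (ι n * (ε ^ h * P)) + β * mass μ) - β   ≡⟨ e₂ (ι n) (ε ^ h) P β (mass μ) ⟩
        (ε ^ h * (4ℚ * (ι n * P)) - β) + β * (2ℚ * mass μ) ≤⟨ +-monoˡ-≤ _ (+-monoˡ-≤ (- β) (≤-trans (*-monoˡ (^-nn h ε≥0) mass-def) (≤-reflexive (sym β≡)))) ⟩
        (β - β) + β * (2ℚ * mass μ)                        ≡⟨ e₃ β (β * (2ℚ * mass μ)) ⟩
        β * (2ℚ * mass μ) ∎)
        where
        β = ω ^ h
        β≡ : β ≡ ε ^ h * M ^ h
        β≡ = trans (cong (_^ h) ω≡) (^-* ε M h)
        β>0 : 0ℚ < β
        β>0 = subst (0ℚ <_) (sym β≡) (pos* (^-pos h ε>0) (<-≤-trans (pos* (0<4) (pos* (ι>0 n>0) (<-≤-trans 0<1 P≥1))) mass-def))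
        main : β ≤ 2ℚ * (ι n * (ε ^ h * P)) + β * mass μ
        main = ≤-trans (Ma.mass-run H w inv-w tf cod) (+-monoˡ-≤ (β * mass μ) (*-mono (^-nn v (nn+ 0≤1 η≥0)) (nn* (ι≥0 n) (nn* (^-nn h ε≥0) P≥0))
          (≤-trans (^-monoʳ (1≤1+ η≥0) v≤n) η-total) total≤))
        e₁ : ∀ b → b * 1ℚ ≡ 2ℚ * b - b
        e₁ = solve-∀ ringℚ
        e₂ : ∀ n x P b m → 2ℚ * (2ℚ * (n * (x * P)) + b * m) - b ≡ (x * (4ℚ * (n * P)) - b) + b * (2ℚ * m)
        e₂ = solve-∀ ringℚ
        e₃ : ∀ b z → (b - b) + z ≡ z
        e₃ = solve-∀ ringℚ

      -- The demands on the next neighbourhood: small increments of the three potentials, few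
      -- vertices, and small codegrees with all older vertices.
      f : Fin 5 → Subset v → ℚ
      f zero I = Q₁.inc H I
      f (suc zero) I = sumS (λ B → Q₂.Ψ H B * (ℓ₂ * two I B)) + Q₂.inc H I
      f (suc (suc zero)) I = sum (λ u → 2ℚ ^ rdeg H u * [ I u ])
      f (suc (suc (suc zero))) I = size I
      f (suc (suc (suc (suc zero)))) I = sum (λ u → two I (adjᴳ H u))

      b : Fin 5 → ℚ
      b zero = 4ℚ * ℓ₁
      b (suc zero) = b₂
      b (suc (suc zero)) = ε * (1ℚ + Φ₃ H)
      b (suc (suc (suc zero))) = ε * ι n
      b (suc (suc (suc (suc zero)))) = ι n * (2ℚ * P)

      b>0 : ∀ i → 0ℚ < b i
      b>0 zero = pos* (0<4) ℓ₁>0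
      b>0 (suc zero) = b₂>0
      b>0 (suc (suc zero)) = pos* ε>0 (<-≤-trans 0<1 (≤⁺ Φ₃≥0 refl))
      b>0 (suc (suc (suc zero))) = pos* ε>0 (ι>0 n>0)
      b>0 (suc (suc (suc (suc zero)))) = pos* (ι>0 n>0) (pos* 0<2 (<-≤-trans 0<1 P≥1))

      f≥0 : ∀ i I → 0ℚ ≤ f i I
      f≥0 zero I = sumS-nn (λ B → nn* (Q₁.Ψ≥0 H B) (nn* (dis-nn I B) (nn* (below-nn s B) (nn* (<⇒≤ ℓ₁>0) (^-nn (count B) σ≥0)))))
      f≥0 (suc zero) I = nn+ (sumS-nn (λ B → nn* (Q₂.Ψ≥0 H B) (nn* (<⇒≤ ℓ₂>0) (two-nn I B)))) (sumS-nn (λ B → nn* (Q₂.Ψ≥0 H B) (nn* (dis-nn I B) (nn* (below-nn s B) (<⇒≤ ℓ₂>0)))))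
      f≥0 (suc (suc zero)) I = sum-nn (λ u → nn* (^-nn (rdeg H u) 0≤2) ([]≥0 (I u)))
      f≥0 (suc (suc (suc zero))) I = sum-nn (λ u → []≥0 (I u))
      f≥0 (suc (suc (suc (suc zero)))) I = sum-nn (λ u → two-nn I (adjᴳ H u))

      -- Only independent sets of size at most s contribute to the potentials.
      potential-step : ∀ {Ψ : Subset v → ℚ} (g : Subset v → Subset v → ℚ) c → (∀ B → 0ℚ ≤ Ψ B) → (∀ B → Ψ B ≡ 0ℚ ⊎ (Indep (graph H) B × count B ℕ.≤ s)) →
        (∀ B → Indep (graph H) B → count B ℕ.≤ s → 𝔼 μ (λ I → g I B) ≤ c) → 𝔼 μ (λ I → sumS (λ B → Ψ B * g I B)) ≤ c * sumS Ψ
      potential-step {Ψ} g c Ψ≥0 cases hg = ≤-trans (≤-reflexive (𝔼-sumS μ (λ B I → Ψ B * g I B))) (≤-trans (sumS-mono (λ B → ≤-trans (≤-reflexive (𝔼-* μ (Ψ B) (λ I → g I B))) (pt B (cases B)))) (≤-reflexive (sumS-* c Ψ)))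
        where
        pt : ∀ B → Ψ B ≡ 0ℚ ⊎ (Indep (graph H) B × count B ℕ.≤ s) → Ψ B * 𝔼 μ (λ I → g I B) ≤ c * Ψ B
        pt B (inj₁ z) = ≤-reflexive (trans (cong (_* 𝔼 μ (λ I → g I B)) z) (trans (*-zeroˡ (𝔼 μ (λ I → g I B))) (sym (trans (cong (c *_) z) (*-zeroʳ c)))))
        pt B (inj₂ (ind , k)) = ≤-trans (*-monoˡ (Ψ≥0 B) (hg B ind k)) (≤-reflexive (*-comm (Ψ B) c))

      σε : ∀ c → (1ℚ + - 1ℚ * ε) ^ c * σ ^ c ≡ 1ℚ
      σε c = trans (sym (^-* (1ℚ + - 1ℚ * ε) σ c)) (trans (cong (_^ c) (trans (*-comm (1ℚ + - 1ℚ * ε) σ) σ-def)) (1^ c))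

      𝔼f : ∀ i → 𝔼 μ (f i) ≤ b i
      𝔼f zero = ≤-trans (potential-step (λ I B → dis I B * (below s B * (ℓ₁ * σ ^ count B))) (2ℚ * ℓ₁) (Q₁.Ψ≥0 H) (Q₁.Ψ-cases H) bound)
        (≤-trans (*-monoˡ (nn* 0≤2 (<⇒≤ ℓ₁>0)) Φ₁≤2) (≤-reflexive (e ℓ₁)))
        where
        e : ∀ l → 2ℚ * l * 2ℚ ≡ 4ℚ * l
        e = solve-∀ ringℚ
        e₁ : ∀ x l z → x * 2ℚ * (1ℚ * (l * z)) ≡ 2ℚ * l * (x * z)
        e₁ = solve-∀ ringℚ
        bound : ∀ B → Indep (graph H) B → count B ℕ.≤ s → 𝔼 μ (λ I → dis I B * (below s B * (ℓ₁ * σ ^ count B))) ≤ 2ℚ * ℓ₁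
        bound B ind c = begin
          𝔼 μ (λ I → dis I B * X)                                     ≡⟨ trans (𝔼-cong μ (λ I → *-comm (dis I B) X)) (trans (𝔼-* μ X (λ I → dis I B)) (*-comm X _)) ⟩
          𝔼 μ (λ I → dis I B) * X                                     ≤⟨ *-mono (𝔼-nn supp (λ I → dis-nn I B)) (nn* 0≤1 t≥0) (𝔼-dis B ind c) (*-monoʳ t≥0 (below≤1 s B)) ⟩
          (1ℚ + - 1ℚ * ε) ^ count B * 2ℚ * (1ℚ * (ℓ₁ * σ ^ count B))  ≡⟨ e₁ ((1ℚ + - 1ℚ * ε) ^ count B) ℓ₁ (σ ^ count B) ⟩
          2ℚ * ℓ₁ * ((1ℚ + - 1ℚ * ε) ^ count B * σ ^ count B)         ≡⟨ trans (cong (2ℚ * ℓ₁ *_) (σε (count B))) (*-identityʳ (2ℚ * ℓ₁)) ⟩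
          2ℚ * ℓ₁ ∎
          where
          X = below s B * (ℓ₁ * σ ^ count B)
          t≥0 : 0ℚ ≤ ℓ₁ * σ ^ count B
          t≥0 = nn* (<⇒≤ ℓ₁>0) (^-nn (count B) σ≥0)
      𝔼f (suc zero) = begin
        𝔼 μ (f (suc zero))  ≡⟨ 𝔼-+ μ (λ I → sumS (λ B → Q₂.Ψ H B * (ℓ₂ * two I B))) (Q₂.inc H) ⟩
        𝔼 μ (λ I → sumS (λ B → Q₂.Ψ H B * (ℓ₂ * two I B))) + 𝔼 μ (Q₂.inc H)
          ≤⟨ +-mono-≤ (potential-step (λ I B → ℓ₂ * two I B) (ℓ₂ * (E * 2ℚ)) (Q₂.Ψ≥0 H) (Q₂.Ψ-cases H) bound₁)
                      (potential-step (λ I B → dis I B * (below s B * ℓ₂)) ℓ₂ (Q₂.Ψ≥0 H) (Q₂.Ψ-cases H) bound₂) ⟩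
        ℓ₂ * (E * 2ℚ) * Q₂.Φ H + ℓ₂ * Q₂.Φ H  ≤⟨ +-mono-≤ (*-monoˡ (nn* ℓ₂≥0 (nn* E≥0 0≤2)) Φ₂≤2) (*-monoˡ ℓ₂≥0 Φ₂≤2) ⟩
        ℓ₂ * (E * 2ℚ) * 2ℚ + ℓ₂ * 2ℚ          ≡⟨ e ℓ₂ E ⟩
        b₂ ∎
        where
        E = (1ℚ + 1ℚ * ε) ^ s
        E≥0 : 0ℚ ≤ E
        E≥0 = ^-nn s (nn+ 0≤1 (nn* 0≤1 ε≥0))
        ℓ₂≥0 = <⇒≤ ℓ₂>0
        e : ∀ l E → l * (E * 2ℚ) * 2ℚ + l * 2ℚ ≡ 2ℚ * (l * (2ℚ * E + 1ℚ))
        e = solve-∀ ringℚ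
        bound₁ : ∀ B → Indep (graph H) B → count B ℕ.≤ s → 𝔼 μ (λ I → ℓ₂ * two I B) ≤ ℓ₂ * (E * 2ℚ)
        bound₁ B ind c = ≤-trans (≤-reflexive (𝔼-* μ ℓ₂ (λ I → two I B))) (*-monoˡ ℓ₂≥0 (≤-trans (𝔼-two B ind c) (*-monoʳ 0≤2 (^-monoʳ (1≤1+ (nn* 0≤1 ε≥0)) c))))
        bound₂ : ∀ B → Indep (graph H) B → count B ℕ.≤ s → 𝔼 μ (λ I → dis I B * (below s B * ℓ₂)) ≤ ℓ₂
        bound₂ B ind c = ≤-trans (≤-reflexive (trans (𝔼-cong μ (λ I → *-comm (dis I B) (below s B * ℓ₂))) (𝔼-* μ (below s B * ℓ₂) (λ I → dis I B))))
          (≤-trans (*-mono (nn* (below-nn s B) ℓ₂≥0) 0≤1 (*-monoʳ ℓ₂≥0 (below≤1 s B)) (𝔼-dis≤1 B)) (≤-reflexive (e₂ ℓ₂)))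
          where e₂ : ∀ l → 1ℚ * l * 1ℚ ≡ l
                e₂ = solve-∀ ringℚ
      𝔼f (suc (suc zero)) = begin
        𝔼 μ (λ I → sum (λ u → 2ℚ ^ rdeg H u * [ I u ]))   ≡⟨ trans (𝔼-sum μ (λ u I → 2ℚ ^ rdeg H u * [ I u ])) (sum-cong (λ u → 𝔼-* μ (2ℚ ^ rdeg H u) (λ I → [ I u ]))) ⟩
        sum (λ u → 2ℚ ^ rdeg H u * marg μ u)              ≤⟨ sum-mono (λ u → ≤-trans (*-monoˡ (^-nn (rdeg H u) 0≤2) (R.marg-run H w inv-w u)) (≤-reflexive (*-comm (2ℚ ^ rdeg H u) ε))) ⟩
        sum (λ u → ε * 2ℚ ^ rdeg H u)                     ≡⟨ sum-* ε (λ u → 2ℚ ^ rdeg H u) ⟩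
        ε * Φ₃ H                                          ≤⟨ *-monoˡ ε≥0 (≤⁺ 0≤1 (+-comm 1ℚ (Φ₃ H))) ⟩
        ε * (1ℚ + Φ₃ H) ∎
      𝔼f (suc (suc (suc zero))) = ≤-trans (≤-reflexive (𝔼-sum μ (λ u I → [ I u ]))) (≤-trans (sum-mono (R.marg-run H w inv-w))
        (≤-trans (≤-reflexive (trans (sum-const v ε) (*-comm (ι v) ε))) (*-monoˡ ε≥0 (ι-mono v≤n))))
      𝔼f (suc (suc (suc (suc zero)))) = ≤-trans (≤-reflexive (𝔼-sum μ (λ u I → two I (adjᴳ H u)))) (≤-trans (sum-mono pt)
        (≤-trans (≤-reflexive (sum-const v (2ℚ * P))) (*-monoʳ (nn* 0≤2 P≥0) (ι-mono v≤n))))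
        where
        1ε≤θε : 1ℚ + 1ℚ * ε ≤ 1ℚ + θ * ε
        1ε≤θε = +-monoʳ-≤ 1ℚ (*-monoʳ ε≥0 (≤-trans 1≤2 (≤-trans (≤-reflexive (sym (*-identityʳ 2ℚ))) (*-monoˡ 0≤2 (≤⁺ (ι≥0 h') refl)))))
        pt : ∀ u → 𝔼 μ (λ I → two I (adjᴳ H u)) ≤ 2ℚ * P
        pt u = ≤-trans (𝔼-two (adjᴳ H u) (nbhd-indep H tf u) (ℕₚ.≤-trans (deg≤D u) D≤s)) (≤-trans (*-monoʳ 0≤2
          (≤-trans (^-monoʳ (1≤1+ (nn* 0≤1 ε≥0)) (deg≤D u)) (^-mono D (nn+ 0≤1 (nn* 0≤1 ε≥0)) 1ε≤θε))) (≤-reflexive (*-comm P 2ℚ)))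

      extend : ∃ λ I → Fine (I ◂ H)
      extend = let I , (ind , _) , bd = markov supp f b f≥0 b>0 𝔼f mass≥½ in I , record
        { tf = ind , tf
        ; cod = cod' I bd , cod
        ; left = ι-cancel (≤-trans (≤-reflexive (sym (sum-[] I))) (≤-trans (bd (suc (suc (suc zero)))) D₁-def)) , left
        ; φ₁ = ≤-trans (+-mono-≤ (≤-trans (≤-reflexive (sumS-cong (λ B → *-identityʳ (Q₁.Ψ H B)))) φ₁) (bd zero)) (≤-reflexive (e₁ (ι v) g₁))
        ; φ₂ = ≤-trans (≤-reflexive (Φ₂-step I)) (≤-trans (+-mono-≤ φ₂ (bd (suc zero))) (≤-reflexive (e₁ (ι v) g₂)))
        ; φ₃ = φ₃' I (bd (suc (suc zero)))
        }
        where
        e₁ : ∀ v g → 1ℚ + v * g + g ≡ 1ℚ + (1ℚ + v) * g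
        e₁ = solve-∀ ringℚ
        cod' : ∀ I → (∀ i → f i I ≤ ι 11 * b i) → ∀ u → hit I (adjᴳ H u) ℕ.≤ k
        cod' I bd u = 2^-cancel (begin
          2ℚ ^ hit I (adjᴳ H u)   ≡⟨ sym (two-hit I (adjᴳ H u)) ⟩
          two I (adjᴳ H u)        ≤⟨ term≤sum (λ x → two-nn I (adjᴳ H x)) u ⟩
          f (suc (suc (suc (suc zero)))) I ≤⟨ bd (suc (suc (suc (suc zero)))) ⟩
          ι 11 * (ι n * (2ℚ * P)) ≤⟨ k-def ⟩
          2ℚ ^ k ∎)
        Φ₂-step : ∀ I → Q₂.Φ (I ◂ H) ≡ Q₂.Φ H + f (suc zero) I
        Φ₂-step I = trans (cong (_+ Q₂.inc H I) (trans (sumS-cong (λ B → trans (*-distribˡ-+ (Q₂.Ψ H B) 1ℚ (ℓ₂ * two I B)) (cong (_+ Q₂.Ψ H B * (ℓ₂ * two I B)) (*-identityʳ (Q₂.Ψ H B)))))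
          (sumS-+ (Q₂.Ψ H) (λ B → Q₂.Ψ H B * (ℓ₂ * two I B))))) (+-assoc (Q₂.Φ H) _ (Q₂.inc H I))
        φ₃' : ∀ I → sum (λ u → 2ℚ ^ rdeg H u * [ I u ]) ≤ ι 11 * (ε * (1ℚ + Φ₃ H)) → 1ℚ + Φ₃ (I ◂ H) ≤ ι (suc (suc v)) * y ^ suc v
        φ₃' I bd = begin
          1ℚ + (1ℚ + sum (λ u → 2ℚ ^ ((if I u then 1 else 0) ℕ.+ rdeg H u)))  ≡⟨ cong (λ z → 1ℚ + (1ℚ + z)) (trans (sum-cong (λ u → pt (I u) (rdeg H u))) (sum-+ (λ u → 2ℚ ^ rdeg H u) (λ u → 2ℚ ^ rdeg H u * [ I u ]))) ⟩
          1ℚ + (1ℚ + (Φ₃ H + sum (λ u → 2ℚ ^ rdeg H u * [ I u ])))            ≤⟨ +-monoʳ-≤ 1ℚ (+-monoʳ-≤ 1ℚ (+-monoʳ-≤ (Φ₃ H) bd)) ⟩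
          1ℚ + (1ℚ + (Φ₃ H + ι 11 * (ε * (1ℚ + Φ₃ H))))                       ≡⟨ e₂ (Φ₃ H) (ι 11) ε ⟩
          1ℚ + (1ℚ + Φ₃ H) * y                                                ≤⟨ +-mono-≤ (^-≥1 (suc v) y≥1) (*-monoʳ (≤-trans 0≤1 y≥1) φ₃) ⟩
          y ^ suc v + ι (suc v) * y ^ v * y                                   ≡⟨ e₃ y (y ^ v) (ι (suc v)) ⟩
          ι (suc (suc v)) * y ^ suc v ∎
          where
          e₂ : ∀ p e x → 1ℚ + (1ℚ + (p + e * (x * (1ℚ + p)))) ≡ 1ℚ + (1ℚ + p) * (1ℚ + e * x)
          e₂ = solve-∀ ringℚ
          e₃ : ∀ y z v → y * z + v * z * y ≡ (1ℚ + v) * (y * z)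
          e₃ = solve-∀ ringℚ
          e₄ : ∀ z → 2ℚ * z ≡ z + z * 1ℚ
          e₄ = solve-∀ ringℚ
          e₅ : ∀ z → z ≡ z + z * 0ℚ
          e₅ = solve-∀ ringℚ
          pt : ∀ i r → 2ℚ ^ ((if i then 1 else 0) ℕ.+ r) ≡ 2ℚ ^ r + 2ℚ ^ r * [ i ]
          pt true r = e₄ (2ℚ ^ r)
          pt false r = e₅ (2ℚ ^ r)

    build : ∀ v → v ℕ.≤ n → ∃ λ (H : Gr v) → Fine H
    build zero _ = []ᴳ , record { tf = tt ; cod = tt ; left = tt ; φ₁ = ≤⁺ (nn* ≤-refl g₁≥0) refl ; φ₂ = ≤⁺ (nn* ≤-refl g₂≥0) refl ; φ₃ = ≤-reflexive refl }
    build (suc v) hv = let H , F = build v (ℕₚ.≤-trans (ℕₚ.n≤1+n v) hv)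
                           I , F' = Consequences.extend (ℕₚ.≤-trans (ℕₚ.n≤1+n v) hv) H F
                       in I ◂ H , F'

-- Reading off small independence number and few edges between independent sets.

module SparseGraphs where

  open Rationals
  open WeightedGraphs
  open SelectionProcess using (true≢false; bool)
  open ProductTests
  open RandomIndependentSet
  open Potentials
  open Growth
  open import Data.Rational.Properties
  open import Relation.Nullary.Decidable using (_×-dec_; dec-true)

  shrink-to : ∀ {n} c (B : Subset n) → c ℕ.≤ count B → ∃ λ A → A ⊆ B × count A ≡ c
  shrink-to {n} c B h = go (count B ℕ.∸ c) B refl h
    where
    go : ∀ k (B : Subset n) → count B ℕ.∸ c ≡ k → c ℕ.≤ count B → ∃ λ A → A ⊆ B × count A ≡ c
    go zero B e h = B , (λ z → z) , ℕₚ.≤-antisym (ℕₚ.m∸n≡0⇒m≤n e) h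
    go (suc k) B e h = at (Finₚ.any? (λ v → B v Boolₚ.≟ true))
      where
      at : Dec (NonEmpty B) → ∃ λ A → A ⊆ B × count A ≡ c
      at (yes (v , hv)) =
        let A , sub , q = go k (B ∖ v) e' h' in A , (λ {x} hx → ∖-⊆ B v {x} (sub hx)) , q
        where
        cB : count B ≡ suc (count (B ∖ v))
        cB = count-∖ B v hv
        c< : c ℕ.< count B
        c< = ℕₚ.≰⇒> (λ q → ℕₚ.1+n≢0 (trans (sym e) (ℕₚ.m≤n⇒m∸n≡0 q)))
        h' : c ℕ.≤ count (B ∖ v)
        h' = ℕₚ.≤-pred (subst (c ℕ.<_) cB c<)
        e' : count (B ∖ v) ℕ.∸ c ≡ k
        e' = ℕₚ.suc-injective (trans (sym (ℕₚ.+-∸-assoc 1 h')) (trans (cong (ℕ._∸ c) (sym cB)) e))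
      at (no emp) = ⊥-elim (ℕₚ.1+n≢0 (trans (sym e) (trans (cong (ℕ._∸ c) c0) (ℕₚ.0∸n≡0 c))))
        where
        c0 : count B ≡ 0
        c0 = ℕₚ.n≤0⇒n≡0 (ι-cancel (≤-reflexive (trans (sym (sum-[] B)) (trans (sum-cong (λ x → cong [_] (size0 B emp x))) (sum-0 n)))))

  -- Only edges whose newer end is in `A` are counted, which is what the second potential sees;
  -- `edges-cross` recovers all edges from both orders of the pair.
  cross : ∀ {n} → Gr n → Subset n → Subset n → ℕ
  cross []ᴳ A B = 0
  cross (I ◂ H) A B = (if A zero then hit I (tail B) else 0) ℕ.+ cross H (tail A) (tail B)

  ι-hit : ∀ {n} (I B : Subset n) → ι (hit I B) ≡ sum (λ y → [ I y ] * [ B y ])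
  ι-hit {zero} I B = refl
  ι-hit {suc n} I B = trans (ι-+ (if I zero ∧ B zero then 1 else 0) (hit (tail I) (tail B))) (cong₂ _+_ (pt (I zero) (B zero)) (ι-hit (tail I) (tail B)))
    where
    pt : ∀ i b → ι (if i ∧ b then 1 else 0) ≡ [ i ] * [ b ]
    pt true true = refl
    pt true false = refl
    pt false true = refl
    pt false false = refl

  edges-cross : ∀ {n} (H : Gr n) A B → edges (graph H) A B ≡ ι (cross H A B) + ι (cross H B A)
  edges-cross []ᴳ A B = refl
  edges-cross (I ◂ H) A B = begin
    a * (0ℚ * b + sum (λ y → [ I y ] * [ B' y ])) + sum (λ x → [ A' x ] * ([ I x ] * b + weightTo (graph H) (λ y → [ B' y ]) x))
      ≡⟨ cong₂ _+_ (cong (λ z → a * (0ℚ * b + z)) (sym (ι-hit I B'))) (trans (sum-cong (λ x → e₁ [ A' x ] [ I x ] b (weightTo (graph H) (λ y → [ B' y ]) x)))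
           (trans (sum-+ (λ x → b * ([ I x ] * [ A' x ])) (λ x → [ A' x ] * weightTo (graph H) (λ y → [ B' y ]) x))
             (cong₂ _+_ (trans (sum-* b (λ x → [ I x ] * [ A' x ])) (cong (b *_) (sym (ι-hit I A')))) (edges-cross H A' B')))) ⟩
    a * (0ℚ * b + ι (hit I B')) + (b * ι (hit I A') + (ι (cross H A' B') + ι (cross H B' A')))
      ≡⟨ e₂ a b (ι (hit I B')) (ι (hit I A')) (ι (cross H A' B')) (ι (cross H B' A')) ⟩
    (a * ι (hit I B') + ι (cross H A' B')) + (b * ι (hit I A') + ι (cross H B' A'))
      ≡⟨ cong₂ _+_ (sym (c-eq (A zero) (hit I B') (cross H A' B'))) (sym (c-eq (B zero) (hit I A') (cross H B' A'))) ⟩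
    ι (cross (I ◂ H) A B) + ι (cross (I ◂ H) B A) ∎
    where
    open ≡-Reasoning
    A' = tail A
    B' = tail B
    a b : ℚ
    a = [ A zero ]
    b = [ B zero ]
    e₁ : ∀ x i b w → x * (i * b + w) ≡ b * (i * x) + x * w
    e₁ = solve-∀ ringℚ
    e₂ : ∀ a b h k c d → a * (0ℚ * b + h) + (b * k + (c + d)) ≡ (a * h + c) + (b * k + d)
    e₂ = solve-∀ ringℚ
    c-eq : ∀ t h c → ι ((if t then h else 0) ℕ.+ c) ≡ [ t ] * ι h + ι c
    c-eq true h c = trans (ι-+ h c) (cong (_+ ι c) (sym (*-identityˡ (ι h))))
    c-eq false h c = trans (sym (+-identityˡ (ι c))) (cong (_+ ι c) (sym (*-zeroˡ (ι h))))

  record Sparse {n} (H : Gr n) (s l : ℕ) : Set where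
    field
      triangle-free : TFᴳ H
      small : ∀ B → Indep (graph H) B → count B ℕ.< s
      thin : ∀ A B → Indep (graph H) B → cross H A B ℕ.≤ l ℕ.* (count A ℕ.+ count B) ℕ.+ 1

  module Extract (Par : Params) (valid : Valid Par) where
    open Params Par
    open Valid valid
    open Construction Par valid

    -- In closed form `ℓ₁ ^ c * σ ^ (c (c - 1) / 2)`: the quadratic exponent makes it large once `c`
    -- is a sufficient multiple of `m / ε`.
    val : ℕ → ℚ
    val zero = 1ℚ
    val (suc c) = val c * (ℓ₁ * σ ^ c)

    Ψ₁-val : ∀ {v} (H : Gr v) B → Indep (graph H) B → count B ℕ.≤ s → Q₁.Ψ H B ≡ val (count B)
    Ψ₁-val []ᴳ B ind c = refl
    Ψ₁-val (I ◂ H) B ind c = cases (B zero) refl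
      where
      ih = Ψ₁-val H (tail B) (λ a b p q → ind (suc a) (suc b) p q) (ℕₚ.≤-trans (count-tail B) c)
      cases : ∀ b → B zero ≡ b → Q₁.Ψ (I ◂ H) B ≡ val (count B)
      cases false e = trans (Q₁.Ψ-false I H B e) (trans (*-identityʳ (Q₁.Ψ H (tail B))) (trans ih (cong val (sym (count-cons B false e)))))
      cases true e = trans (Q₁.Ψ-true I H B e ind c) (trans (cong (_* (ℓ₁ * σ ^ count (tail B))) ih) (cong val (sym (count-cons B true e))))

    -- A lower bound for each factor of `Q₂.Ψ`: `1 + ℓ₂ 2^j` is at least `ℓ₂ 2^j` for a vertex of
    -- `A` and at least one for any other. A factor `Λ` for each element of `A` and `B` cancels the
    -- `ℓ₂`.
    cross-bound : ∀ {v} (H : Gr v) A B → Indep (graph H) B → count B ℕ.≤ s → 2ℚ ^ cross H A B ≤ Q₂.Ψ H B * Λ ^ (count A ℕ.+ count B)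
    cross-bound []ᴳ A B ind c = ≤-reflexive refl
    cross-bound (I ◂ H) A B ind c = subst (λ z → 2ℚ ^ cross (I ◂ H) A B ≤ Q₂.Ψ (I ◂ H) B * Λ ^ (z ℕ.+ count B)) (sym (count-cons A (A zero) refl)) (cases (B zero) refl)
      where
      open ≤-Reasoning
      A' = tail A
      B' = tail B
      j r : ℕ
      j = hit I B'
      r = cross H A' B'
      Ψ′ X : ℚ
      Ψ′ = Q₂.Ψ H B'
      X = Ψ′ * Λ ^ (count A' ℕ.+ count B')
      Λ≥1 : 1ℚ ≤ Λ
      Λ≥1 = ^-≥1 λ₂ 1≤2
      X≥0 : 0ℚ ≤ X
      X≥0 = nn* (Q₂.Ψ≥0 H B') (^-nn (count A' ℕ.+ count B') (≤-trans 0≤1 Λ≥1))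
      ih : 2ℚ ^ r ≤ X
      ih = cross-bound H A' B' (λ a b p q → ind (suc a) (suc b) p q) (ℕₚ.≤-trans (count-tail B) c)
      a : ℕ
      a = if A zero then 1 else 0
      ℓ2j : ℚ
      ℓ2j = ℓ₂ * 2ℚ ^ j
      ℓ2j≥0 : 0ℚ ≤ ℓ2j
      ℓ2j≥0 = nn* (<⇒≤ ℓ₂>0) (^-nn j 0≤2)
      e₁ : ∀ l L x → l * L * x ≡ l * x * (L * 1ℚ)
      e₁ = solve-∀ ringℚ
      e₂ : ∀ p c L z → (1ℚ + c) * L * (p * z) ≡ p * (1ℚ + c) * (L * z)
      e₂ = solve-∀ ringℚ
      e₃ : ∀ p l L M z → p * l * (M * (L * z)) ≡ l * L * (M * (p * z))
      e₃ = solve-∀ ringℚ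
      cases : ∀ b → B zero ≡ b → 2ℚ ^ ((if A zero then j else 0) ℕ.+ r) ≤ Q₂.Ψ (I ◂ H) B * Λ ^ (a ℕ.+ count A' ℕ.+ count B)
      cases false hb = begin
        2ℚ ^ ((if A zero then j else 0) ℕ.+ r)        ≡⟨ ^-+ 2ℚ (if A zero then j else 0) r ⟩
        2ℚ ^ (if A zero then j else 0) * 2ℚ ^ r       ≤⟨ *-mono (^-nn (if A zero then j else 0) 0≤2) X≥0 (pt (A zero)) ih ⟩
        (1ℚ + ℓ2j) * Λ ^ a * X                        ≡⟨ e₂ Ψ′ ℓ2j (Λ ^ a) (Λ ^ (count A' ℕ.+ count B')) ⟩
        Ψ′ * (1ℚ + ℓ2j) * (Λ ^ a * Λ ^ (count A' ℕ.+ count B')) ≡⟨ cong₂ _*_ (sym (trans (Q₂.Ψ-false I H B hb) (cong (λ z → Ψ′ * (1ℚ + ℓ₂ * z)) (two-hit I B'))))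
            (trans (sym (^-+ Λ a (count A' ℕ.+ count B'))) (cong (Λ ^_) (trans (sym (ℕₚ.+-assoc a (count A') (count B'))) (cong (a ℕ.+ count A' ℕ.+_) (sym (count-cons B false hb)))))) ⟩
        Q₂.Ψ (I ◂ H) B * Λ ^ (a ℕ.+ count A' ℕ.+ count B) ∎
        where
        pt : ∀ t → 2ℚ ^ (if t then j else 0) ≤ (1ℚ + ℓ2j) * Λ ^ (if t then 1 else 0)
        pt false = ≤-trans (1≤1+ ℓ2j≥0) (≤-reflexive (sym (*-identityʳ (1ℚ + ℓ2j))))
        pt true = begin
          2ℚ ^ j                   ≡⟨ sym (*-identityˡ (2ℚ ^ j)) ⟩
          1ℚ * 2ℚ ^ j              ≡⟨ cong (_* 2ℚ ^ j) (sym ℓ₂-def) ⟩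
          ℓ₂ * Λ * 2ℚ ^ j          ≡⟨ e₁ ℓ₂ Λ (2ℚ ^ j) ⟩
          ℓ2j * (Λ * 1ℚ)           ≤⟨ *-monoʳ {ℓ2j} {1ℚ + ℓ2j} (nn* (≤-trans 0≤1 Λ≥1) 0≤1) (≤⁺ 0≤1 (+-comm 1ℚ ℓ2j)) ⟩
          (1ℚ + ℓ2j) * (Λ * 1ℚ) ∎
      cases true hb = begin
        2ℚ ^ ((if A zero then j else 0) ℕ.+ r)        ≡⟨ cong (λ z → 2ℚ ^ (z ℕ.+ r)) (trans (cong (λ z → if A zero then z else 0) j≡0) (0-if (A zero))) ⟩
        2ℚ ^ r                                        ≤⟨ ih ⟩
        X                                             ≡⟨ sym (*-identityˡ X) ⟩
        1ℚ * X                                        ≤⟨ *-monoʳ X≥0 (^-≥1 a Λ≥1) ⟩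
        Λ ^ a * X                                     ≡⟨ sym (*-identityˡ (Λ ^ a * X)) ⟩
        1ℚ * (Λ ^ a * X)                              ≡⟨ cong (_* (Λ ^ a * X)) (sym ℓ₂-def) ⟩
        ℓ₂ * Λ * (Λ ^ a * X)                          ≡⟨ sym (e₃ Ψ′ ℓ₂ Λ (Λ ^ a) (Λ ^ (count A' ℕ.+ count B'))) ⟩
        Ψ′ * ℓ₂ * (Λ ^ a * (Λ * Λ ^ (count A' ℕ.+ count B'))) ≡⟨ cong₂ _*_ (sym (Q₂.Ψ-true I H B hb ind c))
            (trans (sym (^-+ Λ a (suc (count A' ℕ.+ count B')))) (cong (Λ ^_) (trans (arith a (count A') (count B')) (cong (a ℕ.+ count A' ℕ.+_) (sym (count-cons B true hb)))))) ⟩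
        Q₂.Ψ (I ◂ H) B * Λ ^ (a ℕ.+ count A' ℕ.+ count B) ∎
        where
        0-if : ∀ t → (if t then 0 else 0) ≡ 0
        0-if true = refl
        0-if false = refl
        j≡0 : j ≡ 0
        j≡0 = hit≡0 I B' (λ z p q → true≢false p (ind zero (suc z) hb q))
        arith : ∀ a x y → a ℕ.+ suc (x ℕ.+ y) ≡ a ℕ.+ x ℕ.+ suc y
        arith = NR.solve-∀

    -- An independent set with at least `s` elements would contain one with exactly `s`, whose term
    -- `val s` in the first potential already exceeds 2.
    sparse : 2ℚ < val s → ∃ λ (H : Gr n) → Sparse H s λ₂
    sparse big = let H , F = build n ℕₚ.≤-refl in H , result H F
      where
      result : ∀ H → Fine H → Sparse H s λ₂
      result H F = record { triangle-free = Fine.tf F ; small = small ; thin = thin }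
        where
        open Consequences ℕₚ.≤-refl H F using (Φ₁≤2; Φ₂≤2)
        open ≤-Reasoning
        small : ∀ B → Indep (graph H) B → count B ℕ.< s
        small B ind = ℕₚ.≰⇒> (λ q → let A , sub , e = shrink-to s B q in
          <-irrefl refl (<-≤-trans big (subst (λ z → val z ≤ 2ℚ) e (≤-trans (≤-reflexive (sym (Ψ₁-val H A (λ x y p q → ind x y (sub p) (sub q)) (ℕₚ.≤-reflexive e))))
            (≤-trans (Q₁.Ψ≤Φ H A) Φ₁≤2)))))
        thin : ∀ A B → Indep (graph H) B → cross H A B ℕ.≤ λ₂ ℕ.* (count A ℕ.+ count B) ℕ.+ 1
        thin A B ind = 2^-cancel (begin
          2ℚ ^ cross H A B                                  ≤⟨ cross-bound H A B ind (ℕₚ.<⇒≤ (small B ind)) ⟩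
          Q₂.Ψ H B * Λ ^ (count A ℕ.+ count B)              ≤⟨ *-monoʳ (^-nn (count A ℕ.+ count B) (^-nn λ₂ 0≤2)) (≤-trans (Q₂.Ψ≤Φ H B) Φ₂≤2) ⟩
          2ℚ * Λ ^ (count A ℕ.+ count B)                    ≡⟨ cong (2ℚ *_) (trans (sym (^-^ 2ℚ (count A ℕ.+ count B) λ₂)) (cong (2ℚ ^_) (ℕₚ.*-comm (count A ℕ.+ count B) λ₂))) ⟩
          2ℚ ^ suc (λ₂ ℕ.* (count A ℕ.+ count B))           ≡⟨ cong (2ℚ ^_) (ℕₚ.+-comm 1 (λ₂ ℕ.* (count A ℕ.+ count B))) ⟩
          2ℚ ^ (λ₂ ℕ.* (count A ℕ.+ count B) ℕ.+ 1) ∎)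

  -- Blow-ups along a map and the degrees of their bipartite subgraphs.

  fiber : ∀ {m n} → (Fin m → Fin n) → Fin n → ℚ
  fiber φ y = sum (λ v → [ δ (φ v) y ])

  sum-∘ : ∀ {m n} (φ : Fin m → Fin n) (f : Fin n → ℚ) → sum (λ v → f (φ v)) ≡ sum (λ y → f y * fiber φ y)
  sum-∘ φ f = trans (sum-cong (λ v → sym (sum-δ (φ v) f))) (trans (sum-swap (λ v y → f y * [ δ (φ v) y ])) (sum-cong (λ y → sum-* (f y) (λ v → [ δ (φ v) y ]))))

  pullback : ∀ {m n} → Graph n → (Fin m → Fin n) → Graph m
  pullback G φ = record { adj = λ u v → adj G (φ u) (φ v) ; sym = λ u v → Graph.sym G (φ u) (φ v) ; irref = λ v → irref G (φ v) }

  pullback-tf : ∀ {m n} (G : Graph n) (φ : Fin m → Fin n) → TriangleFree G → TriangleFree (pullback G φ)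
  pullback-tf G φ tf u v w = tf (φ u) (φ v) (φ w)

  pullback-degree : ∀ {m n} (G : Graph n) (φ : Fin m → Fin n) (S : Subset n) d t → (∀ v → S v ≡ true → d ℕ.≤ degreeIn G S v) →
    (∀ u → S (φ u) ≡ true) → (∀ x → S x ≡ true → ι t ≤ fiber φ x) → MinDegree≥ (pullback G φ) (t ℕ.* d)
  pullback-degree G φ S d t md im fib u = ι-cancel (begin
    ι (t ℕ.* d)                                        ≡⟨ ι-* t d ⟩
    ι t * ι d                                          ≤⟨ *-monoˡ (ι≥0 t) (≤-trans (ι-mono (md (φ u) (im u))) (≤-reflexive (sym (weight-count G S (φ u))))) ⟩
    ι t * sum (λ y → α G (φ u) y * [ S y ])            ≡⟨ sym (sum-* (ι t) (λ y → α G (φ u) y * [ S y ])) ⟩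
    sum (λ y → ι t * (α G (φ u) y * [ S y ]))          ≤⟨ sum-mono (λ y → pt y (bool (S y))) ⟩
    sum (λ y → α G (φ u) y * fiber φ y)                ≡⟨ sym (sum-∘ φ (α G (φ u))) ⟩
    sum (λ v → α G (φ u) (φ v))                        ≡⟨ sum-[] (λ v → adj G (φ u) (φ v)) ⟩
    ι (degree (pullback G φ) u) ∎)
    where
    open ≤-Reasoning
    e₁ : ∀ t a → t * (a * 1ℚ) ≡ a * t
    e₁ = solve-∀ ringℚ
    e₂ : ∀ t a → t * (a * 0ℚ) ≡ 0ℚ
    e₂ = solve-∀ ringℚ
    pt : ∀ y → S y ≡ true ⊎ S y ≡ false → ι t * (α G (φ u) y * [ S y ]) ≤ α G (φ u) y * fiber φ y
    pt y (inj₁ s) = ≤-trans (≤-reflexive (trans (cong (λ b → ι t * (α G (φ u) y * [ b ])) s) (e₁ (ι t) (α G (φ u) y)))) (*-monoˡ (α≥0 G (φ u) y) (fib y s))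
    pt y (inj₂ f) = ≤-trans (≤-reflexive (trans (cong (λ b → ι t * (α G (φ u) y * [ b ])) f) (e₂ (ι t) (α G (φ u) y)))) (nn* (α≥0 G (φ u) y) (sum-nn (λ v → []≥0 (δ (φ v) y))))

  -- Adjacency depends only on the images, so both colour classes have independent images `A` and
  -- `B`, which may overlap. A preimage of a vertex of `A` has `g` neighbours, all over `B` and at
  -- most `t` over each vertex. Summing over both classes gives `g x ≤ 2 t e(A,B) ≤ 4 t (l x + 1)`
  -- with `x = |A| + |B|`, and `x ≥ 1`.
  blow-up-bound : ∀ {m n s l} (H : Gr n) → Sparse H s l → (φ : Fin m → Fin n) (t : ℕ) → (∀ x → fiber φ x ≤ ι t) →
    ∀ g → HasInducedBipartiteMinDeg (pullback (graph H) φ) g → g ℕ.≤ t ℕ.* (4 ℕ.* l ℕ.+ 4)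
  blow-up-bound {m} {n} {s} {l} H sp φ t fib g (S , (v₀ , hv₀) , (c , bip) , md) = g≤
    where
    open Sparse sp
    open ≤-Reasoning
    G = graph H
    image? : ∀ b x → Dec (∃ λ u → S u ≡ true × c u ≡ b × φ u ≡ x)
    image? b x = Finₚ.any? (λ u → (S u Boolₚ.≟ true) ×-dec ((c u Boolₚ.≟ b) ×-dec (φ u Finₚ.≟ x)))
    Im : Bool → Subset n
    Im b x = does (image? b x)
    to-Im : ∀ u → S u ≡ true → Im (c u) (φ u) ≡ true
    to-Im u hu = dec-true (image? (c u) (φ u)) (u , hu , refl , refl)
    from-Im : ∀ b x → Im b x ≡ true → ∃ λ u → S u ≡ true × c u ≡ b × φ u ≡ x
    from-Im b x h = at (image? b x) refl
      where
      at : ∀ d → image? b x ≡ d → ∃ λ u → S u ≡ true × c u ≡ b × φ u ≡ x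
      at (yes r) _ = r
      at (no r) e = ⊥-elim (true≢false h (cong does e))
    indep : ∀ b → Indep G (Im b)
    indep b x y hx hy = at (bool (adjᴳ H x y)) (from-Im b x hx) (from-Im b y hy)
      where
      at : adjᴳ H x y ≡ true ⊎ adjᴳ H x y ≡ false → (∃ λ u → S u ≡ true × c u ≡ b × φ u ≡ x) → (∃ λ u → S u ≡ true × c u ≡ b × φ u ≡ y) → adjᴳ H x y ≡ false
      at (inj₂ f) _ _ = f
      at (inj₁ a) (u , su , cu , refl) (v , sv , cv , refl) = ⊥-elim (bip u v su sv a (trans cu (sym cv)))
    half : ∀ b → ι g * size (Im b) ≤ ι t * edges G (Im b) (Im (not b))
    half b = ≤-trans (≤-reflexive (sym (sum-* (ι g) (λ x → [ Im b x ])))) (≤-trans (sum-mono (λ x → pt x (bool (Im b x)))) (≤-reflexive (sum-* (ι t) (λ x → [ Im b x ] * W x))))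
      where
      W : Fin n → ℚ
      W = weightTo G (λ y → [ Im (not b) y ])
      e₁ : ∀ g x → g * 0ℚ ≡ x * (0ℚ * g)
      e₁ = solve-∀ ringℚ
      e₂ : ∀ t w → t * w ≡ t * (1ℚ * w)
      e₂ = solve-∀ ringℚ
      e₃ : ∀ t w → t * (0ℚ * w) ≡ 0ℚ
      e₃ = solve-∀ ringℚ
      deg : ∀ u → S u ≡ true → c u ≡ b → ι g ≤ ι t * W (φ u)
      deg u su cu = begin
        ι g                                                       ≤⟨ ι-mono (md u su) ⟩
        ι (degreeIn (pullback G φ) S u)                           ≡⟨ sym (sum-[] (λ v → S v ∧ adjᴳ H (φ u) (φ v))) ⟩
        sum (λ v → [ S v ∧ adjᴳ H (φ u) (φ v) ])                  ≤⟨ sum-mono (λ v → on v (bool (S v)) (bool (adjᴳ H (φ u) (φ v)))) ⟩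
        sum (λ v → α G (φ u) (φ v) * [ Im (not b) (φ v) ])        ≡⟨ sum-∘ φ (λ y → α G (φ u) y * [ Im (not b) y ]) ⟩
        sum (λ y → α G (φ u) y * [ Im (not b) y ] * fiber φ y)    ≤⟨ sum-mono (λ y → *-monoˡ (nn* (α≥0 G (φ u) y) ([]≥0 (Im (not b) y))) (fib y)) ⟩
        sum (λ y → α G (φ u) y * [ Im (not b) y ] * ι t)          ≡⟨ trans (sum-cong (λ y → *-comm (α G (φ u) y * [ Im (not b) y ]) (ι t))) (sum-* (ι t) (λ y → α G (φ u) y * [ Im (not b) y ])) ⟩
        ι t * W (φ u) ∎
        where
        other : ∀ b b' → b ≢ b' → not b ≡ b'
        other true true h = ⊥-elim (h refl)
        other true false h = refl
        other false true h = refl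
        other false false h = ⊥-elim (h refl)
        nn : ∀ v → 0ℚ ≤ α G (φ u) (φ v) * [ Im (not b) (φ v) ]
        nn v = nn* (α≥0 G (φ u) (φ v)) ([]≥0 (Im (not b) (φ v)))
        on : ∀ v → S v ≡ true ⊎ S v ≡ false → adjᴳ H (φ u) (φ v) ≡ true ⊎ adjᴳ H (φ u) (φ v) ≡ false →
          [ S v ∧ adjᴳ H (φ u) (φ v) ] ≤ α G (φ u) (φ v) * [ Im (not b) (φ v) ]
        on v (inj₂ f) _ = ≤-trans (≤-reflexive (cong (λ z → [ z ∧ adjᴳ H (φ u) (φ v) ]) f)) (nn v)
        on v (inj₁ sv) (inj₂ f) = ≤-trans (≤-reflexive (trans (cong (λ z → [ S v ∧ z ]) f) (cong [_] (Boolₚ.∧-zeroʳ (S v))))) (nn v)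
        on v (inj₁ sv) (inj₁ a) = ≤-trans ([]≤1 _) (≤-reflexive (sym (trans (cong₂ (λ p q → [ p ] * [ q ]) a inIm) (*-identityˡ 1ℚ))))
          where
          inIm : Im (not b) (φ v) ≡ true
          inIm = trans (cong (λ z → Im z (φ v)) (other b (c v) (λ e → bip u v su sv a (trans cu e)))) (to-Im v sv)
      pt : ∀ x → Im b x ≡ true ⊎ Im b x ≡ false → ι g * [ Im b x ] ≤ ι t * ([ Im b x ] * W x)
      pt x (inj₂ f) = ≤-trans (≤-reflexive (trans (cong (λ z → ι g * [ z ]) f) (*-zeroʳ (ι g)))) (≤-reflexive (sym (trans (cong (λ z → ι t * ([ z ] * W x)) f) (e₃ (ι t) (W x)))))
      pt x (inj₁ h) = at (from-Im b x h)
        where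
        at : (∃ λ u → S u ≡ true × c u ≡ b × φ u ≡ x) → ι g * [ Im b x ] ≤ ι t * ([ Im b x ] * W x)
        at (u , su , cu , refl) = ≤-trans (≤-reflexive (trans (cong (λ z → ι g * [ z ]) h) (*-identityʳ (ι g))))
          (≤-trans (deg u su cu) (≤-reflexive (trans (e₂ (ι t) (W (φ u))) (cong (λ z → ι t * ([ z ] * W (φ u))) (sym h)))))
    A B : Subset n
    A = Im true
    B = Im false
    x : ℕ
    x = count A ℕ.+ count B
    E = ι (cross H A B) + ι (cross H B A)
    E≤ : E ≤ ι (2 ℕ.* (l ℕ.* x ℕ.+ 1))
    E≤ = ≤-trans (≤-reflexive (sym (ι-+ (cross H A B) (cross H B A)))) (ι-mono (ℕₚ.≤-trans (ℕₚ.+-mono-≤ (thin A B (indep false))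
      (ℕₚ.≤-trans (thin B A (indep true)) (ℕₚ.≤-reflexive (cong (λ z → l ℕ.* z ℕ.+ 1) (ℕₚ.+-comm (count B) (count A)))))) (ℕₚ.≤-reflexive (double (l ℕ.* x ℕ.+ 1)))))
      where
      double : ∀ z → z ℕ.+ z ≡ 2 ℕ.* z
      double = NR.solve-∀
    both : ι g * ι x ≤ ι t * (2ℚ * E)
    both = begin
      ι g * ι x                       ≡⟨ cong (ι g *_) (trans (ι-+ (count A) (count B)) (cong₂ _+_ (sym (sum-[] A)) (sym (sum-[] B)))) ⟩
      ι g * (size A + size B)         ≡⟨ *-distribˡ-+ (ι g) (size A) (size B) ⟩
      ι g * size A + ι g * size B     ≤⟨ +-mono-≤ (half true) (half false) ⟩
      ι t * edges G A B + ι t * edges G B A ≡⟨ cong₂ (λ p q → ι t * p + ι t * q) (edges-cross H A B) (trans (edges-cross H B A) (+-comm (ι (cross H B A)) _)) ⟩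
      ι t * E + ι t * E               ≡⟨ e (ι t) E ⟩
      ι t * (2ℚ * E) ∎
      where e : ∀ t E → t * E + t * E ≡ t * (2ℚ * E)
            e = solve-∀ ringℚ
    x>0 : 0 ℕ.< x
    x>0 = ι-cancel< (<-≤-trans 0<1 (≤-trans (at (c v₀) refl) (≤-reflexive (trans (cong₂ _+_ (sum-[] A) (sum-[] B)) (sym (ι-+ (count A) (count B)))))))
      where
      mem : ∀ b → c v₀ ≡ b → 1ℚ ≤ size (Im b)
      mem b e = ≤-trans (≤-reflexive (sym (cong [_] (trans (cong (λ z → Im z (φ v₀)) (sym e)) (to-Im v₀ hv₀))))) (term≤sum (λ y → []≥0 (Im b y)) (φ v₀))
      at : ∀ b → c v₀ ≡ b → 1ℚ ≤ size A + size B
      at true e = ≤-trans (mem true e) (≤⁺ (sum-nn (λ y → []≥0 (B y))) refl)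
      at false e = ≤-trans (mem false e) (≤⁺ (sum-nn (λ y → []≥0 (A y))) (+-comm (size A) (size B)))
    g≤ : g ℕ.≤ t ℕ.* (4 ℕ.* l ℕ.+ 4)
    g≤ = ℕₚ.*-cancelʳ-≤ g (t ℕ.* (4 ℕ.* l ℕ.+ 4)) x {{ℕ.>-nonZero x>0}} (ℕₚ.≤-trans gx (ℕₚ.≤-trans (ℕₚ.*-monoʳ-≤ t (ℕₚ.≤-trans (ℕₚ.*-monoʳ-≤ 4 (ℕₚ.+-monoʳ-≤ (l ℕ.* x) x>0)) (ℕₚ.≤-reflexive (arith l x)))) (ℕₚ.≤-reflexive (sym (ℕₚ.*-assoc t (4 ℕ.* l ℕ.+ 4) x)))))
      where
      arith : ∀ l x → 4 ℕ.* (l ℕ.* x ℕ.+ x) ≡ (4 ℕ.* l ℕ.+ 4) ℕ.* x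
      arith = NR.solve-∀
      gx : g ℕ.* x ℕ.≤ t ℕ.* (4 ℕ.* (l ℕ.* x ℕ.+ 1))
      gx = ι-cancel (≤-trans (≤-reflexive (ι-* g x)) (≤-trans both (≤-trans (*-monoˡ (ι≥0 t) (*-monoˡ 0≤2 E≤)) (≤-reflexive
        (trans (cong (ι t *_) (trans (sym (ι-* 2 (2 ℕ.* (l ℕ.* x ℕ.+ 1)))) (cong ι (sym (ℕₚ.*-assoc 2 2 (l ℕ.* x ℕ.+ 1)))))) (sym (ι-* t (4 ℕ.* (l ℕ.* x ℕ.+ 1)))))))))

-- Balanced blow-ups of the dense core of a sparse graph.

module BlowUpGraphs where

  open Rationals
  open WeightedGraphs
  open SelectionProcess using (true≢false)
  open LowerBound
  open ProductTests
  open RandomIndependentSet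
  open Growth
  open Potentials using (count-cons)
  open SparseGraphs
  open import Data.Fin using (_↑ˡ_; _↑ʳ_; splitAt)
  open import Data.List using ([])
  open import Data.List.Membership.Propositional using (_∈_)
  open import Data.Sum using ([_,_]′)
  open import Data.Rational.Properties

  sum-split : ∀ a {b} (f : Fin (a ℕ.+ b) → ℚ) → sum f ≡ sum (λ i → f (i ↑ˡ b)) + sum (λ j → f (a ↑ʳ j))
  sum-split zero f = sym (+-identityˡ (sum f))
  sum-split (suc a) f = trans (cong (f zero +_) (sum-split a (λ i → f (suc i)))) (sym (+-assoc (f zero) _ _))

  glue : ∀ {a b} {A : Set} → (Fin a → A) → (Fin b → A) → Fin (a ℕ.+ b) → A
  glue {a} e f i = [ e , f ]′ (splitAt a i)

  fiber-glue : ∀ {a b n} (e : Fin a → Fin n) (f : Fin b → Fin n) x → fiber (glue e f) x ≡ fiber e x + fiber f x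
  fiber-glue {a} {b} e f x = trans (sum-split a (λ v → Rationals.[ δ (glue e f v) x ])) (cong₂ _+_
    (sum-cong (λ i → cong (λ z → Rationals.[ δ ([ e , f ]′ z) x ]) (Finₚ.splitAt-↑ˡ a i b)))
    (sum-cong (λ j → cong (λ z → Rationals.[ δ ([ e , f ]′ z) x ]) (Finₚ.splitAt-↑ʳ a b j))))

  glue-all : ∀ {a b} {A : Set} {P : A → Set} (e : Fin a → A) (f : Fin b → A) → (∀ i → P (e i)) → (∀ j → P (f j)) → ∀ i → P (glue e f i)
  glue-all {a} e f he hf i with splitAt a i
  ... | inj₁ j = he j
  ... | inj₂ j = hf j

  record Balanced {n} (S : Subset n) (q m : ℕ) : Set where
    field
      to : Fin m → Fin n
      inside : ∀ i → S (to i) ≡ true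
      lower : ∀ x → S x ≡ true → ι q ≤ fiber to x
      upper : ∀ x → fiber to x ≤ ι (q ℕ.+ 1)

  enumerate : ∀ {n} (S : Subset n) → ∃ λ (e : Fin (count S) → Fin n) → (∀ i → S (e i) ≡ true) × (∀ x → fiber e x ≡ Rationals.[ S x ])
  enumerate {zero} S = (λ ()) , (λ ()) , (λ ())
  enumerate {suc n} S = subst (λ c → ∃ λ (e : Fin c → Fin (suc n)) → (∀ i → S (e i) ≡ true) × (∀ x → fiber e x ≡ Rationals.[ S x ])) (sym (count-cons S (S zero) refl)) (go (S zero) refl)
    where
    ih = enumerate (λ x → S (suc x))
    e = proj₁ ih
    go : ∀ b → S zero ≡ b → ∃ λ (e : Fin ((if b then 1 else 0) ℕ.+ count (λ x → S (suc x))) → Fin (suc n)) → (∀ i → S (e i) ≡ true) × (∀ x → fiber e x ≡ Rationals.[ S x ])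
    go true h = e' , in' , fib
      where
      e' : Fin (suc (count (λ x → S (suc x)))) → Fin (suc n)
      e' zero = zero
      e' (suc i) = suc (e i)
      in' : ∀ i → S (e' i) ≡ true
      in' zero = h
      in' (suc i) = proj₁ (proj₂ ih) i
      fib : ∀ x → fiber e' x ≡ Rationals.[ S x ]
      fib zero = trans (trans (cong (1ℚ +_) (sum-0 (count (λ x → S (suc x))))) (+-identityʳ 1ℚ)) (sym (cong Rationals.[_] h))
      fib (suc x) = trans (+-identityˡ _) (proj₂ (proj₂ ih) x)
    go false h = (λ i → suc (e i)) , proj₁ (proj₂ ih) , fib
      where
      fib : ∀ x → fiber (λ i → suc (e i)) x ≡ Rationals.[ S x ]
      fib zero = trans (sum-0 (count (λ x → S (suc x)))) (sym (cong Rationals.[_] h))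
      fib (suc x) = proj₂ (proj₂ ih) x

  prefix : ∀ {c n} r k → r ℕ.+ k ≡ c → (e : Fin c → Fin n) → ∃ λ (e' : Fin r → Fin n) →
    (∀ {P : Fin n → Set} → (∀ i → P (e i)) → ∀ i → P (e' i)) × (∀ x → fiber e' x ≤ fiber e x)
  prefix r k refl e = (λ i → e (i ↑ˡ k)) , (λ h i → h (i ↑ˡ k)) , λ x → ≤-trans (≤⁺ (sum-nn (λ j → []≥0 (δ (e (r ↑ʳ j)) x))) refl) (≤-reflexive (sym (sum-split r (λ v → Rationals.[ δ (e v) x ]))))

  -- All of `S` is listed `q` times and then `r` of its elements once more, so the fibres over `S`
  -- have size `q` or `q + 1`.
  balanced : ∀ {n} (S : Subset n) q r → r ℕ.≤ count S → Balanced S q (q ℕ.* count S ℕ.+ r)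
  balanced S zero r h = let e , ins , fib = enumerate S
                            e' , all' , le = prefix r (count S ℕ.∸ r) (ℕₚ.m+[n∸m]≡n h) e
    in record { to = e' ; inside = all' {λ x → S x ≡ true} ins ; lower = λ x _ → sum-nn (λ i → []≥0 (δ (e' i) x)) ;
                upper = λ x → ≤-trans (le x) (≤-trans (≤-reflexive (fib x)) ([]≤1 (S x))) }
  balanced S (suc q) r h = let e , ins , fib = enumerate S in
    subst (Balanced S (suc q)) (sym (ℕₚ.+-assoc (count S) (q ℕ.* count S) r)) (record
      { to = glue e B.to
      ; inside = glue-all {P = λ x → S x ≡ true} e B.to ins B.inside
      ; lower = λ x s → ≤-trans (+-mono-≤ (≤-reflexive (sym (trans (fib x) (cong Rationals.[_] s)))) (B.lower x s)) (≤-reflexive (sym (fiber-glue e B.to x)))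
      ; upper = λ x → ≤-trans (≤-reflexive (fiber-glue e B.to x)) (+-mono-≤ (≤-trans (≤-reflexive (fib x)) ([]≤1 (S x))) (B.upper x)) })
    where module B = Balanced (balanced S q r h)

  count-not : ∀ {n} (S : Subset n) → count S ℕ.+ count (λ x → not (S x)) ≡ n
  count-not {zero} S = refl
  count-not {suc n} S with S zero
  ... | true = cong suc (count-not (λ x → S (suc x)))
  ... | false = trans (ℕₚ.+-suc (count (λ x → S (suc x))) _) (cong suc (count-not (λ x → S (suc x))))

  count≤n : ∀ {n} (S : Subset n) → count S ℕ.≤ n
  count≤n {n} S = subst (count S ℕ.≤_) (count-not S) (ℕₚ.m≤m+n (count S) _)

  -- The removed vertices are d-degenerate, so they contain a large independent set; hence there are few of them.
  sparse-core : ∀ {n s l} (H : Gr n) → Sparse H s l → ∀ h d → 0 ℕ.< h → 0 ℕ.< d → h ℕ.* 2 ℕ.^ h ℕ.≤ 4 ℕ.* d → 32 ℕ.* d ℕ.* s ℕ.≤ n ℕ.* h →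
    ∃ λ S → (∀ v → S v ≡ true → d ℕ.≤ degreeIn (graph H) S v) × n ℕ.≤ 2 ℕ.* count S
  sparse-core {n} {s} H sp h d h>0 d>0 hd room =
    let S , xs , _ , md , D , cov , _ = peel (graph H) d n (λ _ → true) [] (count≤n (λ _ → true)) tt
        few = λ u m → ℕₚ.<⇒≤ (ℕₚ.≤-<-trans (ℕₚ.m≤m+n (earlier (graph H) xs u) (degreeIn (graph H) S u)) (Degenerate-earlier (graph H) d S xs u D m))
        I , ind , le = large-independent-set h>0 d>0 hd (graph H) (TFᴳ⇒ H triangle-free) xs few (λ x → not (S x)) (cov' S xs cov)
    in S , md , half S I ind le
    where
    open Sparse sp using (triangle-free)
    cov' : ∀ (S : Subset n) xs → (∀ v → true ≡ true → S v ≡ true ⊎ v ∈ xs) → ∀ v → not (S v) ≡ true → v ∈ xs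
    cov' S xs cov v hv with cov v refl
    ... | inj₂ m = m
    ... | inj₁ t = ⊥-elim (true≢false hv (cong not t))
    half : ∀ (S I : Subset n) → Indep (graph H) I → count (λ x → not (S x)) ℕ.* h ℕ.≤ 16 ℕ.* d ℕ.* count I → n ℕ.≤ 2 ℕ.* count S
    half S I ind le = ℕₚ.+-cancelʳ-≤ n n (2 ℕ.* count S) (subst₂ ℕ._≤_ refl (cong (2 ℕ.* count S ℕ.+_) refl)
      (ℕₚ.≤-trans (ℕₚ.≤-reflexive (trans (cong₂ ℕ._+_ (sym (count-not S)) (sym (count-not S))) (arith (count S) K)))
        (ℕₚ.+-monoʳ-≤ (2 ℕ.* count S) 2K≤n)))
      where
      K = count (λ x → not (S x))
      arith : ∀ c k → c ℕ.+ k ℕ.+ (c ℕ.+ k) ≡ 2 ℕ.* c ℕ.+ 2 ℕ.* k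
      arith = NR.solve-∀
      arith₂ : ∀ d x → 2 ℕ.* (16 ℕ.* d ℕ.* x) ≡ 32 ℕ.* d ℕ.* x
      arith₂ = NR.solve-∀
      2K≤n : 2 ℕ.* K ℕ.≤ n
      2K≤n = ℕₚ.*-cancelʳ-≤ (2 ℕ.* K) n h {{ℕ.>-nonZero h>0}} (ℕₚ.≤-trans (ℕₚ.≤-reflexive (ℕₚ.*-assoc 2 K h)) (ℕₚ.≤-trans (ℕₚ.*-monoʳ-≤ 2 le)
        (ℕₚ.≤-trans (ℕₚ.≤-reflexive (arith₂ d (count I))) (ℕₚ.≤-trans (ℕₚ.*-monoʳ-≤ (32 ℕ.* d) (ℕₚ.<⇒≤ (small' ind))) room))))
        where small' = Sparse.small sp I

  -- Blow-ups of a graph on about n vertices, of minimum degree D and with parameter C.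
  BlowUps : ℕ → ℕ → ℕ → Set
  BlowUps n D C = ∀ N d → n ℕ.≤ N → 2 ℕ.* n ℕ.* d ℕ.≤ N ℕ.* D →
    ∃ λ (G : Graph N) → TriangleFree G × MinDegree≥ G d × (∀ g → HasInducedBipartiteMinDeg G g → g ℕ.* n ℕ.≤ N ℕ.* C)

  -- The core has `c` vertices with `n ≤ 2 c` and `c ≤ n`. For `q = N / c` this gives `N ≤ 2 n q`,
  -- whence `d ≤ q D`. Replacing `q + 1` by `2 q` and `n` by `2 c` in the bound on `g` costs a
  -- factor 4, which makes `4 l + 4` into `16 (l + 1)`.
  blow-ups : ∀ {n s l} (H : Gr n) → 0 ℕ.< n → Sparse H s l → ∀ h d → 0 ℕ.< h → 0 ℕ.< d → h ℕ.* 2 ℕ.^ h ℕ.≤ 4 ℕ.* d → 32 ℕ.* d ℕ.* s ℕ.≤ n ℕ.* h →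
    BlowUps n d (16 ℕ.* (l ℕ.+ 1))
  blow-ups {n} {s} {l} H n>0 sp h D h>0 D>0 small room N d n≤N hd =
    pullback (graph H) B.to , pullback-tf (graph H) B.to (TFᴳ⇒ H (Sparse.triangle-free sp)) ,
    (λ v → ℕₚ.≤-trans d≤ (pullback-degree (graph H) B.to S D q md B.inside B.lower v)) ,
    λ g hg → bound g (blow-up-bound H sp B.to (q ℕ.+ 1) B.upper g hg)
    where
    core = sparse-core H sp h D h>0 D>0 small room
    S = proj₁ core
    md = proj₁ (proj₂ core)
    n≤2c = proj₂ (proj₂ core)
    c : ℕ
    c = count S
    c>0 : 0 ℕ.< c
    c>0 = pos c n≤2c
      where pos : ∀ c → n ℕ.≤ 2 ℕ.* c → 0 ℕ.< c
            pos zero h = ⊥-elim (ℕₚ.n≮0 (ℕₚ.<-≤-trans n>0 h))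
            pos (suc c) _ = ℕ.s≤s ℕ.z≤n
    instance
      c-nonZero : ℕ.NonZero c
      c-nonZero = ℕ.>-nonZero c>0
    q r : ℕ
    q = N ℕ./ c
    r = N ℕ.% c
    N≡ : N ≡ q ℕ.* c ℕ.+ r
    N≡ = trans (DM.m≡m%n+[m/n]*n N c) (ℕₚ.+-comm r (q ℕ.* c))
    r<c : r ℕ.< c
    r<c = DM.m%n<n N c
    module B = Balanced (subst (Balanced S q) (sym N≡) (balanced S q r (ℕₚ.<⇒≤ r<c)))
    q≥1 : 1 ℕ.≤ q
    q≥1 = DM.m≥n⇒m/n>0 (ℕₚ.≤-trans (count≤n S) n≤N)
    N≤ : N ℕ.≤ q ℕ.* (2 ℕ.* n)
    N≤ = ℕₚ.≤-trans (ℕₚ.≤-reflexive N≡) (ℕₚ.≤-trans (ℕₚ.+-mono-≤ (ℕₚ.*-monoʳ-≤ q (count≤n S)) (ℕₚ.≤-trans (ℕₚ.<⇒≤ r<c) (ℕₚ.≤-trans (count≤n S) (ℕₚ.≤-trans (ℕₚ.≤-reflexive (sym (ℕₚ.*-identityˡ n))) (ℕₚ.*-monoˡ-≤ n q≥1)))))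
      (ℕₚ.≤-reflexive (arith q n)))
      where arith : ∀ q n → q ℕ.* n ℕ.+ q ℕ.* n ≡ q ℕ.* (2 ℕ.* n)
            arith = NR.solve-∀
    d≤ : d ℕ.≤ q ℕ.* D
    d≤ = ℕₚ.*-cancelˡ-≤ (2 ℕ.* n) {{ℕ.>-nonZero (ℕₚ.<-≤-trans n>0 (ℕₚ.m≤m+n n _))}} (ℕₚ.≤-trans hd (ℕₚ.≤-trans (ℕₚ.*-monoˡ-≤ D N≤) (ℕₚ.≤-reflexive (arith q n D))))
      where arith : ∀ q n D → q ℕ.* (2 ℕ.* n) ℕ.* D ≡ 2 ℕ.* n ℕ.* (q ℕ.* D)
            arith = NR.solve-∀
    bound : ∀ g → g ℕ.≤ (q ℕ.+ 1) ℕ.* (4 ℕ.* l ℕ.+ 4) → g ℕ.* n ℕ.≤ N ℕ.* (16 ℕ.* (l ℕ.+ 1))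
    bound g hg = begin
      g ℕ.* n                                          ≤⟨ ℕₚ.*-mono-≤ hg n≤2c ⟩
      (q ℕ.+ 1) ℕ.* (4 ℕ.* l ℕ.+ 4) ℕ.* (2 ℕ.* c)      ≤⟨ ℕₚ.*-monoˡ-≤ (2 ℕ.* c) (ℕₚ.*-monoˡ-≤ (4 ℕ.* l ℕ.+ 4) (ℕₚ.+-monoʳ-≤ q q≥1)) ⟩
      (q ℕ.+ q) ℕ.* (4 ℕ.* l ℕ.+ 4) ℕ.* (2 ℕ.* c)      ≡⟨ arith q l c ⟩
      q ℕ.* c ℕ.* (16 ℕ.* (l ℕ.+ 1))                   ≤⟨ ℕₚ.*-monoˡ-≤ (16 ℕ.* (l ℕ.+ 1)) (ℕₚ.≤-trans (ℕₚ.m≤m+n (q ℕ.* c) r) (ℕₚ.≤-reflexive (sym N≡))) ⟩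
      N ℕ.* (16 ℕ.* (l ℕ.+ 1)) ∎
      where
      open ℕₚ.≤-Reasoning
      arith : ∀ q l c → (q ℕ.+ q) ℕ.* (4 ℕ.* l ℕ.+ 4) ℕ.* (2 ℕ.* c) ≡ q ℕ.* c ℕ.* (16 ℕ.* (l ℕ.+ 1))
      arith = NR.solve-∀

-- Integer inequalities for the choice of parameters.

module Numerics where

  open import Data.Nat
  open import Data.Nat.Properties
  open import Data.Bool using (T)
  open import Data.Nat.Tactic.RingSolver using (solve-∀)

  p5 : ℕ → ℕ
  p5 x = x * (x * (x * (x * x)))

  ≤! : ∀ {a b} → T (a ≤ᵇ b) → a ≤ b
  ≤! {a} {b} = ≤ᵇ⇒≤ a b

  opaque
    -- A common bound for the numerical factors that the estimates below absorb into `U = 2^m`.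
    big : ℕ
    big = 10000000

    ≤big : ∀ {c} → T (c ≤ᵇ 10000000) → c ≤ big
    ≤big = ≤!

    big≤ : big * p5 64 ≤ 2 ^ 64
    big≤ = ≤ᵇ⇒≤ (10000000 * p5 64) (2 ^ 64) tt

  p5-step : ∀ x → 8 ≤ x → p5 (x + 1) ≤ 2 * p5 x
  p5-step x h = begin
    p5 (x + 1)                                                                ≡⟨ e₁ x ⟩
    p5 x + (5 * x⁴ + (10 * x³ + (10 * x² + (5 * x + 1))))  ≤⟨ +-monoʳ-≤ (p5 x) (begin
      5 * x⁴ + (10 * x³ + (10 * x² + (5 * x + 1)))         ≤⟨ +-monoʳ-≤ (5 * x⁴) (+-monoʳ-≤ (10 * x³) (+-monoʳ-≤ (10 * x²) (begin
        5 * x + 1   ≤⟨ +-monoʳ-≤ (5 * x) (≤-trans (s≤s z≤n) h) ⟩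
        5 * x + x   ≤⟨ ≤-reflexive (e₂ x) ⟩
        6 * x       ≤⟨ *-monoˡ-≤ x (≤-trans (≤! {6} {8} tt) h) ⟩
        x² ∎))) ⟩
      5 * x⁴ + (10 * x³ + (10 * x² + x²))                  ≤⟨ +-monoʳ-≤ (5 * x⁴) (+-monoʳ-≤ (10 * x³) (begin
        10 * x² + x²      ≤⟨ m≤m+n (10 * x² + x²) (5 * x²) ⟩
        10 * x² + x² + 5 * x² ≤⟨ ≤-reflexive (e₃ x²) ⟩
        2 * (8 * x²)      ≤⟨ *-monoʳ-≤ 2 (*-monoˡ-≤ x² h) ⟩
        2 * x³ ∎)) ⟩
      5 * x⁴ + (10 * x³ + 2 * x³)                          ≤⟨ +-monoʳ-≤ (5 * x⁴) (begin
        10 * x³ + 2 * x³   ≤⟨ m≤m+n (10 * x³ + 2 * x³) (4 * x³) ⟩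
        10 * x³ + 2 * x³ + 4 * x³ ≤⟨ ≤-reflexive (e₄ x³) ⟩
        2 * (8 * x³)       ≤⟨ *-monoʳ-≤ 2 (*-monoˡ-≤ x³ h) ⟩
        2 * x⁴ ∎) ⟩
      5 * x⁴ + 2 * x⁴                                      ≤⟨ ≤-reflexive (e₅ x⁴) ⟩
      7 * x⁴                                               ≤⟨ *-monoˡ-≤ x⁴ (≤-trans (≤! {7} {8} tt) h) ⟩
      p5 x ∎) ⟩
    p5 x + p5 x                                                               ≡⟨ e₆ (p5 x) ⟩
    2 * p5 x ∎
    where
    open ≤-Reasoning
    x² x³ x⁴ : ℕ
    x² = x * x
    x³ = x * (x * x)
    x⁴ = x * (x * (x * x))
    e₁ : ∀ x → (x + 1) * ((x + 1) * ((x + 1) * ((x + 1) * (x + 1)))) ≡ x * (x * (x * (x * x))) + (5 * (x * (x * (x * x))) + (10 * (x * (x * x)) + (10 * (x * x) + (5 * x + 1))))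
    e₁ = solve-∀
    e₂ : ∀ x → 5 * x + x ≡ 6 * x
    e₂ = solve-∀
    e₃ : ∀ y → 10 * y + y + 5 * y ≡ 2 * (8 * y)
    e₃ = solve-∀
    e₄ : ∀ y → 10 * y + 2 * y + 4 * y ≡ 2 * (8 * y)
    e₄ = solve-∀
    e₅ : ∀ y → 5 * y + 2 * y ≡ 7 * y
    e₅ = solve-∀
    e₆ : ∀ y → y + y ≡ 2 * y
    e₆ = solve-∀

  threshold : ∀ c → c * p5 64 ≤ 2 ^ 64 → ∀ k → c * p5 (k + 64) ≤ 2 ^ (k + 64)
  threshold c h zero = h
  threshold c h (suc k) = ≤-trans (*-monoʳ-≤ c (subst (λ z → p5 z ≤ 2 * p5 x) (+-comm x 1) (p5-step x (≤-trans (≤! {8} {64} tt) (m≤n+m 64 k)))))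
    (≤-trans (≤-reflexive (sw c (p5 x))) (*-monoʳ-≤ 2 (threshold c h k)))
    where
    x = k + 64
    sw : ∀ c x → c * (2 * x) ≡ 2 * (c * x)
    sw = solve-∀

  lit : ∀ a b c x → a * b ≡ c → a * (b * x) ≡ c * x
  lit a b c x e = trans (sym (*-assoc a b x)) (cong (_* x) e)

  sqrt : ∀ m → ∃ λ s → s * s ≤ m × m < suc s * suc s
  sqrt zero = 0 , z≤n , s≤s z≤n
  sqrt (suc m) = go (sqrt m)
    where
    go : (∃ λ s → s * s ≤ m × m < suc s * suc s) → ∃ λ s → s * s ≤ suc m × suc m < suc s * suc s
    go (s , lo , hi) with suc m <? suc s * suc s
    ... | yes q = s , m≤n⇒m≤1+n lo , q
    ... | no q = suc s , ≮⇒≥ q , ≤-<-trans hi (*-mono-< (n<1+n (suc s)) (n<1+n (suc s)))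

  -- e is about 2^(5m) / √m, E = 96 e, and n = 2^(10m).
  record Scale (m : ℕ) : Set where
    field
      e : ℕ
      m≥1 : 1 ≤ m
      bigU : big * p5 m ≤ 2 ^ m
      U5≤em : p5 (2 ^ m) ≤ e * m
      n≤e²m : p5 (2 ^ m) * p5 (2 ^ m) ≤ e * e * m
      e²m≤n : e * e * m ≤ 16 * (p5 (2 ^ m) * p5 (2 ^ m))
      e≤U5 : e ≤ 2 * p5 (2 ^ m)

  -- With `s` the integer part of `√m`, `e` is one more than the integer part of `2^(5m) / s`;
  -- `m ≤ 4 s²` limits the rounding loss. The offset 64 gives `10000000 m⁵ ≤ 2^m`.
  scale : ∀ k → Scale (k + 64)
  scale k = record { e = e ; m≥1 = m≥1 ; bigU = threshold big big≤ k ; U5≤em = ≤-trans U5≤es (*-monoʳ-≤ e s≤m) ;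
      n≤e²m = ≤-trans (*-mono-≤ U5≤es U5≤es) (≤-trans (≤-reflexive (ar₁ e s)) (*-monoʳ-≤ (e * e) lo)) ;
      e²m≤n = ≤-trans (*-monoʳ-≤ (e * e) m≤4s²) (≤-trans (≤-reflexive (ar₂ e s)) (≤-trans (*-monoʳ-≤ 4 (*-mono-≤ es≤ es≤)) (≤-reflexive (ar₃ U5)))) ;
      e≤U5 = ≤-trans (≤-trans (≤-reflexive (sym (*-identityʳ e))) (*-monoʳ-≤ e s≥1)) es≤ }
    where
    m = k + 64
    m≥1 : 1 ≤ m
    m≥1 = ≤-trans (≤! tt) (m≤n+m 64 k)
    s = proj₁ (sqrt m)
    lo = proj₁ (proj₂ (sqrt m))
    hi = proj₂ (proj₂ (sqrt m))
    s≥1 : 1 ≤ s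
    s≥1 = go s hi
      where go : ∀ s → m < suc s * suc s → 1 ≤ s
            go zero h = ⊥-elim (<-irrefl refl (≤-trans h m≥1))
            go (suc s) _ = s≤s z≤n
    s≤m : s ≤ m
    s≤m = ≤-trans (≤-trans (≤-reflexive (sym (*-identityʳ s))) (*-monoʳ-≤ s s≥1)) lo
    instance
      s-nz : NonZero s
      s-nz = >-nonZero s≥1
    U5 = p5 (2 ^ m)
    q = U5 / s
    e = suc q
    U5≤es : U5 ≤ e * s
    U5≤es = ≤-trans (≤-reflexive (DM.m≡m%n+[m/n]*n U5 s)) (+-monoˡ-≤ (q * s) (<⇒≤ (DM.m%n<n U5 s)))
    m≤U : m ≤ 2 ^ m
    m≤U = go m
      where go : ∀ m → m ≤ 2 ^ m
            go zero = z≤n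
            go (suc m) = ≤-trans (+-mono-≤ (m^n>0 2 m) (go m)) (≤-reflexive (ar (2 ^ m)))
              where ar : ∀ x → x + x ≡ 2 * x
                    ar = solve-∀
    s≤U5 : s ≤ U5
    s≤U5 = ≤-trans s≤m (≤-trans m≤U (≤-trans (≤-reflexive (sym (*-identityʳ (2 ^ m)))) (*-monoʳ-≤ (2 ^ m) (*-mono-≤ u (*-mono-≤ u (*-mono-≤ u u))))))
      where u : 1 ≤ 2 ^ m
            u = m^n>0 2 m
    es≤ : e * s ≤ 2 * U5
    es≤ = ≤-trans (+-mono-≤ s≤U5 (DM.m/n*n≤m U5 s)) (≤-reflexive (ar U5))
      where ar : ∀ x → x + x ≡ 2 * x
            ar = solve-∀
    m≤4s² : m ≤ 4 * (s * s)
    m≤4s² = ≤-trans (<⇒≤ hi) (≤-trans (*-mono-≤ s+1 s+1) (≤-reflexive (ar s)))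
      where
      s+1 : suc s ≤ 2 * s
      s+1 = ≤-trans (+-monoˡ-≤ s s≥1) (≤-reflexive (ar' s))
        where ar' : ∀ s → s + s ≡ 2 * s
              ar' = solve-∀
      ar : ∀ s → 2 * s * (2 * s) ≡ 4 * (s * s)
      ar = solve-∀
    ar₁ : ∀ e s → e * s * (e * s) ≡ e * e * (s * s)
    ar₁ = solve-∀
    ar₂ : ∀ e s → e * e * (4 * (s * s)) ≡ 4 * (e * s * (e * s))
    ar₂ = solve-∀
    ar₃ : ∀ x → 4 * (2 * x * (2 * x)) ≡ 16 * (x * x)
    ar₃ = solve-∀

  module Bounds {m : ℕ} (sc : Scale m) where
    open Scale sc
    open ≤-Reasoning

    -- Opaque, since unfolding multiplies out large literals.
    opaque
      U n E A k l : ℕ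
      U = 2 ^ m
      n = p5 U * p5 U
      -- `96 = 2 · 2 · 24`: as `D ≤ 2 e m` and `θ = 24`, it makes `(1 + 24 ε)^(2 e) ≤ 2` and hence
      -- `P ≤ 2^m`.
      E = 96 * e
      -- In `val-big` the last `44 m E + 1` factors outweigh the first `44 m E`.
      A = suc (44 * m * E + 44 * m * E)
      -- From `22 n P ≤ U · U^10 · U`.
      k = 12 * m
      -- The exponents to be covered are `176 m` for `(1 + ε)^A`, `10 m` for `n`, and 8 for the
      -- constants.
      l = 200 * m

      U≡ : U ≡ 2 ^ m
      U≡ = refl
      n≡ : n ≡ p5 U * p5 U
      n≡ = refl
      E≡ : E ≡ 96 * e
      E≡ = refl
      A≡ : A ≡ suc (44 * m * E + 44 * m * E)
      A≡ = refl
      k≡ : k ≡ 12 * m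
      k≡ = refl
      l≡ : l ≡ 200 * m
      l≡ = refl

      big·m⁵ : big * p5 m ≤ U
      big·m⁵ = bigU
      U5≤em' : p5 U ≤ e * m
      U5≤em' = U5≤em
      n≤e²m' : n ≤ e * e * m
      n≤e²m' = n≤e²m
      e²m≤n' : e * e * m ≤ 16 * n
      e²m≤n' = e²m≤n
      e≤U5' : e ≤ 2 * p5 U
      e≤U5' = e≤U5
      U≥1 : 1 ≤ U
      U≥1 = m^n>0 2 m

    instance
      m-nz : NonZero m
      m-nz = >-nonZero m≥1

    x≤x² : ∀ x → x ≤ x * x
    x≤x² zero = z≤n
    x≤x² (suc x) = ≤-trans (≤-reflexive (sym (*-identityʳ (suc x)))) (*-monoʳ-≤ (suc x) (s≤s z≤n))

    ≤x* : ∀ {x} y → 1 ≤ x → y ≤ x * y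
    ≤x* {x} y h = ≤-trans (≤-reflexive (sym (*-identityˡ y))) (*-monoˡ-≤ y h)

    U5≥1 : 1 ≤ p5 U
    U5≥1 = *-mono-≤ U≥1 (*-mono-≤ U≥1 (*-mono-≤ U≥1 (*-mono-≤ U≥1 U≥1)))

    U≤U5 : U ≤ p5 U
    U≤U5 = ≤-trans (≤-reflexive (sym (*-identityʳ U))) (*-monoʳ-≤ U (*-mono-≤ U≥1 (*-mono-≤ U≥1 (*-mono-≤ U≥1 U≥1))))

    e≥1 : 1 ≤ e
    e≥1 = go e U5≤em'
      where go : ∀ e → p5 U ≤ e * m → 1 ≤ e
            go zero h = ⊥-elim (<-irrefl refl (≤-trans U5≥1 h))
            go (suc e) _ = s≤s z≤n

    E≥1 : 1 ≤ E
    E≥1 = ≤-trans (≤-trans e≥1 (m≤n*m e 96)) (≤-reflexive (sym E≡))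

    instance
      E-nz : NonZero E
      E-nz = >-nonZero E≥1
      TE-nz : NonZero (1440 * E)
      TE-nz = >-nonZero (≤-trans E≥1 (m≤n*m E 1440))

    opaque
      r' Dm : ℕ
      r' = n / E
      -- 1440 serves `room`: `A ≤ 89 m E`, and `32 · 89 = 2 · 1424`.
      Dm = n / (1440 * E)

      r'-lower : r' * E ≤ n
      r'-lower = DM.m/n*n≤m n E
      r'-upper : n ≤ E + r' * E
      r'-upper = ≤-trans (≤-reflexive (DM.m≡m%n+[m/n]*n n E)) (+-monoˡ-≤ (r' * E) (<⇒≤ (DM.m%n<n n E)))
      Dm-lower : Dm * (1440 * E) ≤ n
      Dm-lower = DM.m/n*n≤m n (1440 * E)
      Dm-upper : n ≤ 1440 * E + Dm * (1440 * E)
      Dm-upper = ≤-trans (≤-reflexive (DM.m≡m%n+[m/n]*n n (1440 * E))) (+-monoˡ-≤ (Dm * (1440 * E)) (<⇒≤ (DM.m%n<n n (1440 * E))))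
      Dm-pos : 1440 * E ≤ n → 1 ≤ Dm
      Dm-pos h = DM.m≥n⇒m/n>0 h

    r D₁ D₂ : ℕ
    r = 1 + r'
    -- `r` is at least `ε n`, the bound on the mean size of a neighbourhood; 11 is the loss in
    -- `markov`.
    D₁ = 11 * r
    -- `2^(24 r)` bounds `(1 + 11 ε)^n` and `2^(1 + 10 m)` bounds `n + 1`.
    D₂ = 24 * r + (1 + 10 * m)

    m²≤p5 : m * m ≤ p5 m
    m²≤p5 = *-monoʳ-≤ m (≤-trans (≤-reflexive (sym (*-identityʳ m))) (*-monoʳ-≤ m (*-mono-≤ m≥1 (*-mono-≤ m≥1 m≥1))))

    c·p5≤U : ∀ c → T (c ≤ᵇ 10000000) → c * p5 m ≤ U
    c·p5≤U c h = ≤-trans (*-monoˡ-≤ (p5 m) (≤big {c} h)) big·m⁵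

    c·m²≤U : ∀ c → T (c ≤ᵇ 10000000) → c * (m * m) ≤ U
    c·m²≤U c h = ≤-trans (*-monoʳ-≤ c m²≤p5) (c·p5≤U c h)

    c·m≤U : ∀ c → T (c ≤ᵇ 10000000) → c * m ≤ U
    c·m≤U c h = ≤-trans (*-monoʳ-≤ c (x≤x² m)) (c·m²≤U c h)

    c≤U : ∀ c → T (c ≤ᵇ 10000000) → c ≤ U
    c≤U c h = ≤-trans (≤-trans (≤-reflexive (sym (*-identityʳ c))) (*-monoʳ-≤ c m≥1)) (c·m≤U c h)

    e≤E : e ≤ E
    e≤E = ≤-trans (m≤n*m e 96) (≤-reflexive (sym E≡))

    U5≤Em : p5 U ≤ E * m
    U5≤Em = ≤-trans U5≤em' (*-monoˡ-≤ m e≤E)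

    ≤E : ∀ x → x * m ≤ p5 U → x ≤ E
    ≤E x h = *-cancelʳ-≤ x E m (≤-trans h U5≤Em)

    U³≤U5 : U * (U * U) ≤ p5 U
    U³≤U5 = *-monoʳ-≤ U (*-monoʳ-≤ U (≤-trans (≤-reflexive (sym (*-identityʳ U))) (*-monoʳ-≤ U (*-mono-≤ U≥1 U≥1))))

    cmU²≤E : ∀ c → T (c ≤ᵇ 10000000) → c * m * (U * U) ≤ E
    cmU²≤E c h = ≤E (c * m * (U * U)) (≤-trans (≤-reflexive (ar c m (U * U))) (≤-trans (*-monoˡ-≤ (U * U) (c·m²≤U c h)) U³≤U5))
      where ar : ∀ c m x → c * m * x * m ≡ c * (m * m) * x
            ar = solve-∀

    cU≤E : ∀ c → T (c ≤ᵇ 10000000) → c * U ≤ E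
    cU≤E c h = ≤-trans (*-mono-≤ (≤-trans (≤-reflexive (sym (*-identityʳ c))) (*-monoʳ-≤ c m≥1)) (x≤x² U)) (cmU²≤E c h)

    A≥1 : 1 ≤ A
    A≥1 = ≤-trans (s≤s z≤n) (≤-reflexive (sym A≡))

    A≤ : A ≤ 89 * (m * E)
    A≤ = begin
      A                                             ≡⟨ A≡ ⟩
      1 + (44 * m * E + 44 * m * E)                 ≤⟨ +-monoˡ-≤ (44 * m * E + 44 * m * E) (*-mono-≤ m≥1 E≥1) ⟩
      m * E + (44 * m * E + 44 * m * E)             ≡⟨ ar m E ⟩
      89 * (m * E) ∎
      where ar : ∀ m E → m * E + (44 * m * E + 44 * m * E) ≡ 89 * (m * E)
            ar = solve-∀

    B-θω : 24 * U ≤ E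
    B-θω = cU≤E 24 tt

    B-ω²A : 4 * (U * (U * A)) ≤ E * E
    B-ω²A = begin
      4 * (U * (U * A))                 ≤⟨ *-monoʳ-≤ 4 (*-monoʳ-≤ U (*-monoʳ-≤ U A≤)) ⟩
      4 * (U * (U * (89 * (m * E))))    ≡⟨ ar 4 89 U m E ⟩
      356 * m * (U * U) * E             ≤⟨ *-monoˡ-≤ E (cmU²≤E 356 tt) ⟩
      E * E ∎
      where ar : ∀ a b U m E → a * (U * (U * (b * (m * E)))) ≡ a * b * m * (U * U) * E
            ar = solve-∀

    B-η-small : 4 * (U * (24 * U * k)) ≤ E * E
    B-η-small = begin
      4 * (U * (24 * U * k))            ≡⟨ cong (λ z → 4 * (U * (24 * U * z))) k≡ ⟩
      4 * (U * (24 * U * (12 * m)))     ≡⟨ ar 4 24 12 U m ⟩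
      1152 * m * (U * U)                ≤⟨ cmU²≤E 1152 tt ⟩
      E                                 ≤⟨ x≤x² E ⟩
      E * E ∎
      where ar : ∀ a b c U m → a * (U * (b * U * (c * m))) ≡ a * b * c * m * (U * U)
            ar = solve-∀

    ≤E³ : ∀ x → x * (m * (m * m)) ≤ p5 U * n → x ≤ E * (E * E)
    ≤E³ x h = *-cancelʳ-≤ x (E * (E * E)) (m * (m * m)) {{>-nonZero (*-mono-≤ m≥1 (*-mono-≤ m≥1 m≥1))}} (begin
      x * (m * (m * m))                  ≤⟨ h ⟩
      p5 U * n                           ≡⟨ cong (p5 U *_) n≡ ⟩
      p5 U * (p5 U * p5 U)               ≤⟨ *-mono-≤ U5≤Em (*-mono-≤ U5≤Em U5≤Em) ⟩
      E * m * (E * m * (E * m))          ≡⟨ ar E m ⟩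
      E * (E * E) * (m * (m * m)) ∎)
      where
      ar : ∀ E m → E * m * (E * m * (E * m)) ≡ E * (E * E) * (m * (m * m))
      ar = solve-∀

    U⁴ : ℕ
    U⁴ = U * (U * (U * U))

    B-η : 2 * (n * (2 * U * (24 * U * k * (24 * U * k)))) ≤ E * (E * E)
    B-η = ≤E³ (2 * (n * (2 * U * (24 * U * k * (24 * U * k))))) (begin
      2 * (n * (2 * U * (24 * U * k * (24 * U * k)))) * (m * (m * m)) ≡⟨ ar 24 n U k (m * (m * m)) ⟩
      4 * (24 * 24) * (k * k * (m * (m * m))) * (U * (U * U) * n) ≡⟨ cong (λ z → z * (k * k * (m * (m * m))) * (U * (U * U) * n)) {4 * (24 * 24)} {2304} refl ⟩
      2304 * (k * k * (m * (m * m))) * (U * (U * U) * n)     ≡⟨ cong (λ z → 2304 * (z * z * (m * (m * m))) * (U * (U * U) * n)) k≡ ⟩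
      2304 * (12 * m * (12 * m) * (m * (m * m))) * (U * (U * U) * n) ≡⟨ cong (λ z → 2304 * z * (U * (U * U) * n)) (ar₁ m) ⟩
      2304 * (144 * p5 m) * (U * (U * U) * n)                ≡⟨ cong (_* (U * (U * U) * n)) (lit 2304 144 331776 (p5 m) refl) ⟩
      331776 * p5 m * (U * (U * U) * n)                      ≤⟨ *-mono-≤ (c·p5≤U 331776 tt) (*-monoˡ-≤ n (*-monoʳ-≤ U (*-monoʳ-≤ U (x≤x² U)))) ⟩
      U * (U⁴ * n)                                           ≡⟨ sym (*-assoc U U⁴ n) ⟩
      p5 U * n ∎)
      where
      ar : ∀ a n U k c → 2 * (n * (2 * U * (a * U * k * (a * U * k)))) * c ≡ 4 * (a * a) * (k * k * c) * (U * (U * U) * n)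
      ar = solve-∀
      ar₁ : ∀ m → 12 * m * (12 * m) * (m * (m * m)) ≡ 144 * (m * (m * (m * (m * m))))
      ar₁ = solve-∀

    B-inner : A * (2 + 2 * (l * A)) ≤ 402 * m * (89 * (m * E) * (89 * (m * E)))
    B-inner = begin
      A * (2 + 2 * (l * A))               ≤⟨ *-monoʳ-≤ A (+-monoˡ-≤ (2 * (l * A)) (*-monoʳ-≤ 2 (*-mono-≤ m≥1 A≥1))) ⟩
      A * (2 * (m * A) + 2 * (l * A))     ≡⟨ ar m l A ⟩
      (2 * m + 2 * l) * (A * A)           ≡⟨ cong (λ z → (2 * m + 2 * z) * (A * A)) l≡ ⟩
      (2 * m + 2 * (200 * m)) * (A * A)   ≡⟨ cong (_* (A * A)) (ar₂ m) ⟩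
      402 * m * (A * A)                   ≤⟨ *-monoʳ-≤ (402 * m) (*-mono-≤ A≤ A≤) ⟩
      402 * m * (89 * (m * E) * (89 * (m * E))) ∎
      where
      ar : ∀ m l A → A * (2 * (m * A) + 2 * (l * A)) ≡ (2 * m + 2 * l) * (A * A)
      ar = solve-∀
      ar₂ : ∀ m → 2 * m + 2 * (200 * m) ≡ 402 * m
      ar₂ = solve-∀

    -- The constant `4 · 402 · 89² = 12736968` in `B-sq₂` exceeds `big`; its factor 2 is absorbed by
    -- another `m`.
    m≥2 : 2 ≤ m
    m≥2 = go m (≤-trans (c≤U 3 tt) (≤-reflexive U≡))
      where go : ∀ m → 3 ≤ 2 ^ m → 2 ≤ m
            go zero h = ⊥-elim (<-irrefl refl (≤-trans h (s≤s z≤n)))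
            go (suc zero) h = ⊥-elim (<-irrefl refl h)
            go (suc (suc m)) h = s≤s (s≤s z≤n)

    B-sq₁ : 4 * (U⁴ * (n * (2 * l * (2 * l)))) ≤ E * (E * E)
    B-sq₁ = ≤E³ (4 * (U⁴ * (n * (2 * l * (2 * l))))) (begin
      4 * (U⁴ * (n * (2 * l * (2 * l)))) * (m * (m * m))    ≡⟨ ar U⁴ n l (m * (m * m)) ⟩
      16 * (l * l * (m * (m * m))) * (U⁴ * n)               ≡⟨ cong (λ z → 16 * (z * z * (m * (m * m))) * (U⁴ * n)) l≡ ⟩
      16 * (200 * m * (200 * m) * (m * (m * m))) * (U⁴ * n) ≡⟨ cong (λ z → 16 * z * (U⁴ * n)) (ar₃ m) ⟩
      16 * (40000 * p5 m) * (U⁴ * n)                        ≡⟨ cong (_* (U⁴ * n)) (lit 16 40000 640000 (p5 m) refl) ⟩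
      640000 * p5 m * (U⁴ * n)                              ≤⟨ *-monoˡ-≤ (U⁴ * n) (c·p5≤U 640000 tt) ⟩
      U * (U⁴ * n)                                          ≡⟨ sym (*-assoc U U⁴ n) ⟩
      p5 U * n ∎)
      where
      ar : ∀ u n l c → 4 * (u * (n * (2 * l * (2 * l)))) * c ≡ 16 * (l * l * c) * (u * n)
      ar = solve-∀
      ar₃' : ∀ a m → a * m * (a * m) * (m * (m * m)) ≡ a * a * (m * (m * (m * (m * m))))
      ar₃' = solve-∀
      ar₃ : ∀ m → 200 * m * (200 * m) * (m * (m * m)) ≡ 40000 * p5 m
      ar₃ m = trans (ar₃' 200 m) (cong (_* p5 m) {200 * 200} {40000} refl)

    B-sq₂ : 4 * (U⁴ * (A * (2 + 2 * (l * A)))) ≤ E * (E * E)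
    B-sq₂ = begin
      4 * (U⁴ * (A * (2 + 2 * (l * A))))                            ≤⟨ *-monoʳ-≤ 4 (*-monoʳ-≤ U⁴ B-inner) ⟩
      4 * (U⁴ * (402 * m * (89 * (m * E) * (89 * (m * E)))))        ≡⟨ ar 4 402 89 U⁴ m E ⟩
      4 * 402 * (89 * 89) * (m * (m * m)) * U⁴ * (E * E)            ≡⟨ cong (λ z → z * (m * (m * m)) * U⁴ * (E * E)) {4 * 402 * (89 * 89)} {6368484 * 2} refl ⟩
      6368484 * 2 * (m * (m * m)) * U⁴ * (E * E)                    ≡⟨ cong (λ z → z * U⁴ * (E * E)) (*-assoc 6368484 2 (m * (m * m))) ⟩
      6368484 * (2 * (m * (m * m))) * U⁴ * (E * E)                  ≤⟨ *-monoˡ-≤ (E * E) (≤E (6368484 * (2 * (m * (m * m))) * U⁴) (begin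
        6368484 * (2 * (m * (m * m))) * U⁴ * m                      ≡⟨ ar₂ 6368484 (m * (m * m)) U⁴ m ⟩
        6368484 * (2 * (m * (m * (m * m)))) * U⁴                                     ≤⟨ *-monoˡ-≤ U⁴ (≤-trans (*-monoʳ-≤ 6368484 (*-monoˡ-≤ (m * (m * (m * m))) m≥2)) (c·p5≤U 6368484 tt)) ⟩
        U * U⁴ ∎)) ⟩
      E * (E * E) ∎
      where
      ar : ∀ c a b u m E → c * (u * (a * m * (b * (m * E) * (b * (m * E))))) ≡ c * a * (b * b) * (m * (m * m)) * u * (E * E)
      ar = solve-∀
      ar₂ : ∀ c x u m → c * (2 * x) * u * m ≡ c * (2 * (m * x)) * u
      ar₂ = solve-∀

    B-sq : 2 * (U⁴ * (n * (2 * l * (2 * l)) + A * (2 + 2 * (l * A)))) ≤ E * (E * E)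
    B-sq = *-cancelˡ-≤ 2 (begin
      2 * (2 * (U⁴ * (n * (2 * l * (2 * l)) + A * (2 + 2 * (l * A)))))     ≡⟨ ar₀ U⁴ (n * (2 * l * (2 * l))) (A * (2 + 2 * (l * A))) ⟩
      4 * (U⁴ * (n * (2 * l * (2 * l)))) + 4 * (U⁴ * (A * (2 + 2 * (l * A)))) ≤⟨ +-mono-≤ B-sq₁ B-sq₂ ⟩
      E * (E * E) + E * (E * E)                                            ≡⟨ ar₁ (E * (E * E)) ⟩
      2 * (E * (E * E)) ∎)
      where
      ar₀ : ∀ u x y → 2 * (2 * (u * (x + y))) ≡ 4 * (u * x) + 4 * (u * y)
      ar₀ = solve-∀
      ar₁ : ∀ x → x + x ≡ 2 * x
      ar₁ = solve-∀

    n≤rE : n ≤ r * E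
    n≤rE = r'-upper

    96r'≤em : 96 * r' ≤ e * m
    96r'≤em = *-cancelʳ-≤ (96 * r') (e * m) e {{>-nonZero e≥1}} (begin
      96 * r' * e           ≡⟨ ar r' e ⟩
      r' * (96 * e)         ≡⟨ cong (r' *_) (sym E≡) ⟩
      r' * E                ≤⟨ r'-lower ⟩
      n                     ≤⟨ n≤e²m' ⟩
      e * e * m             ≡⟨ ar₂ e m ⟩
      e * m * e ∎)
      where
      ar : ∀ r e → 96 * r * e ≡ r * (96 * e)
      ar = solve-∀
      ar₂ : ∀ e m → e * e * m ≡ e * m * e
      ar₂ = solve-∀

    D≤ : D₁ + D₂ ≤ 2 * e * m
    D≤ = begin
      11 * (1 + r') + (24 * (1 + r') + (1 + 10 * m))   ≡⟨ ar r' m ⟩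
      35 * r' + (36 + 10 * m)                          ≤⟨ +-mono-≤ (≤-trans (*-monoˡ-≤ r' (≤! {35} {96} tt)) 96r'≤em) rest ⟩
      e * m + e * m                                    ≡⟨ ar₂ e m ⟩
      2 * e * m ∎
      where
      ar : ∀ r m → 11 * (1 + r) + (24 * (1 + r) + (1 + 10 * m)) ≡ 35 * r + (36 + 10 * m)
      ar = solve-∀
      ar₂ : ∀ e m → e * m + e * m ≡ 2 * e * m
      ar₂ = solve-∀
      ar₃ : ∀ m → 36 * m + 10 * m ≡ 46 * m
      ar₃ = solve-∀
      rest : 36 + 10 * m ≤ e * m
      rest = begin
        36 + 10 * m          ≤⟨ +-monoˡ-≤ (10 * m) (*-monoʳ-≤ 36 m≥1) ⟩
        36 * m + 10 * m      ≡⟨ ar₃ m ⟩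
        46 * m               ≤⟨ c·m≤U 46 tt ⟩
        U                    ≤⟨ U≤U5 ⟩
        p5 U                 ≤⟨ U5≤em' ⟩
        e * m ∎

    D≤A : D₁ + D₂ ≤ A
    D≤A = begin
      D₁ + D₂                                ≤⟨ D≤ ⟩
      2 * e * m                              ≤⟨ m≤m+n (2 * e * m) (2 * (2111 * e * m)) ⟩
      2 * e * m + 2 * (2111 * e * m)         ≡⟨ ar 2111 e m ⟩
      2 * (1 + 2111) * (e * m)               ≡⟨ cong (_* (e * m)) {2 * (1 + 2111)} {44 * 96} refl ⟩
      44 * 96 * (e * m)                      ≡⟨ ar₂ 44 96 e m ⟩
      44 * m * (96 * e)                      ≡⟨ cong (44 * m *_) (sym E≡) ⟩
      44 * m * E                             ≤⟨ m≤m+n (44 * m * E) (44 * m * E) ⟩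
      44 * m * E + 44 * m * E                ≤⟨ n≤1+n _ ⟩
      suc (44 * m * E + 44 * m * E)          ≡⟨ sym A≡ ⟩
      A ∎
      where
      ar : ∀ a e m → 2 * e * m + 2 * (a * e * m) ≡ 2 * (1 + a) * (e * m)
      ar = solve-∀
      ar₂ : ∀ a b e m → a * b * (e * m) ≡ a * m * (b * e)
      ar₂ = solve-∀

    E≤U5 : E ≤ 192 * p5 U
    E≤U5 = begin
      E                    ≡⟨ E≡ ⟩
      96 * e               ≤⟨ *-monoʳ-≤ 96 e≤U5' ⟩
      96 * (2 * p5 U)      ≡⟨ lit 96 2 192 (p5 U) refl ⟩
      192 * p5 U ∎

    TE≤ : 1440 * E ≤ 276480 * p5 U
    TE≤ = ≤-trans (*-monoʳ-≤ 1440 E≤U5) (≤-reflexive (lit 1440 192 276480 (p5 U) refl))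

    TE≤n : 1440 * E ≤ n
    TE≤n = begin
      1440 * E             ≤⟨ TE≤ ⟩
      276480 * p5 U        ≤⟨ *-monoˡ-≤ (p5 U) (≤-trans (c≤U 276480 tt) U≤U5) ⟩
      p5 U * p5 U          ≡⟨ sym n≡ ⟩
      n ∎

    Dm≥1 : 1 ≤ Dm
    Dm≥1 = Dm-pos TE≤n

    n≤2TDm : n ≤ 2 * (1440 * E) * Dm
    n≤2TDm = begin
      n                                      ≤⟨ Dm-upper ⟩
      1440 * E + Dm * (1440 * E)             ≤⟨ +-monoˡ-≤ (Dm * (1440 * E)) (≤x* (1440 * E) Dm≥1) ⟩
      Dm * (1440 * E) + Dm * (1440 * E)      ≡⟨ ar Dm (1440 * E) ⟩
      2 * (1440 * E) * Dm ∎
      where ar : ∀ d t → d * t + d * t ≡ 2 * t * d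
            ar = solve-∀

    n≥1 : 1 ≤ n
    n≥1 = ≤-trans (*-mono-≤ U5≥1 U5≥1) (≤-reflexive (sym n≡))

    -- 1223059046400 = 16 · (2 · 1440 · 96)².
    mn≤Dm² : m * n ≤ 1223059046400 * (Dm * Dm)
    mn≤Dm² = *-cancelʳ-≤ (m * n) (1223059046400 * (Dm * Dm)) n {{>-nonZero n≥1}} (begin
      m * n * n                                                  ≡⟨ *-assoc m n n ⟩
      m * (n * n)                                                ≤⟨ *-monoʳ-≤ m (*-mono-≤ n≤2TDm n≤2TDm) ⟩
      m * (2 * (1440 * E) * Dm * (2 * (1440 * E) * Dm))          ≡⟨ ar 1440 m E Dm ⟩
      4 * (1440 * 1440) * (Dm * Dm) * (m * (E * E))              ≡⟨ cong (λ z → z * (Dm * Dm) * (m * (E * E))) {4 * (1440 * 1440)} {8294400} refl ⟩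
      8294400 * (Dm * Dm) * (m * (E * E))                        ≡⟨ cong (λ z → 8294400 * (Dm * Dm) * (m * (z * z))) E≡ ⟩
      8294400 * (Dm * Dm) * (m * (96 * e * (96 * e)))            ≡⟨ cong (8294400 * (Dm * Dm) *_) (trans (ar₁ 96 m e) (cong (_* (e * e * m)) {96 * 96} {9216} refl)) ⟩
      8294400 * (Dm * Dm) * (9216 * (e * e * m))                 ≤⟨ *-monoʳ-≤ (8294400 * (Dm * Dm)) (*-monoʳ-≤ 9216 e²m≤n') ⟩
      8294400 * (Dm * Dm) * (9216 * (16 * n))                    ≡⟨ ar₂ 8294400 9216 16 (Dm * Dm) n ⟩
      8294400 * (9216 * 16) * (Dm * Dm) * n                      ≡⟨ cong (λ z → z * (Dm * Dm) * n) {8294400 * (9216 * 16)} {1223059046400} refl ⟩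
      1223059046400 * (Dm * Dm) * n ∎)
      where
      ar : ∀ t m E d → m * (2 * (t * E) * d * (2 * (t * E) * d)) ≡ 4 * (t * t) * (d * d) * (m * (E * E))
      ar = solve-∀
      ar₁ : ∀ t m e → m * (t * e * (t * e)) ≡ t * t * (e * e * m)
      ar₁ = solve-∀
      ar₂ : ∀ a b c x n → a * x * (b * (c * n)) ≡ a * (b * c) * x * n
      ar₂ = solve-∀

    U5≤Dm : p5 U ≤ 552960 * Dm
    U5≤Dm = *-cancelʳ-≤ (p5 U) (552960 * Dm) (p5 U) {{>-nonZero U5≥1}} (begin
      p5 U * p5 U                    ≡⟨ sym n≡ ⟩
      n                              ≤⟨ n≤2TDm ⟩
      2 * (1440 * E) * Dm            ≤⟨ *-monoˡ-≤ Dm (*-monoʳ-≤ 2 TE≤) ⟩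
      2 * (276480 * p5 U) * Dm       ≡⟨ ar 2 276480 (p5 U) Dm ⟩
      2 * 276480 * Dm * p5 U         ≡⟨ cong (λ z → z * Dm * p5 U) {2 * 276480} {552960} refl ⟩
      552960 * Dm * p5 U ∎)
      where
      ar : ∀ a b x d → a * (b * x) * d ≡ a * b * d * x
      ar = solve-∀

    small : 2 * m * 2 ^ (2 * m) ≤ 4 * Dm
    small = *-cancelˡ-≤ 552960 (begin
      552960 * (2 * m * 2 ^ (2 * m))     ≡⟨ cong (λ z → 552960 * (2 * m * z)) pw ⟩
      552960 * (2 * m * (U * U))         ≡⟨ ar 552960 2 m (U * U) ⟩
      552960 * 2 * m * (U * U)           ≡⟨ cong (λ z → z * m * (U * U)) {552960 * 2} {1105920} refl ⟩
      1105920 * m * (U * U)              ≤⟨ *-monoˡ-≤ (U * U) (c·m≤U 1105920 tt) ⟩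
      U * (U * U)                        ≤⟨ U³≤U5 ⟩
      p5 U                               ≤⟨ U5≤Dm ⟩
      552960 * Dm                        ≤⟨ *-monoʳ-≤ 552960 (m≤n*m Dm 4) ⟩
      552960 * (4 * Dm) ∎)
      where
      ar : ∀ a b m x → a * (b * m * x) ≡ a * b * m * x
      ar = solve-∀
      pw : 2 ^ (2 * m) ≡ U * U
      pw = trans (cong (λ z → 2 ^ (m + z)) (+-identityʳ m)) (trans (^-distribˡ-+-* 2 m m) (sym (cong₂ _*_ U≡ U≡)))

    room : 32 * Dm * A ≤ n * (2 * m)
    room = begin
      32 * Dm * A                     ≤⟨ *-monoʳ-≤ (32 * Dm) A≤ ⟩
      32 * Dm * (89 * (m * E))        ≡⟨ ar 32 89 Dm m E ⟩
      32 * 89 * (m * (E * Dm))        ≡⟨ cong (_* (m * (E * Dm))) {32 * 89} {2 * 1424} refl ⟩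
      2 * 1424 * (m * (E * Dm))       ≡⟨ ar₃ 2 1424 m (E * Dm) ⟩
      2 * (m * (1424 * (E * Dm)))     ≤⟨ *-monoʳ-≤ 2 (*-monoʳ-≤ m (*-monoˡ-≤ (E * Dm) (≤! {1424} {1440} tt))) ⟩
      2 * (m * (1440 * (E * Dm)))     ≡⟨ ar₁ 1440 m E Dm ⟩
      2 * (m * (Dm * (1440 * E)))     ≤⟨ *-monoʳ-≤ 2 (*-monoʳ-≤ m Dm-lower) ⟩
      2 * (m * n)                     ≡⟨ ar₂ m n ⟩
      n * (2 * m) ∎
      where
      ar : ∀ a b d m E → a * d * (b * (m * E)) ≡ a * b * (m * (E * d))
      ar = solve-∀
      ar₃ : ∀ a b m x → a * b * (m * x) ≡ a * (m * (b * x))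
      ar₃ = solve-∀
      ar₁ : ∀ t m E d → 2 * (m * (t * (E * d))) ≡ 2 * (m * (d * (t * E)))
      ar₁ = solve-∀
      ar₂ : ∀ m n → 2 * (m * n) ≡ n * (2 * m)
      ar₂ = solve-∀

-- The parameters satisfy all requirements, one graph for each m.

module Family where

  open Rationals
  open Measures using (0<*⇒0<ˡ)
  open Growth
  open SparseGraphs
  open BlowUpGraphs
  open import Data.Rational.Properties

  module Instance {m : ℕ} (sc : Numerics.Scale m) where
    open Numerics.Scale sc using (e; m≥1)
    open Numerics.Bounds sc
    open ≤-Reasoning

    u x ε ω γ η σ ℓ₁ ℓ₂ ε³ : ℚ
    u = ι U
    x = ι E
    ε = inv x
    ω = ε * u
    γ = u * (ω * (ω * ω))
    η = 2ℚ * ω * ((2ℚ * ι 12 * ω * ι k) * (2ℚ * ι 12 * ω * ι k))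
    σ = inv (1ℚ + - 1ℚ * ε)
    ℓ₁ = inv (2ℚ ^ (11 ℕ.* m))
    ℓ₂ = inv (2ℚ ^ l)
    ε³ = ε * (ε * ε)

    par : Params
    par = record { n = n ; s = A ; k = k ; D₁ = D₁ ; D₂ = D₂ ; λ₂ = l ; h' = 11 ; ε = ε ; ω = ω ; M = u ; γ = γ ; η = η ; σ = σ ; ℓ₁ = ℓ₁ ; ℓ₂ = ℓ₂ }

    x>0 : 0ℚ < x
    x>0 = ι>0 E≥1

    xε : x * ε ≡ 1ℚ
    xε = inv-r x>0

    ε>0 : 0ℚ < ε
    ε>0 = inv-pos x>0

    ε≥0 : 0ℚ ≤ ε
    ε≥0 = <⇒≤ ε>0

    frac₁ : ∀ a → a ℕ.≤ E → ι a * ε ≤ 1ℚ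
    frac₁ a h = ≤-trans (*-monoʳ ε≥0 (ι-mono h)) (≤-reflexive xε)

    frac₂ : ∀ a → a ℕ.≤ E ℕ.* E → ι a * (ε * ε) ≤ 1ℚ
    frac₂ a h = ≤-trans (*-monoʳ (nn* ε≥0 ε≥0) (ι-mono h)) (≤-reflexive (trans (cong (_* (ε * ε)) (ι-* E E)) (trans (e₁ x ε) (cong₂ _*_ xε xε))))
      where e₁ : ∀ x e → x * x * (e * e) ≡ x * e * (x * e)
            e₁ = solve-∀ ringℚ

    frac₃ : ∀ a → a ℕ.≤ E ℕ.* (E ℕ.* E) → ι a * ε³ ≤ 1ℚ
    frac₃ a h = ≤-trans (*-monoʳ (nn* ε≥0 (nn* ε≥0 ε≥0)) (ι-mono h)) (≤-reflexive (trans (cong (_* ε³) (trans (ι-* E (E ℕ.* E)) (cong (x *_) (ι-* E E)))) (trans (e₁ x ε) (trans (cong₂ (λ a b → a * (b * b)) xε xε) refl))))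
      where e₁ : ∀ x e → x * (x * x) * (e * (e * e)) ≡ x * e * (x * e * (x * e))
            e₁ = solve-∀ ringℚ

    ι3 : ∀ a b c → ι (a ℕ.* (b ℕ.* c)) ≡ ι a * (ι b * ι c)
    ι3 a b c = trans (ι-* a (b ℕ.* c)) (cong (ι a *_) (ι-* b c))

    ι4 : ∀ a b c d → ι (a ℕ.* (b ℕ.* (c ℕ.* d))) ≡ ι a * (ι b * (ι c * ι d))
    ι4 a b c d = trans (ι-* a (b ℕ.* (c ℕ.* d))) (cong (ι a *_) (ι3 b c d))

    u≥0 : 0ℚ ≤ u
    u≥0 = ι≥0 U

    ω≥0 : 0ℚ ≤ ω
    ω≥0 = nn* ε≥0 u≥0

    24ω≤1 : 2ℚ * (ι 12 * ω) ≤ 1ℚ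
    24ω≤1 = ≤-trans (≤-reflexive (trans (e₁ ε u) (cong (_* ε) (sym (ι-* 24 U))))) (frac₁ (24 ℕ.* U) B-θω)
      where e₁ : ∀ e u → 2ℚ * (ι 12 * (e * u)) ≡ ι 24 * u * e
            e₁ = solve-∀ ringℚ

    ε≤1 : ε ≤ 1ℚ
    ε≤1 = ≤-trans (≤-trans (≤-reflexive (sym (*-identityˡ ε))) (≤-reflexive (cong (_* ε) (sym (+-identityʳ 1ℚ))))) (frac₁ 1 E≥1)

    2ε≤1 : 2ℚ * ε ≤ 1ℚ
    2ε≤1 = frac₁ 2 (ℕₚ.≤-trans (ℕₚ.≤-trans (Numerics.≤! {2} {24} tt) (ℕₚ.≤-trans (ℕₚ.≤-reflexive (sym (ℕₚ.*-identityʳ 24))) (ℕₚ.*-monoʳ-≤ 24 U≥1))) B-θω)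

    1-ε>0 : 0ℚ < 1ℚ + - 1ℚ * ε
    1-ε>0 = 0<*⇒0<ˡ 0≤2 (<-≤-trans 0<1 (≤⁺ (p≤q⇒0≤q-p 2ε≤1) (e₁ ε)))
      where e₁ : ∀ e → (1ℚ + - 1ℚ * e) * 2ℚ ≡ 1ℚ + (1ℚ - 2ℚ * e)
            e₁ = solve-∀ ringℚ

    σ-def : σ * (1ℚ + - 1ℚ * ε) ≡ 1ℚ
    σ-def = trans (*-comm σ _) (inv-r 1-ε>0)

    u≡2^m : u ≡ 2ℚ ^ m
    u≡2^m = trans (cong ι U≡) (ι-^ 2 m)

    2^[c*m] : ∀ c → 2ℚ ^ (c ℕ.* m) ≡ u ^ c
    2^[c*m] c = trans (^-^ 2ℚ c m) (cong (_^ c) (sym u≡2^m))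

    ιn : ι n ≡ u ^ 10
    ιn = trans (cong ι n≡) (trans (ι-* (Numerics.p5 U) (Numerics.p5 U)) (trans (cong₂ _*_ p p) (e₁ u)))
      where
      p : ι (Numerics.p5 U) ≡ u * (u * (u * (u * u)))
      p = trans (ι4 U U U (U ℕ.* U)) (cong (λ z → u * (u * (u * z))) (ι-* U U))
      e₁ : ∀ u → u * (u * (u * (u * u))) * (u * (u * (u * (u * u)))) ≡ u * (u * (u * (u * (u * (u * (u * (u * (u * (u * 1ℚ)))))))))
      e₁ = solve-∀ ringℚ

    -- Each block of `a e` factors is at most 2 by `^≤2`, since `2 a e c ε ≤ 96 e ε = 1`; there are
    -- at most `b` blocks.
    power : ∀ a b j c → 0ℚ ≤ c → c ≤ x → j ℕ.≤ b ℕ.* (a ℕ.* e) → 2ℚ * (ι a * c) ≤ ι 96 → (1ℚ + c * ε) ^ j ≤ 2ℚ ^ b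
    power a b j c hc c≤x hj h = begin
      y ^ j                         ≤⟨ ^-monoʳ y≥1 hj ⟩
      y ^ (b ℕ.* (a ℕ.* e))         ≡⟨ ^-^ y b (a ℕ.* e) ⟩
      (y ^ (a ℕ.* e)) ^ b           ≤⟨ ^-mono b (^-nn (a ℕ.* e) (≤-trans 0≤1 y≥1)) (^≤2 (a ℕ.* e) (nn* hc ε≥0) (≤-trans (*-monoʳ ε≥0 c≤x) (≤-reflexive xε)) le) ⟩
      2ℚ ^ b ∎
      where
      y = 1ℚ + c * ε
      y≥1 : 1ℚ ≤ y
      y≥1 = ≤⁺ (nn* hc ε≥0) refl
      e₁ : ∀ a e c i → 2ℚ * (a * e * (c * i)) ≡ 2ℚ * (a * c) * (e * i)
      e₁ = solve-∀ ringℚ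
      le : 2ℚ * (ι (a ℕ.* e) * (c * ε)) ≤ 1ℚ
      le = begin
        2ℚ * (ι (a ℕ.* e) * (c * ε))   ≡⟨ cong (λ z → 2ℚ * (z * (c * ε))) (ι-* a e) ⟩
        2ℚ * (ι a * ι e * (c * ε))     ≡⟨ e₁ (ι a) (ι e) c ε ⟩
        2ℚ * (ι a * c) * (ι e * ε)     ≤⟨ *-monoʳ (nn* (ι≥0 e) ε≥0) h ⟩
        ι 96 * (ι e * ε)               ≡⟨ trans (sym (*-assoc (ι 96) (ι e) ε)) (cong (_* ε) (sym (trans (cong ι E≡) (ι-* 96 e)))) ⟩
        x * ε                          ≡⟨ xε ⟩
        1ℚ ∎

    24≤x : ι 24 ≤ x
    24≤x = ι-mono (ℕₚ.≤-trans (ℕₚ.≤-trans (ℕₚ.≤-reflexive (sym (ℕₚ.*-identityʳ 24))) (ℕₚ.*-monoʳ-≤ 24 U≥1)) B-θω)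

    P : ℚ
    P = (1ℚ + 2ℚ * ι 12 * ε) ^ (D₁ ℕ.+ D₂)

    P≤u : P ≤ u
    P≤u = ≤-trans (power 2 m (D₁ ℕ.+ D₂) (2ℚ * ι 12) (nn* 0≤2 (ι≥0 12)) 24≤x (ℕₚ.≤-trans D≤ (ℕₚ.≤-reflexive (ℕₚ.*-comm (2 ℕ.* e) m))) ≤-refl) (≤-reflexive (sym u≡2^m))

    P≥0 : 0ℚ ≤ P
    P≥0 = ^-nn (D₁ ℕ.+ D₂) (nn+ 0≤1 (nn* (nn* 0≤2 (ι≥0 12)) ε≥0))

    mass-def : 4ℚ * (ι n * P) ≤ u ^ 12
    mass-def = begin
      4ℚ * (ι n * P)       ≤⟨ *-mono 0≤4 (nn* (ι≥0 n) u≥0) (ι-mono (c≤U 4 tt)) (*-monoˡ (ι≥0 n) P≤u) ⟩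
      u * (ι n * u)        ≡⟨ cong (λ z → u * (z * u)) ιn ⟩
      u * (u ^ 10 * u)     ≡⟨ cong (u *_) (*-comm (u ^ 10) u) ⟩
      u ^ 12 ∎

    k-def : ι 11 * (ι n * (2ℚ * P)) ≤ 2ℚ ^ k
    k-def = begin
      ι 11 * (ι n * (2ℚ * P))     ≡⟨ e₁ (ι n) P ⟩
      ι 22 * (ι n * P)            ≤⟨ *-mono (ι≥0 22) (nn* (ι≥0 n) u≥0) (ι-mono (c≤U 22 tt)) (*-monoˡ (ι≥0 n) P≤u) ⟩
      u * (ι n * u)               ≡⟨ trans (cong (λ z → u * (z * u)) ιn) (cong (u *_) (*-comm (u ^ 10) u)) ⟩
      u ^ 12                      ≡⟨ sym (2^[c*m] 12) ⟩
      2ℚ ^ (12 ℕ.* m)             ≡⟨ cong (2ℚ ^_) (sym k≡) ⟩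
      2ℚ ^ k ∎
      where e₁ : ∀ n P → ι 11 * (n * (2ℚ * P)) ≡ ι 22 * (n * P)
            e₁ = solve-∀ ringℚ

    Λ₁>0 : 0ℚ < 2ℚ ^ (11 ℕ.* m)
    Λ₁>0 = ^-pos (11 ℕ.* m) 0<2

    growth₁ : ι n * (ι 11 * (4ℚ * ℓ₁)) ≤ 1ℚ
    growth₁ = begin
      ι n * (ι 11 * (4ℚ * ℓ₁))      ≡⟨ e₁ (ι n) ℓ₁ ⟩
      ι 44 * ι n * ℓ₁               ≤⟨ *-monoʳ (<⇒≤ (inv-pos Λ₁>0)) (*-mono (ι≥0 44) (≤-trans (ι≥0 n) (≤-reflexive ιn)) (ι-mono (c≤U 44 tt)) (≤-reflexive ιn)) ⟩
      u ^ 11 * ℓ₁                   ≡⟨ cong (_* ℓ₁) (sym (2^[c*m] 11)) ⟩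
      2ℚ ^ (11 ℕ.* m) * ℓ₁          ≡⟨ inv-r Λ₁>0 ⟩
      1ℚ ∎
      where e₁ : ∀ n l → n * (ι 11 * (4ℚ * l)) ≡ ι 44 * n * l
            e₁ = solve-∀ ringℚ

    y^A : (1ℚ + 1ℚ * ε) ^ A ≤ 2ℚ ^ suc (176 ℕ.* m)
    y^A = begin
      (1ℚ + 1ℚ * ε) ^ A                                   ≡⟨ cong ((1ℚ + 1ℚ * ε) ^_) A≡ ⟩
      (1ℚ + 1ℚ * ε) * (1ℚ + 1ℚ * ε) ^ (44 ℕ.* m ℕ.* E ℕ.+ 44 ℕ.* m ℕ.* E)
        ≤⟨ *-mono (nn+ 0≤1 (nn* 0≤1 ε≥0)) (^-nn (176 ℕ.* m) 0≤2) (+-monoʳ-≤ 1ℚ (≤-trans (≤-reflexive (*-identityˡ ε)) ε≤1))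
             (power 48 (176 ℕ.* m) (44 ℕ.* m ℕ.* E ℕ.+ 44 ℕ.* m ℕ.* E) 1ℚ 0≤1 (≤-trans (ι-mono {1} {24} (ℕ.s≤s ℕ.z≤n)) 24≤x) (ℕₚ.≤-reflexive eq) ≤-refl) ⟩
      2ℚ * 2ℚ ^ (176 ℕ.* m) ∎
      where
      ar : ∀ a b m e → a ℕ.* m ℕ.* (b ℕ.* e) ℕ.+ a ℕ.* m ℕ.* (b ℕ.* e) ≡ (2 ℕ.* a ℕ.* b) ℕ.* (m ℕ.* e)
      ar = NR.solve-∀
      ar₂ : ∀ a b m e → a ℕ.* b ℕ.* (m ℕ.* e) ≡ a ℕ.* m ℕ.* (b ℕ.* e)
      ar₂ = NR.solve-∀
      eq : 44 ℕ.* m ℕ.* E ℕ.+ 44 ℕ.* m ℕ.* E ≡ 176 ℕ.* m ℕ.* (48 ℕ.* e)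
      eq = trans (cong (λ z → 44 ℕ.* m ℕ.* z ℕ.+ 44 ℕ.* m ℕ.* z) E≡) (trans (ar 44 96 m e) (trans (cong (ℕ._* (m ℕ.* e)) {2 ℕ.* 44 ℕ.* 96} {176 ℕ.* 48} refl) (ar₂ 176 48 m e)))

    ℓ₂>0 : 0ℚ < ℓ₂
    ℓ₂>0 = inv-pos (^-pos l 0<2)

    ℓ₂-def : ℓ₂ * 2ℚ ^ l ≡ 1ℚ
    ℓ₂-def = trans (*-comm ℓ₂ (2ℚ ^ l)) (inv-r (^-pos l 0<2))

    growth₂ : ι n * (ι 11 * (2ℚ * (ℓ₂ * (2ℚ * (1ℚ + 1ℚ * ε) ^ A + 1ℚ)))) ≤ 1ℚ
    growth₂ = begin
      ι n * (ι 11 * (2ℚ * (ℓ₂ * (2ℚ * (1ℚ + 1ℚ * ε) ^ A + 1ℚ))))     ≡⟨ e₁ (ι n) ℓ₂ (2ℚ * (1ℚ + 1ℚ * ε) ^ A + 1ℚ) ⟩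
      ι 22 * ι n * (2ℚ * (1ℚ + 1ℚ * ε) ^ A + 1ℚ) * ℓ₂                ≤⟨ *-monoʳ (<⇒≤ ℓ₂>0) (*-mono (nn* (ι≥0 22) (ι≥0 n)) (nn* 0≤2 (nn* 0≤2 (nn* 0≤2 (^-nn (176 ℕ.* m) 0≤2)))) (*-mono (ι≥0 22) (^-nn 10 u≥0) (ι-mono {22} {32} (ℕₚ.m≤m+n 22 10)) (≤-reflexive ιn)) inner) ⟩
      ι 32 * u ^ 10 * (2ℚ * (2ℚ * (2ℚ * 2ℚ ^ (176 ℕ.* m)))) * ℓ₂      ≡⟨ cong (_* ℓ₂) (trans (e₂ (u ^ 10) (2ℚ ^ (176 ℕ.* m))) (cong (λ z → 2ℚ ^ 8 * (z * 2ℚ ^ (176 ℕ.* m))) (sym (2^[c*m] 10)))) ⟩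
      2ℚ ^ 8 * (2ℚ ^ (10 ℕ.* m) * 2ℚ ^ (176 ℕ.* m)) * ℓ₂             ≡⟨ cong (_* ℓ₂) (trans (cong (2ℚ ^ 8 *_) (sym (^-+ 2ℚ (10 ℕ.* m) (176 ℕ.* m)))) (sym (^-+ 2ℚ 8 (10 ℕ.* m ℕ.+ 176 ℕ.* m)))) ⟩
      2ℚ ^ (8 ℕ.+ (10 ℕ.* m ℕ.+ 176 ℕ.* m)) * ℓ₂                     ≤⟨ *-monoʳ (<⇒≤ ℓ₂>0) (^-monoʳ 1≤2 exps) ⟩
      2ℚ ^ l * ℓ₂                                                    ≡⟨ inv-r (^-pos l 0<2) ⟩
      1ℚ ∎
      where
      e₁ : ∀ n l z → n * (ι 11 * (2ℚ * (l * z))) ≡ ι 22 * n * z * l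
      e₁ = solve-∀ ringℚ
      e₂ : ∀ a b → ι 32 * a * (2ℚ * (2ℚ * (2ℚ * b))) ≡ 2ℚ ^ 8 * (a * b)
      e₂ = solve-∀ ringℚ
      e₃ : ∀ z → z + z ≡ 2ℚ * z
      e₃ = solve-∀ ringℚ
      inner : 2ℚ * (1ℚ + 1ℚ * ε) ^ A + 1ℚ ≤ 2ℚ * (2ℚ * (2ℚ * 2ℚ ^ (176 ℕ.* m)))
      inner = begin
        2ℚ * (1ℚ + 1ℚ * ε) ^ A + 1ℚ                                     ≤⟨ +-mono-≤ (*-monoˡ 0≤2 y^A) (^-≥1 (suc (suc (176 ℕ.* m))) 1≤2) ⟩
        2ℚ * (2ℚ * 2ℚ ^ (176 ℕ.* m)) + 2ℚ * (2ℚ * 2ℚ ^ (176 ℕ.* m))     ≡⟨ e₃ (2ℚ * (2ℚ * 2ℚ ^ (176 ℕ.* m))) ⟩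
        2ℚ * (2ℚ * (2ℚ * 2ℚ ^ (176 ℕ.* m))) ∎
      ar : ∀ m → 8 ℕ.* m ℕ.+ (10 ℕ.* m ℕ.+ 176 ℕ.* m) ≡ 194 ℕ.* m
      ar = NR.solve-∀
      exps : 8 ℕ.+ (10 ℕ.* m ℕ.+ 176 ℕ.* m) ℕ.≤ l
      exps = ℕₚ.≤-trans (ℕₚ.+-monoˡ-≤ (10 ℕ.* m ℕ.+ 176 ℕ.* m) (ℕₚ.*-monoʳ-≤ 8 m≥1)) (ℕₚ.≤-trans (ℕₚ.≤-reflexive (ar m)) (ℕₚ.≤-trans (ℕₚ.*-monoˡ-≤ m (Numerics.≤! {194} {200} tt)) (ℕₚ.≤-reflexive (sym l≡))))

    D₁-def : ι 11 * (ε * ι n) ≤ ι D₁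
    D₁-def = begin
      ι 11 * (ε * ι n)            ≤⟨ *-monoˡ (ι≥0 11) (*-monoˡ ε≥0 (≤-trans (ι-mono n≤rE) (≤-reflexive (ι-* r E)))) ⟩
      ι 11 * (ε * (ι r * x))      ≡⟨ cong (ι 11 *_) (e₁ ε (ι r) x) ⟩
      ι 11 * (ι r * (x * ε))      ≡⟨ cong (λ z → ι 11 * (ι r * z)) xε ⟩
      ι 11 * (ι r * 1ℚ)           ≡⟨ trans (cong (ι 11 *_) (*-identityʳ (ι r))) (sym (ι-* 11 r)) ⟩
      ι D₁ ∎
      where e₁ : ∀ e r x → e * (r * x) ≡ r * (x * e)
            e₁ = solve-∀ ringℚ

    D₂-def : ι (suc n) * (1ℚ + ι 11 * ε) ^ n ≤ 2ℚ ^ D₂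
    D₂-def = begin
      ι (suc n) * (1ℚ + ι 11 * ε) ^ n      ≤⟨ *-mono (ι≥0 (suc n)) (^-nn (24 ℕ.* r) 0≤2) sn (power 4 (24 ℕ.* r) n (ι 11) (ι≥0 11) (≤-trans (ι-mono {11} {24} (ℕₚ.m≤m+n 11 13)) 24≤x) n≤ (ι-mono {88} {96} (ℕₚ.m≤m+n 88 8))) ⟩
      2ℚ ^ (1 ℕ.+ 10 ℕ.* m) * 2ℚ ^ (24 ℕ.* r) ≡⟨ trans (*-comm (2ℚ ^ (1 ℕ.+ 10 ℕ.* m)) _) (sym (^-+ 2ℚ (24 ℕ.* r) (1 ℕ.+ 10 ℕ.* m))) ⟩
      2ℚ ^ D₂ ∎
      where
      e₁ : ∀ z → z + z ≡ 2ℚ * z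
      e₁ = solve-∀ ringℚ
      sn : ι (suc n) ≤ 2ℚ ^ (1 ℕ.+ 10 ℕ.* m)
      sn = begin
        1ℚ + ι n               ≤⟨ +-monoˡ-≤ (ι n) (ι-mono n≥1) ⟩
        ι n + ι n              ≡⟨ trans (e₁ (ι n)) (cong (2ℚ *_) (trans ιn (sym (2^[c*m] 10)))) ⟩
        2ℚ * 2ℚ ^ (10 ℕ.* m) ∎
      ar : ∀ a b r e → r ℕ.* (a ℕ.* b ℕ.* e) ≡ a ℕ.* r ℕ.* (b ℕ.* e)
      ar = NR.solve-∀
      n≤ : n ℕ.≤ 24 ℕ.* r ℕ.* (4 ℕ.* e)
      n≤ = ℕₚ.≤-trans n≤rE (ℕₚ.≤-reflexive (trans (cong (r ℕ.*_) E≡) (ar 24 4 r e)))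

    sq-def : 2ℚ * (γ * ι (n ℕ.* (2 ℕ.* l ℕ.* (2 ℕ.* l)) ℕ.+ A ℕ.* (2 ℕ.+ 2 ℕ.* (l ℕ.* A)))) ≤ 1ℚ
    sq-def = go (n ℕ.* (2 ℕ.* l ℕ.* (2 ℕ.* l)) ℕ.+ A ℕ.* (2 ℕ.+ 2 ℕ.* (l ℕ.* A))) B-sq
      where
      e₁ : ∀ u e X → 2ℚ * (u * ((e * u) * ((e * u) * (e * u))) * X) ≡ ι 2 * (u * (u * (u * u)) * X) * (e * (e * e))
      e₁ = solve-∀ ringℚ
      go : ∀ X → 2 ℕ.* (U⁴ ℕ.* X) ℕ.≤ E ℕ.* (E ℕ.* E) → 2ℚ * (γ * ι X) ≤ 1ℚ
      go X h = ≤-trans (≤-reflexive (trans (e₁ u ε (ι X)) (cong (_* ε³) (sym (trans (ι3 2 U⁴ X) (cong (λ z → ι 2 * (z * ι X)) (trans (ι4 U U U U) refl))))))) (frac₃ (2 ℕ.* (U⁴ ℕ.* X)) h)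

    4ω²s≤1 : 4ℚ * (ω * (ω * ι A)) ≤ 1ℚ
    4ω²s≤1 = ≤-trans (≤-reflexive (trans (e₁ ε u (ι A)) (cong (_* (ε * ε)) (sym (ι4 4 U U A))))) (frac₂ (4 ℕ.* (U ℕ.* (U ℕ.* A))) B-ω²A)
      where e₁ : ∀ e u a → 4ℚ * (e * u * (e * u * a)) ≡ ι 4 * (u * (u * a)) * (e * e)
            e₁ = solve-∀ ringℚ

    24Uk : ι (24 ℕ.* U ℕ.* k) ≡ ι 24 * u * ι k
    24Uk = trans (ι-* (24 ℕ.* U) k) (cong (_* ι k) (ι-* 24 U))

    η-small : 4ℚ * (ω * (2ℚ * ι 12 * ω * ι k)) ≤ 1ℚ
    η-small = ≤-trans (≤-reflexive (trans (e₁ ε u (ι k)) (cong (_* (ε * ε)) (sym (trans (ι3 4 U (24 ℕ.* U ℕ.* k)) (cong (λ z → ι 4 * (u * z)) 24Uk)))))) (frac₂ (4 ℕ.* (U ℕ.* (24 ℕ.* U ℕ.* k))) B-η-small)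
      where e₁ : ∀ e u k → 4ℚ * (e * u * (2ℚ * ι 12 * (e * u) * k)) ≡ ι 4 * (u * (ι 24 * u * k)) * (e * e)
            e₁ = solve-∀ ringℚ

    η≥0 : 0ℚ ≤ η
    η≥0 = nn* (nn* 0≤2 ω≥0) (nn* θωk≥0 θωk≥0)
      where θωk≥0 : 0ℚ ≤ 2ℚ * ι 12 * ω * ι k
            θωk≥0 = nn* (nn* (nn* 0≤2 (ι≥0 12)) ω≥0) (ι≥0 k)

    2nη≤1 : 2ℚ * (ι n * η) ≤ 1ℚ
    2nη≤1 = ≤-trans (≤-reflexive (trans (e₁ (ι n) ε u (ι k)) (cong (_* ε³) (sym hom)))) (frac₃ (2 ℕ.* (n ℕ.* (2 ℕ.* U ℕ.* (24 ℕ.* U ℕ.* k ℕ.* (24 ℕ.* U ℕ.* k))))) B-η)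
      where
      e₁ : ∀ n e u k → 2ℚ * (n * (2ℚ * (e * u) * ((2ℚ * ι 12 * (e * u) * k) * (2ℚ * ι 12 * (e * u) * k)))) ≡ ι 2 * (n * (ι 2 * u * (ι 24 * u * k * (ι 24 * u * k)))) * (e * (e * e))
      e₁ = solve-∀ ringℚ
      hom : ι (2 ℕ.* (n ℕ.* (2 ℕ.* U ℕ.* (24 ℕ.* U ℕ.* k ℕ.* (24 ℕ.* U ℕ.* k))))) ≡ ι 2 * (ι n * (ι 2 * u * (ι 24 * u * ι k * (ι 24 * u * ι k))))
      hom = trans (ι4 2 n (2 ℕ.* U) (24 ℕ.* U ℕ.* k ℕ.* (24 ℕ.* U ℕ.* k))) (cong₂ (λ a b → ι 2 * (ι n * (a * b))) (ι-* 2 U) (trans (ι-* (24 ℕ.* U ℕ.* k) (24 ℕ.* U ℕ.* k)) (cong₂ _*_ 24Uk 24Uk)))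

    η≤1 : η ≤ 1ℚ
    η≤1 = ≤-trans (≤-trans (≤-trans (≤-reflexive (sym (*-identityˡ η))) (*-monoʳ η≥0 (ι-mono n≥1))) (≤⁺ (nn* (ι≥0 n) η≥0) (e₁ (ι n * η)))) 2nη≤1
      where e₁ : ∀ z → 2ℚ * z ≡ z + z
            e₁ = solve-∀ ringℚ

    valid : Valid par
    valid = record
      { n>0 = n≥1 ; ε>0 = ε>0 ; ε≤1 = ε≤1 ; M≥0 = u≥0 ; ω≡ = refl ; θω≤1 = 24ω≤1
      ; 4ω≤1 = ≤-trans (≤⁺ (nn* (ι≥0 20) ω≥0) (e₁ ω)) 24ω≤1
      ; 2ω³≤γ = *-monoʳ (nn* ω≥0 (nn* ω≥0 ω≥0)) (ι-mono (c≤U 2 tt))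
      ; Mω³≤γ = ≤-refl ; 4ω²s≤1 = 4ω²s≤1 ; η≥0 = η≥0 ; η-small = η-small ; η-def = ≤-refl
      ; σ≥0 = <⇒≤ (inv-pos 1-ε>0) ; σ-def = σ-def ; ℓ₁>0 = inv-pos Λ₁>0 ; ℓ₂>0 = ℓ₂>0 ; ℓ₂-def = ℓ₂-def
      ; growth₁ = growth₁ ; growth₂ = growth₂ ; D₁-def = D₁-def ; D₂-def = D₂-def ; D≤s = D≤A
      ; mass-def = mass-def ; η-total = ^≤2 n η≥0 η≤1 2nη≤1 ; k-def = k-def ; sq-def = sq-def }
      where e₁ : ∀ o → 2ℚ * (ι 12 * o) ≡ 4ℚ * o + ι 20 * o
            e₁ = solve-∀ ringℚ

    open Extract par valid

    σ≥1+ε : 1ℚ + ε ≤ σ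
    σ≥1+ε = *-cancelʳ 1-ε>0 (≤-trans (≤⁺ (nn* ε≥0 ε≥0) (e₁ ε)) (≤-reflexive (sym σ-def)))
      where e₁ : ∀ e → 1ℚ ≡ (1ℚ + e) * (1ℚ + - 1ℚ * e) + e * e
            e₁ = solve-∀ ringℚ

    σ≥1 : 1ℚ ≤ σ
    σ≥1 = ≤-trans (≤⁺ ε≥0 refl) σ≥1+ε

    σ^E≥2 : 2ℚ ≤ σ ^ E
    σ^E≥2 = begin
      2ℚ              ≡⟨ cong (1ℚ +_) (sym xε) ⟩
      1ℚ + x * ε      ≤⟨ bernoulli E ε≥0 ⟩
      (1ℚ + ε) ^ E    ≤⟨ ^-mono E (nn+ 0≤1 ε≥0) σ≥1+ε ⟩
      σ ^ E ∎

    Λ₁ : ℚ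
    Λ₁ = 2ℚ ^ (11 ℕ.* m)

    c₁ : ℕ
    c₁ = 44 ℕ.* m ℕ.* E

    ℓ₁≥0 : 0ℚ ≤ ℓ₁
    ℓ₁≥0 = <⇒≤ (inv-pos Λ₁>0)

    ℓΛ : ℓ₁ * Λ₁ ≡ 1ℚ
    ℓΛ = trans (*-comm ℓ₁ Λ₁) (inv-r Λ₁>0)

    val-low : ∀ c → ℓ₁ ^ c ≤ val c
    val-low zero = ≤-refl
    val-low (suc c) = ≤-trans (≤-reflexive (trans (*-comm ℓ₁ (ℓ₁ ^ c)) (cong (ℓ₁ ^ c *_) (sym (*-identityʳ ℓ₁)))))
      (*-mono (^-nn c ℓ₁≥0) (nn* ℓ₁≥0 (^-nn c (≤-trans 0≤1 σ≥1))) (val-low c) (*-monoˡ ℓ₁≥0 (^-≥1 c σ≥1)))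

    σ^c₁ : Λ₁ * Λ₁ ≤ σ ^ c₁
    σ^c₁ = begin
      Λ₁ * Λ₁                      ≡⟨ sym (^-+ 2ℚ (11 ℕ.* m) (11 ℕ.* m)) ⟩
      2ℚ ^ (11 ℕ.* m ℕ.+ 11 ℕ.* m) ≤⟨ ^-monoʳ 1≤2 (ℕₚ.≤-trans (ℕₚ.≤-reflexive (ar m)) (ℕₚ.*-monoˡ-≤ m (Numerics.≤! {22} {44} tt))) ⟩
      2ℚ ^ (44 ℕ.* m)              ≤⟨ ^-mono (44 ℕ.* m) 0≤2 σ^E≥2 ⟩
      (σ ^ E) ^ (44 ℕ.* m)         ≡⟨ sym (^-^ σ (44 ℕ.* m) E) ⟩
      σ ^ c₁ ∎
      where ar : ∀ m → 11 ℕ.* m ℕ.+ 11 ℕ.* m ≡ 22 ℕ.* m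
            ar = NR.solve-∀

    -- From size `c₁` on, `σ ^ c` is at least `Λ₁²` and each new factor `ℓ₁ * σ ^ c` at least `Λ₁`.
    -- The first `c₁` factors are only bounded below by `ℓ₁ = 1 / Λ₁`.
    val-high : ∀ j → ℓ₁ ^ c₁ * Λ₁ ^ j ≤ val (j ℕ.+ c₁)
    val-high zero = ≤-trans (≤-reflexive (*-identityʳ (ℓ₁ ^ c₁))) (val-low c₁)
    val-high (suc j) = begin
      ℓ₁ ^ c₁ * (Λ₁ * Λ₁ ^ j)                  ≡⟨ e₁ (ℓ₁ ^ c₁) Λ₁ (Λ₁ ^ j) ⟩
      ℓ₁ ^ c₁ * Λ₁ ^ j * Λ₁                    ≤⟨ *-mono (nn* (^-nn c₁ ℓ₁≥0) (^-nn j (<⇒≤ Λ₁>0))) (nn* ℓ₁≥0 (^-nn (j ℕ.+ c₁) (≤-trans 0≤1 σ≥1))) (val-high j) factor ⟩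
      val (j ℕ.+ c₁) * (ℓ₁ * σ ^ (j ℕ.+ c₁)) ∎
      where
      e₁ : ∀ a b c → a * (b * c) ≡ a * c * b
      e₁ = solve-∀ ringℚ
      factor : Λ₁ ≤ ℓ₁ * σ ^ (j ℕ.+ c₁)
      factor = begin
        Λ₁                       ≡⟨ trans (sym (*-identityˡ Λ₁)) (trans (cong (_* Λ₁) (sym ℓΛ)) (*-assoc ℓ₁ Λ₁ Λ₁)) ⟩
        ℓ₁ * (Λ₁ * Λ₁)           ≤⟨ *-monoˡ ℓ₁≥0 (≤-trans σ^c₁ (^-monoʳ σ≥1 (ℕₚ.m≤n+m c₁ j))) ⟩
        ℓ₁ * σ ^ (j ℕ.+ c₁) ∎

    val-big : 2ℚ < val A
    val-big = <-≤-trans 2<Λ₁ (begin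
      Λ₁                             ≡⟨ sym (*-identityˡ Λ₁) ⟩
      1ℚ * Λ₁                        ≡⟨ cong (_* Λ₁) (sym (trans (sym (^-* ℓ₁ Λ₁ c₁)) (trans (cong (_^ c₁) ℓΛ) (1^ c₁)))) ⟩
      ℓ₁ ^ c₁ * Λ₁ ^ c₁ * Λ₁         ≡⟨ e₁ (ℓ₁ ^ c₁) (Λ₁ ^ c₁) Λ₁ ⟩
      ℓ₁ ^ c₁ * Λ₁ ^ suc c₁          ≤⟨ val-high (suc c₁) ⟩
      val (suc c₁ ℕ.+ c₁)            ≡⟨ cong val (sym A≡) ⟩
      val A ∎)
      where
      e₁ : ∀ a b c → a * b * c ≡ a * (c * b)
      e₁ = solve-∀ ringℚ
      2<Λ₁ : 2ℚ < Λ₁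
      2<Λ₁ = <-≤-trans (ι-mono< {2} {4} (ℕ.s≤s (ℕ.s≤s (ℕ.s≤s ℕ.z≤n)))) (^-monoʳ {2ℚ} {2} 1≤2 (ℕₚ.≤-trans (ℕₚ.≤-trans (Numerics.≤! {2} {11} tt) (ℕₚ.≤-reflexive (sym (ℕₚ.*-identityʳ 11)))) (ℕₚ.*-monoʳ-≤ 11 m≥1)))

    blow-up-family : BlowUps n Dm (16 ℕ.* (l ℕ.+ 1))
    blow-up-family = let H , sp = sparse val-big in
      blow-ups H n≥1 sp (2 ℕ.* m) Dm (ℕₚ.≤-trans m≥1 (ℕₚ.m≤n*m m 2)) Dm≥1 small room

  -- Here n = 2^(10 m).
  family : ∀ k → let m = k ℕ.+ 64 ; n = Numerics.p5 (2 ℕ.^ m) ℕ.* Numerics.p5 (2 ℕ.^ m) in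
    ∃ λ D → m ℕ.* n ℕ.≤ 1223059046400 ℕ.* (D ℕ.* D) × BlowUps n D (16 ℕ.* (200 ℕ.* m ℕ.+ 1))
  family k = B.Dm , subst (λ z → m ℕ.* z ℕ.≤ 1223059046400 ℕ.* (B.Dm ℕ.* B.Dm)) n≡' B.mn≤Dm² ,
      subst₂ (λ a b → BlowUps a B.Dm (16 ℕ.* (b ℕ.+ 1))) n≡' B.l≡ (Instance.blow-up-family sc)
    where
    m = k ℕ.+ 64
    sc = Numerics.scale k
    module B = Numerics.Bounds sc
    n≡' : B.n ≡ Numerics.p5 (2 ℕ.^ m) ℕ.* Numerics.p5 (2 ℕ.^ m)
    n≡' = trans B.n≡ (cong₂ (λ a b → Numerics.p5 a ℕ.* Numerics.p5 b) B.U≡ B.U≡)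

-- Existence of the maximum: decidability and an upper bound.

module Decidability where

  open WeightedGraphs using (δ)
  open SelectionProcess using (δ-refl)
  open LowerBound using (count-cong)
  open BlowUpGraphs using (count≤n)
  open import Data.Nat using (ℕ; zero; suc; _+_; _*_; _≤_; z≤n; s≤s; _≤?_; _<ᵇ_)
  open import Data.Nat.Properties
  open import Data.Fin using (toℕ; combine; remQuot)
  import Data.Fin.Subset.Properties as Subsetₚ
  open import Data.Vec using (lookup; tabulate)
  open import Data.Vec.Properties using (lookup∘tabulate)
  open import Function using (_∘_)
  open import Relation.Nullary.Decidable using (_×-dec_; _→-dec_; ¬?; map′; decidable-stable)

  _≈_ : ∀ {n} → Subset n → Subset n → Set
  S ≈ T = ∀ x → S x ≡ T x

  any-subset? : ∀ {n} {P : Subset n → Set} → (∀ {S T} → S ≈ T → P S → P T) → (∀ S → Dec (P S)) → Dec (∃ P)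
  any-subset? {P = P} resp P? = map′ (λ (v , h) → lookup v , h) (λ (S , h) → tabulate S , resp (λ x → sym (lookup∘tabulate S x)) h)
    (Subsetₚ.anySubset? (λ v → P? (lookup v)))

  all-subset? : ∀ {n} {P : Subset n → Set} → (∀ {S T} → S ≈ T → P S → P T) → (∀ S → Dec (P S)) → Dec (∀ S → P S)
  all-subset? resp P? = map′ (λ none S → decidable-stable (P? S) (λ ¬h → none (S , ¬h))) (λ h (S , ¬h) → ¬h (h S))
    (¬? (any-subset? (λ e ¬h h → ¬h (resp (λ x → sym (e x)) h)) (λ S → ¬? (P? S))))

  _≅_ : ∀ {n} → Graph n → Graph n → Set
  G ≅ H = ∀ u v → adj G u v ≡ adj H u v

  triangleFree-resp : ∀ {n} {G H : Graph n} → G ≅ H → TriangleFree G → TriangleFree H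
  triangleFree-resp e tf u v w a b c = tf u v w (trans (e u v) a) (trans (e v w) b) (trans (e u w) c)

  minDegree-resp : ∀ {n d} {G H : Graph n} → G ≅ H → MinDegree≥ G d → MinDegree≥ H d
  minDegree-resp {d = d} e md v = subst (d ≤_) (count-cong (e v)) (md v)

  hasInduced-resp : ∀ {n g} {G H : Graph n} → G ≅ H → HasInducedBipartiteMinDeg G g → HasInducedBipartiteMinDeg H g
  hasInduced-resp {g = g} e (S , ne , (c , proper) , md) = S , ne , (c , λ u v a b h → proper u v a b (trans (e u v) h)) ,
    λ v h → subst (g ≤_) (count-cong (λ u → cong (S u ∧_) (e v u))) (md v h)

  triangleFree? : ∀ {n} (G : Graph n) → Dec (TriangleFree G)
  triangleFree? G = Finₚ.all? λ u → Finₚ.all? λ v → Finₚ.all? λ w →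
    (adj G u v Boolₚ.≟ true) →-dec ((adj G v w Boolₚ.≟ true) →-dec ¬? (adj G u w Boolₚ.≟ true))

  minDegree? : ∀ {n} (G : Graph n) d → Dec (MinDegree≥ G d)
  minDegree? G d = Finₚ.all? λ v → d ≤? degree G v

  inducedBipartite? : ∀ {n} (G : Graph n) S → Dec (InducedBipartite G S)
  inducedBipartite? G S = any-subset?
    (λ e proper u v a b h c → proper u v a b h (trans (e u) (trans c (sym (e v)))))
    (λ c → Finₚ.all? λ u → Finₚ.all? λ v → (S u Boolₚ.≟ true) →-dec ((S v Boolₚ.≟ true) →-dec ((adj G u v Boolₚ.≟ true) →-dec ¬? (c u Boolₚ.≟ c v))))

  hasInduced? : ∀ {n} (G : Graph n) g → Dec (HasInducedBipartiteMinDeg G g)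
  hasInduced? G g = any-subset?
    (λ e ((v , h) , (c , proper) , md) → (v , trans (sym (e v)) h) , (c , λ u v a b → proper u v (trans (e u) a) (trans (e v) b)) ,
      λ v h → subst (g ≤_) (count-cong (λ u → cong (_∧ adj G v u) (e u))) (md v (trans (e v) h)))
    (λ S → Finₚ.any? (λ v → S v Boolₚ.≟ true) ×-dec inducedBipartite? G S ×-dec
      Finₚ.all? (λ v → (S v Boolₚ.≟ true) →-dec (g ≤? degreeIn G S v)))

  -- Graphs on Fin n are coded by subsets of Fin (n * n); every subset codes a graph.
  decode : ∀ {n} → Subset (n * n) → Graph n
  decode f .adj u v = (f (combine u v) ∧ f (combine v u)) ∧ not (δ u v)
  decode f .Defs.sym u v = cong₂ _∧_ (Boolₚ.∧-comm (f (combine u v)) (f (combine v u))) (cong not (δ-sym u v))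
    where
    δ-sym : ∀ u v → δ u v ≡ δ v u
    δ-sym u v with u Finₚ.≟ v | v Finₚ.≟ u
    ... | yes _ | yes _ = refl
    ... | no _ | no _ = refl
    ... | yes e | no ne = ⊥-elim (ne (sym e))
    ... | no ne | yes e = ⊥-elim (ne (sym e))
  decode f .irref v = trans (cong (λ b → (f (combine v v) ∧ f (combine v v)) ∧ not b) (δ-refl v)) (Boolₚ.∧-zeroʳ (f (combine v v) ∧ f (combine v v)))

  encode : ∀ {n} → Graph n → Subset (n * n)
  encode {n} G i = let u , v = remQuot {n} n i in adj G u v

  decode-encode : ∀ {n} (G : Graph n) → decode (encode G) ≅ G
  decode-encode {n} G u v = trans (cong₂ (λ a b → (a ∧ b) ∧ not (δ u v)) (code u v) (trans (code v u) (Graph.sym G v u))) (go (u Finₚ.≟ v))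
    where
    code : ∀ u v → encode G (combine u v) ≡ adj G u v
    code u v = cong (λ (x , y) → adj G x y) (Finₚ.remQuot-combine {n} u v)
    go : (dec : Dec (u ≡ v)) → (adj G u v ∧ adj G u v) ∧ not (does dec) ≡ adj G u v
    go (yes refl) = trans (Boolₚ.∧-zeroʳ _) (sym (irref G u))
    go (no _) = trans (Boolₚ.∧-identityʳ _) (Boolₚ.∧-idem _)

  decode-resp : ∀ {n} {f f' : Subset (n * n)} → f ≈ f' → decode {n} f ≅ decode f'
  decode-resp e u v = cong₂ (λ a b → (a ∧ b) ∧ not (δ u v)) (e (combine u v)) (e (combine v u))

  -- `IsG` asks for the maximum itself, which is found by testing candidates. The quantifier over
  -- graphs becomes a finite search over codes; a graph agrees with its decoded code only pointwise,
  -- so the properties are transported.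
  good? : ∀ n d g → Dec (Good n d g)
  good? n d g = map′
    (λ h G tf md → hasInduced-resp {G = decode (encode G)} {H = G} (decode-encode G)
      (h (encode G) (triangleFree-resp {G = G} {H = decode (encode G)} (back G) tf) (minDegree-resp {G = G} {H = decode (encode G)} (back G) md)))
    (λ h f → h (decode f))
    (all-subset? resp (λ f → triangleFree? (decode f) →-dec (minDegree? (decode f) d →-dec hasInduced? (decode f) g)))
    where
    back : (G : Graph n) → G ≅ decode (encode G)
    back G u v = sym (decode-encode G u v)
    resp : ∀ {f f' : Subset (n * n)} → f ≈ f' →
      (TriangleFree (decode {n} f) → MinDegree≥ (decode {n} f) d → HasInducedBipartiteMinDeg (decode {n} f) g) →
      TriangleFree (decode {n} f') → MinDegree≥ (decode {n} f') d → HasInducedBipartiteMinDeg (decode {n} f') g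
    resp {f} {f'} e h tf md = hasInduced-resp {G = decode f} {H = decode f'} (decode-resp e)
      (h (triangleFree-resp {G = decode f'} {H = decode f} back' tf) (minDegree-resp {G = decode f'} {H = decode f} back' md))
      where back' : decode {n} f' ≅ decode f
            back' u v = sym (decode-resp {f = f} {f' = f'} e u v)

  greatest : ∀ {P : ℕ → Set} → (∀ g → Dec (P g)) → ∀ {g₀} → P g₀ → ∀ u → (∀ g → P g → g ≤ u) → ∃ λ g → P g × (∀ g' → P g' → g' ≤ g)
  greatest {P} P? {g₀} h₀ u bd = go u bd
    where
    go : ∀ u → (∀ g → P g → g ≤ u) → ∃ λ g → P g × (∀ g' → P g' → g' ≤ g)
    go u bd with P? u
    ... | yes h = u , h , bd
    go zero bd | no ¬h = ⊥-elim (¬h (subst P (n≤0⇒n≡0 (bd g₀ h₀)) h₀))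
    go (suc u) bd | no ¬h = go u (λ g h → ≤-pred (≤∧≢⇒< (bd g h) (λ { refl → ¬h h })))

  last : ∀ {P : ℕ → Set} → (∀ k → Dec (P k)) → P 0 → ∀ K → ¬ P K → ∃ λ k → P k × ¬ P (suc k)
  last P? h₀ zero ¬h = ⊥-elim (¬h h₀)
  last P? h₀ (suc K) ¬h with P? K
  ... | yes h = K , h , ¬h
  ... | no ¬h' = last P? h₀ K ¬h'

  split : ∀ n → ℕ → Subset n
  split n d x = toℕ x <ᵇ d

  count-split : ∀ {n} d → d ≤ n → count (split n d) ≡ d
  count-split {zero} zero h = refl
  count-split {suc n} zero h = count-split {n} zero z≤n
  count-split {suc n} (suc d) (s≤s h) = cong suc (count-split d h)

  count-split-not : ∀ {n} d → d ≤ n → count (not ∘ split n d) + d ≡ n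
  count-split-not {zero} zero h = refl
  count-split-not {suc n} zero h = cong suc (count-split-not {n} zero z≤n)
  count-split-not {suc n} (suc d) (s≤s h) = trans (+-suc _ d) (cong suc (count-split-not d h))

  diff : Bool → Bool → Bool
  diff true b = not b
  diff false b = b

  complete-bipartite : ∀ n d → Graph n
  complete-bipartite n d .adj u v = diff (split n d u) (split n d v)
  complete-bipartite n d .Defs.sym u v = go (split n d u) (split n d v)
    where go : ∀ a b → diff a b ≡ diff b a
          go true true = refl
          go true false = refl
          go false true = refl
          go false false = refl
  complete-bipartite n d .irref v = go (split n d v)
    where go : ∀ a → diff a a ≡ false
          go true = refl
          go false = refl

  -- If no triangle-free graph had minimum degree `d`, every `g` would be good. The complete
  -- bipartite graph with parts of sizes `d` and `n - d` is such a graph, as `2 d ≤ n`.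
  good≤n : ∀ {n d} → 2 * d ≤ n → ∀ g → Good n d g → g ≤ n
  good≤n {n} {d} h g good with good (complete-bipartite n d) tf md
    where
    tf : TriangleFree (complete-bipartite n d)
    tf u v w = go (split n d u) (split n d v) (split n d w)
      where go : ∀ a b c → diff a b ≡ true → diff b c ≡ true → diff a c ≡ true → ⊥
            go true false false _ () _
            go true false true _ _ ()
            go true true _ ()
            go false false _ ()
            go false true true _ ()
            go false true false _ _ ()
    d≤n : d ≤ n
    d≤n = ≤-trans (m≤m+n d (d + 0)) h
    md : MinDegree≥ (complete-bipartite n d) d
    md v with split n d v
    ... | true = +-cancelʳ-≤ d d _ (≤-trans (≤-reflexive (cong (d +_) (sym (+-identityʳ d)))) (≤-trans h (≤-reflexive (sym (count-split-not d d≤n)))))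
    ... | false = ≤-reflexive (sym (count-split d d≤n))
  ... | S , (v , hv) , _ , deg = ≤-trans (deg v hv) (count≤n (λ u → S u ∧ adj (complete-bipartite n d) v u))

-- Logarithms and the comparison of scales.

module Assembly where

  open LowerBound using (log-bipartite; dense-bipartite)
  open BlowUpGraphs using (BlowUps)
  open Decidability
  open import Data.Nat
  open import Data.Nat.Properties
  open import Data.Nat.Logarithm using (⌊log₂_⌋; ⌊log₂⌋-mono-≤; ⌊log₂⌊n/2⌋⌋≡⌊log₂n⌋∸1; ⌊log₂[2^n]⌋≡n)
  open import Data.Fin using (fromℕ<)
  open import Relation.Nullary.Decidable using (_×-dec_)
  open import Data.Nat.Tactic.RingSolver using (solve-∀)

  -- `k` bounds the recursion, which halves `d`.
  2^-log≤ : ∀ k d → d ≤ k → 0 < d → 2 ^ ⌊log₂ d ⌋ ≤ d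
  2^-log≤ (suc k) 1 h _ = ≤-refl
  2^-log≤ (suc k) d@(suc (suc d')) h _ = begin
    2 ^ ⌊log₂ d ⌋                 ≤⟨ ^-monoʳ-≤ 2 (m≤n+m∸n ⌊log₂ d ⌋ 1) ⟩
    2 * 2 ^ (⌊log₂ d ⌋ ∸ 1)       ≡⟨ cong (λ z → 2 * 2 ^ z) (sym (⌊log₂⌊n/2⌋⌋≡⌊log₂n⌋∸1 d)) ⟩
    2 * 2 ^ ⌊log₂ ⌊ d /2⌋ ⌋       ≤⟨ *-monoʳ-≤ 2 (2^-log≤ k ⌊ d /2⌋ (≤-pred (≤-trans (⌊n/2⌋<n (suc d')) h)) (s≤s z≤n)) ⟩
    2 * ⌊ d /2⌋                   ≡⟨ cong (⌊ d /2⌋ +_) (+-identityʳ ⌊ d /2⌋) ⟩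
    ⌊ d /2⌋ + ⌊ d /2⌋             ≤⟨ +-monoʳ-≤ ⌊ d /2⌋ (⌊n/2⌋≤⌈n/2⌉ d) ⟩
    ⌊ d /2⌋ + ⌈ d /2⌉             ≡⟨ ⌊n/2⌋+⌈n/2⌉≡n d ⟩
    d ∎
    where open ≤-Reasoning

  <2^-log : ∀ d → d < 2 ^ suc ⌊log₂ d ⌋
  <2^-log d = ≰⇒> λ h → <-irrefl refl (≤-trans (≤-reflexive (sym (⌊log₂[2^n]⌋≡n (suc ⌊log₂ d ⌋)))) (⌊log₂⌋-mono-≤ h))

  ≤log : ∀ k {d} → 2 ^ k ≤ d → k ≤ ⌊log₂ d ⌋
  ≤log k h = ≤-trans (≤-reflexive (sym (⌊log₂[2^n]⌋≡n k))) (⌊log₂⌋-mono-≤ h)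

  n<2^n : ∀ n → n < 2 ^ n
  n<2^n zero = s≤s z≤n
  n<2^n (suc n) = ≤-trans (+-mono-≤ (m^n>0 2 n) (n<2^n n)) (≤-reflexive (cong (2 ^ n +_) (sym (+-identityʳ (2 ^ n)))))

  ^-cancelˡ-≤ : ∀ q a b → a ^ q ≤ b ^ q → 0 < q → a ≤ b
  ^-cancelˡ-≤ (suc q) a b h _ = ≮⇒≥ λ lt → <-irrefl refl (<-≤-trans (^-monoˡ-< (suc q) lt) h)

  -- Take `g = ⌊L / 128⌋` and `h = 64 g + 1`: then `h 2^h ≤ 2 · 2^(128 g) ≤ 2 d`. The bound
  -- `d ≥ 2^128` makes `g` positive, so rounding down loses at most a factor 2.
  good-log : ∀ {n d} → 0 < n → 2 ^ 128 ≤ d → ∃ λ g → Good n d g × ⌊log₂ d ⌋ ≤ 256 * g × 0 < g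
  good-log {n} {d} n>0 big = go (last {λ g → g * 128 ≤ L} (λ g → g * 128 ≤? L) z≤n (suc L) (λ h → <-irrefl refl (≤-trans (m≤m*n (suc L) 128) h)))
    where
    L = ⌊log₂ d ⌋
    d>0 : 0 < d
    d>0 = ≤-trans (m^n>0 2 128) big
    go : (∃ λ g → g * 128 ≤ L × ¬ suc g * 128 ≤ L) → ∃ λ g → Good n d g × L ≤ 256 * g × 0 < g
    go (g , lo , hi) = g , (λ G tf md → log-bipartite {h = suc x} {d = d} (s≤s z≤n) d>0 small G (fromℕ< n>0) tf md g (s≤s ≤-refl)) , upper , g>0 g hi
      where
      x = 64 * g
      small : suc x * 2 ^ suc x ≤ 4 * d
      small = begin
        suc x * 2 ^ suc x      ≤⟨ *-monoˡ-≤ (2 ^ suc x) (n<2^n x) ⟩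
        2 ^ x * (2 * 2 ^ x)    ≡⟨ e₁ (2 ^ x) ⟩
        2 * (2 ^ x * 2 ^ x)    ≡⟨ cong (2 *_) (sym (^-distribˡ-+-* 2 x x)) ⟩
        2 * 2 ^ (x + x)        ≡⟨ cong (λ z → 2 * 2 ^ z) (e₂ g) ⟩
        2 * 2 ^ (g * 128)      ≤⟨ *-monoʳ-≤ 2 (^-monoʳ-≤ 2 lo) ⟩
        2 * 2 ^ L              ≤⟨ *-monoʳ-≤ 2 (2^-log≤ d d ≤-refl d>0) ⟩
        2 * d                  ≤⟨ *-monoˡ-≤ d {2} {4} (s≤s (s≤s z≤n)) ⟩
        4 * d ∎
        where
        open ≤-Reasoning
        e₁ : ∀ y → y * (2 * y) ≡ 2 * (y * y)
        e₁ = solve-∀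
        e₂ : ∀ g → 64 * g + 64 * g ≡ g * 128
        e₂ = solve-∀
      g>0 : ∀ g → ¬ suc g * 128 ≤ L → 0 < g
      g>0 zero h = ⊥-elim (h (≤log 128 big))
      g>0 (suc g) _ = s≤s z≤n
      upper : L ≤ 256 * g
      upper = begin
        L                  ≤⟨ <⇒≤ (≰⇒> hi) ⟩
        128 + g * 128      ≤⟨ +-monoˡ-≤ (g * 128) (≤-trans (≤-reflexive (sym (*-identityˡ 128))) (*-monoˡ-≤ 128 (g>0 g hi))) ⟩
        g * 128 + g * 128  ≡⟨ e g ⟩
        256 * g ∎
        where
        open ≤-Reasoning
        e : ∀ g → g * 128 + g * 128 ≡ 256 * g
        e = solve-∀

  good-dense : ∀ {n d} → 0 < n → 0 < d → ∃ λ g → Good n d g × d * d ≤ 4 * suc g * n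
  good-dense {n} {d} n>0 d>0 = go (last {λ g → 4 * g * n < d * d} (λ g → 4 * g * n <? d * d) (*-mono-< d>0 d>0) (d * d) stop)
    where
    stop : ¬ 4 * (d * d) * n < d * d
    stop h = <-irrefl refl (<-≤-trans h (≤-trans (m≤n*m (d * d) 4) (m≤m*n (4 * (d * d)) n {{>-nonZero n>0}})))
    go : (∃ λ g → 4 * g * n < d * d × ¬ 4 * suc g * n < d * d) → ∃ λ g → Good n d g × d * d ≤ 4 * suc g * n
    go (g , lo , hi) = g , (λ G tf md → dense-bipartite G (fromℕ< n>0) tf md g lo) , ≮⇒≥ hi

  lower-bound : ∀ {n d} → 0 < n → 2 ^ 128 ≤ d → ∃ λ g₀ → Good n d g₀ ×
    (∀ g → (∀ g' → Good n d g' → g' ≤ g) → ⌊log₂ d ⌋ * n ⊔ d * d ≤ 256 * (g * n))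
  lower-bound {n} {d} n>0 big = g₁ , good₁ , bound
    where
    d>0 : 0 < d
    d>0 = ≤-trans (m^n>0 2 128) big
    lg = good-log {n} {d} n>0 big
    g₁ = proj₁ lg
    good₁ = proj₁ (proj₂ lg)
    dn = good-dense {n} {d} n>0 d>0
    g₂ = proj₁ dn
    bound : ∀ g → (∀ g' → Good n d g' → g' ≤ g) → ⌊log₂ d ⌋ * n ⊔ d * d ≤ 256 * (g * n)
    bound g max = ⊔-lub
      (begin
        ⌊log₂ d ⌋ * n     ≤⟨ *-monoˡ-≤ n (proj₁ (proj₂ (proj₂ lg))) ⟩
        256 * g₁ * n      ≤⟨ *-monoˡ-≤ n (*-monoʳ-≤ 256 (max g₁ good₁)) ⟩
        256 * g * n       ≡⟨ *-assoc 256 g n ⟩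
        256 * (g * n) ∎)
      (begin
        d * d             ≤⟨ proj₂ (proj₂ dn) ⟩
        -- The positive value from the logarithmic bound absorbs the one in `suc g₂`, also when `g₂`
        -- is zero.
        4 * suc g₂ * n    ≤⟨ *-monoˡ-≤ n (*-monoʳ-≤ 4 (+-mono-≤ g>0 (max g₂ (proj₁ (proj₂ dn))))) ⟩
        4 * (g + g) * n   ≡⟨ e g n ⟩
        8 * (g * n)       ≤⟨ *-monoˡ-≤ (g * n) (Numerics.≤! {8} {256} tt) ⟩
        256 * (g * n) ∎)
      where
      open ≤-Reasoning
      g>0 : 0 < g
      g>0 = ≤-trans (proj₂ (proj₂ (proj₂ lg))) (max g₁ good₁)
      e : ∀ g n → 4 * (g + g) * n ≡ 8 * (g * n)
      e = solve-∀

  -- `N k`, `D k`: order and degree of the graph with `m = k + 64`. By `dense` the degree is at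
  -- least of order `√(m N)`, so blow-ups to `n` vertices reach degrees of order `n √(m / N)` with
  -- `g` of order `n m / N`, the square of this degree over `n`.
  module Upper (K : ℕ) (N D : ℕ → ℕ) (N≡ : ∀ k → N k ≡ 2 ^ (10 * (k + 64)))
    (dense : ∀ k → (k + 64) * N k ≤ K * (D k * D k))
    (blow-ups : ∀ k → BlowUps (N k) (D k) (16 * (200 * (k + 64) + 1))) where

    E : ℕ
    E = 2 ^ 10

    N-suc : ∀ k → N (suc k) ≡ E * N k
    N-suc k = trans (N≡ (suc k)) (trans (cong (2 ^_) (e k)) (trans (^-distribˡ-+-* 2 10 (10 * (k + 64))) (cong (E *_) (sym (N≡ k)))))
      where e : ∀ k → 10 * (suc k + 64) ≡ 10 + 10 * (k + 64)
            e = solve-∀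

    N>0 : ∀ k → 0 < N k
    N>0 k = subst (0 <_) (sym (N≡ k)) (m^n>0 2 (10 * (k + 64)))

    instance
      N-nonZero : ∀ {k} → NonZero (N k)
      N-nonZero {k} = >-nonZero (N>0 k)

    -- The hypothesis says that d is beyond the reach of the k-th family of blow-ups.
    too-dense : ∀ k {n d} → n * D k ≤ 2 * N k * d → (k + 64) * (n * n) ≤ 4 * K * N k * (d * d)
    too-dense k {n} {d} h = *-cancelˡ-≤ (N k) (begin
      N k * (m * (n * n))              ≡⟨ e₁ (N k) m n ⟩
      m * N k * (n * n)                ≤⟨ *-monoˡ-≤ (n * n) (dense k) ⟩
      K * (D k * D k) * (n * n)        ≡⟨ e₂ K (D k) n ⟩
      K * (n * D k * (n * D k))        ≤⟨ *-monoʳ-≤ K (*-mono-≤ h h) ⟩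
      K * (2 * N k * d * (2 * N k * d)) ≡⟨ e₃ K (N k) d ⟩
      N k * (4 * K * N k * (d * d)) ∎)
      where
      open ≤-Reasoning
      m = k + 64
      e₁ : ∀ a m n → a * (m * (n * n)) ≡ m * a * (n * n)
      e₁ = solve-∀
      e₂ : ∀ k d n → k * (d * d) * (n * n) ≡ k * (n * d * (n * d))
      e₂ = solve-∀
      e₃ : ∀ k a d → k * (2 * a * d * (2 * a * d)) ≡ a * (4 * k * a * (d * d))
      e₃ = solve-∀

    Fits : ℕ → ℕ → ℕ → Set
    Fits n d k = N k ≤ n × 2 * N k * d ≤ n * D k

    fits? : ∀ n d k → Dec (Fits n d k)
    fits? n d k = (N k ≤? n) ×-dec (2 * N k * d ≤? n * D k)

    good-bound : ∀ {n d k} → Fits n d k → ∀ {g} → Good n d g → g * N k ≤ n * (16 * (200 * (k + 64) + 1))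
    good-bound {n} {d} {k} (h₁ , h₂) {g} good with blow-ups k n d h₁ h₂
    ... | G , tf , md , bd = bd g (good G tf md)

    module _ {p q n d : ℕ} (p>0 : 0 < p) (n^p≤d^q : n ^ p ≤ d ^ q) (2d≤n : 2 * d ≤ n) (L>0 : 0 < ⌊log₂ d ⌋) (N₀≤n : N 0 ≤ n) where

      private
        L = ⌊log₂ d ⌋
        n>0 : 0 < n
        n>0 = ≤-trans (N>0 0) N₀≤n

      -- This is where `γ` enters: `2^(10 m) ≤ n` and `n^p ≤ d^q` force `m` to be at most a multiple
      -- of `q log d`.
      m≤ : ∀ k → N k ≤ n → k + 64 ≤ 2 * q * L
      m≤ k h = begin
        m                    ≤⟨ m≤n*m m 10 ⟩
        10 * m               ≤⟨ m≤m*n (10 * m) p {{>-nonZero p>0}} ⟩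
        10 * m * p           ≤⟨ ≮⇒≥ (λ lt → <-irrefl refl (<-≤-trans (^-monoʳ-< 2 (s≤s (s≤s z≤n)) lt) below)) ⟩
        suc L * q            ≤⟨ *-monoˡ-≤ q (+-monoˡ-≤ L L>0) ⟩
        (L + L) * q          ≡⟨ e L q ⟩
        2 * q * L ∎
        where
        open ≤-Reasoning
        m = k + 64
        e : ∀ l q → (l + l) * q ≡ 2 * q * l
        e = solve-∀
        below : 2 ^ (10 * m * p) ≤ 2 ^ (suc L * q)
        below = begin
          2 ^ (10 * m * p)    ≡⟨ sym (^-*-assoc 2 (10 * m) p) ⟩
          (2 ^ (10 * m)) ^ p  ≡⟨ cong (_^ p) (sym (N≡ k)) ⟩
          N k ^ p             ≤⟨ ^-monoˡ-≤ p h ⟩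
          n ^ p               ≤⟨ n^p≤d^q ⟩
          d ^ q               ≤⟨ ^-monoˡ-≤ q (<⇒≤ (<2^-log d)) ⟩
          (2 ^ suc L) ^ q     ≡⟨ ^-*-assoc 2 (suc L) q ⟩
          2 ^ (suc L * q) ∎

      16l≤ : ∀ k → 16 * (200 * (k + 64) + 1) ≤ 3216 * (k + 64)
      16l≤ k = begin
        16 * (200 * (k + 64) + 1)        ≤⟨ *-monoʳ-≤ 16 (+-monoʳ-≤ (200 * (k + 64)) (≤-trans (s≤s z≤n) (m≤n+m 64 k))) ⟩
        16 * (200 * (k + 64) + (k + 64)) ≡⟨ e (k + 64) ⟩
        3216 * (k + 64) ∎
        where
        open ≤-Reasoning
        e : ∀ m → 16 * (200 * m + m) ≡ 3216 * m
        e = solve-∀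

      -- Consecutive orders differ by the factor `2^10`, so the blow-up factor `n / N k` is bounded
      -- and `g` is of order `m`.
      sparse-case : ∀ k → Fits n d k → n < N (suc k) → ∀ {g} → Good n d g → g * n ≤ E * 3216 * (2 * q) * (L * n)
      sparse-case k f lt {g} good = begin
        g * n                               ≤⟨ *-monoˡ-≤ n (≤-trans g≤ (*-monoʳ-≤ (E * 3216) (m≤ k (proj₁ f)))) ⟩
        E * 3216 * (2 * q * L) * n          ≡⟨ e (E * 3216) (2 * q) L n ⟩
        E * 3216 * (2 * q) * (L * n) ∎
        where
        open ≤-Reasoning
        e : ∀ a b c n → a * (b * c) * n ≡ a * b * (c * n)
        e = solve-∀
        e' : ∀ a b c m → a * b * (c * m) ≡ b * (a * c * m)
        e' = solve-∀
        g≤ : g ≤ E * 3216 * (k + 64)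
        g≤ = *-cancelˡ-≤ (N k) (begin
          N k * g                          ≡⟨ *-comm (N k) g ⟩
          g * N k                          ≤⟨ good-bound {k = k} f good ⟩
          n * (16 * (200 * (k + 64) + 1))  ≤⟨ *-mono-≤ (<⇒≤ lt) (16l≤ k) ⟩
          N (suc k) * (3216 * (k + 64))    ≡⟨ cong (_* (3216 * (k + 64))) (N-suc k) ⟩
          E * N k * (3216 * (k + 64))      ≡⟨ e' E (N k) 3216 (k + 64) ⟩
          N k * (E * 3216 * (k + 64)) ∎)

      -- As `d` is beyond the reach of scale `k + 1`, `d²` is at least of order `n² m / N (suc k)`,
      -- while scale `k` gives `g n` of order `n² m / N k`.
      dense-case : ∀ k → Fits n d k → n * D (suc k) < 2 * N (suc k) * d → ∀ {g} → Good n d g → g * n ≤ 3216 * (4 * K) * E * (d * d)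
      dense-case k f lt {g} good = *-cancelˡ-≤ (N k) (begin
        N k * (g * n)                              ≡⟨ e₁ (N k) g n ⟩
        g * N k * n                                ≤⟨ *-monoˡ-≤ n (good-bound {k = k} f good) ⟩
        n * (16 * (200 * (k + 64) + 1)) * n        ≤⟨ *-monoˡ-≤ n (*-monoʳ-≤ n (≤-trans (16l≤ k) (*-monoʳ-≤ 3216 (n≤1+n (k + 64))))) ⟩
        n * (3216 * (suc k + 64)) * n              ≡⟨ e₂ n 3216 (suc k + 64) ⟩
        3216 * ((suc k + 64) * (n * n))            ≤⟨ *-monoʳ-≤ 3216 (too-dense (suc k) {n} {d} (<⇒≤ lt)) ⟩
        3216 * (4 * K * N (suc k) * (d * d))       ≡⟨ cong (λ z → 3216 * (4 * K * z * (d * d))) (N-suc k) ⟩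
        3216 * (4 * K * (E * N k) * (d * d))       ≡⟨ e₃ 3216 (4 * K) E (N k) (d * d) ⟩
        N k * (3216 * (4 * K) * E * (d * d)) ∎)
        where
        open ≤-Reasoning
        e₁ : ∀ a g n → a * (g * n) ≡ g * a * n
        e₁ = solve-∀
        e₂ : ∀ n c m → n * (c * m) * n ≡ c * (m * (n * n))
        e₂ = solve-∀
        e₃ : ∀ c k e a x → c * (k * (e * a) * x) ≡ a * (c * k * e * x)
        e₃ = solve-∀

      -- Here `d` is at least a constant fraction of `n`, so the trivial bound `g ≤ n` is of the
      -- right order.
      very-dense-case : n * D 0 < 2 * N 0 * d → ∀ {g} → Good n d g → g * n ≤ 4 * K * N 0 * (d * d)
      very-dense-case lt {g} good = begin
        g * n                   ≤⟨ *-monoˡ-≤ n (good≤n {n} {d} 2d≤n g good) ⟩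
        n * n                   ≤⟨ m≤n*m (n * n) 64 ⟩
        64 * (n * n)            ≤⟨ too-dense 0 {n} {d} (<⇒≤ lt) ⟩
        4 * K * N 0 * (d * d) ∎
        where open ≤-Reasoning

      -- Take the last scale that fits. The next one fails because `n` is too small, which is the
      -- logarithmic regime, or because `d` is too large, which is the regime of `d²/n`.
      upper-bound : ∀ {g} → Good n d g → g * n ≤ (E * 3216 * (2 * q) + (3216 * (4 * K) * E + 4 * K * N 0)) * (L * n ⊔ d * d)
      upper-bound {g} good = first (2 * N 0 * d ≤? n * D 0)
        where
        c₁ = E * 3216 * (2 * q)
        c₂ = 3216 * (4 * K) * E
        c₃ = 4 * K * N 0
        M = L * n ⊔ d * d
        Goal = g * n ≤ (c₁ + (c₂ + c₃)) * M
        second : ∀ k → Fits n d k → Dec (N (suc k) ≤ n) → Dec (2 * N (suc k) * d ≤ n * D (suc k)) → ¬ Fits n d (suc k) → Goal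
        second k f (no ¬a) _ _ = ≤-trans (sparse-case k f (≰⇒> ¬a) good) (*-mono-≤ (m≤m+n c₁ (c₂ + c₃)) (m≤m⊔n (L * n) (d * d)))
        second k f (yes _) (no ¬b) _ = ≤-trans (dense-case k f (≰⇒> ¬b) good) (*-mono-≤ (≤-trans (m≤m+n c₂ c₃) (m≤n+m (c₂ + c₃) c₁)) (m≤n⊔m (L * n) (d * d)))
        second k f (yes a) (yes b) ¬f = ⊥-elim (¬f (a , b))
        large : ¬ Fits n d n
        large (h , _) = <-irrefl refl (<-≤-trans (<-≤-trans (n<2^n n) (^-monoʳ-≤ 2 (≤-trans (m≤m+n n 64) (m≤n*m (n + 64) 10)))) (≤-trans (≤-reflexive (sym (N≡ n))) h))
        first : Dec (2 * N 0 * d ≤ n * D 0) → Goal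
        first (no ¬b) = ≤-trans (very-dense-case (≰⇒> ¬b) good) (*-mono-≤ (≤-trans (m≤n+m c₃ c₂) (m≤n+m (c₂ + c₃) c₁)) (m≤n⊔m (L * n) (d * d)))
        first (yes b) = let k , f , ¬f = last (fits? n d) (N₀≤n , b) n large in
          second k f (N (suc k) ≤? n) (2 * N (suc k) * d ≤? n * D (suc k)) ¬f

  family-N : ∀ k → Numerics.p5 (2 ^ (k + 64)) * Numerics.p5 (2 ^ (k + 64)) ≡ 2 ^ (10 * (k + 64))
  family-N k = trans (e (2 ^ (k + 64))) (trans (^-*-assoc 2 (k + 64) 10) (cong (2 ^_) (*-comm (k + 64) 10)))
    where e : ∀ x → x * (x * (x * (x * x))) * (x * (x * (x * (x * x)))) ≡ x * (x * (x * (x * (x * (x * (x * (x * (x * (x * 1)))))))))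
          e = solve-∀

-- The theorem with explicit constants.

open Assembly
open Decidability using (good?; greatest; good≤n)
open import Data.Nat
open import Data.Nat.Logarithm using (⌊log₂_⌋)
open import Data.Nat.Properties

theorem4 : (p q : ℕ) → 0 < p → p < q →
    ∃ λ a₁ → ∃ λ a₂ → ∃ λ b₁ → ∃ λ b₂ → ∃ λ n₀ →
    0 < a₁ × 0 < a₂ × 0 < b₁ × 0 < b₂ × a₁ * b₂ ≤ b₁ * a₂ ×
    ((n d : ℕ) → n₀ ≤ n → n ^ p ≤ d ^ q → 2 * d ≤ n →
    ∃ λ g → IsG n d g ×
    a₁ * (⌊log₂ d ⌋ * n ⊔ d * d) ≤ a₂ * (g * n) ×
    b₂ * (g * n) ≤ b₁ * (⌊log₂ d ⌋ * n ⊔ d * d))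
theorem4 p q p>0 p<q = 1 , 256 , 1 + b , 1 , 2 ^ (640 * q) , s≤s z≤n , s≤s z≤n , s≤s z≤n , s≤s z≤n , s≤s z≤n , main
  where
  module U = Upper 1223059046400 (λ k → Numerics.p5 (2 ^ (k + 64)) * Numerics.p5 (2 ^ (k + 64))) (λ k → proj₁ (Family.family k)) family-N
    (λ k → proj₁ (proj₂ (Family.family k))) (λ k → proj₂ (proj₂ (Family.family k)))
  b : ℕ
  b = U.E * 3216 * (2 * q) + (3216 * (4 * 1223059046400) * U.E + 4 * 1223059046400 * (Numerics.p5 (2 ^ 64) * Numerics.p5 (2 ^ 64)))
  q>0 : 0 < q
  q>0 = <-trans p>0 p<q
  main : ∀ n d → 2 ^ (640 * q) ≤ n → n ^ p ≤ d ^ q → 2 * d ≤ n → ∃ λ g → IsG n d g ×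
    1 * (⌊log₂ d ⌋ * n ⊔ d * d) ≤ 256 * (g * n) × 1 * (g * n) ≤ (1 + b) * (⌊log₂ d ⌋ * n ⊔ d * d)
  main n d big n^p≤d^q 2d≤n = finish (greatest (good? n d) (proj₁ (proj₂ lb)) n (good≤n {n} {d} 2d≤n))
    where
    n>0 : 0 < n
    n>0 = ≤-trans (m^n>0 2 (640 * q)) big
    -- The threshold for `n` has exponent `640 q`, where `640 = 10 · 64` belongs to the smallest
    -- order `N 0`; the factor `q` pays for taking the `q`-th root in `n ≤ n ^ p ≤ d ^ q`.
    d-big : 2 ^ 128 ≤ d
    d-big = ^-cancelˡ-≤ q (2 ^ 128) d (begin
      (2 ^ 128) ^ q  ≡⟨ ^-*-assoc 2 128 q ⟩
      2 ^ (128 * q)  ≤⟨ ^-monoʳ-≤ 2 (*-monoˡ-≤ q (Numerics.≤! {128} {640} tt)) ⟩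
      2 ^ (640 * q)  ≤⟨ big ⟩
      n              ≡⟨ sym (*-identityʳ n) ⟩
      n ^ 1          ≤⟨ ^-monoʳ-≤ n {{>-nonZero n>0}} p>0 ⟩
      n ^ p          ≤⟨ n^p≤d^q ⟩
      d ^ q ∎) q>0
      where open ≤-Reasoning
    N₀≤n : Numerics.p5 (2 ^ 64) * Numerics.p5 (2 ^ 64) ≤ n
    N₀≤n = ≤-trans (≤-reflexive (family-N 0)) (≤-trans (^-monoʳ-≤ 2 (m≤m*n 640 q {{>-nonZero q>0}})) big)
    lb = lower-bound n>0 d-big
    finish : (∃ λ g → Good n d g × (∀ g' → Good n d g' → g' ≤ g)) → ∃ λ g → IsG n d g ×
      1 * (⌊log₂ d ⌋ * n ⊔ d * d) ≤ 256 * (g * n) × 1 * (g * n) ≤ (1 + b) * (⌊log₂ d ⌋ * n ⊔ d * d)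
    finish (g , good , max) = g , (good , max) ,
      ≤-trans (≤-reflexive (*-identityˡ _)) (proj₂ (proj₂ lb) g max) ,
      ≤-trans (≤-reflexive (*-identityˡ (g * n))) (≤-trans
        (U.upper-bound {p} {q} {n} {d} p>0 n^p≤d^q 2d≤n (≤-trans (s≤s z≤n) (≤log 128 d-big)) N₀≤n good)
        (*-monoˡ-≤ (⌊log₂ d ⌋ * n ⊔ d * d) (m≤n+m b 1)))
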